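{- (a) Suppose that there exists a constant $t_0 \geq 1$ such that every $t_0$-tough graph is Hamiltonian. Then there exist positive constants $c_1 = c_1(t_0)$ and $c_2 = c_2(t_0)$ such that the following holds. Let $G$ be an $n$-vertex graph with minimum degree $k$. If $\alpha(G) \leq c_2 k$, then $G \cup \mathbb{G}(n,p)$ is a.a.s. pancyclic whenever $p \geq \frac{c_1 \log n}{nk}$. (b) For every sufficiently large integer $n$, constant $0 < \varepsilon < 1/2$, integer $n^{\varepsilon} \leq k \leq n^{1-\varepsilon}$, and constant $0 < c < 1$, there exist a constant $c' > 0$ and an $n$-vertex graph $H$ with $\delta(H) = k$ and $\alpha(H) \leq ck$ such that $H \cup \mathbb{G}(n,p)$ is a.a.s. not Hamiltonian whenever $p := p(n) \leq \frac{c' \log n}{nk}$. (c) For every sufficiently large integer $n$ and every integer $k := k(n) \leq n/2$ with $k \to \infty$ as $n \to \infty$, there exists an $n$-vertex graph $H$ with $\alpha(H) = k$ and $\delta(H) \geq k/2$ such that $H \cup \mathbb{G}(n,p)$ is a.a.s. not Hamiltonian whenever $p := p(n) \leq \frac{1}{3n}$.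
   Context: A graph $G$ is $t$-tough if for every $S \subseteq V(G)$ the number of connected components of $G \setminus S$ is at most $\max\{1, |S|/t\}$. For an $n$-vertex graph $G$, $G \cup \mathbb{G}(n,p)$ denotes the union $G \cup R$ where $R$ is the binomial random graph on the vertex set $V(G)$ in which each pair of vertices is an edge independently with probability $p$. "A.a.s." means with probability tending to $1$ as $n \to \infty$. $\alpha$ is the independence number and $\delta$ the minimum degree. Hamiltonian: has a cycle through all vertices; pancyclic: has a cycle of every length from $3$ to the number of vertices. -}

module Defs where

open import Data.Nat.Base as ℕ using (ℕ; zero; suc)
import Data.Nat.Properties as ℕP
open import Data.Integer.Base as ℤ using (+_; -[1+_])
import Data.Integer.Properties as ℤP
open import Data.Rational.Base as ℚ using (ℚ; 0ℚ; 1ℚ; _/_)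
import Data.Rational.Properties as ℚP
import Data.Rational.Unnormalised.Base as ℚᵘ
import Data.Rational.Unnormalised.Properties as ℚᵘP
import Data.Rational.Solver as ℚSolver
open import Data.Fin.Base using (Fin)
import Data.Fin.Properties as FinP
open import Data.Fin.Subset using (Subset; inside; outside; ∣_∣; _∈_; _∉_)
open import Data.Fin.Subset.Properties using (_∈?_)
open import Data.Vec.Base using (Vec; []; _∷_; toList)
open import Data.List.Base using (List; []; _∷_; _++_; _∷ʳ_; map; filter; length; allFin; cartesianProduct)
open import Data.List.Extrema.Nat using (min; max)
import Data.List.Membership.Propositional as ListMem
import Data.List.Membership.DecPropositional as ListMem?
open import Data.List.Relation.Unary.Linked using (Linked; linked?)
open import Data.List.Relation.Unary.Unique.Propositional using (Unique)
import Data.List.Relation.Unary.Unique.DecPropositional as Unique?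
open import Data.Product.Base using (∃; _×_; _,_; proj₁; proj₂)
open import Data.Product.Properties using (≡-dec)
open import Data.Sum.Base using (_⊎_; swap)
import Data.Sum.Base as Sum
open import Function.Base using (_∘_; _$_)
open import Function.Bundles using (_⇔_)
open import Function.Definitions using (StrictlySurjective)
open import Relation.Binary.Construct.Closure.ReflexiveTransitive using (Star)
open import Relation.Binary.PropositionalEquality
open import Relation.Nullary using (¬_; Dec; yes; no)
open import Relation.Nullary.Decidable using (map′; ¬?; _×-dec_; _⊎-dec_; _→-dec_)

module ℚS = ℚSolver.+-*-Solver

fromℕ : ℕ → ℚ
fromℕ n = + n / 1

-- recip 0 = 0 is a junk value.
recip : ℕ → ℚ
recip zero    = 0ℚ
recip (suc n) = + 1 / suc n

toℚᵘ-/ : ∀ i n → ℚ.toℚᵘ (i / suc n) ℚᵘ.≃ ℚᵘ.mkℚᵘ i n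
toℚᵘ-/ i n = ℚP.toℚᵘ-fromℚᵘ (ℚᵘ.mkℚᵘ i n)

fromℕ-suc : ∀ n → fromℕ (suc n) ≡ 1ℚ ℚ.+ fromℕ n
fromℕ-suc n = ℚP.toℚᵘ-injective $ ℚᵘP.≃-trans (toℚᵘ-/ (+ suc n) 0) $ ℚᵘP.≃-sym $
  ℚᵘP.≃-trans (ℚP.toℚᵘ-homo-+ 1ℚ (fromℕ n)) $
  ℚᵘP.≃-trans (ℚᵘP.+-congʳ (ℚ.toℚᵘ 1ℚ) (toℚᵘ-/ (+ n) 0)) $
  ℚᵘ.*≡* (cong (ℤ._* (+ 1)) (cong (λ z → (+ 1) ℤ.+ z) (ℤP.*-identityʳ (+ n))))

fromℕ*recip : ∀ n → fromℕ (suc n) ℚ.* recip (suc n) ≡ 1ℚ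
fromℕ*recip n = ℚP.toℚᵘ-injective $
  ℚᵘP.≃-trans (ℚP.toℚᵘ-homo-* (fromℕ (suc n)) (recip (suc n))) $
  ℚᵘP.≃-trans (ℚᵘP.*-cong (toℚᵘ-/ (+ suc n) 0) (toℚᵘ-/ (+ 1) n)) $
  ℚᵘ.*≡* (trans (ℤP.*-identityʳ _) (trans (ℤP.*-identityʳ _) (sym (trans (ℤP.*-identityˡ _) (cong (+_ ∘ suc) (ℕP.+-identityʳ n))))))

*-mono : ∀ {a b c} → 0ℚ ℚ.≤ a → b ℚ.≤ c → a ℚ.* b ℚ.≤ a ℚ.* c
*-mono {a} 0≤a = ℚP.*-monoˡ-≤-nonNeg a {{ℚ.nonNegative 0≤a}}

*-mono₂ : ∀ {a b c d} → 0ℚ ℚ.≤ a → a ℚ.≤ b → 0ℚ ℚ.≤ c → c ℚ.≤ d → a ℚ.* c ℚ.≤ b ℚ.* d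
*-mono₂ {a} {b} {c} {d} 0≤a a≤b 0≤c c≤d =
  ℚP.≤-trans (*-mono 0≤a c≤d) $
  ℚP.*-monoʳ-≤-nonNeg d {{ℚ.nonNegative (ℚP.≤-trans 0≤c c≤d)}} a≤b

*-nonNeg : ∀ {a b} → 0ℚ ℚ.≤ a → 0ℚ ℚ.≤ b → 0ℚ ℚ.≤ a ℚ.* b
*-nonNeg {a} 0≤a 0≤b = ℚP.≤-trans (ℚP.≤-reflexive (sym (ℚP.*-zeroʳ a))) (*-mono 0≤a 0≤b)

+-nonNeg : ∀ {a b} → 0ℚ ℚ.≤ a → 0ℚ ℚ.≤ b → 0ℚ ℚ.≤ a ℚ.+ b
+-nonNeg = ℚP.+-mono-≤

≤-+ʳ : ∀ {a b} → 0ℚ ℚ.≤ b → a ℚ.≤ a ℚ.+ b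
≤-+ʳ {a} 0≤b = ℚP.≤-trans (ℚP.≤-reflexive (sym (ℚP.+-identityʳ a))) (ℚP.+-monoʳ-≤ a 0≤b)

0≤1 : 0ℚ ℚ.≤ 1ℚ
0≤1 = ℚP.nonNegative⁻¹ 1ℚ

fromℕ-nonNeg : ∀ n → 0ℚ ℚ.≤ fromℕ n
fromℕ-nonNeg n = ℚP.nonNegative⁻¹ (fromℕ n) {{ℚP.normalize-nonNeg n 1}}

recip-nonNeg : ∀ n → 0ℚ ℚ.≤ recip n
recip-nonNeg zero    = ℚP.≤-refl
recip-nonNeg (suc n) = ℚP.nonNegative⁻¹ (recip (suc n)) {{ℚP.normalize-nonNeg 1 (suc n)}}

fromℕ-pos : ∀ n → 0ℚ ℚ.< fromℕ (suc n)
fromℕ-pos n = ℚP.positive⁻¹ (fromℕ (suc n)) {{ℚP.normalize-pos (suc n) 1}}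

fromℕ-mono : ∀ {m n} → m ℕ.≤ n → fromℕ m ℚ.≤ fromℕ n
fromℕ-mono {n = n} ℕ.z≤n = fromℕ-nonNeg n
fromℕ-mono (ℕ.s≤s {m} {n} m≤n) =
  subst₂ ℚ._≤_ (sym (fromℕ-suc m)) (sym (fromℕ-suc n)) (ℚP.+-monoʳ-≤ 1ℚ (fromℕ-mono m≤n))

≤recip : ∀ n {a b} → fromℕ (suc n) ℚ.* a ℚ.≤ b → a ℚ.≤ recip (suc n) ℚ.* b
≤recip n {a} {b} h = subst (ℚ._≤ recip (suc n) ℚ.* b) eq (*-mono (recip-nonNeg (suc n)) h)
  where
  eq : recip (suc n) ℚ.* (fromℕ (suc n) ℚ.* a) ≡ a
  eq = begin
    recip (suc n) ℚ.* (fromℕ (suc n) ℚ.* a)  ≡⟨ ℚP.*-assoc (recip (suc n)) (fromℕ (suc n)) a ⟨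
    recip (suc n) ℚ.* fromℕ (suc n) ℚ.* a    ≡⟨ cong (ℚ._* a) (trans (ℚP.*-comm (recip (suc n)) (fromℕ (suc n))) (fromℕ*recip n)) ⟩
    1ℚ ℚ.* a                                 ≡⟨ ℚP.*-identityˡ a ⟩
    a                                        ∎ where open ≡-Reasoning

recip≤ : ∀ n {a b} → b ℚ.≤ fromℕ (suc n) ℚ.* a → recip (suc n) ℚ.* b ℚ.≤ a
recip≤ n {a} {b} h = subst (recip (suc n) ℚ.* b ℚ.≤_) eq (*-mono (recip-nonNeg (suc n)) h)
  where
  eq : recip (suc n) ℚ.* (fromℕ (suc n) ℚ.* a) ≡ a
  eq = begin
    recip (suc n) ℚ.* (fromℕ (suc n) ℚ.* a)  ≡⟨ ℚP.*-assoc (recip (suc n)) (fromℕ (suc n)) a ⟨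
    recip (suc n) ℚ.* fromℕ (suc n) ℚ.* a    ≡⟨ cong (ℚ._* a) (trans (ℚP.*-comm (recip (suc n)) (fromℕ (suc n))) (fromℕ*recip n)) ⟩
    1ℚ ℚ.* a                                 ≡⟨ ℚP.*-identityˡ a ⟩
    a                                        ∎ where open ≡-Reasoning

archimedean : ∀ q → ∃ λ n → q ℚ.≤ fromℕ n
archimedean q@(ℚ.mkℚ (+ n) d _) = n , ℚP.toℚᵘ-cancel-≤
  (ℚᵘP.≤-trans (ℚᵘ.*≤* (ℤP.*-monoˡ-≤-nonNeg (+ n) (ℤ.+≤+ (ℕ.s≤s ℕ.z≤n)))) (ℚᵘP.≤-reflexive (ℚᵘP.≃-sym (toℚᵘ-/ (+ n) 0))))
archimedean q@(ℚ.mkℚ -[1+ n ] d _) = 0 , ℚP.<⇒≤ (ℚP.negative⁻¹ q)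

scale : ∀ C {ε} → 0ℚ ℚ.< C → 0ℚ ℚ.< ε → ∃ λ δ → 0ℚ ℚ.< δ × C ℚ.* δ ≡ ε
scale C {ε} 0<C 0<ε = δ , 0<δ , eq
  where
  instance
    pC = ℚ.positive 0<C
    nzC = ℚP.pos⇒nonZero C {{pC}}
    pε = ℚ.positive 0<ε
    pC⁻¹ = ℚP.1/pos⇒pos C
  δ = ℚ.1/ C ℚ.* ε
  0<δ = ℚP.positive⁻¹ δ {{ℚP.pos*pos⇒pos (ℚ.1/ C) ε}}
  eq : C ℚ.* δ ≡ ε
  eq = trans (sym (ℚP.*-assoc C (ℚ.1/ C) ε)) (trans (cong (ℚ._* ε) (ℚP.*-inverseʳ C)) (ℚP.*-identityˡ ε))

half : ∀ {ε} → 0ℚ ℚ.< ε → ∃ λ δ → 0ℚ ℚ.< δ × δ ℚ.+ δ ≡ ε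
half {ε} 0<ε with δ , 0<δ , eq ← scale (1ℚ ℚ.+ 1ℚ) (ℚP.positive⁻¹ (1ℚ ℚ.+ 1ℚ)) 0<ε =
  δ , 0<δ , trans (sym (cong₂ ℚ._+_ (ℚP.*-identityˡ δ) (ℚP.*-identityˡ δ))) (trans (sym (ℚP.*-distribʳ-+ δ 1ℚ 1ℚ)) eq)

archimedean′ : ∀ C {ε} → 0ℚ ℚ.< ε → ∃ λ N → C ℚ.≤ fromℕ N ℚ.* ε
archimedean′ C {ε} 0<ε = n , subst (ℚ._≤ fromℕ n ℚ.* ε) eq
    (ℚP.*-monoʳ-≤-nonNeg ε {{ℚ.nonNegative (ℚP.<⇒≤ 0<ε)}} le)
  where
  instance
    nzε = ℚP.pos⇒nonZero ε {{ℚ.positive 0<ε}}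
  n = proj₁ (archimedean (C ℚ.* ℚ.1/ ε))
  le = proj₂ (archimedean (C ℚ.* ℚ.1/ ε))
  eq : C ℚ.* ℚ.1/ ε ℚ.* ε ≡ C
  eq = trans (ℚP.*-assoc C (ℚ.1/ ε) ε) (trans (cong (C ℚ.*_) (ℚP.*-inverseˡ ε)) (ℚP.*-identityʳ C))

dist : ℚ → ℚ → ℚ
dist p q = ℚ.∣ p ℚ.- q ∣

dist-sym : ∀ p q → dist p q ≡ dist q p
dist-sym p q = trans (sym (ℚP.∣-p∣≡∣p∣ (p ℚ.- q)))
  (cong ℚ.∣_∣ (ℚS.solve 2 (λ a b → ℚS.:- (a ℚS.:- b) ℚS.:= b ℚS.:- a) refl p q))

dist-tri : ∀ p q r → dist p r ℚ.≤ dist p q ℚ.+ dist q r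
dist-tri p q r = subst (ℚ._≤ dist p q ℚ.+ dist q r)
  (cong ℚ.∣_∣ (ℚS.solve 3 (λ a b c → (a ℚS.:- b) ℚS.:+ (b ℚS.:- c) ℚS.:= a ℚS.:- c) refl p q r))
  (ℚP.∣p+q∣≤∣p∣+∣q∣ (p ℚ.- q) (q ℚ.- r))

dist-+ : ∀ a b c d → dist (a ℚ.+ b) (c ℚ.+ d) ℚ.≤ dist a c ℚ.+ dist b d
dist-+ a b c d = subst (ℚ._≤ dist a c ℚ.+ dist b d)
  (cong ℚ.∣_∣ (ℚS.solve 4 (λ a b c d → (a ℚS.:- c) ℚS.:+ (b ℚS.:- d) ℚS.:= (a ℚS.:+ b) ℚS.:- (c ℚS.:+ d)) refl a b c d))
  (ℚP.∣p+q∣≤∣p∣+∣q∣ (a ℚ.- c) (b ℚ.- d))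

dist-* : ∀ a b c d → dist (a ℚ.* b) (c ℚ.* d) ℚ.≤ ℚ.∣ a ∣ ℚ.* dist b d ℚ.+ ℚ.∣ d ∣ ℚ.* dist a c
dist-* a b c d = begin
  dist (a ℚ.* b) (c ℚ.* d)
    ≡⟨ cong ℚ.∣_∣ (ℚS.solve 4 (λ a b c d → a ℚS.:* b ℚS.:- c ℚS.:* d ℚS.:= a ℚS.:* (b ℚS.:- d) ℚS.:+ d ℚS.:* (a ℚS.:- c)) refl a b c d) ⟩
  ℚ.∣ a ℚ.* (b ℚ.- d) ℚ.+ d ℚ.* (a ℚ.- c) ∣
    ≤⟨ ℚP.∣p+q∣≤∣p∣+∣q∣ (a ℚ.* (b ℚ.- d)) (d ℚ.* (a ℚ.- c)) ⟩
  ℚ.∣ a ℚ.* (b ℚ.- d) ∣ ℚ.+ ℚ.∣ d ℚ.* (a ℚ.- c) ∣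
    ≡⟨ cong₂ ℚ._+_ (ℚP.∣p*q∣≡∣p∣*∣q∣ a (b ℚ.- d)) (ℚP.∣p*q∣≡∣p∣*∣q∣ d (a ℚ.- c)) ⟩
  ℚ.∣ a ∣ ℚ.* dist b d ℚ.+ ℚ.∣ d ∣ ℚ.* dist a c ∎
  where open ℚP.≤-Reasoning

dist-between : ∀ {p q e} → p ℚ.≤ q → q ℚ.≤ p ℚ.+ e → dist q p ℚ.≤ e
dist-between {p} {q} {e} p≤q q≤p+e = begin
  dist q p              ≡⟨ ℚP.0≤p⇒∣p∣≡p (subst (ℚ._≤ q ℚ.- p) (ℚP.+-inverseʳ p) (ℚP.+-monoˡ-≤ (ℚ.- p) p≤q)) ⟩
  q ℚ.- p               ≤⟨ ℚP.+-monoˡ-≤ (ℚ.- p) q≤p+e ⟩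
  p ℚ.+ e ℚ.- p         ≡⟨ ℚS.solve 2 (λ p e → p ℚS.:+ e ℚS.:- p ℚS.:= e) refl p e ⟩
  e                     ∎
  where open ℚP.≤-Reasoning

IsCauchy : (ℕ → ℚ) → Set
IsCauchy s = ∀ ε → 0ℚ ℚ.< ε → ∃ λ N → ∀ m n → N ℕ.≤ m → N ℕ.≤ n → ℚ.∣ s m ℚ.- s n ∣ ℚ.≤ ε

record ℝ : Set where
  constructor mkℝ
  field
    seq    : ℕ → ℚ
    cauchy : IsCauchy seq

open ℝ public

fromTail : ∀ (s : ℕ → ℚ) → (∀ ε → 0ℚ ℚ.< ε → ∃ λ N → ∀ n → N ℕ.≤ n → dist (s n) (s N) ℚ.≤ ε) → IsCauchy s
fromTail s h ε 0<ε with δ , 0<δ , refl ← half 0<ε with N , hN ← h δ 0<δ = N , λ m n N≤m N≤n →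
  ℚP.≤-trans (dist-tri (s m) (s N) (s n))
    (ℚP.+-mono-≤ (hN m N≤m) (subst (ℚ._≤ δ) (dist-sym (s n) (s N)) (hN n N≤n)))

bound : ∀ s → IsCauchy s → ∃ λ B → 0ℚ ℚ.< B × ∃ λ N → ∀ n → N ℕ.≤ n → ℚ.∣ s n ∣ ℚ.≤ B
bound s c with N , hN ← c 1ℚ (ℚP.positive⁻¹ 1ℚ) =
  1ℚ ℚ.+ ℚ.∣ s N ∣ ,
  ℚP.<-≤-trans (ℚP.positive⁻¹ 1ℚ) (≤-+ʳ (ℚP.0≤∣p∣ (s N))) ,
  N , λ n N≤n → begin
    ℚ.∣ s n ∣                     ≡⟨ cong ℚ.∣_∣ (ℚS.solve 2 (λ a b → a ℚS.:= a ℚS.:- b ℚS.:+ b) refl (s n) (s N)) ⟩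
    ℚ.∣ s n ℚ.- s N ℚ.+ s N ∣     ≤⟨ ℚP.∣p+q∣≤∣p∣+∣q∣ (s n ℚ.- s N) (s N) ⟩
    dist (s n) (s N) ℚ.+ ℚ.∣ s N ∣ ≤⟨ ℚP.+-monoˡ-≤ ℚ.∣ s N ∣ (hN n N N≤n ℕP.≤-refl) ⟩
    1ℚ ℚ.+ ℚ.∣ s N ∣              ∎
  where open ℚP.≤-Reasoning

+-cauchy : ∀ s t → IsCauchy s → IsCauchy t → IsCauchy (λ n → s n ℚ.+ t n)
+-cauchy s t cs ct ε 0<ε with δ , 0<δ , refl ← half 0<ε with M , hM ← cs δ 0<δ | N , hN ← ct δ 0<δ =
  M ℕ.⊔ N , λ m n ≤m ≤n → ℚP.≤-trans (dist-+ (s m) (t m) (s n) (t n))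
    (ℚP.+-mono-≤ (hM m n (ℕP.m⊔n≤o⇒m≤o M N ≤m) (ℕP.m⊔n≤o⇒m≤o M N ≤n))
                 (hN m n (ℕP.m⊔n≤o⇒n≤o M N ≤m) (ℕP.m⊔n≤o⇒n≤o M N ≤n)))

neg-cauchy : ∀ s → IsCauchy s → IsCauchy (λ n → ℚ.- s n)
neg-cauchy s cs ε 0<ε with N , hN ← cs ε 0<ε = N , λ m n N≤m N≤n →
  subst (ℚ._≤ ε) (trans (dist-sym (s m) (s n))
    (cong ℚ.∣_∣ (ℚS.solve 2 (λ a b → b ℚS.:- a ℚS.:= ℚS.:- a ℚS.:- (ℚS.:- b)) refl (s m) (s n)))) (hN m n N≤m N≤n)

*-cauchy : ∀ s t → IsCauchy s → IsCauchy t → IsCauchy (λ n → s n ℚ.* t n)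
*-cauchy s t cs ct ε 0<ε =
  let η , 0<η , η+η≡ε = half 0<ε
      A , 0<A , K , hA = bound s cs
      B , 0<B , L , hB = bound t ct
      α , 0<α , Aα≡η = scale A 0<A 0<η
      β , 0<β , Bβ≡η = scale B 0<B 0<η
      M , hM = cs β 0<β
      N , hN = ct α 0<α
  in (K ℕ.⊔ L) ℕ.⊔ (M ℕ.⊔ N) , λ m n ≤m ≤n →
    let KL≤m = ℕP.m⊔n≤o⇒m≤o (K ℕ.⊔ L) (M ℕ.⊔ N) ≤m
        KL≤n = ℕP.m⊔n≤o⇒m≤o (K ℕ.⊔ L) (M ℕ.⊔ N) ≤n
        MN≤m = ℕP.m⊔n≤o⇒n≤o (K ℕ.⊔ L) (M ℕ.⊔ N) ≤m
        MN≤n = ℕP.m⊔n≤o⇒n≤o (K ℕ.⊔ L) (M ℕ.⊔ N) ≤n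
    in begin
      dist (s m ℚ.* t m) (s n ℚ.* t n)
        ≤⟨ dist-* (s m) (t m) (s n) (t n) ⟩
      ℚ.∣ s m ∣ ℚ.* dist (t m) (t n) ℚ.+ ℚ.∣ t n ∣ ℚ.* dist (s m) (s n)
        ≤⟨ ℚP.+-mono-≤
             (*-mono₂ (ℚP.0≤∣p∣ (s m)) (hA m (ℕP.m⊔n≤o⇒m≤o K L KL≤m)) (ℚP.0≤∣p∣ (t m ℚ.- t n))
                      (hN m n (ℕP.m⊔n≤o⇒n≤o M N MN≤m) (ℕP.m⊔n≤o⇒n≤o M N MN≤n)))
             (*-mono₂ (ℚP.0≤∣p∣ (t n)) (hB n (ℕP.m⊔n≤o⇒n≤o K L KL≤n)) (ℚP.0≤∣p∣ (s m ℚ.- s n))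
                      (hM m n (ℕP.m⊔n≤o⇒m≤o M N MN≤m) (ℕP.m⊔n≤o⇒m≤o M N MN≤n))) ⟩
      A ℚ.* α ℚ.+ B ℚ.* β
        ≡⟨ trans (cong₂ ℚ._+_ Aα≡η Bβ≡η) η+η≡ε ⟩
      ε ∎
  where open ℚP.≤-Reasoning

infix  4 _≤_ _<_
infixl 6 _+_ _-_
infixl 7 _*_

ι : ℚ → ℝ
ι q = mkℝ (λ _ → q) λ ε 0<ε → 0 , λ _ _ _ _ →
  ℚP.≤-trans (ℚP.≤-reflexive (cong ℚ.∣_∣ (ℚP.+-inverseʳ q))) (ℚP.<⇒≤ 0<ε)

_+_ _-_ _*_ : ℝ → ℝ → ℝ
x + y = mkℝ (λ n → seq x n ℚ.+ seq y n) (+-cauchy (seq x) (seq y) (cauchy x) (cauchy y))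
x - y = mkℝ (λ n → seq x n ℚ.- seq y n) (+-cauchy (seq x) (λ n → ℚ.- seq y n) (cauchy x) (neg-cauchy (seq y) (cauchy y)))
x * y = mkℝ (λ n → seq x n ℚ.* seq y n) (*-cauchy (seq x) (seq y) (cauchy x) (cauchy y))

_≤_ _<_ : ℝ → ℝ → Set
x ≤ y = ∀ ε → 0ℚ ℚ.< ε → ∃ λ N → ∀ n → N ℕ.≤ n → seq x n ℚ.≤ seq y n ℚ.+ ε
x < y = ∃ λ ε → 0ℚ ℚ.< ε × ∃ λ N → ∀ n → N ℕ.≤ n → seq x n ℚ.+ ε ℚ.≤ seq y n

induct-≥ : ∀ {p} (P : ℕ → Set p) N → P N → (∀ n → N ℕ.≤ n → P n → P (suc n)) → ∀ n → N ℕ.≤ n → P n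
induct-≥ P N base step n N≤n = go (ℕP.≤⇒≤′ N≤n)
  where
  go : ∀ {n} → N ℕ.≤′ n → P n
  go ℕ.≤′-refl = base
  go (ℕ.≤′-step N≤n) = step _ (ℕP.≤′⇒≤ N≤n) (go N≤n)

telescope : ∀ (s : ℕ → ℚ) (e : ℕ → ℚ) → (∀ n → 0ℚ ℚ.≤ e n) → ∀ N →
            (∀ n → N ℕ.≤ n → s n ℚ.≤ s (suc n)) →
            (∀ n → N ℕ.≤ n → s (suc n) ℚ.+ e (suc n) ℚ.≤ s n ℚ.+ e n) →
            ∀ n → N ℕ.≤ n → s N ℚ.≤ s n × s n ℚ.≤ s N ℚ.+ e N
telescope s e 0≤e N up down n N≤n =
  induct-≥ (λ n → s N ℚ.≤ s n) N ℚP.≤-refl (λ n N≤n ih → ℚP.≤-trans ih (up n N≤n)) n N≤n ,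
  ℚP.≤-trans (≤-+ʳ (0≤e n))
    (induct-≥ (λ n → s n ℚ.+ e n ℚ.≤ s N ℚ.+ e N) N ℚP.≤-refl (λ n N≤n ih → ℚP.≤-trans (down n N≤n) ih) n N≤n)

harmonic : ℕ → ℚ
harmonic zero    = 0ℚ
harmonic (suc n) = harmonic n ℚ.+ recip (suc n)

recip-anti : ∀ {m n} → m ℕ.≤ n → recip (suc n) ℚ.≤ recip (suc m)
recip-anti {m} {n} m≤n = subst (ℚ._≤ recip (suc m)) (ℚP.*-identityʳ (recip (suc n)))
  (recip≤ n (subst (ℚ._≤ fromℕ (suc n) ℚ.* recip (suc m)) (fromℕ*recip m)
    (ℚP.*-monoʳ-≤-nonNeg (recip (suc m)) {{ℚ.nonNegative (recip-nonNeg (suc m))}} (fromℕ-mono (ℕ.s≤s m≤n)))))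

harmonic-≥ : ∀ r s b → r ℕ.+ s ℕ.≤ suc b → harmonic s ℚ.+ fromℕ r ℚ.* recip (suc b) ℚ.≤ harmonic (r ℕ.+ s)
harmonic-≥ zero s b _ = ℚP.≤-reflexive (trans (cong (harmonic s ℚ.+_) (ℚP.*-zeroˡ (recip (suc b)))) (ℚP.+-identityʳ _))
harmonic-≥ (suc r) s b h = begin
  harmonic s ℚ.+ fromℕ (suc r) ℚ.* recip (suc b)
    ≡⟨ cong (λ z → harmonic s ℚ.+ z ℚ.* recip (suc b)) (fromℕ-suc r) ⟩
  harmonic s ℚ.+ (1ℚ ℚ.+ fromℕ r) ℚ.* recip (suc b)
    ≡⟨ ℚS.solve 3 (λ h r u → h ℚS.:+ (ℚS.con 1ℚ ℚS.:+ r) ℚS.:* u ℚS.:= (h ℚS.:+ r ℚS.:* u) ℚS.:+ u) refl (harmonic s) (fromℕ r) (recip (suc b)) ⟩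
  harmonic s ℚ.+ fromℕ r ℚ.* recip (suc b) ℚ.+ recip (suc b)
    ≤⟨ ℚP.+-mono-≤ (harmonic-≥ r s b (ℕP.≤-trans (ℕP.n≤1+n _) h)) (recip-anti (ℕP.≤-pred h)) ⟩
  harmonic (r ℕ.+ s) ℚ.+ recip (suc (r ℕ.+ s)) ∎
  where open ℚP.≤-Reasoning

harmonic-≤ : ∀ r s b → b ℕ.≤ s → harmonic (r ℕ.+ s) ℚ.≤ harmonic s ℚ.+ fromℕ r ℚ.* recip (suc b)
harmonic-≤ zero s b _ = ℚP.≤-reflexive (sym (trans (cong (harmonic s ℚ.+_) (ℚP.*-zeroˡ (recip (suc b)))) (ℚP.+-identityʳ _)))
harmonic-≤ (suc r) s b h = begin
  harmonic (r ℕ.+ s) ℚ.+ recip (suc (r ℕ.+ s))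
    ≤⟨ ℚP.+-mono-≤ (harmonic-≤ r s b h) (recip-anti (ℕP.≤-trans h (ℕP.m≤n+m s r))) ⟩
  harmonic s ℚ.+ fromℕ r ℚ.* recip (suc b) ℚ.+ recip (suc b)
    ≡⟨ ℚS.solve 3 (λ h r u → (h ℚS.:+ r ℚS.:* u) ℚS.:+ u ℚS.:= h ℚS.:+ (ℚS.con 1ℚ ℚS.:+ r) ℚS.:* u) refl (harmonic s) (fromℕ r) (recip (suc b)) ⟩
  harmonic s ℚ.+ (1ℚ ℚ.+ fromℕ r) ℚ.* recip (suc b)
    ≡⟨ cong (λ z → harmonic s ℚ.+ z ℚ.* recip (suc b)) (fromℕ-suc r) ⟨
  harmonic s ℚ.+ fromℕ (suc r) ℚ.* recip (suc b) ∎
  where open ℚP.≤-Reasoning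

recip-cancel : ∀ n m → fromℕ (suc n) ℚ.* recip (suc n ℕ.* suc m) ≡ recip (suc m)
recip-cancel n m = ℚP.toℚᵘ-injective $
  ℚᵘP.≃-trans (ℚP.toℚᵘ-homo-* (fromℕ (suc n)) (recip (suc n ℕ.* suc m))) $
  ℚᵘP.≃-trans (ℚᵘP.*-cong (toℚᵘ-/ (+ suc n) 0) (toℚᵘ-/ (+ 1) (m ℕ.+ n ℕ.* suc m))) $
  ℚᵘP.≃-trans (ℚᵘ.*≡* (cong +_ eq)) (ℚᵘP.≃-sym (toℚᵘ-/ (+ 1) m))
  where
  eq : suc n ℕ.* 1 ℕ.* suc m ≡ 1 ℕ.* (1 ℕ.* (suc n ℕ.* suc m))
  eq = trans (cong (ℕ._* suc m) (ℕP.*-identityʳ (suc n))) (sym (trans (ℕP.*-identityˡ _) (ℕP.*-identityˡ _)))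

-- With M = m + 1, the lower Riemann sum ∑ 1/i (M < i ≤ nM) of ∫₁ⁿ dx/x for the
-- mesh 1/M.
logSeq : ℕ → ℕ → ℚ
logSeq n m = harmonic (n ℕ.* suc m) ℚ.- harmonic (suc m)

module _ (n : ℕ) where
  harmonic-next : ∀ m → harmonic (suc n ℕ.* suc (suc m)) ≡ harmonic (suc n ℕ.+ suc n ℕ.* suc m)
  harmonic-next m = cong harmonic (ℕP.*-suc (suc n) (suc m))

  logSeq-up : ∀ m → logSeq (suc n) m ℚ.≤ logSeq (suc n) (suc m)
  logSeq-up m = begin
    H₁ ℚ.- h                       ≡⟨ ℚS.solve 3 (λ a h u → a ℚS.:- h ℚS.:= (a ℚS.:+ u) ℚS.:- (h ℚS.:+ u)) refl H₁ h u ⟩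
    H₁ ℚ.+ u ℚ.- (h ℚ.+ u)         ≤⟨ ℚP.+-monoˡ-≤ (ℚ.- (h ℚ.+ u)) le ⟩
    harmonic (suc n ℕ.* suc (suc m)) ℚ.- (h ℚ.+ u) ∎
    where
    open ℚP.≤-Reasoning
    H₁ = harmonic (suc n ℕ.* suc m)
    h = harmonic (suc m)
    u = recip (suc (suc m))
    le : H₁ ℚ.+ u ℚ.≤ harmonic (suc n ℕ.* suc (suc m))
    le = subst₂ ℚ._≤_ (cong (H₁ ℚ.+_) (recip-cancel n (suc m))) (sym (harmonic-next m))
      (harmonic-≥ (suc n) (suc n ℕ.* suc m) (suc m ℕ.+ n ℕ.* suc (suc m)) (ℕP.≤-reflexive (sym (ℕP.*-suc (suc n) (suc m)))))

  logSeq-down : ∀ m → logSeq (suc n) (suc m) ℚ.+ recip (suc (suc m)) ℚ.≤ logSeq (suc n) m ℚ.+ recip (suc m)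
  logSeq-down m = begin
    harmonic (suc n ℕ.* suc (suc m)) ℚ.- (h ℚ.+ u) ℚ.+ u
      ≤⟨ ℚP.+-monoˡ-≤ u (ℚP.+-monoˡ-≤ (ℚ.- (h ℚ.+ u)) le) ⟩
    H₁ ℚ.+ v ℚ.- (h ℚ.+ u) ℚ.+ u
      ≡⟨ ℚS.solve 4 (λ a h u v → a ℚS.:+ v ℚS.:- (h ℚS.:+ u) ℚS.:+ u ℚS.:= (a ℚS.:- h) ℚS.:+ v) refl H₁ h u v ⟩
    H₁ ℚ.- h ℚ.+ v ∎
    where
    open ℚP.≤-Reasoning
    H₁ = harmonic (suc n ℕ.* suc m)
    h = harmonic (suc m)
    u = recip (suc (suc m))
    v = recip (suc m)
    le : harmonic (suc n ℕ.* suc (suc m)) ℚ.≤ H₁ ℚ.+ v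
    le = subst₂ ℚ._≤_ (sym (harmonic-next m)) (cong (H₁ ℚ.+_) (recip-cancel n m))
      (harmonic-≤ (suc n) (suc n ℕ.* suc m) (m ℕ.+ n ℕ.* suc m) (ℕP.n≤1+n _))

C*recip≤ : ∀ C {ε} → 0ℚ ℚ.< ε → ∃ λ N → recip (suc N) ℚ.* C ℚ.≤ ε
C*recip≤ C {ε} 0<ε with N , h ← archimedean′ C 0<ε = N ,
  recip≤ N (ℚP.≤-trans h (ℚP.*-monoʳ-≤-nonNeg ε {{ℚ.nonNegative (ℚP.<⇒≤ 0<ε)}} (fromℕ-mono (ℕP.n≤1+n N))))

logSeq-cauchy : ∀ n → IsCauchy (logSeq (suc n))
logSeq-cauchy n = fromTail (logSeq (suc n)) λ ε 0<ε →
  let N , h = C*recip≤ 1ℚ 0<ε in N , λ m N≤m →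
  let lo , hi = telescope (logSeq (suc n)) (recip ∘ suc) (recip-nonNeg ∘ suc) N (λ m _ → logSeq-up n m) (λ m _ → logSeq-down n m) m N≤m in
  ℚP.≤-trans (dist-between {logSeq (suc n) N} {logSeq (suc n) m} lo hi) (subst (ℚ._≤ ε) (ℚP.*-identityʳ (recip (suc N))) h)

-- Natural logarithm; log 0 = 0 is a junk value.
log : ℕ → ℝ
log zero    = ι 0ℚ
log (suc n) = mkℝ (logSeq (suc n)) (logSeq-cauchy n)

-- qⁱ / i!
expTerm : ℚ → ℕ → ℚ
expTerm q zero    = 1ℚ
expTerm q (suc i) = expTerm q i ℚ.* q ℚ.* recip (suc i)

expSum : ℚ → ℕ → ℚ
expSum q zero    = 0ℚ
expSum q (suc n) = expSum q n ℚ.+ expTerm q n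

expTerm-nonNeg : ∀ {B} → 0ℚ ℚ.≤ B → ∀ i → 0ℚ ℚ.≤ expTerm B i
expTerm-nonNeg 0≤B zero    = 0≤1
expTerm-nonNeg 0≤B (suc i) = *-nonNeg (*-nonNeg (expTerm-nonNeg 0≤B i) 0≤B) (recip-nonNeg (suc i))

expTerm-suc : ∀ B i → fromℕ (suc i) ℚ.* expTerm B (suc i) ≡ B ℚ.* expTerm B i
expTerm-suc B i = begin
  n ℚ.* (a ℚ.* B ℚ.* u)  ≡⟨ ℚS.solve 4 (λ n a B u → n ℚS.:* (a ℚS.:* B ℚS.:* u) ℚS.:= (n ℚS.:* u) ℚS.:* (B ℚS.:* a)) refl n a B u ⟩
  n ℚ.* u ℚ.* (B ℚ.* a)  ≡⟨ cong (ℚ._* (B ℚ.* a)) (fromℕ*recip i) ⟩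
  1ℚ ℚ.* (B ℚ.* a)       ≡⟨ ℚP.*-identityˡ (B ℚ.* a) ⟩
  B ℚ.* a                ∎
  where
  open ≡-Reasoning
  n = fromℕ (suc i)
  a = expTerm B i
  u = recip (suc i)

∣expTerm∣≤ : ∀ {q B} → ℚ.∣ q ∣ ℚ.≤ B → ∀ i → ℚ.∣ expTerm q i ∣ ℚ.≤ expTerm B i
∣expTerm∣≤ h zero = ℚP.≤-refl
∣expTerm∣≤ {q} {B} h (suc i) = begin
  ℚ.∣ t ℚ.* q ℚ.* u ∣            ≡⟨ ℚP.∣p*q∣≡∣p∣*∣q∣ (t ℚ.* q) u ⟩
  ℚ.∣ t ℚ.* q ∣ ℚ.* ℚ.∣ u ∣      ≡⟨ cong₂ ℚ._*_ (ℚP.∣p*q∣≡∣p∣*∣q∣ t q) (ℚP.0≤p⇒∣p∣≡p (recip-nonNeg (suc i))) ⟩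
  ℚ.∣ t ∣ ℚ.* ℚ.∣ q ∣ ℚ.* u      ≤⟨ ℚP.*-monoʳ-≤-nonNeg u {{ℚ.nonNegative (recip-nonNeg (suc i))}}
                                      (*-mono₂ (ℚP.0≤∣p∣ t) (∣expTerm∣≤ h i) (ℚP.0≤∣p∣ q) h) ⟩
  expTerm B i ℚ.* B ℚ.* u        ∎
  where
  open ℚP.≤-Reasoning
  t = expTerm q i
  u = recip (suc i)

-- Termwise derivative of the exponential series.
expTerm′ : ℚ → ℕ → ℚ
expTerm′ B zero    = 0ℚ
expTerm′ B (suc i) = expTerm B i

B*expTerm′ : ∀ B i → B ℚ.* expTerm′ B i ≡ fromℕ i ℚ.* expTerm B i
B*expTerm′ B zero    = trans (ℚP.*-zeroʳ B) (sym (ℚP.*-zeroˡ 1ℚ))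
B*expTerm′ B (suc i) = sym (expTerm-suc B i)

dist-*ʳ : ∀ a b {u} → 0ℚ ℚ.≤ u → dist (a ℚ.* u) (b ℚ.* u) ≡ dist a b ℚ.* u
dist-*ʳ a b {u} 0≤u = begin
  ℚ.∣ a ℚ.* u ℚ.- b ℚ.* u ∣  ≡⟨ cong ℚ.∣_∣ (ℚS.solve 3 (λ a b u → a ℚS.:* u ℚS.:- b ℚS.:* u ℚS.:= (a ℚS.:- b) ℚS.:* u) refl a b u) ⟩
  ℚ.∣ (a ℚ.- b) ℚ.* u ∣      ≡⟨ ℚP.∣p*q∣≡∣p∣*∣q∣ (a ℚ.- b) u ⟩
  dist a b ℚ.* ℚ.∣ u ∣       ≡⟨ cong (dist a b ℚ.*_) (ℚP.0≤p⇒∣p∣≡p 0≤u) ⟩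
  dist a b ℚ.* u             ∎
  where open ≡-Reasoning

expTerm-lip : ∀ {q r B} → ℚ.∣ q ∣ ℚ.≤ B → ℚ.∣ r ∣ ℚ.≤ B → ∀ i →
              dist (expTerm q i) (expTerm r i) ℚ.≤ expTerm′ B i ℚ.* dist q r
expTerm-lip {q} {r} hq hr zero = ℚP.≤-reflexive (sym (ℚP.*-zeroˡ (dist q r)))
expTerm-lip {q} {r} {B} hq hr (suc i) = begin
  dist (x ℚ.* q ℚ.* u) (y ℚ.* r ℚ.* u)           ≡⟨ dist-*ʳ (x ℚ.* q) (y ℚ.* r) 0≤u ⟩
  dist (x ℚ.* q) (y ℚ.* r) ℚ.* u                 ≤⟨ ℚP.*-monoʳ-≤-nonNeg u {{ℚ.nonNegative 0≤u}} step ⟩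
  (n ℚ.* a) ℚ.* d ℚ.* u                          ≡⟨ ℚS.solve 4 (λ n a d u → n ℚS.:* a ℚS.:* d ℚS.:* u ℚS.:= (n ℚS.:* u) ℚS.:* (a ℚS.:* d)) refl n a d u ⟩
  (n ℚ.* u) ℚ.* (a ℚ.* d)                        ≡⟨ cong (ℚ._* (a ℚ.* d)) (fromℕ*recip i) ⟩
  1ℚ ℚ.* (a ℚ.* d)                               ≡⟨ ℚP.*-identityˡ (a ℚ.* d) ⟩
  a ℚ.* d                                        ∎
  where
  open ℚP.≤-Reasoning
  x = expTerm q i
  y = expTerm r i
  u = recip (suc i)
  n = fromℕ (suc i)
  a = expTerm B i
  a′ = expTerm′ B i
  d = dist q r
  0≤u = recip-nonNeg (suc i)
  step : dist (x ℚ.* q) (y ℚ.* r) ℚ.≤ (n ℚ.* a) ℚ.* d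
  step = begin
    dist (x ℚ.* q) (y ℚ.* r)                     ≤⟨ dist-* x q y r ⟩
    ℚ.∣ x ∣ ℚ.* d ℚ.+ ℚ.∣ r ∣ ℚ.* dist x y       ≤⟨ ℚP.+-mono-≤
                                                     (ℚP.*-monoʳ-≤-nonNeg d {{ℚP.∣-∣-nonNeg (q ℚ.- r)}} (∣expTerm∣≤ hq i))
                                                     (*-mono₂ (ℚP.0≤∣p∣ r) hr (ℚP.0≤∣p∣ (x ℚ.- y)) (expTerm-lip hq hr i)) ⟩
    a ℚ.* d ℚ.+ B ℚ.* (a′ ℚ.* d)                 ≡⟨ cong (a ℚ.* d ℚ.+_) (ℚP.*-assoc B a′ d) ⟨
    a ℚ.* d ℚ.+ B ℚ.* a′ ℚ.* d                   ≡⟨ cong (λ z → a ℚ.* d ℚ.+ z ℚ.* d) (B*expTerm′ B i) ⟩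
    a ℚ.* d ℚ.+ fromℕ i ℚ.* a ℚ.* d              ≡⟨ ℚS.solve 3 (λ a d n → a ℚS.:* d ℚS.:+ n ℚS.:* a ℚS.:* d ℚS.:= ((ℚS.con 1ℚ ℚS.:+ n) ℚS.:* a) ℚS.:* d) refl a d (fromℕ i) ⟩
    (1ℚ ℚ.+ fromℕ i) ℚ.* a ℚ.* d                 ≡⟨ cong (λ z → z ℚ.* a ℚ.* d) (fromℕ-suc i) ⟨
    n ℚ.* a ℚ.* d                                ∎

expSum-lip : ∀ {q r B} → ℚ.∣ q ∣ ℚ.≤ B → ℚ.∣ r ∣ ℚ.≤ B → ∀ n →
             dist (expSum q (suc n)) (expSum r (suc n)) ℚ.≤ expSum B n ℚ.* dist q r
expSum-lip {q} {r} hq hr zero = ℚP.≤-reflexive (sym (ℚP.*-zeroˡ (dist q r)))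
expSum-lip {q} {r} {B} hq hr (suc n) = begin
  dist (expSum q (suc n) ℚ.+ expTerm q (suc n)) (expSum r (suc n) ℚ.+ expTerm r (suc n))
    ≤⟨ dist-+ (expSum q (suc n)) (expTerm q (suc n)) (expSum r (suc n)) (expTerm r (suc n)) ⟩
  dist (expSum q (suc n)) (expSum r (suc n)) ℚ.+ dist (expTerm q (suc n)) (expTerm r (suc n))
    ≤⟨ ℚP.+-mono-≤ (expSum-lip hq hr n) (expTerm-lip hq hr (suc n)) ⟩
  expSum B n ℚ.* dist q r ℚ.+ expTerm B n ℚ.* dist q r
    ≡⟨ ℚP.*-distribʳ-+ (dist q r) (expSum B n) (expTerm B n) ⟨
  (expSum B n ℚ.+ expTerm B n) ℚ.* dist q r ∎
  where open ℚP.≤-Reasoning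

expSum-tail : ∀ {q B} → ℚ.∣ q ∣ ℚ.≤ B → ∀ N n → N ℕ.≤ n →
              dist (expSum q n) (expSum q N) ℚ.+ expSum B N ℚ.≤ expSum B n
expSum-tail {q} {B} h N = induct-≥ P N base step
  where
  open ℚP.≤-Reasoning
  P : ℕ → Set
  P n = dist (expSum q n) (expSum q N) ℚ.+ expSum B N ℚ.≤ expSum B n
  base : P N
  base = ℚP.≤-reflexive (trans (cong (λ z → ℚ.∣ z ∣ ℚ.+ expSum B N) (ℚP.+-inverseʳ (expSum q N))) (ℚP.+-identityˡ (expSum B N)))
  step : ∀ n → N ℕ.≤ n → P n → P (suc n)
  step n _ ih = begin
    dist (S ℚ.+ t) S₀ ℚ.+ E₀                 ≤⟨ ℚP.+-monoˡ-≤ E₀ (dist-tri (S ℚ.+ t) S S₀) ⟩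
    dist (S ℚ.+ t) S ℚ.+ dist S S₀ ℚ.+ E₀    ≡⟨ cong (λ z → ℚ.∣ z ∣ ℚ.+ dist S S₀ ℚ.+ E₀) (ℚS.solve 2 (λ S t → S ℚS.:+ t ℚS.:- S ℚS.:= t) refl S t) ⟩
    ℚ.∣ t ∣ ℚ.+ dist S S₀ ℚ.+ E₀             ≡⟨ ℚP.+-assoc ℚ.∣ t ∣ (dist S S₀) E₀ ⟩
    ℚ.∣ t ∣ ℚ.+ (dist S S₀ ℚ.+ E₀)           ≤⟨ ℚP.+-mono-≤ (∣expTerm∣≤ h n) ih ⟩
    expTerm B n ℚ.+ expSum B n               ≡⟨ ℚP.+-comm (expTerm B n) (expSum B n) ⟩
    expSum B n ℚ.+ expTerm B n               ∎
    where
    S = expSum q n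
    S₀ = expSum q N
    E₀ = expSum B N
    t = expTerm q n

module ExpBound (B : ℚ) (0≤B : 0ℚ ℚ.≤ B) (K : ℕ) (2B≤K : B ℚ.+ B ℚ.≤ fromℕ K) where
  a : ℕ → ℚ
  a = expTerm B

  0≤a : ∀ i → 0ℚ ℚ.≤ a i
  0≤a = expTerm-nonNeg 0≤B

  2B≤ : ∀ {n} → K ℕ.≤ n → B ℚ.+ B ℚ.≤ fromℕ n
  2B≤ K≤n = ℚP.≤-trans 2B≤K (fromℕ-mono K≤n)

  halving : ∀ n → K ℕ.≤ n → a (suc n) ℚ.+ a (suc n) ℚ.≤ a n
  halving n K≤n = begin
    a n ℚ.* B ℚ.* u ℚ.+ a n ℚ.* B ℚ.* u  ≡⟨ ℚS.solve 3 (λ a B u → a ℚS.:* B ℚS.:* u ℚS.:+ a ℚS.:* B ℚS.:* u ℚS.:= u ℚS.:* ((B ℚS.:+ B) ℚS.:* a)) refl (a n) B u ⟩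
    u ℚ.* ((B ℚ.+ B) ℚ.* a n)            ≤⟨ recip≤ n (ℚP.*-monoʳ-≤-nonNeg (a n) {{ℚ.nonNegative (0≤a n)}} (2B≤ (ℕP.m≤n⇒m≤1+n K≤n))) ⟩
    a n                                  ∎
    where
    open ℚP.≤-Reasoning
    u = recip (suc n)

  e : ℕ → ℚ
  e n = a n ℚ.+ a n

  tail : ∀ N → K ℕ.≤ N → ∀ n → N ℕ.≤ n → expSum B n ℚ.≤ expSum B N ℚ.+ e N
  tail N K≤N n N≤n = proj₂ (telescope (expSum B) e (λ n → +-nonNeg (0≤a n) (0≤a n)) N
    (λ n _ → ≤-+ʳ (0≤a n))
    (λ n N≤n → ℚP.≤-trans (ℚP.≤-reflexive (ℚP.+-assoc (expSum B n) (a n) (e (suc n))))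
      (ℚP.+-monoʳ-≤ (expSum B n) (ℚP.+-monoʳ-≤ (a n) (halving n (ℕP.≤-trans K≤N N≤n)))))
    n N≤n)

  C₀ : ℚ
  C₀ = fromℕ K ℚ.* a K

  decay : ∀ n → K ℕ.≤ n → fromℕ n ℚ.* a n ℚ.≤ C₀
  decay = induct-≥ (λ n → fromℕ n ℚ.* a n ℚ.≤ C₀) K ℚP.≤-refl λ n K≤n ih → begin
    fromℕ (suc n) ℚ.* a (suc n)  ≡⟨ expTerm-suc B n ⟩
    B ℚ.* a n                    ≤⟨ ℚP.*-monoʳ-≤-nonNeg (a n) {{ℚ.nonNegative (0≤a n)}} (ℚP.≤-trans (≤-+ʳ {B} 0≤B) (2B≤ K≤n)) ⟩
    fromℕ n ℚ.* a n              ≤⟨ ih ⟩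
    C₀                           ∎
    where open ℚP.≤-Reasoning

  0≤C₀ : 0ℚ ℚ.≤ C₀
  0≤C₀ = *-nonNeg (fromℕ-nonNeg K) (0≤a K)

  e≤ : ∀ n → K ℕ.≤ n → e (suc n) ℚ.≤ recip (suc n) ℚ.* (C₀ ℚ.+ C₀)
  e≤ n K≤n = ℚP.≤-trans (ℚP.+-mono-≤ h h) (ℚP.≤-reflexive (sym (ℚP.*-distribˡ-+ (recip (suc n)) C₀ C₀)))
    where h = ≤recip n (decay (suc n) (ℕP.m≤n⇒m≤1+n K≤n))

  C : ℚ
  C = 1ℚ ℚ.+ (expSum B K ℚ.+ e K)

  expSum-nonNeg : ∀ n → 0ℚ ℚ.≤ expSum B n
  expSum-nonNeg zero    = ℚP.≤-refl
  expSum-nonNeg (suc n) = +-nonNeg (expSum-nonNeg n) (0≤a n)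

  0<C : 0ℚ ℚ.< C
  0<C = ℚP.<-≤-trans (ℚP.positive⁻¹ 1ℚ) (≤-+ʳ (+-nonNeg (expSum-nonNeg K) (+-nonNeg (0≤a K) (0≤a K))))

  expSum≤C : ∀ n → K ℕ.≤ n → expSum B n ℚ.≤ C
  expSum≤C n K≤n = ℚP.≤-trans (tail K ℕP.≤-refl n K≤n)
    (ℚP.≤-trans (≤-+ʳ 0≤1) (ℚP.≤-reflexive (ℚP.+-comm (expSum B K ℚ.+ e K) 1ℚ)))

  diff : ∀ {q r} → ℚ.∣ q ∣ ℚ.≤ B → ℚ.∣ r ∣ ℚ.≤ B → ∀ N n → K ℕ.≤ N → N ℕ.≤ n →
         dist (expSum q (suc n)) (expSum r (suc N)) ℚ.≤ C ℚ.* dist q r ℚ.+ recip (suc N) ℚ.* (C₀ ℚ.+ C₀)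
  diff {q} {r} hq hr N n K≤N N≤n = begin
    dist (expSum q (suc n)) (expSum r (suc N))
      ≤⟨ dist-tri (expSum q (suc n)) (expSum r (suc n)) (expSum r (suc N)) ⟩
    dist (expSum q (suc n)) (expSum r (suc n)) ℚ.+ dist (expSum r (suc n)) (expSum r (suc N))
      ≤⟨ ℚP.+-mono-≤ first second ⟩
    C ℚ.* dist q r ℚ.+ recip (suc N) ℚ.* (C₀ ℚ.+ C₀) ∎
    where
    open ℚP.≤-Reasoning
    first = ℚP.≤-trans (expSum-lip hq hr n)
      (ℚP.*-monoʳ-≤-nonNeg (dist q r) {{ℚP.∣-∣-nonNeg (q ℚ.- r)}} (expSum≤C n (ℕP.≤-trans K≤N N≤n)))
    D = dist (expSum r (suc n)) (expSum r (suc N))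
    E = expSum B (suc N)
    second : D ℚ.≤ recip (suc N) ℚ.* (C₀ ℚ.+ C₀)
    second = begin
      D                     ≡⟨ ℚS.solve 2 (λ D E → D ℚS.:= D ℚS.:+ E ℚS.:- E) refl D E ⟩
      D ℚ.+ E ℚ.- E         ≤⟨ ℚP.+-monoˡ-≤ (ℚ.- E) (ℚP.≤-trans (expSum-tail hr (suc N) (suc n) (ℕ.s≤s N≤n))
                                 (tail (suc N) (ℕP.m≤n⇒m≤1+n K≤N) (suc n) (ℕ.s≤s N≤n))) ⟩
      E ℚ.+ e (suc N) ℚ.- E ≡⟨ ℚS.solve 2 (λ E e → E ℚS.:+ e ℚS.:- E ℚS.:= e) refl E (e (suc N)) ⟩
      e (suc N)             ≤⟨ e≤ N K≤N ⟩
      recip (suc N) ℚ.* (C₀ ℚ.+ C₀) ∎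

exp-cauchy : ∀ s → IsCauchy s → IsCauchy (λ n → expSum (s n) (suc n))
exp-cauchy s cs = fromTail (λ n → expSum (s n) (suc n)) λ ε 0<ε →
  let B , 0<B , L , hB = bound s cs
      K , 2B≤K = archimedean (B ℚ.+ B)
      open ExpBound B (ℚP.<⇒≤ 0<B) K 2B≤K
      δ , 0<δ , δ+δ≡ε = half 0<ε
      η , 0<η , Cη≡δ = scale C 0<C 0<δ
      M , hM = cs η 0<η
      P , hP = C*recip≤ (C₀ ℚ.+ C₀) 0<δ
      N = (K ℕ.⊔ L) ℕ.⊔ (M ℕ.⊔ P)
      KL≤N = ℕP.m≤m⊔n (K ℕ.⊔ L) (M ℕ.⊔ P)
      MP≤N = ℕP.m≤n⊔m (K ℕ.⊔ L) (M ℕ.⊔ P)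
      K≤N = ℕP.m⊔n≤o⇒m≤o K L KL≤N
      L≤N = ℕP.m⊔n≤o⇒n≤o K L KL≤N
      M≤N = ℕP.m⊔n≤o⇒m≤o M P MP≤N
      P≤N = ℕP.m⊔n≤o⇒n≤o M P MP≤N
  in N , λ n N≤n → begin
    dist (expSum (s n) (suc n)) (expSum (s N) (suc N))
      ≤⟨ diff (hB n (ℕP.≤-trans L≤N N≤n)) (hB N L≤N) N n K≤N N≤n ⟩
    C ℚ.* dist (s n) (s N) ℚ.+ recip (suc N) ℚ.* (C₀ ℚ.+ C₀)
      ≤⟨ ℚP.+-mono-≤ (*-mono (ℚP.<⇒≤ 0<C) (hM n N (ℕP.≤-trans M≤N N≤n) M≤N))
           (ℚP.*-monoʳ-≤-nonNeg (C₀ ℚ.+ C₀) {{ℚ.nonNegative (+-nonNeg 0≤C₀ 0≤C₀)}} (recip-anti P≤N)) ⟩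
    C ℚ.* η ℚ.+ recip (suc P) ℚ.* (C₀ ℚ.+ C₀)
      ≤⟨ ℚP.+-mono-≤ (ℚP.≤-reflexive Cη≡δ) hP ⟩
    δ ℚ.+ δ
      ≡⟨ δ+δ≡ε ⟩
    ε ∎
  where open ℚP.≤-Reasoning

exp : ℝ → ℝ
exp x = mkℝ (λ n → expSum (seq x n) (suc n)) (exp-cauchy (seq x) (cauchy x))

infixl 7 _/ℕ_
infixr 8 _^ʳ_
infix  4 _⟶_

nat : ℕ → ℝ
nat n = ι (fromℕ n)

-- x /ℕ 0 = 0 is a junk value.
_/ℕ_ : ℝ → ℕ → ℝ
x /ℕ n = x * ι (recip n)

-- n to a real power, for n ≥ 1.
_^ʳ_ : ℕ → ℝ → ℝ
n ^ʳ x = exp (x * log n)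

Eventually : (ℕ → Set) → Set
Eventually P = ∃ λ N → ∀ n → N ℕ.≤ n → P n

_⟶_ : (ℕ → ℝ) → ℝ → Set
f ⟶ l = ∀ ε → ι 0ℚ < ε → Eventually λ n → l - ε ≤ f n × f n ≤ l + ε

record Graph (n : ℕ) : Set₁ where
  field
    Adj    : Fin n → Fin n → Set
    adj?   : ∀ u v → Dec (Adj u v)
    symm   : ∀ {u v} → Adj u v → Adj v u
    irrefl : ∀ {v} → ¬ Adj v v

open Graph public

infixr 6 _∪_

_∪_ : ∀ {n} → Graph n → Graph n → Graph n
G ∪ H = record
  { Adj    = λ u v → Adj G u v ⊎ Adj H u v
  ; adj?   = λ u v → adj? G u v ⊎-dec adj? H u v
  ; symm   = Sum.map (symm G) (symm H)
  ; irrefl = Sum.[ irrefl G , irrefl H ]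
  }

edgeGraph : ∀ {n} → List (Fin n × Fin n) → Graph n
edgeGraph {n} F = record
  { Adj    = λ u v → u ≢ v × (((u , v) ∈ₗ F) ⊎ ((v , u) ∈ₗ F))
  ; adj?   = λ u v → ¬? (u FinP.≟ v) ×-dec (((u , v) ∈ₗ? F) ⊎-dec ((v , u) ∈ₗ? F))
  ; symm   = λ (u≢v , uv) → u≢v ∘ sym , swap uv
  ; irrefl = λ (v≢v , _) → v≢v refl
  }
  where
  open ListMem using () renaming (_∈_ to _∈ₗ_)
  open ListMem? (≡-dec (FinP._≟_ {n}) (FinP._≟_ {n})) using () renaming (_∈?_ to _∈ₗ?_)

degree : ∀ {n} → Graph n → Fin n → ℕ
degree {n} G v = length (filter (adj? G v) (allFin n))

-- The seed n of the minimum is inert for n ≥ 1, since degrees are smaller than n.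
δ : ∀ {n} → Graph n → ℕ
δ {n} G = min n (map (degree G) (allFin n))

Independent : ∀ {n} → Graph n → Subset n → Set
Independent G S = ∀ u v → u ∈ S → v ∈ S → ¬ Adj G u v

independent? : ∀ {n} (G : Graph n) (S : Subset n) → Dec (Independent G S)
independent? G S = FinP.all? λ u → FinP.all? λ v →
  (u ∈? S) →-dec ((v ∈? S) →-dec ¬? (adj? G u v))

subsets : ∀ n → List (Subset n)
subsets zero    = [] ∷ []
subsets (suc n) = map (outside ∷_) (subsets n) ++ map (inside ∷_) (subsets n)

α : ∀ {n} → Graph n → ℕ
α {n} G = max 0 (map ∣_∣ (filter (independent? G) (subsets n)))

closed : ∀ {A : Set} → List A → List A
closed []       = []
closed (x ∷ xs) = (x ∷ xs) ∷ʳ x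

HasCycle : ∀ {n} → Graph n → ℕ → Set
HasCycle {n} G ℓ = 3 ℕ.≤ ℓ × ∃ λ (xs : Vec (Fin n) ℓ) →
  Unique (toList xs) × Linked (Adj G) (closed (toList xs))

Hamiltonian : ∀ {n} → Graph n → Set
Hamiltonian {n} G = HasCycle G n

Pancyclic : ∀ {n} → Graph n → Set
Pancyclic {n} G = ∀ ℓ → 3 ℕ.≤ ℓ → ℓ ℕ.≤ n → HasCycle G ℓ

anyVec? : ∀ {n} m {P : Vec (Fin n) m → Set} → (∀ xs → Dec (P xs)) → Dec (∃ P)
anyVec? zero    P? = map′ ([] ,_) (λ { ([] , p) → p }) (P? [])
anyVec? (suc m) P? = map′ (λ (x , xs , p) → x ∷ xs , p) (λ { (x ∷ xs , p) → x , xs , p })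
  (FinP.any? λ x → anyVec? m λ xs → P? (x ∷ xs))

hasCycle? : ∀ {n} (G : Graph n) ℓ → Dec (HasCycle G ℓ)
hasCycle? {n} G ℓ = (3 ℕP.≤? ℓ) ×-dec anyVec? ℓ λ xs →
  Unique?.unique? (FinP._≟_ {n}) (toList xs) ×-dec linked? (adj? G) (closed (toList xs))

hamiltonian? : ∀ {n} (G : Graph n) → Dec (Hamiltonian G)
hamiltonian? {n} G = hasCycle? G n

nonHamiltonian? : ∀ {n} (G : Graph n) → Dec (¬ Hamiltonian G)
nonHamiltonian? G = ¬? (hamiltonian? G)

pancyclic? : ∀ {n} (G : Graph n) → Dec (Pancyclic G)
pancyclic? {n} G =
  map′ (λ h ℓ 3≤ℓ ℓ≤n → h (ℕ.s≤s ℓ≤n) 3≤ℓ) (λ h {ℓ} ℓ<1+n 3≤ℓ → h ℓ 3≤ℓ (ℕP.≤-pred ℓ<1+n))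
    (ℕP.allUpTo? (λ ℓ → (3 ℕP.≤? ℓ) →-dec hasCycle? G ℓ) (suc n))

module _ {n} (G : Graph n) (S : Subset n) where

  Remaining : Set
  Remaining = ∃ λ (v : Fin n) → v ∉ S

  Reachable : Remaining → Remaining → Set
  Reachable = Star λ u v → Adj G (proj₁ u) (proj₁ v)

  -- G ∖ S has exactly c connected components: labelling vertices by components
  -- identifies the quotient of V(G) ∖ S by reachability with Fin c.
  record ComponentCount (c : ℕ) : Set where
    field
      component  : Remaining → Fin c
      surjective : StrictlySurjective _≡_ component
      separates  : ∀ u v → component u ≡ component v ⇔ Reachable u v

-- For t > 0: the number c of components of G ∖ S is at most max {1, ∣S∣ / t}.
Tough : ∀ {n} → ℝ → Graph n → Set
Tough t G = ∀ S c → ComponentCount G S c → c ℕ.≤ 1 ⊎ t * nat c ≤ nat ∣ S ∣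

-- Expectation of f of the random sublist of xs that keeps each entry
-- independently with probability p.
𝔼 : ∀ {A : Set} → ℝ → List A → (List A → ℝ) → ℝ
𝔼 p []       f = f []
𝔼 p (x ∷ xs) f = p * 𝔼 p xs (f ∘ (x ∷_)) + (ι 1ℚ - p) * 𝔼 p xs f

𝟙 : ∀ {P : Set} → Dec P → ℝ
𝟙 (yes _) = ι 1ℚ
𝟙 (no _)  = ι 0ℚ

pairs : ∀ n → List (Fin n × Fin n)
pairs n = filter (λ (i , j) → i FinP.<? j) (cartesianProduct (allFin n) (allFin n))

-- The probability that G ∪ 𝔾(n,p) has the property decided by P?.
ℙ[_∪𝔾_⊨_] : ∀ {n} {P : Graph n → Set} → Graph n → ℝ → (∀ H → Dec (P H)) → ℝ
ℙ[_∪𝔾_⊨_] {n} G p P? = 𝔼 p (pairs n) λ F → 𝟙 (P? (G ∪ edgeGraph F))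

AAS[_∪𝔾_⊨_] : {P : ∀ {n} → Graph n → Set} →
              (∀ n → Graph n) → (ℕ → ℝ) → (∀ {n} (H : Graph n) → Dec (P H)) → Set
AAS[ G ∪𝔾 p ⊨ P? ] = (λ n → ℙ[ G n ∪𝔾 p n ⊨ P? ]) ⟶ ι 1ℚ

IsProbability : ℝ → Set
IsProbability p = ι 0ℚ ≤ p × p ≤ ι 1ℚ

_⟶∞ : (ℕ → ℕ) → Set
k ⟶∞ = ∀ M → Eventually λ n → M ℕ.≤ k n

{-# OPTIONS --safe #-}
module Submission where

-- Write R for the random graph, a = α(G), k = δ(G).
--
-- (a) If k is a large multiple of a, then G ∪ R restricted to any vertex set W of at least n/2 vertices
-- in which all degrees of G stay of order k is a.a.s. tough: a set S violating toughness is coded, together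
-- with the smaller half of the components of (G ∪ R) ∖ S, by few vertices, and R has no edge between the two
-- halves, which is too unlikely for the number of codes.  Such a W is Hamiltonian by hypothesis.  Half of the
-- vertices can be chosen so that all vertices keep degree k/20 into it, which gives all cycles of length at
-- least n/2.  For the lengths between 4a and n/2, set a chain of 2a triangles aside, whose ends are joined by
-- paths of many lengths, and shorten an arc of a Hamilton cycle of the rest along the chords that the small
-- independence number forces.
-- The lengths up to 4a are found in G alone, from its breadth-first levels, as in the Ramsey problem of a cycle
-- against a complete graph.
--
-- (b) H consists of many cliques of size k + 1 and one large clique; a.a.s. one of the small cliques meets no
-- edge of R (second moment method).
--
-- (c) H is complete except for an independent set A with k - 1 vertices that sees only k/2 vertices.  A Hamilton
-- cycle would need more edges of R at A than there are (Chebyshev).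

-- In (a) two quantities compete, both exponential in the number M of representatives in a code. A
-- set `S` that violates toughness has fewer than T elements per component, and the M
-- representatives of the chosen half have disjoint neighbourhoods of order k outside `S`. So there
-- are at most n^((3T + 1)M) codes with M representatives, while at least M times a quantity of
-- order nk pairs join the two halves. All of them are avoided with probability n^(-CM) once p is a
-- large multiple of log n / (nk): this is the origin of the threshold. For the middle lengths the
-- obstacle is that a chord shortens a path by an unknown amount between 1 and 2a. The triangle
-- chain repairs exactly this, since its 2a apices can be visited or skipped at will. In (b) the
-- pairs from a small clique to the large one form disjoint sets for distinct cliques, so the events
-- that they contain no edge are independent; the pairs among the small cliques are so few that
-- a.a.s. none of them is an edge. All probabilities are estimated for rational p and transferred to
-- real p by approximation.

-- Counting in finite types

module Counting where

  open import Data.Nat.Base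
  open import Data.Nat.Properties
  open import Data.Nat.Solver using (module +-*-Solver)
  open import Data.Fin.Base using (Fin; zero; suc)
  import Data.Fin.Properties as Fin
  open import Data.List.Base using (List; []; _∷_; _++_; map; filter; length; allFin; tabulate; cartesianProduct; lookup)
  open import Data.List.Membership.Propositional using (_∈_; _∉_)
  import Data.List.Membership.DecPropositional as Mem?
  open import Data.List.Membership.Propositional.Properties using (∈-filter⁺; ∈-filter⁻; ∈-allFin; ∈-lookup)
  open import Data.List.Relation.Unary.Any using (here; there)
  open import Data.List.Relation.Unary.All as All using (All; []; _∷_)
  open import Data.List.Relation.Unary.AllPairs using ([]; _∷_)
  open import Data.List.Relation.Unary.Unique.Propositional using (Unique)
  import Data.List.Relation.Unary.Unique.Propositional.Properties as Unique
  open import Data.Product.Base using (∃; _×_; _,_; proj₂)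
  open import Data.Sum.Base using (_⊎_; inj₁; inj₂)
  open import Data.Empty using (⊥; ⊥-elim)
  open import Function.Base using (_∘_; id)
  open import Relation.Binary.PropositionalEquality
  open import Relation.Nullary using (¬_; Dec; yes; no; contradiction)
  open import Relation.Nullary.Decidable using (_×-dec_; ¬?)

  bit : ∀ {P : Set} → Dec P → ℕ
  bit (yes _) = 1
  bit (no _)  = 0

  bit-mono : ∀ {P Q : Set} (p : Dec P) (q : Dec Q) → (P → Q) → bit p ≤ bit q
  bit-mono (no _)  _       _ = z≤n
  bit-mono (yes p) (yes _) _ = s≤s z≤n
  bit-mono (yes p) (no ¬q) f = contradiction (f p) ¬q

  bit-yes : ∀ {P : Set} (p : Dec P) → P → bit p ≡ 1
  bit-yes (yes _) _ = refl
  bit-yes (no ¬p) p = contradiction p ¬p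

  bit-no : ∀ {P : Set} (p : Dec P) → ¬ P → bit p ≡ 0
  bit-no (yes p) ¬p = contradiction p ¬p
  bit-no (no _)  _  = refl

  bit≤1 : ∀ {P : Set} (p : Dec P) → bit p ≤ 1
  bit≤1 (yes _) = s≤s z≤n
  bit≤1 (no _)  = z≤n

  bit-⊎ : ∀ {P Q R : Set} (p : Dec P) (q : Dec Q) (r : Dec R) → (R → P ⊎ Q) → bit r ≤ bit p + bit q
  bit-⊎ p q (no _) _ = z≤n
  bit-⊎ p q (yes r) f with f r
  ... | inj₁ x = ≤-trans (≤-reflexive (sym (bit-yes p x))) (m≤m+n _ _)
  ... | inj₂ y = ≤-trans (≤-reflexive (sym (bit-yes q y))) (m≤n+m _ _)

  bit-disjoint : ∀ {P Q R : Set} (p : Dec P) (q : Dec Q) (r : Dec R) →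
                 (P → R) → (Q → R) → (P → Q → ⊥) → bit p + bit q ≤ bit r
  bit-disjoint (no _)  q       r _ g _ = bit-mono q r g
  bit-disjoint (yes p) (no _)  r f _ _ = ≤-reflexive (trans (+-identityʳ 1) (sym (bit-yes r (f p))))
  bit-disjoint (yes p) (yes q) r _ _ h = ⊥-elim (h p q)

  opaque
    ∑ : ∀ {n} → (Fin n → ℕ) → ℕ
    ∑ {zero}  f = 0
    ∑ {suc n} f = f zero + ∑ (f ∘ suc)

    ∑-mono : ∀ {n} {f g : Fin n → ℕ} → (∀ i → f i ≤ g i) → ∑ f ≤ ∑ g
    ∑-mono {zero}  h = z≤n
    ∑-mono {suc n} h = +-mono-≤ (h zero) (∑-mono (h ∘ suc))

    ∑-cong : ∀ {n} {f g : Fin n → ℕ} → (∀ i → f i ≡ g i) → ∑ f ≡ ∑ g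
    ∑-cong {zero}  h = refl
    ∑-cong {suc n} h = cong₂ _+_ (h zero) (∑-cong (h ∘ suc))

    ∑-+ : ∀ {n} (f g : Fin n → ℕ) → ∑ (λ i → f i + g i) ≡ ∑ f + ∑ g
    ∑-+ {zero}  f g = refl
    ∑-+ {suc n} f g = trans (cong (f zero + g zero +_) (∑-+ (f ∘ suc) (g ∘ suc)))
      (solve 4 (λ a b c d → a :+ b :+ (c :+ d) := a :+ c :+ (b :+ d)) refl (f zero) (g zero) (∑ (f ∘ suc)) (∑ (g ∘ suc)))
      where open +-*-Solver

    ∑-const : ∀ n c → ∑ {n} (λ _ → c) ≡ n * c
    ∑-const zero    c = refl
    ∑-const (suc n) c = cong (c +_) (∑-const n c)

    ∑-*ˡ : ∀ {n} c (f : Fin n → ℕ) → ∑ (λ i → c * f i) ≡ c * ∑ f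
    ∑-*ˡ {zero}  c f = sym (*-zeroʳ c)
    ∑-*ˡ {suc n} c f = trans (cong (c * f zero +_) (∑-*ˡ c (f ∘ suc))) (sym (*-distribˡ-+ c (f zero) _))

  ∑-*ʳ : ∀ {n} c (f : Fin n → ℕ) → ∑ (λ i → f i * c) ≡ ∑ f * c
  ∑-*ʳ c f = trans (∑-cong λ i → *-comm (f i) c) (trans (∑-*ˡ c f) (*-comm c _))

  opaque
    unfolding ∑

    ∑-swap : ∀ {m n} (f : Fin m → Fin n → ℕ) → ∑ (λ i → ∑ (f i)) ≡ ∑ (λ j → ∑ (λ i → f i j))
    ∑-swap {zero}  {n} f = sym (trans (∑-const n 0) (*-zeroʳ n))
    ∑-swap {suc m} f = trans (cong (∑ (f zero) +_) (∑-swap (f ∘ suc))) (sym (∑-+ (f zero) _))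

    ∑-term : ∀ {n} (f : Fin n → ℕ) i → f i ≤ ∑ f
    ∑-term f zero    = m≤m+n _ _
    ∑-term f (suc i) = ≤-trans (∑-term (f ∘ suc) i) (m≤n+m _ _)

    ∑-delta : ∀ {n} (f : Fin n → ℕ) j → ∑ (λ i → bit (i Fin.≟ j) * f i) ≡ f j
    ∑-delta {suc n} f zero = trans (cong₂ _+_ (+-identityʳ (f zero)) (trans (∑-const n 0) (*-zeroʳ n))) (+-identityʳ _)
    ∑-delta f (suc j) = trans (∑-cong λ i → cong (_* f (suc i)) (lemma i)) (∑-delta (f ∘ suc) j)
      where
      lemma : ∀ i → bit (suc i Fin.≟ suc j) ≡ bit (i Fin.≟ j)
      lemma i with i Fin.≟ j
      ... | yes _ = refl
      ... | no _  = refl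

  # : ∀ {n} {P : Fin n → Set} → (∀ i → Dec (P i)) → ℕ
  # P? = ∑ (λ i → bit (P? i))

  module _ {n : ℕ} {P Q : Fin n → Set} (P? : ∀ i → Dec (P i)) (Q? : ∀ i → Dec (Q i)) where

    #-mono : (∀ i → P i → Q i) → # P? ≤ # Q?
    #-mono h = ∑-mono λ i → bit-mono (P? i) (Q? i) (h i)

    #-⊎ : ∀ {R : Fin n → Set} (R? : ∀ i → Dec (R i)) → (∀ i → R i → P i ⊎ Q i) → # R? ≤ # P? + # Q?
    #-⊎ R? h = ≤-trans (∑-mono λ i → bit-⊎ (P? i) (Q? i) (R? i) (h i)) (≤-reflexive (∑-+ _ _))

    #-disjoint : ∀ {R : Fin n → Set} (R? : ∀ i → Dec (R i)) → (∀ i → P i → R i) → (∀ i → Q i → R i) →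
                 (∀ i → P i → Q i → ⊥) → # P? + # Q? ≤ # R?
    #-disjoint R? f g h = ≤-trans (≤-reflexive (sym (∑-+ _ _)))
      (∑-mono λ i → bit-disjoint (P? i) (Q? i) (R? i) (f i) (g i) (h i))

  module _ {n : ℕ} {P : Fin n → Set} (P? : ∀ i → Dec (P i)) where

    #-all : (∀ i → P i) → # P? ≡ n
    #-all h = trans (∑-cong λ i → bit-yes (P? i) (h i)) (trans (∑-const n 1) (*-identityʳ n))

    #≤n : # P? ≤ n
    #≤n = ≤-trans (∑-mono λ i → bit≤1 (P? i)) (≤-reflexive (trans (∑-const n 1) (*-identityʳ n)))

    #-∃ : ∀ i → P i → 1 ≤ # P?
    #-∃ i p = ≤-trans (≤-reflexive (sym (bit-yes (P? i) p))) (∑-term (λ i → bit (P? i)) i)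

  opaque
    unfolding ∑

    #-find : ∀ {n} {P : Fin n → Set} (P? : ∀ i → Dec (P i)) → 1 ≤ # P? → ∃ P
    #-find {zero}  P? ()
    #-find {suc n} P? h with P? zero
    ... | yes p = zero , p
    ... | no _  with i , p ← #-find (P? ∘ suc) h = suc i , p

  sumL : ∀ {A : Set} → (A → ℕ) → List A → ℕ
  sumL f []       = 0
  sumL f (x ∷ xs) = f x + sumL f xs

  module _ {A : Set} where

    sumL-++ : ∀ (f : A → ℕ) xs ys → sumL f (xs ++ ys) ≡ sumL f xs + sumL f ys
    sumL-++ f []       ys = refl
    sumL-++ f (x ∷ xs) ys = trans (cong (f x +_) (sumL-++ f xs ys)) (sym (+-assoc (f x) _ _))

    sumL-cong : ∀ {f g : A → ℕ} xs → (∀ {x} → x ∈ xs → f x ≡ g x) → sumL f xs ≡ sumL g xs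
    sumL-cong []       h = refl
    sumL-cong (x ∷ xs) h = cong₂ _+_ (h (here refl)) (sumL-cong xs (h ∘ there))

    sumL-mono : ∀ {f g : A → ℕ} xs → (∀ {x} → x ∈ xs → f x ≤ g x) → sumL f xs ≤ sumL g xs
    sumL-mono []       h = z≤n
    sumL-mono (x ∷ xs) h = +-mono-≤ (h (here refl)) (sumL-mono xs (h ∘ there))

    sumL-+ : ∀ (f g : A → ℕ) xs → sumL (λ x → f x + g x) xs ≡ sumL f xs + sumL g xs
    sumL-+ f g []       = refl
    sumL-+ f g (x ∷ xs) = trans (cong (f x + g x +_) (sumL-+ f g xs))
      (solve 4 (λ a b c d → a :+ b :+ (c :+ d) := a :+ c :+ (b :+ d)) refl (f x) (g x) (sumL f xs) (sumL g xs))
      where open +-*-Solver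

    sumL-const : ∀ c (xs : List A) → sumL (λ _ → c) xs ≡ length xs * c
    sumL-const c []       = refl
    sumL-const c (x ∷ xs) = cong (c +_) (sumL-const c xs)

    sumL-filter : ∀ {P : A → Set} (P? : ∀ x → Dec (P x)) f xs →
                  sumL f (filter P? xs) ≡ sumL (λ x → bit (P? x) * f x) xs
    sumL-filter P? f []       = refl
    sumL-filter P? f (x ∷ xs) with P? x
    ... | yes _ = cong₂ _+_ (sym (+-identityʳ (f x))) (sumL-filter P? f xs)
    ... | no _  = sumL-filter P? f xs

    sumL-map : ∀ {B : Set} (f : A → ℕ) (g : B → A) xs → sumL f (map g xs) ≡ sumL (f ∘ g) xs
    sumL-map f g []       = refl
    sumL-map f g (x ∷ xs) = cong (f (g x) +_) (sumL-map f g xs)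

    sumL-term : ∀ (f : A → ℕ) {x xs} → x ∈ xs → f x ≤ sumL f xs
    sumL-term f (here refl) = m≤m+n _ _
    sumL-term f (there x∈)  = ≤-trans (sumL-term f x∈) (m≤n+m _ _)

  sumL-swap : ∀ {A B : Set} (f : A → B → ℕ) xs ys → sumL (λ x → sumL (f x) ys) xs ≡ sumL (λ y → sumL (λ x → f x y) xs) ys
  sumL-swap f []       ys = sym (trans (sumL-const 0 ys) (*-zeroʳ (length ys)))
  sumL-swap f (x ∷ xs) ys = trans (cong (sumL (f x) ys +_) (sumL-swap f xs ys)) (sym (sumL-+ (f x) _ ys))

  opaque
    unfolding ∑

    sumL-lookup : ∀ {A : Set} (f : A → ℕ) xs → ∑ (λ i → f (lookup xs i)) ≡ sumL f xs
    sumL-lookup f []       = refl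
    sumL-lookup f (x ∷ xs) = cong (f x +_) (sumL-lookup f xs)

    sumL-tabulate : ∀ {n} {A : Set} (f : A → ℕ) (g : Fin n → A) → sumL f (tabulate g) ≡ ∑ (f ∘ g)
    sumL-tabulate {zero}  f g = refl
    sumL-tabulate {suc n} f g = cong (f (g zero) +_) (sumL-tabulate f (g ∘ suc))

  sumL-allFin : ∀ {n} (f : Fin n → ℕ) → sumL f (allFin n) ≡ ∑ f
  sumL-allFin f = sumL-tabulate f id

  sumL-cartesian : ∀ {A B : Set} (f : A × B → ℕ) xs ys →
                   sumL f (cartesianProduct xs ys) ≡ sumL (λ x → sumL (λ y → f (x , y)) ys) xs
  sumL-cartesian f []       ys = refl
  sumL-cartesian f (x ∷ xs) ys = trans (sumL-++ f (map (x ,_) ys) _)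
    (cong₂ _+_ (sumL-map f (x ,_) ys) (sumL-cartesian f xs ys))

  length-filter : ∀ {A : Set} {P : A → Set} (P? : ∀ x → Dec (P x)) xs → length (filter P? xs) ≡ sumL (λ x → bit (P? x)) xs
  length-filter P? []       = refl
  length-filter P? (x ∷ xs) with P? x
  ... | yes _ = cong suc (length-filter P? xs)
  ... | no _  = length-filter P? xs

  module _ {n : ℕ} where

    open Mem? (Fin._≟_ {n}) public using (_∈?_)

    _∉?_ : ∀ (x : Fin n) xs → Dec (x ∉ xs)
    x ∉? xs = ¬? (x ∈? xs)

    -- Induction on the list: the head pays for its own value, and `g` is `f` with that value
    -- erased. The tail avoids the head, so it has the same sum for both functions.
    sumL-unique : ∀ (f : Fin n → ℕ) {xs} → Unique xs → sumL f xs ≤ ∑ f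
    sumL-unique f [] = z≤n
    sumL-unique f {x ∷ xs} (x∉xs ∷ u) = begin
      f x + sumL f xs                             ≡⟨ cong (f x +_) (sumL-cong xs eq) ⟩
      f x + sumL g xs                             ≤⟨ +-monoʳ-≤ (f x) (sumL-unique g u) ⟩
      f x + ∑ g                                   ≡⟨ cong (_+ ∑ g) (∑-delta f x) ⟨
      ∑ (λ i → bit (i Fin.≟ x) * f i) + ∑ g       ≡⟨ ∑-+ _ g ⟨
      ∑ (λ i → bit (i Fin.≟ x) * f i + g i)       ≡⟨ ∑-cong split ⟩
      ∑ f                                         ∎
      where
      open ≤-Reasoning
      g : Fin n → ℕ
      g i = bit (¬? (i Fin.≟ x)) * f i
      eq : ∀ {y} → y ∈ xs → f y ≡ g y
      eq {y} y∈ with y Fin.≟ x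
      ... | yes refl = contradiction refl (All.lookup x∉xs y∈)
      ... | no _     = sym (+-identityʳ (f y))
      split : ∀ i → bit (i Fin.≟ x) * f i + g i ≡ f i
      split i with i Fin.≟ x
      ... | yes _ = trans (+-identityʳ _) (+-identityʳ _)
      ... | no _  = +-identityʳ _

    length≤# : ∀ {P : Fin n → Set} (P? : ∀ i → Dec (P i)) {xs} → Unique xs → All P xs → length xs ≤ # P?
    length≤# P? {xs} u ps = begin
      length xs                    ≡⟨ *-identityʳ _ ⟨
      length xs * 1                ≡⟨ sumL-const 1 xs ⟨
      sumL (λ _ → 1) xs            ≡⟨ sumL-cong xs (λ x∈ → sym (bit-yes (P? _) (All.lookup ps x∈))) ⟩
      sumL (λ x → bit (P? x)) xs   ≤⟨ sumL-unique _ u ⟩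
      # P?                         ∎
      where open ≤-Reasoning

    #-singleton : ∀ (x : Fin n) → # (Fin._≟ x) ≡ 1
    #-singleton x = trans (∑-cong λ i → sym (*-identityʳ _)) (∑-delta (λ _ → 1) x)

    #-∈ : ∀ (xs : List (Fin n)) → # (_∈? xs) ≤ length xs
    #-∈ []       = ≤-reflexive (trans (∑-cong λ i → bit-no (i ∈? []) λ ()) (trans (∑-const n 0) (*-zeroʳ n)))
    #-∈ (x ∷ xs) = ≤-trans
      (#-⊎ (Fin._≟ x) (_∈? xs) (_∈? (x ∷ xs)) λ { i (here p) → inj₁ p ; i (there p) → inj₂ p })
      (+-mono-≤ (≤-reflexive (#-singleton x)) (#-∈ xs))

    #-avoid : ∀ {P : Fin n → Set} (P? : ∀ i → Dec (P i)) xs → # P? ≤ # (λ i → P? i ×-dec (i ∉? xs)) + length xs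
    #-avoid {P} P? xs = ≤-trans (#-⊎ _ (_∈? xs) P? split) (+-monoʳ-≤ _ (#-∈ xs))
      where
      split : ∀ i → P i → (P i × i ∉ xs) ⊎ i ∈ xs
      split i p with i ∈? xs
      ... | yes q = inj₂ q
      ... | no q  = inj₁ (p , q)

    elems : ∀ {P : Fin n → Set} → (∀ i → Dec (P i)) → List (Fin n)
    elems P? = filter P? (allFin n)

    module _ {P : Fin n → Set} (P? : ∀ i → Dec (P i)) where

      elems-unique : Unique (elems P?)
      elems-unique = Unique.filter⁺ P? (Unique.allFin⁺ n)

      ∈-elems⁺ : ∀ {i} → P i → i ∈ elems P?
      ∈-elems⁺ p = ∈-filter⁺ P? (∈-allFin _) p

      ∈-elems⁻ : ∀ {i} → i ∈ elems P? → P i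
      ∈-elems⁻ i∈ = proj₂ (∈-filter⁻ P? {xs = allFin n} i∈)

      length-elems : length (elems P?) ≡ # P?
      length-elems = trans (length-filter P? (allFin n)) (sumL-allFin _)

      sumL-elems : ∀ f → sumL f (elems P?) ≡ ∑ (λ i → bit (P? i) * f i)
      sumL-elems f = trans (sumL-filter P? f (allFin n)) (sumL-allFin _)

  lookup-injective : ∀ {A : Set} {xs : List A} → Unique xs → ∀ {i j} → lookup xs i ≡ lookup xs j → i ≡ j
  lookup-injective (_ ∷ _)  {zero}  {zero}  _ = refl
  lookup-injective (x∉ ∷ _) {zero}  {suc j} e = contradiction e (All.lookup x∉ (∈-lookup j))
  lookup-injective (x∉ ∷ _) {suc i} {zero}  e = contradiction (sym e) (All.lookup x∉ (∈-lookup i))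
  lookup-injective (_ ∷ u)  {suc i} {suc j} e = cong suc (lookup-injective u e)

-- Paths, cycles, degrees and the independence number

module Graphs where

  open Counting
  open import Defs using (Graph; Adj; adj?; symm; irrefl; degree; δ; α; Independent; independent?; subsets; closed; HasCycle)
  open import Data.Nat.Base
  open import Data.Nat.Properties
  open import Data.Fin.Base using (Fin; suc)
  import Data.Fin.Properties as Fin
  import Data.Fin.Subset as Subset
  import Data.Fin.Subset.Properties as Subset?
  open import Data.Fin.Subset using (Subset; inside; outside; ∣_∣)
  open import Data.Vec.Base as Vec using (Vec; []; _∷_; toList; fromList)
  import Data.Vec.Properties as Vec
  open import Data.Vec.Relation.Unary.Any using (here; there)
  open import Data.List.Base using (List; []; _∷_; _++_; _∷ʳ_; map; length; allFin; reverse)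
  open import Data.List.Properties using (++-assoc; unfold-reverse; length-++; length-map; length-reverse)
  open import Data.List.Extrema.Nat using (min≤v⁺; v≤min⁺; max≤v⁺; v≤max⁺)
  open import Data.List.Membership.Propositional using (_∈_; lose)
  open import Data.List.Membership.Propositional.Properties using (∈-filter⁺; ∈-filter⁻; ∈-allFin; ∈-++⁺ˡ; ∈-++⁺ʳ; ∈-++⁻; ∈-map⁺; ∈-∃++)
  import Data.List.Relation.Unary.Any as Any
  open import Data.List.Relation.Unary.All as All using (All; []; _∷_)
  import Data.List.Relation.Unary.All.Properties as All
  import Data.List.Relation.Unary.AllPairs as AP
  import Data.List.Relation.Unary.AllPairs.Properties as AP
  open import Data.List.Relation.Unary.Linked using (Linked; []; [-]; _∷_)
  open import Data.List.Relation.Unary.Unique.Propositional using (Unique)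
  import Data.List.Relation.Unary.Unique.Propositional.Properties as Unique
  open import Data.List.Relation.Binary.Permutation.Propositional using (_↭_; ↭⇒↭ₛ; ↭-refl; ↭-sym; ↭-trans; ↭-reflexive)
  open import Data.List.Relation.Binary.Permutation.Propositional.Properties using (++-comm; ↭-reverse; ∈-resp-↭; All-resp-↭)
  import Data.List.Relation.Binary.Permutation.Setoid.Properties as Perm
  open import Data.Product.Base using (∃; _×_; _,_; proj₁; proj₂)
  open import Data.Sum.Base using (inj₁; inj₂)
  open import Function.Base using (_∘_)
  open import Relation.Binary.PropositionalEquality
  open import Relation.Nullary using (Dec; yes; no; does; contradiction)
  open import Relation.Nullary.Decidable using (_×-dec_)

  Unique-resp-↭ : ∀ {A : Set} {xs ys : List A} → xs ↭ ys → Unique xs → Unique ys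
  Unique-resp-↭ {A} p = Perm.Unique-resp-↭ (setoid A) (↭⇒↭ₛ p)

  Unique-++⁻ˡ : ∀ {A : Set} (xs : List A) {ys} → Unique (xs ++ ys) → Unique xs
  Unique-++⁻ˡ []       _        = AP.[]
  Unique-++⁻ˡ (x ∷ xs) (p AP.∷ u) = All.++⁻ˡ xs p AP.∷ Unique-++⁻ˡ xs u

  module _ {A : Set} (R : A → A → Set) where

    -- Indexed by both ends and by the list of all vertices, ends included, so that lengths,
    -- disjointness and uniqueness are facts about lists.
    data Path : A → A → List A → Set where
      end  : ∀ {u} → Path u u (u ∷ [])
      step : ∀ {u w v xs} → R u w → Path w v xs → Path u v (u ∷ xs)

  module _ {A : Set} {R : A → A → Set} where

    Path-++ : ∀ {u v w z xs ys} → Path R u v xs → R v w → Path R w z ys → Path R u z (xs ++ ys)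
    Path-++ end        r q = step r q
    Path-++ (step s p) r q = step s (Path-++ p r q)

    Path-mono : ∀ {S : A → A → Set} → (∀ {x y} → R x y → S x y) → ∀ {u v xs} → Path R u v xs → Path S u v xs
    Path-mono f end        = end
    Path-mono f (step r p) = step (f r) (Path-mono f p)

    Path-reverse : (∀ {x y} → R x y → R y x) → ∀ {u v xs} → Path R u v xs → Path R v u (reverse xs)
    Path-reverse sy end = end
    Path-reverse sy {u} {v} (step {xs = xs} r p) =
      subst (Path R v u) (sym (unfold-reverse u xs)) (Path-++ (Path-reverse sy p) (sy r) end)

    Path-∷ : ∀ {u v xs} → Path R u v xs → ∃ λ ys → xs ≡ u ∷ ys
    Path-∷ end        = [] , refl
    Path-∷ (step _ p) = _ , refl

    Path-prefix : ∀ {u v i} ys {zs} → Path R u v (ys ++ i ∷ zs) → Path R u i (ys ∷ʳ i) × Path R i v (i ∷ zs)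
    Path-prefix []       end        = end , end
    Path-prefix []       (step r p) = end , step r p
    Path-prefix (y ∷ [])      (step r p) with q , s ← Path-prefix [] p = step r q , s
    Path-prefix (y ∷ z ∷ ys)  (step r p) with q , s ← Path-prefix (z ∷ ys) p = step r q , s

    Path⇒Linked : ∀ {u v w xs} → Path R u v xs → R v w → Linked R (xs ∷ʳ w)
    Path⇒Linked end r = r ∷ [-]
    Path⇒Linked (step s end) r = s ∷ Path⇒Linked end r
    Path⇒Linked (step s p@(step _ _)) r = s ∷ Path⇒Linked p r

    Path⇒Linked-closed : ∀ {u v xs} → Path R u v xs → R v u → Linked R (closed xs)
    Path⇒Linked-closed end        r = Path⇒Linked end r
    Path⇒Linked-closed (step s p) r = Path⇒Linked (step s p) r

    Linked⇒Path : ∀ {w} x xs → Linked R ((x ∷ xs) ∷ʳ w) → ∃ λ l → Path R x l (x ∷ xs) × R l w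
    Linked⇒Path x []       (r ∷ _) = x , end , r
    Linked⇒Path x (y ∷ xs) (r ∷ l) with z , p , s ← Linked⇒Path y xs l = z , step r p , s

    module _ (sy : ∀ {x y} → R x y → R y x) where

      private
        -- The cycle is read from `u`, with `i` before `j`. One arc is a segment of the list; the
        -- other leaves `j`, passes through the closing edge from `l` to `u` and ends at `i`. Both
        -- lists are initial parts of permutations of the cycle, hence free of repetitions.
        arcs′ : ∀ {u l i j} ys as bs → Path R u l (ys ++ i ∷ as ++ j ∷ bs) → R l u → Unique (ys ++ i ∷ as ++ j ∷ bs) →
                ∃ λ P → ∃ λ Q → Path R i j P × Path R j i Q × Unique P × Unique Q ×
                  All (_∈ (ys ++ i ∷ as ++ j ∷ bs)) P × All (_∈ (ys ++ i ∷ as ++ j ∷ bs)) Q ×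
                  length P + length Q ≡ 2 + length (ys ++ i ∷ as ++ j ∷ bs)
        arcs′ {u} {l} {i} {j} ys as bs p r uq =
          i ∷ as ∷ʳ j , (j ∷ bs) ++ (ys ∷ʳ i) , p₁ , p₂ ,
          Unique-++⁻ˡ _ (Unique-resp-↭ perm₁ uq) , Unique-++⁻ˡ _ (Unique-resp-↭ perm₂ uq) ,
          All.tabulate (λ x∈ → ∈-resp-↭ (↭-sym perm₁) (∈-++⁺ˡ x∈)) ,
          All.tabulate (λ x∈ → ∈-resp-↭ (↭-sym perm₂) (∈-++⁺ˡ x∈)) , len
          where
          C = ys ++ i ∷ as ++ j ∷ bs
          ps = Path-prefix ys p
          qs = Path-prefix (i ∷ as) (proj₂ ps)
          p₁ = proj₁ qs
          p₂ = Path-++ (proj₂ qs) r (proj₁ ps)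
          perm₁ : C ↭ (i ∷ as ∷ʳ j) ++ (bs ++ ys)
          perm₁ = ↭-trans (++-comm ys _) (↭-reflexive (cong (i ∷_)
            (trans (++-assoc as (j ∷ bs) ys) (sym (++-assoc as (j ∷ []) (bs ++ ys))))))
          perm₂ : C ↭ ((j ∷ bs) ++ (ys ∷ʳ i)) ++ as
          perm₂ = ↭-trans (↭-reflexive (trans (cong (ys ++_) refl) (sym (trans (++-assoc (ys ∷ʳ i) as (j ∷ bs)) (++-assoc ys (i ∷ []) _)))))
            (↭-trans (++⁺ˡ-comm (ys ∷ʳ i) as (j ∷ bs)) ↭-refl)
            where
            ++⁺ˡ-comm : ∀ (a b c : List A) → (a ++ b) ++ c ↭ (c ++ a) ++ b
            ++⁺ˡ-comm a b c = ↭-trans (++-comm (a ++ b) c) (↭-reflexive (sym (++-assoc c a b)))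
          len : length (i ∷ as ∷ʳ j) + length ((j ∷ bs) ++ (ys ∷ʳ i)) ≡ 2 + length C
          len = begin
            length (i ∷ as ∷ʳ j) + length ((j ∷ bs) ++ (ys ∷ʳ i))
              ≡⟨ cong₂ (λ x y → suc x + y) (length-++ as) (trans (length-++ (j ∷ bs)) (cong (suc (length bs) +_) (length-++ ys))) ⟩
            suc (length as + 1) + (suc (length bs) + (length ys + 1))
              ≡⟨ solve 3 (λ a b y → con 1 :+ (a :+ con 1) :+ (con 1 :+ b :+ (y :+ con 1)) := con 2 :+ (y :+ (con 1 :+ (a :+ (con 1 :+ b))))) refl (length as) (length bs) (length ys) ⟩
            2 + (length ys + suc (length as + suc (length bs)))
              ≡⟨ cong (2 +_) (sym (trans (length-++ ys) (cong (λ z → length ys + suc z) (length-++ as)))) ⟩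
            2 + length C ∎
            where
            open ≡-Reasoning
            open import Data.Nat.Solver using (module +-*-Solver)
            open +-*-Solver

        ↭-All : ∀ {xs ys zs : List A} → xs ↭ ys → All (_∈ zs) xs → All (_∈ zs) ys
        ↭-All = All-resp-↭

      -- Both arcs contain the two ends, which are therefore counted twice: this is the summand 2.
      -- One arc is reversed, so that both run from `i` to `j`.
      arcs : ∀ {u l C i j} → Path R u l C → R l u → Unique C → i ∈ C → j ∈ C → i ≢ j →
             ∃ λ P → ∃ λ Q → Path R i j P × Path R i j Q × Unique P × Unique Q ×
               All (_∈ C) P × All (_∈ C) Q × length P + length Q ≡ 2 + length C
      arcs {C = C} {i} {j} p r uq i∈ j∈ i≢j with ys , zs , refl ← ∈-∃++ i∈ with ∈-++⁻ ys j∈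
      ... | inj₂ (Any.here j≡i) = contradiction (sym j≡i) i≢j
      ... | inj₂ (Any.there j∈zs) with as , bs , refl ← ∈-∃++ j∈zs
            with P , Q , pP , pQ , uP , uQ , aP , aQ , len ← arcs′ ys as bs p r uq =
        P , reverse Q , pP , Path-reverse sy pQ , uP , Unique-resp-↭ (↭-sym (↭-reverse Q)) uQ ,
        aP , ↭-All (↭-sym (↭-reverse Q)) aQ , trans (cong (length P +_) (length-reverse Q)) len
      ... | inj₁ j∈ys with as , bs , refl ← ∈-∃++ j∈ys
            with P , Q , pP , pQ , uP , uQ , aP , aQ , len ←
                 arcs′ as bs zs (subst (Path R _ _) (++-assoc as (j ∷ bs) (i ∷ zs)) p) r (subst Unique (++-assoc as (j ∷ bs) (i ∷ zs)) uq) =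
        Q , reverse P , pQ , Path-reverse sy pP , uQ , Unique-resp-↭ (↭-sym (↭-reverse P)) uP ,
        subst (λ z → All (_∈ z) Q) (sym eq′) aQ , ↭-All (↭-sym (↭-reverse P)) (subst (λ z → All (_∈ z) P) (sym eq′) aP) ,
        trans (cong (length Q +_) (length-reverse P)) (trans (+-comm (length Q) _) (trans len (cong (λ z → 2 + length z) (sym eq′))))
        where eq′ = ++-assoc as (j ∷ bs) (i ∷ zs)

  mkCycle : ∀ {n} {G : Graph n} {u v} zs → 3 ≤ length zs → Unique zs → Path (Adj G) u v zs → Adj G v u → HasCycle G (length zs)
  mkCycle {G = G} zs 3≤ uq p r = 3≤ , fromList zs ,
    subst Unique (sym (Vec.toList∘fromList zs)) uq ,
    subst (λ z → Linked (Adj G) (closed z)) (sym (Vec.toList∘fromList zs)) (Path⇒Linked-closed p r)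

  cyclePath : ∀ {n ℓ} {G : Graph n} → HasCycle G ℓ →
              ∃ λ C → length C ≡ ℓ × Unique C × ∃ λ u → ∃ λ v → Path (Adj G) u v C × Adj G v u
  cyclePath {ℓ = suc ℓ} (_ , x ∷ xs , uq , lk) with l , p , r ← Linked⇒Path x (toList xs) lk =
    x ∷ toList xs , cong suc (Vec.length-toList xs) , uq , x , l , p , r

  -- Induced subgraphs are pulled back along an injection, because the hypothesis on tough graphs
  -- speaks of graphs on some `Fin m`.
  pull : ∀ {m n} → (Fin m → Fin n) → Graph n → Graph m
  pull e G = record
    { Adj    = λ u v → Adj G (e u) (e v)
    ; adj?   = λ u v → adj? G (e u) (e v)
    ; symm   = symm G
    ; irrefl = irrefl G
    }

  Path-map : ∀ {A B : Set} {R : B → B → Set} (f : A → B) {u v xs} →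
             Path (λ x y → R (f x) (f y)) u v xs → Path R (f u) (f v) (map f xs)
  Path-map f end        = end
  Path-map f (step r p) = step r (Path-map f p)

  pull-cycle : ∀ {m n ℓ} (e : Fin m → Fin n) → (∀ {i j} → e i ≡ e j → i ≡ j) → (G : Graph n) → HasCycle (pull e G) ℓ → HasCycle G ℓ
  pull-cycle e inj G c@(3≤ , _) with C , refl , uq , u , v , p , r ← cyclePath {G = pull e G} c =
    subst (HasCycle G) len (mkCycle {G = G} (map e C) (subst (3 ≤_) (sym len) 3≤) (Unique.map⁺ inj uq) (Path-map e p) r)
    where len = length-map e C

  degree≡# : ∀ {n} (G : Graph n) v → degree G v ≡ # (adj? G v)
  degree≡# G v = length-elems (adj? G v)

  δ≤# : ∀ {n} (G : Graph n) v → δ G ≤ # (adj? G v)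
  δ≤# {n} G v = subst (δ G ≤_) (degree≡# G v) (min≤v⁺ n _ (inj₂ (lose (∈-map⁺ (degree G) (∈-allFin v)) ≤-refl)))

  -- The premise `d ≤ n` accounts for the seed `n` of the minimum.
  ≤δ : ∀ {n} (G : Graph n) {d} → d ≤ n → (∀ v → d ≤ # (adj? G v)) → d ≤ δ G
  ≤δ {n} G d≤n h = v≤min⁺ {xs = map (degree G) (allFin n)} d≤n (All.map⁺ (All.tabulate λ {v} _ → subst (_ ≤_) (sym (degree≡# G v)) (h v)))

  ∈-subsets : ∀ {n} (S : Subset n) → S ∈ subsets n
  ∈-subsets []            = Any.here refl
  ∈-subsets (outside ∷ S) = ∈-++⁺ˡ (∈-map⁺ (outside ∷_) (∈-subsets S))
  ∈-subsets {suc n} (inside ∷ S) = ∈-++⁺ʳ (map (outside ∷_) (subsets n)) (∈-map⁺ (inside ∷_) (∈-subsets S))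

  ∣S∣≤α : ∀ {n} (G : Graph n) {S} → Independent G S → ∣ S ∣ ≤ α G
  ∣S∣≤α G {S} ind = v≤max⁺ 0 _ (inj₂ (lose (∈-map⁺ ∣_∣ (∈-filter⁺ (independent? G) (∈-subsets S) ind)) ≤-refl))

  α≤ : ∀ {n} (G : Graph n) {b} → (∀ S → Independent G S → ∣ S ∣ ≤ b) → α G ≤ b
  α≤ {n} G h = max≤v⁺ z≤n (All.map⁺ (All.tabulate λ S∈ → h _ (proj₂ (∈-filter⁻ (independent? G) {xs = subsets n} S∈))))

  opaque
    unfolding ∑

    ∣S∣≡# : ∀ {n} (S : Subset n) → ∣ S ∣ ≡ # (Subset?._∈? S)
    ∣S∣≡# []            = refl
    ∣S∣≡# (outside ∷ S) = trans (∣S∣≡# S) (∑-cong λ i → eq i)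
      where
      eq : ∀ i → bit (i Subset?.∈? S) ≡ bit (suc i Subset?.∈? (outside ∷ S))
      eq i with i Subset?.∈? S
      ... | yes _ = refl
      ... | no _  = refl
    ∣S∣≡# (inside ∷ S) = cong suc (trans (∣S∣≡# S) (∑-cong λ i → eq i))
      where
      eq : ∀ i → bit (i Subset?.∈? S) ≡ bit (suc i Subset?.∈? (inside ∷ S))
      eq i with i Subset?.∈? S
      ... | yes _ = refl
      ... | no _  = refl

  fromPred : ∀ {n} {P : Fin n → Set} → (∀ i → Dec (P i)) → Subset n
  fromPred P? = Vec.tabulate (does ∘ P?)

  fromPred⁺ : ∀ {n} {P : Fin n → Set} (P? : ∀ i → Dec (P i)) {i} → P i → i Subset.∈ fromPred P?
  fromPred⁺ P? {i} p = Vec.lookup⇒[]= i _ (trans (Vec.lookup∘tabulate _ i) (dec-true (P? i) p))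
    where open import Relation.Nullary.Decidable using (dec-true)

  fromPred⁻ : ∀ {n} {P : Fin n → Set} (P? : ∀ i → Dec (P i)) {i} → i Subset.∈ fromPred P? → P i
  fromPred⁻ P? {i} i∈ with P? i | trans (sym (Vec.lookup∘tabulate (does ∘ P?) i)) (Vec.[]=⇒lookup i∈)
  ... | yes p | _  = p
  ... | no _  | ()

  -- This is α(G) ≤ a, stated for decidable predicates instead of subsets. In this form it is
  -- applied directly to neighbourhoods, levels and parts of paths, and it passes to induced
  -- subgraphs and to graphs with more edges.
  Dense : ∀ {n} → Graph n → ℕ → Set₁
  Dense {n} G a = ∀ {P : Fin n → Set} (P? : ∀ i → Dec (P i)) → a < # P? → ∃ λ u → ∃ λ v → P u × P v × Adj G u v

  α-dense : ∀ {n} (G : Graph n) → Dense G (α G)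
  α-dense {n} G {P} P? a<# with Fin.any? (λ u → Fin.any? λ v → P? u ×-dec P? v ×-dec adj? G u v)
  ... | yes (u , v , pu , pv , uv) = u , v , pu , pv , uv
  ... | no none = contradiction (begin-strict
    α G                          <⟨ a<# ⟩
    # P?                         ≤⟨ #-mono P? (Subset?._∈? S) (λ i → fromPred⁺ P?) ⟩
    # (Subset?._∈? S)             ≡⟨ ∣S∣≡# S ⟨
    ∣ S ∣                        ≤⟨ ∣S∣≤α G (λ u v u∈ v∈ uv → none (u , v , fromPred⁻ P? u∈ , fromPred⁻ P? v∈ , uv)) ⟩
    α G                          ∎) (<-irrefl refl)
    where
    open ≤-Reasoning
    S = fromPred P?

  #-image : ∀ {m n} (e : Fin m → Fin n) → (∀ {i j} → e i ≡ e j → i ≡ j) → {P : Fin m → Set} (P? : ∀ i → Dec (P i))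
            {Q : Fin n → Set} (Q? : ∀ i → Dec (Q i)) → (∀ i → P i → Q (e i)) → # P? ≤ # Q?
  #-image e inj P? Q? h = ≤-trans (≤-reflexive (sym (trans (length-map e (elems P?)) (length-elems P?))))
    (length≤# Q? (Unique.map⁺ inj (elems-unique P?)) (All.map⁺ (All.tabulate λ x∈ → h _ (∈-elems⁻ P? x∈))))

  Dense-pull : ∀ {m n} (e : Fin m → Fin n) → (∀ {i j} → e i ≡ e j → i ≡ j) → {G : Graph n} {a : ℕ} → Dense G a → Dense (pull e G) a
  Dense-pull {m} {n} e inj {G} dense {P} P? a<
    with u , v , (i , refl , pi) , (j , refl , pj) , uv ←
         dense (λ u → Fin.any? λ i → (e i Fin.≟ u) ×-dec P? i) (<-≤-trans a< (#-image e inj P? _ λ i p → i , refl , p)) =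
    i , j , pi , pj , uv

-- Chains of triangles, and shortening paths along chords

module TriangleChains where

  open Counting
  open Graphs
  open import Defs using (Graph; Adj; adj?; symm; irrefl)
  open import Data.Nat.Base
  open import Data.Nat.Properties
  open import Data.Nat.Solver using (module +-*-Solver)
  open +-*-Solver using (solve; con; _:+_; _:=_)
  open import Data.Nat.Induction using (<-wellFounded)
  open import Induction.WellFounded using (Acc; acc)
  open import Data.Unit.Base using (⊤; tt)
  open import Data.Fin.Base using (Fin)
  open import Data.List.Base using (List; []; _∷_; _++_; _∷ʳ_; length)
  open import Data.List.Properties using (++-assoc; length-++)
  open import Data.List.Membership.Propositional using (_∈_; _∉_)
  open import Data.List.Membership.Propositional.Properties using (∈-++⁺ˡ; ∈-++⁺ʳ; ∈-++⁻)
  open import Data.List.Relation.Unary.Any using (here; there)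
  open import Data.List.Relation.Unary.All as All using (All; []; _∷_)
  import Data.List.Relation.Unary.All.Properties as All
  open import Data.List.Relation.Unary.AllPairs using ([]; _∷_)
  open import Data.List.Relation.Unary.Unique.Propositional using (Unique)
  open import Data.Product.Base using (∃; _×_; _,_; proj₁; proj₂)
  open import Data.Sum.Base using (_⊎_; inj₁; inj₂)
  open import Function.Base using (_∘_)
  open import Relation.Binary.PropositionalEquality
  open import Relation.Nullary using (Dec; yes; no; contradiction)
  open import Relation.Nullary.Decidable using (_×-dec_)

  -- A triangle chain starting at v is coded by the list of its pairs (apex, next vertex).
  module _ {A : Set} where

    flat : List (A × A) → List A
    flat []             = []
    flat ((w , v) ∷ ps) = w ∷ v ∷ flat ps

    lastVertex : A → List (A × A) → A
    lastVertex v []              = v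
    lastVertex v ((_ , v′) ∷ ps) = lastVertex v′ ps

    IsChain : (A → A → Set) → A → List (A × A) → Set
    IsChain R v []              = ⊤
    IsChain R v ((w , v′) ∷ ps) = R v w × R w v′ × R v v′ × IsChain R v′ ps

    -- The walk along the chain that visits the first r apices.
    walk : ℕ → A → List (A × A) → List A
    walk r       v []              = v ∷ []
    walk zero    v ((w , v′) ∷ ps) = v ∷ walk zero v′ ps
    walk (suc r) v ((w , v′) ∷ ps) = v ∷ w ∷ walk r v′ ps

    walk-path : ∀ {R : A → A → Set} r v ps → IsChain R v ps → Path R v (lastVertex v ps) (walk r v ps)
    walk-path r       v []              _               = end
    walk-path zero    v ((w , v′) ∷ ps) (_ , _ , b , c) = step b (walk-path zero v′ ps c)
    walk-path (suc r) v ((w , v′) ∷ ps) (a , b , _ , c) = step a (step b (walk-path r v′ ps c))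

    -- Each apex that is visited adds one vertex. Hence a chain of s triangles joins its ends by
    -- paths with any number of vertices from 1 + s to 1 + 2s.
    length-walk : ∀ r v (ps : List (A × A)) → r ≤ length ps → length (walk r v ps) ≡ suc (length ps + r)
    length-walk zero    v []       z≤n     = refl
    length-walk zero    v (_ ∷ ps) z≤n     = cong suc (length-walk zero _ ps z≤n)
    length-walk (suc r) v (_ ∷ ps) (s≤s h) =
      cong suc (trans (cong suc (length-walk r _ ps h)) (cong suc (sym (+-suc (length ps) r))))

    walk⊆ : ∀ r v (ps : List (A × A)) {x} → x ∈ walk r v ps → x ∈ v ∷ flat ps
    walk⊆ r       v []       x∈                  = x∈
    walk⊆ zero    v (_ ∷ ps) (here p)            = here p
    walk⊆ zero    v (_ ∷ ps) (there x∈)          = there (there (walk⊆ zero _ ps x∈))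
    walk⊆ (suc r) v (_ ∷ ps) (here p)            = here p
    walk⊆ (suc r) v (_ ∷ ps) (there (here p))    = there (here p)
    walk⊆ (suc r) v (_ ∷ ps) (there (there x∈))  = there (there (walk⊆ r _ ps x∈))

    walk-unique : ∀ r v (ps : List (A × A)) → Unique (v ∷ flat ps) → Unique (walk r v ps)
    walk-unique r v [] u = u
    walk-unique zero v (_ ∷ ps) ((_ ∷ p) ∷ (_ ∷ u)) =
      All.tabulate (λ x∈ → All.lookup p (walk⊆ zero _ ps x∈)) ∷ walk-unique zero _ ps u
    walk-unique (suc r) v (_ ∷ ps) ((q ∷ p) ∷ (p′ ∷ u)) =
      (q ∷ All.tabulate (λ x∈ → All.lookup p (walk⊆ r _ ps x∈))) ∷
      (All.tabulate (λ x∈ → All.lookup p′ (walk⊆ r _ ps x∈)) ∷ walk-unique r _ ps u)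

    length-flat : ∀ (ps : List (A × A)) → length (flat ps) ≡ length ps + length ps
    length-flat []       = refl
    length-flat (_ ∷ ps) = cong suc (trans (cong suc (length-flat ps)) (sym (+-suc (length ps) (length ps))))

    lastVertex∈ : ∀ v (ps : List (A × A)) → lastVertex v ps ∈ v ∷ flat ps
    lastVertex∈ v []       = here refl
    lastVertex∈ v (_ ∷ ps) = there (there (lastVertex∈ _ ps))

    lastVertex≢ : ∀ {v} {ps : List (A × A)} → Unique (v ∷ flat ps) → 1 ≤ length ps → lastVertex v ps ≢ v
    lastVertex≢ {v} {_ ∷ ps} ((_ ∷ p) ∷ _) _ eq = All.lookup p (lastVertex∈ _ ps) (sym eq)

  module _ {n : ℕ} {G : Graph n} {a : ℕ} (dense : Dense G a) where

    module _ {Good : ℕ → Fin n → Set} (good? : ∀ t v → Dec (Good t v)) (D : ℕ)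
             (deg : ∀ t v → Good t v → D ≤ # (λ u → adj? G v u ×-dec good? (suc t) u)) where

      private
        fresh? : ∀ t v used u → Dec ((Adj G v u × Good (suc t) u) × u ∉ used)
        fresh? t v used u = (adj? G v u ×-dec good? (suc t) u) ×-dec (u ∉? used)

        many : ∀ s t v used → Good t v → length used + (suc s + suc s) + a ≤ D → a < # (fresh? t v used)
        many s t v used g h = +-cancelˡ-≤ (length used) (suc a) _ (begin
          length used + suc a                     ≤⟨ +-monoʳ-≤ (length used) (s≤s (m≤n+m a (s + suc s))) ⟩
          length used + (suc s + suc s + a)       ≡⟨ +-assoc (length used) (suc s + suc s) a ⟨
          length used + (suc s + suc s) + a       ≤⟨ ≤-trans h (deg t v g) ⟩
          _                                       ≤⟨ #-avoid _ used ⟩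
          # (fresh? t v used) + length used       ≡⟨ +-comm (# (fresh? t v used)) (length used) ⟩
          length used + # (fresh? t v used)       ∎)
          where open ≤-Reasoning

      chain : ∀ s t v used → Good t v → length used + (s + s) + a ≤ D →
              ∃ λ ps → length ps ≡ s × IsChain (Adj G) v ps × Unique (flat ps) × All (_∉ used) (flat ps) ×
                All (λ u → ∃ λ t → Good t u) (flat ps) × Good (s + t) (lastVertex v ps)
      chain zero    t v used g _ = [] , refl , tt , [] , [] , [] , g
      chain (suc s) t v used g h
        with w , v′ , ((vw , gw) , w∉) , ((vv′ , gv′) , v′∉) , wv′ ← dense (fresh? t v used) (many s t v used g h)
        with ps , refl , ch , u , av , gs , gl ← chain s (suc t) v′ (w ∷ v′ ∷ used) gv′ (≤-trans (≤-reflexive (solve 3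
               (λ l s a → con 2 :+ l :+ (s :+ s) :+ a := l :+ ((con 1 :+ s) :+ (con 1 :+ s)) :+ a) refl (length used) s a)) h) =
        (w , v′) ∷ ps , refl , (vw , wv′ , vv′ , ch) ,
        ((λ w≡v′ → irrefl G (subst (Adj G w) (sym w≡v′) wv′)) ∷ All.map (λ x∉ w≡x → x∉ (here (sym w≡x))) av) ∷
          (All.map (λ x∉ v≡x → x∉ (there (here (sym v≡x)))) av ∷ u) ,
        w∉ ∷ v′∉ ∷ All.map (λ x∉ x∈ → x∉ (there (there x∈))) av ,
        (suc t , gw) ∷ (suc t , gv′) ∷ gs , subst (λ z → Good z (lastVertex v′ ps)) (+-suc s t) gl

    private
      -- Every second entry, at most `k + 1` of them. Two chosen entries are never consecutive, so a
      -- chord between them skips at least one vertex, and it skips at most 2k.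
      evens : ℕ → List (Fin n) → List (Fin n)
      evens _       []           = []
      evens zero    (x ∷ _)      = x ∷ []
      evens (suc k) (x ∷ [])     = x ∷ []
      evens (suc k) (x ∷ _ ∷ xs) = x ∷ evens k xs

      evens⊆ : ∀ k xs {x} → x ∈ evens k xs → x ∈ xs
      evens⊆ zero    (_ ∷ _)      (here p)   = here p
      evens⊆ (suc k) (_ ∷ [])     (here p)   = here p
      evens⊆ (suc k) (_ ∷ _ ∷ xs) (here p)   = here p
      evens⊆ (suc k) (_ ∷ _ ∷ xs) (there x∈) = there (there (evens⊆ k xs x∈))

      evens-unique : ∀ k {xs} → Unique xs → Unique (evens k xs)
      evens-unique k       {[]}         []                  = []
      evens-unique zero    {_ ∷ _}      _                   = [] ∷ []
      evens-unique (suc k) {_ ∷ []}     _                   = [] ∷ []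
      evens-unique (suc k) {_ ∷ _ ∷ xs} ((_ ∷ p) ∷ (_ ∷ u)) =
        All.tabulate (λ x∈ → All.lookup p (evens⊆ k xs x∈)) ∷ evens-unique k u

      length-evens : ∀ k xs → 1 + (k + k) ≤ length xs → length (evens k xs) ≡ suc k
      length-evens zero    (_ ∷ _)      _       = refl
      length-evens (suc k) (_ ∷ [])     (s≤s ())
      length-evens (suc k) (_ ∷ _ ∷ xs) (s≤s (s≤s h)) =
        cong suc (length-evens k xs (subst (_≤ length xs) (+-suc k k) h))

      locate : ∀ k xs {v} → v ∈ evens k xs → ∃ λ m → ∃ λ post → xs ≡ m ++ v ∷ post × length m ≤ k + k
      locate zero    (_ ∷ xs)     (here refl) = [] , xs , refl , z≤n
      locate (suc k) (_ ∷ [])     (here refl) = [] , [] , refl , z≤n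
      locate (suc k) (_ ∷ _ ∷ xs) (here refl) = [] , _ , refl , z≤n
      locate (suc k) (x ∷ y ∷ xs) (there v∈) with m , post , refl , h ← locate k xs v∈ =
        x ∷ y ∷ m , post , refl , s≤s (subst (suc (length m) ≤_) (sym (+-suc k k)) (s≤s h))

      Between : ℕ → List (Fin n) → Fin n → Fin n → Set
      Between k xs u v = ∃ λ pre → ∃ λ mid → ∃ λ post → xs ≡ pre ++ u ∷ mid ++ v ∷ post × 1 ≤ length mid × length mid ≤ k + k

      between : ∀ k xs {u v} → u ∈ evens k xs → v ∈ evens k xs → u ≢ v → Between k xs u v ⊎ Between k xs v u
      between zero    (_ ∷ _)      (here refl) (here refl) u≢v = contradiction refl u≢v
      between (suc k) (_ ∷ [])     (here refl) (here refl) u≢v = contradiction refl u≢v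
      between (suc k) (_ ∷ _ ∷ xs) (here refl) (here refl) u≢v = contradiction refl u≢v
      between (suc k) (_ ∷ y ∷ xs) (here refl) (there v∈) _ with m , post , refl , h ← locate k xs v∈ =
        inj₁ ([] , y ∷ m , post , refl , s≤s z≤n , s≤s (≤-trans h (+-monoʳ-≤ k (n≤1+n k))))
      between (suc k) (_ ∷ y ∷ xs) (there u∈) (here refl) _ with m , post , refl , h ← locate k xs u∈ =
        inj₂ ([] , y ∷ m , post , refl , s≤s z≤n , s≤s (≤-trans h (+-monoʳ-≤ k (n≤1+n k))))
      between (suc k) (x ∷ y ∷ xs) (there u∈) (there v∈) u≢v with between k xs u∈ v∈ u≢v
      ... | inj₁ (pre , mid , post , refl , l , h) = inj₁ (x ∷ y ∷ pre , mid , post , refl , l , ≤-trans h (+-mono-≤ (n≤1+n k) (n≤1+n k)))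
      ... | inj₂ (pre , mid , post , refl , l , h) = inj₂ (x ∷ y ∷ pre , mid , post , refl , l , ≤-trans h (+-mono-≤ (n≤1+n k) (n≤1+n k)))

      ∷-++-unique : ∀ {A : Set} pre (mid : List A) {post} → Unique (pre ++ mid ++ post) → Unique (pre ++ post)
      ∷-++-unique []        []        u       = u
      ∷-++-unique []        (x ∷ mid) (_ ∷ u) = ∷-++-unique [] mid u
      ∷-++-unique (x ∷ pre) mid {post} (p ∷ u) = All.tabulate (λ y∈ → All.lookup p (lemma y∈)) ∷ ∷-++-unique pre mid u
        where
        lemma : ∀ {y} → y ∈ pre ++ post → y ∈ pre ++ mid ++ post
        lemma y∈ with ∈-++⁻ pre y∈
        ... | inj₁ q = ∈-++⁺ˡ q
        ... | inj₂ q = ∈-++⁺ʳ pre (∈-++⁺ʳ mid q)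

      module _ {H : Graph n} where

        shortcut : ∀ {x y u v xs} → Path (Adj H) x y xs → Unique xs → Adj H u v → Between a xs u v →
                   ∃ λ ys → Path (Adj H) x y ys × Unique ys × (∀ {z} → z ∈ ys → z ∈ xs) ×
                     length ys < length xs × length xs ≤ length ys + (a + a)
        shortcut {u = u} {v} p uq uv (pre , mid , post , refl , l , h) =
          (pre ∷ʳ u) ++ (v ∷ post) ,
          Path-++ (proj₁ ps) uv (proj₂ (Path-prefix (u ∷ mid) (proj₂ ps))) ,
          ∷-++-unique (pre ∷ʳ u) mid (subst Unique (sym (++-assoc pre (u ∷ []) _)) uq) ,
          (λ z∈ → subst (_ ∈_) (++-assoc pre (u ∷ []) _) (lemma z∈)) ,
          subst₂ _<_ (sym len₁) (sym len₂) (+-monoʳ-< (length pre) (s≤s (m<n+m _ l))) ,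
          subst₂ _≤_ (sym len₂) (cong (_+ (a + a)) (sym len₁)) (begin
            length pre + suc (length mid + suc (length post))    ≤⟨ +-monoʳ-≤ (length pre) (s≤s (+-monoˡ-≤ _ h)) ⟩
            length pre + suc (a + a + suc (length post))         ≡⟨ solve 3 (λ p a q → p :+ (con 1 :+ (a :+ (con 1 :+ q))) := p :+ (con 1 :+ (con 1 :+ q)) :+ a) refl (length pre) (a + a) (length post) ⟩
            length pre + suc (suc (length post)) + (a + a)       ∎)
          where
          open ≤-Reasoning
          ps = Path-prefix pre p
          lemma : ∀ {z} → z ∈ (pre ∷ʳ u) ++ (v ∷ post) → z ∈ (pre ∷ʳ u) ++ mid ++ v ∷ post
          lemma z∈ with ∈-++⁻ (pre ∷ʳ u) z∈
          ... | inj₁ q = ∈-++⁺ˡ q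
          ... | inj₂ q = ∈-++⁺ʳ (pre ∷ʳ u) (∈-++⁺ʳ mid q)
          len₁ : length ((pre ∷ʳ u) ++ (v ∷ post)) ≡ length pre + suc (suc (length post))
          len₁ = trans (cong length (++-assoc pre (u ∷ []) (v ∷ post))) (length-++ pre)
          len₂ : length (pre ++ u ∷ mid ++ v ∷ post) ≡ length pre + suc (length mid + suc (length post))
          len₂ = trans (length-++ pre) (cong (λ z → length pre + suc z) (length-++ mid))

    module _ {H : Graph n} (G⊆H : ∀ {u v} → Adj G u v → Adj H u v) where

      -- The `a + 1` vertices selected by `evens a` are too many to be independent in `G`; the path
      -- takes the chord between two of them. Chords come from `G`, while the path itself may use
      -- edges of `H`.
      shrink : ∀ {x y xs} → Path (Adj H) x y xs → Unique xs → 1 + (a + a) ≤ length xs →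
               ∃ λ ys → Path (Adj H) x y ys × Unique ys × (∀ {z} → z ∈ ys → z ∈ xs) ×
                 length ys < length xs × length xs ≤ length ys + (a + a)
      shrink {xs = xs} p uq h
        with u , v , u∈ , v∈ , uv ← dense (_∈? evens a xs)
               (subst (_≤ # (_∈? evens a xs)) (length-evens a xs h) (length≤# (_∈? evens a xs) (evens-unique a uq) (All.tabulate λ x∈ → x∈)))
        with between a xs u∈ v∈ (λ { refl → irrefl G uv })
      ... | inj₁ b = shortcut {H} p uq (G⊆H uv) b
      ... | inj₂ b = shortcut {H} p uq (symm H (G⊆H uv)) b

      -- One step loses at most 2a vertices, so it cannot jump from above `hi` to below `lo`.
      shrinkTo : ∀ lo hi → a + a ≤ hi → lo + (a + a) ≤ suc hi → ∀ {x y xs} → Path (Adj H) x y xs → Unique xs → lo ≤ length xs →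
                 ∃ λ ys → Path (Adj H) x y ys × Unique ys × (∀ {z} → z ∈ ys → z ∈ xs) × lo ≤ length ys × length ys ≤ hi
      shrinkTo lo hi h₁ h₂ {x} {y} {xs} p uq l = go xs (<-wellFounded (length xs)) p uq l
        where
        go : ∀ xs → Acc _<_ (length xs) → Path (Adj H) x y xs → Unique xs → lo ≤ length xs →
             ∃ λ ys → Path (Adj H) x y ys × Unique ys × (∀ {z} → z ∈ ys → z ∈ xs) × lo ≤ length ys × length ys ≤ hi
        go xs (acc rec) p uq l with length xs ≤? hi
        ... | yes le = xs , p , uq , (λ z → z) , l , le
        ... | no ¬le with ys , q , u , sub , lt , le ← shrink p uq (≤-trans (s≤s h₁) (≰⇒> ¬le))
              with zs , r , u′ , sub′ , b , c ← go ys (rec lt) q u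
                     (+-cancelʳ-≤ (a + a) lo _ (≤-trans h₂ (≤-trans (≰⇒> ¬le) le))) =
          zs , r , u′ , sub ∘ sub′ , b , c

-- Breadth-first levels, and cycles from a wide level

module Levels where

  open Counting
  open Graphs
  open import Defs using (Graph; Adj; adj?; symm; irrefl; HasCycle)
  open import Data.Nat.Base
  open import Data.Nat.Properties
  open import Data.Nat.Solver using (module +-*-Solver)
  open import Data.Fin.Base using (Fin; toℕ)
  import Data.Fin.Properties as Fin
  open import Data.List.Base using (List; []; _∷_; _++_; _∷ʳ_; length; reverse; map; take; drop)
  open import Data.List.Properties using (++-assoc; length-++; length-reverse; length-take; take++drop≡id; ∷-injective; ++-identityʳ)
  open import Data.List.Membership.Propositional using (_∈_)
  open import Data.List.Membership.Propositional.Properties using (∈-++⁺ˡ; ∈-++⁺ʳ; ∈-map⁺)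
  open import Data.List.Relation.Unary.Any using (here; there)
  open import Data.List.Relation.Unary.All as All using (All; []; _∷_)
  import Data.List.Relation.Unary.All.Properties as All
  open import Data.List.Relation.Unary.AllPairs as AllPairs using (AllPairs; []; _∷_)
  import Data.List.Relation.Unary.AllPairs.Properties as AllPairs
  open import Data.List.Relation.Unary.Unique.Propositional using (Unique)
  import Data.List.Relation.Unary.Unique.Propositional.Properties as Unique
  open import Data.List.Relation.Binary.Permutation.Propositional using (↭-sym)
  open import Data.List.Relation.Binary.Permutation.Propositional.Properties using (↭-reverse; ∈-resp-↭)
  open import Data.Product.Base using (∃; _×_; _,_; proj₁; proj₂)
  open import Data.Sum.Base using (_⊎_; inj₁; inj₂)
  open import Function.Base using (_∘_)
  open import Relation.Binary.PropositionalEquality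
  open import Relation.Binary.Definitions using (tri<; tri≈; tri>)
  open import Relation.Nullary using (¬_; Dec; yes; no; contradiction)
  open import Relation.Nullary.Decidable using (_×-dec_; _⊎-dec_; ¬?)

  module _ {n : ℕ} (G : Graph n) (x : Fin n) where

    Ball : ℕ → Fin n → Set
    Ball zero    v = v ≡ x
    Ball (suc t) v = Ball t v ⊎ ∃ λ u → Ball t u × Adj G u v

    ball? : ∀ t v → Dec (Ball t v)
    ball? zero    v = v Fin.≟ x
    ball? (suc t) v = ball? t v ⊎-dec Fin.any? λ u → ball? t u ×-dec adj? G u v

    Lev : ℕ → Fin n → Set
    Lev zero    v = v ≡ x
    Lev (suc t) v = Ball (suc t) v × ¬ Ball t v

    lev? : ∀ t v → Dec (Lev t v)
    lev? zero    v = v Fin.≟ x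
    lev? (suc t) v = ball? (suc t) v ×-dec ¬? (ball? t v)

    Lev⇒Ball : ∀ t {v} → Lev t v → Ball t v
    Lev⇒Ball zero    l = l
    Lev⇒Ball (suc t) l = proj₁ l

    Ball-mono : ∀ {s t v} → s ≤ t → Ball s v → Ball t v
    Ball-mono {s} {t} s≤t b = go (≤⇒≤′ s≤t)
      where
      go : ∀ {t} → s ≤′ t → Ball t _
      go ≤′-refl     = b
      go (≤′-step h) = inj₁ (go h)

    Ball⇒Lev : ∀ t {v} → Ball t v → ∃ λ s → s ≤ t × Lev s v
    Ball⇒Lev zero b = 0 , z≤n , b
    Ball⇒Lev (suc t) {v} b with ball? t v
    ... | no ¬b = suc t , ≤-refl , b , ¬b
    ... | yes b′ with s , s≤t , l ← Ball⇒Lev t b′ = s , m≤n⇒m≤1+n s≤t , l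

    Lev-minimal : ∀ {s t v} → Lev s v → Ball t v → s ≤ t
    Lev-minimal {zero}  _        _ = z≤n
    Lev-minimal {suc s} {t} (_ , ¬b) b with suc s ≤? t
    ... | yes h = h
    ... | no ¬h = contradiction (Ball-mono (≤-pred (≰⇒> ¬h)) b) ¬b

    Lev-unique : ∀ {s t v} → Lev s v → Lev t v → s ≡ t
    Lev-unique l l′ = ≤-antisym (Lev-minimal l (Lev⇒Ball _ l′)) (Lev-minimal l′ (Lev⇒Ball _ l))

    Lev-step : ∀ {s t u v} → Adj G u v → Lev s u → Lev t v → t ≤ suc s
    Lev-step {s} uv l l′ = Lev-minimal l′ (inj₂ (_ , Lev⇒Ball s l , uv))

    parent : ∀ t {v} → Lev (suc t) v → ∃ λ u → Lev t u × Adj G u v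
    parent t (inj₁ b , ¬b) = contradiction b ¬b
    parent zero (inj₂ (u , b , uv) , ¬b) = u , b , uv
    parent (suc t) {v} (inj₂ (u , b , uv) , ¬b) = u , (b , λ b′ → ¬b (inj₂ (u , b′ , uv))) , uv

    -- The choice of one parent per vertex fixes a breadth-first tree. The value outside level
    -- `t + 1` is a junk value.
    π : ℕ → Fin n → Fin n
    π t v with lev? (suc t) v
    ... | yes l = proj₁ (parent t l)
    ... | no _  = v

    π-lev : ∀ t {v} → Lev (suc t) v → Lev t (π t v)
    π-lev t {v} l with lev? (suc t) v
    ... | yes l = proj₁ (proj₂ (parent t l))
    ... | no ¬l = contradiction l ¬l

    π-adj : ∀ t {v} → Lev (suc t) v → Adj G (π t v) v
    π-adj t {v} l with lev? (suc t) v
    ... | yes l = proj₂ (proj₂ (parent t l))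
    ... | no ¬l = contradiction l ¬l

    Below : ℕ → Fin n → Set
    Below r v = ∃ λ t → t < r × Lev t v

    -- The path in the tree from `u` to `w` over their common ancestor `h` levels up. It has 2h
    -- edges, hence 2h - 1 inner vertices, all of them in levels below `r`.
    record Link (r h : ℕ) (u w : Fin n) : Set where
      field
        {first last} : Fin n
        inner  : List (Fin n)
        size   : suc (length inner) ≡ h + h
        below  : All (Below r) inner
        unique : Unique inner
        path   : Path (Adj G) first last inner
        start  : Adj G u first
        stop   : Adj G last w

    link-base : ∀ r {u w} → Lev (suc r) u → Lev (suc r) w → π r u ≡ π r w → Link (suc r) 1 u w
    link-base r {u} {w} lu lw eq = record
      { inner = π r u ∷ [] ; size = refl ; below = (r , ≤-refl , π-lev r lu) ∷ [] ; unique = [] ∷ []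
      ; path = end ; start = symm G (π-adj r lu) ; stop = subst (λ z → Adj G z w) (sym eq) (π-adj r lw) }

    ¬Below : ∀ {r v} → Lev r v → ¬ Below r v
    ¬Below l (t , t<r , l′) = <-irrefl (Lev-unique l′ l) t<r

    link-up : ∀ r {h u w} → Lev (suc r) u → Lev (suc r) w → π r u ≢ π r w → Link r h (π r u) (π r w) → Link (suc r) (suc h) u w
    link-up r {h} {u} {w} lu lw ne L = record
      { inner = π r u ∷ inner ∷ʳ π r w
      ; size = cong suc (trans (cong suc (trans (length-++ inner) (+-comm _ 1))) (trans (cong suc size) (sym (+-suc h h))))
      ; below = (r , ≤-refl , π-lev r lu) ∷ All.++⁺ (All.map up below) ((r , ≤-refl , π-lev r lw) ∷ [])
      ; unique = All.++⁺ (All.map (λ b e → ¬Below (π-lev r lu) (subst (Below r) (sym e) b)) below) (ne ∷ []) ∷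
                 Unique.++⁺ unique ([] ∷ []) λ { (a , here refl) → ¬Below (π-lev r lw) (All.lookup below a) }
      ; path = step start (Path-++ path stop end)
      ; start = symm G (π-adj r lu) ; stop = π-adj r lw }
      where
      open Link L
      up : ∀ {v} → Below r v → Below (suc r) v
      up (t , t<r , l) = t , m<n⇒m<1+n t<r , l

    -- Both vertices climb to their parents until these coincide, at the latest in the root.
    link : ∀ r {u w} → Lev r u → Lev r w → u ≢ w → ∃ λ h → 1 ≤ h × h ≤ r × Link r h u w
    link zero    refl refl u≢w = contradiction refl u≢w
    link (suc r) {u} {w} lu lw u≢w with π r u Fin.≟ π r w
    ... | yes eq = 1 , ≤-refl , s≤s z≤n , link-base r lu lw eq
    ... | no ne with h , _ , h≤r , L ← link r (π-lev r lu) (π-lev r lw) ne =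
      suc h , s≤s z≤n , s≤s h≤r , link-up r lu lw ne L

    -- The path `L` has no vertex in the levels below `r`, and the inner vertices of the link lie in
    -- these levels only, so the two are disjoint.
    close : ∀ {r h u w ℓ} L → Path (Adj G) u w L → Unique L → 2 ≤ length L → All (λ v → ¬ Below r v) L → Link r h u w →
            suc ℓ ≡ length L + (h + h) → HasCycle G ℓ
    close {ℓ = ℓ} L p uq 2≤ nb K eq = subst (HasCycle G) len
      (mkCycle {G = G} (L ++ reverse inner) (subst (3 ≤_) (sym len) 3≤)
        (Unique.++⁺ uq (Unique-resp-↭ (↭-sym (↭-reverse inner)) unique)
          λ (a , b) → All.lookup nb a (All.lookup below (∈-resp-↭ (↭-reverse inner) b)))
        (Path-++ p (symm G stop) (Path-reverse (symm G) path)) (symm G start))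
      where
      open Link K
      len′ : length (L ++ reverse inner) ≡ length L + length inner
      len′ = trans (length-++ L) (cong (length L +_) (length-reverse inner))
      len : length (L ++ reverse inner) ≡ ℓ
      len = trans len′ (suc-injective (trans (sym (+-suc (length L) (length inner))) (trans (cong (length L +_) size) (sym eq))))
      3≤ : 3 ≤ ℓ
      3≤ with ys , refl ← Path-∷ path = subst (3 ≤_) (trans (sym len′) len) (+-mono-≤ 2≤ (s≤s z≤n))

    -- The vertices on the tree path from the root to `v`, without the root, read as digits in base
    -- n. In this order the descendants of any vertex of the tree are consecutive within a level.
    key : ℕ → Fin n → ℕ
    key zero    v = 0
    key (suc r) v = n * key r (π r v) + toℕ v

    key-mono : ∀ r {u w} → key (suc r) u ≤ key (suc r) w → key r (π r u) ≤ key r (π r w)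
    key-mono r {u} {w} h with key r (π r u) ≤? key r (π r w)
    ... | yes h′ = h′
    ... | no ¬h  = contradiction (begin-strict
      n * K′ + toℕ w     <⟨ +-monoʳ-< (n * K′) (Fin.toℕ<n w) ⟩
      n * K′ + n         ≡⟨ trans (+-comm (n * K′) n) (sym (*-suc n K′)) ⟩
      n * suc K′         ≤⟨ *-monoʳ-≤ n (≰⇒> ¬h) ⟩
      n * K              ≤⟨ m≤m+n _ _ ⟩
      n * K + toℕ u      ≤⟨ h ⟩
      n * K′ + toℕ w     ∎) (<-irrefl refl)
      where
      open ≤-Reasoning
      K  = key r (π r u)
      K′ = key r (π r w)

    key-injective : ∀ r {u w} → Lev r u → Lev r w → key r u ≡ key r w → u ≡ w
    key-injective zero    refl refl _ = refl
    key-injective (suc r) {u} {w} lu lw eq = Fin.toℕ-injective (+-cancelˡ-≡ (n * key r (π r u)) _ _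
      (trans eq (cong (λ z → n * z + toℕ w) (sym K≡K′))))
      where
      K≡K′ : key r (π r u) ≡ key r (π r w)
      K≡K′ = ≤-antisym (key-mono r (≤-reflexive eq)) (key-mono r (≤-reflexive (sym eq)))

    private
      Sorted : ℕ → List (Fin n) → Set
      Sorted r = AllPairs (λ u w → key r u ≤ key r w)

      -- Lists of parents are sorted but may contain repetitions, which are consecutive since the
      -- key is injective on a level. This settles the case of `branch` in which all vertices have
      -- the same parent: the copies of the first vertex are split off.
      splitAtFirst : ∀ r u us → Sorted r (u ∷ us) → All (Lev r) (u ∷ us) → ∀ {w} → w ∈ u ∷ us → w ≢ u →
        ∃ λ as → ∃ λ bs → us ≡ as ++ bs × All (_≡ u) as × 1 ≤ length bs × All (_≢ u) bs
      splitAtFirst r u us _ _ (here refl) ne = contradiction refl ne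
      splitAtFirst r u (v ∷ us) ((p ∷ ps) ∷ (q ∷ qs)) (lu ∷ lv ∷ ls) (there w∈) ne with v Fin.≟ u
      ... | no v≢u = [] , v ∷ us , refl , [] , s≤s z≤n , v≢u ∷ All.tabulate λ {y} y∈ y≡u →
            v≢u (key-injective r lv lu (≤-antisym (subst (λ z → key r v ≤ key r z) y≡u (All.lookup q y∈)) p))
      ... | yes refl with as , bs , refl , e , l , ne′ ← splitAtFirst r v us (q ∷ qs) (lv ∷ ls) w∈ ne =
        v ∷ as , bs , refl , refl ∷ e , l , ne′

      unmap : ∀ {A B : Set} (f : A → B) us as {bs} → map f us ≡ as ++ bs →
              ∃ λ as′ → ∃ λ bs′ → us ≡ as′ ++ bs′ × map f as′ ≡ as × map f bs′ ≡ bs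
      unmap f us [] eq = [] , us , refl , refl , eq
      unmap f (u ∷ us) (a ∷ as) eq with e , eq′ ← ∷-injective eq
        with as′ , bs′ , refl , p , q ← unmap f us as eq′ = u ∷ as′ , bs′ , refl , cong₂ _∷_ e p , q

      length-map′ : ∀ {A B : Set} (f : A → B) us {vs} → map f us ≡ vs → 1 ≤ length vs → 1 ≤ length us
      length-map′ f []       refl ()
      length-map′ f (_ ∷ us) _    _ = s≤s z≤n

    -- The sequence splits where the tree branches: all pairs across the split have the same lowest common ancestor.
    branch : ∀ r u us {w} → AllPairs (λ u w → key r u ≤ key r w) (u ∷ us) → All (Lev r) (u ∷ us) → w ∈ us → u ≢ w →
             ∃ λ as → ∃ λ bs → ∃ λ h → u ∷ us ≡ as ++ bs × 1 ≤ length as × 1 ≤ length bs × 1 ≤ h × h ≤ r ×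
               (∀ {u w} → u ∈ as → w ∈ bs → u ≢ w × Link r h u w)
    branch zero u us _ (refl ∷ ls) w∈ u≢w = contradiction (sym (All.lookup ls w∈)) u≢w
    branch (suc r) u us {w} srt ls@(lu ∷ _) w∈ u≢w with Fin.any? (λ v → (v ∈? us) ×-dec ¬? (π r u Fin.≟ π r v))
    ... | no same with as , bs , refl , e , l , ne ← splitAtFirst (suc r) u us srt ls (there w∈) (u≢w ∘ sym) =
      u ∷ as , bs , 1 , refl , s≤s z≤n , l , ≤-refl , s≤s z≤n , λ {y} {z} y∈ z∈ →
        let y≡u = All.lookup (refl ∷ e) y∈
            z∈us = ∈-++⁺ʳ as z∈
        in (λ y≡z → All.lookup ne z∈ (trans (sym y≡z) y≡u)) , link-base r (subst (Lev (suc r)) (sym y≡u) lu) (All.lookup ls (there z∈us))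
             (trans (cong (π r) y≡u) (same-π z∈us))
      where
      same-π : ∀ {z} → z ∈ as ++ bs → π r u ≡ π r z
      same-π {z} z∈ with π r u Fin.≟ π r z
      ... | yes q = q
      ... | no q  = contradiction (z , z∈ , q) same
    ... | yes (v , v∈ , πu≢πv)
      with as , bs , h , eq , la , lb , 1≤h , h≤r , L ← branch r (π r u) (map (π r) us)
             (AllPairs.map⁺ (AllPairs.map (key-mono r) srt)) (All.map⁺ (All.map (π-lev r) ls)) (∈-map⁺ (π r) v∈) πu≢πv
      with as′ , bs′ , eq′ , refl , refl ← unmap (π r) (u ∷ us) as eq =
      as′ , bs′ , suc h , eq′ , length-map′ (π r) as′ refl la , length-map′ (π r) bs′ refl lb , s≤s z≤n , s≤s h≤r , λ {y} {z} y∈ z∈ →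
        let ly = All.lookup ls (subst (y ∈_) (sym eq′) (∈-++⁺ˡ y∈))
            lz = All.lookup ls (subst (z ∈_) (sym eq′) (∈-++⁺ʳ as′ z∈))
            ne , K = L (∈-map⁺ (π r) y∈) (∈-map⁺ (π r) z∈)
        in (λ y≡z → ne (cong (π r) y≡z)) , link-up r ly lz ne K

  -- The left part loses its first entries as long as the remaining ones suffice; the right part is
  -- cut only when a single entry is left of the other. Thus the place where the two parts meet
  -- stays inside the window.
  trim : ∀ {A : Set} (a : A) (as bs : List A) c → 1 ≤ length bs → 2 ≤ c → c ≤ suc (length as + length bs) →
         ∃ λ pre → ∃ λ as′ → ∃ λ bs′ → ∃ λ post → a ∷ as ≡ pre ++ as′ × bs ≡ bs′ ++ post ×
           1 ≤ length as′ × 1 ≤ length bs′ × length as′ + length bs′ ≡ c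
  trim x [] bs (suc c) lb (s≤s 1≤c) (s≤s c≤) =
    [] , x ∷ [] , take c bs , drop c bs , refl , sym (take++drop≡id c bs) , s≤s z≤n , subst (1 ≤_) (sym len) 1≤c , cong suc len
    where len = trans (length-take c bs) (m≤n⇒m⊓n≡m c≤)
  trim x (y ∷ as) bs c lb 2≤c c≤ with c ≤? suc (length as + length bs)
  ... | no ¬h = [] , x ∷ y ∷ as , bs , [] , refl , sym (++-identityʳ bs) , s≤s z≤n , lb , ≤-antisym (≰⇒> ¬h) c≤
  ... | yes h = let pre , as′ , bs′ , post , e , e′ , r = trim y as bs c lb 2≤c h in
    x ∷ pre , as′ , bs′ , post , cong (x ∷_) e , e′ , r

  infixPath : ∀ {A : Set} {R : A → A → Set} {u v} pre as bs post → 1 ≤ length as → 1 ≤ length bs →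
              Path R u v ((pre ++ as) ++ (bs ++ post)) → ∃ λ u′ → ∃ λ v′ → u′ ∈ as × v′ ∈ bs × Path R u′ v′ (as ++ bs)
  infixPath {A} {R} {u} {v} pre (a ∷ as) (b ∷ bs) post _ _ p =
    a , z , here refl , subst (z ∈_) (sym e) (∈-++⁺ʳ ys (here refl)) ,
    subst (Path R a z) (trans (++-assoc (a ∷ as) ys (z ∷ [])) (cong ((a ∷ as) ++_) (sym e)))
      (proj₁ (Path-prefix ((a ∷ as) ++ ys) (subst (Path R a v) eq (proj₂ (Path-prefix pre (subst (Path R u v) (++-assoc pre (a ∷ as) _) p))))))
    where
    unsnoc : ∀ (b : A) bs → ∃ λ ys → ∃ λ z → b ∷ bs ≡ ys ∷ʳ z
    unsnoc b []        = [] , b , refl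
    unsnoc b (b′ ∷ bs) with ys , z , e ← unsnoc b′ bs = b ∷ ys , z , cong (b ∷_) e
    ys = proj₁ (unsnoc b bs)
    z = proj₁ (proj₂ (unsnoc b bs))
    e = proj₂ (proj₂ (unsnoc b bs))
    eq : (a ∷ as) ++ ((b ∷ bs) ++ post) ≡ ((a ∷ as) ++ ys) ++ z ∷ post
    eq = trans (cong (λ w → (a ∷ as) ++ (w ++ post)) e)
      (trans (cong ((a ∷ as) ++_) (++-assoc ys (z ∷ []) post)) (sym (++-assoc (a ∷ as) ys (z ∷ post))))

  module _ {n : ℕ} {G : Graph n} {a : ℕ} (dense : Dense G a) where

    -- Peeling off the vertices without a smaller neighbour, an independent set, m times leaves a vertex that ends an increasing path.
    increasing : ∀ (k : Fin n → ℕ) m {P : Fin n → Set} (P? : ∀ v → Dec (P v)) →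
                 (∀ {u v} → P u → P v → k u ≡ k v → u ≡ v) → m * a < # P? →
                 ∃ λ us → ∃ λ u → ∃ λ v → length us ≡ suc m × Path (Adj G) u v us × AllPairs (λ x y → k x < k y) us × All P us
    increasing k zero P? inj h with v , p ← #-find P? h = v ∷ [] , v , v , refl , end , [] ∷ [] , p ∷ []
    increasing k (suc m) {P} P? inj h = extend (increasing k m P′? (λ p q → inj (proj₁ p) (proj₁ q)) m*a<)
      where
      Smaller : Fin n → Set
      Smaller v = ∃ λ u → P u × k u < k v × Adj G u v
      smaller? : ∀ v → Dec (Smaller v)
      smaller? v = Fin.any? λ u → P? u ×-dec (k u <? k v) ×-dec adj? G u v
      P′? : ∀ v → Dec (P v × Smaller v)
      P′? v = P? v ×-dec smaller? v
      I? : ∀ v → Dec (P v × ¬ Smaller v)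
      I? v = P? v ×-dec ¬? (smaller? v)
      #I≤a : # I? ≤ a
      #I≤a with # I? ≤? a
      ... | yes h = h
      ... | no ¬h with u , v , (pu , nu) , (pv , nv) , uv ← dense I? (≰⇒> ¬h) with <-cmp (k u) (k v)
      ...   | tri< lt _ _ = contradiction (u , pu , lt , uv) nv
      ...   | tri> _ _ gt = contradiction (v , pv , gt , symm G uv) nu
      ...   | tri≈ _ eq _ = contradiction (subst (Adj G u) (sym (inj pu pv eq)) uv) (irrefl G)
      split : ∀ v → P v → (P v × ¬ Smaller v) ⊎ (P v × Smaller v)
      split v p with smaller? v
      ... | yes s = inj₂ (p , s)
      ... | no s  = inj₁ (p , s)
      m*a< : m * a < # P′?
      m*a< = +-cancelˡ-< a (m * a) _ (<-≤-trans h (≤-trans (#-⊎ I? P′? P? split) (+-monoˡ-≤ _ #I≤a)))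
      extend : (∃ λ us → ∃ λ u → ∃ λ v → length us ≡ suc m × Path (Adj G) u v us × AllPairs (λ x y → k x < k y) us × All (λ v → P v × Smaller v) us) →
               ∃ λ us → ∃ λ u → ∃ λ v → length us ≡ suc (suc m) × Path (Adj G) u v us × AllPairs (λ x y → k x < k y) us × All P us
      extend ([] , _ , _ , () , _)
      extend (u ∷ us , u′ , v , len , p , q ∷ qs , (pu , w , pw , wu , adj) ∷ ps) with _ , refl ← Path-∷ p =
        w ∷ u ∷ us , w , v , cong suc len , step adj p , (wu ∷ All.map (<-trans wu) q) ∷ q ∷ qs , pw ∷ pu ∷ All.map proj₁ ps

    -- The level contains a path with m + 1 vertices and increasing keys. All pairs across its
    -- branching point have links with the same number 2h - 1 of inner vertices. So m + 2 - 2h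
    -- consecutive vertices around that point close up to a cycle with m + 1 vertices, wherever
    -- exactly the window ends. The premise on r makes the window contain at least two vertices.
    wideLevel : ∀ x r m → 1 ≤ m → r + r ≤ m → m * a < # (lev? G x r) → HasCycle G (suc m)
    wideLevel x r m 1≤m r≤ h = go (increasing (key G x r) m (lev? G x r) (key-injective G x r) h)
      where
      2≤c : ∀ {h} → h ≤ r → 2 ≤ suc (suc m) ∸ (h + h)
      2≤c {h} h≤r = m+n≤o⇒m≤o∸n 2 (s≤s (s≤s (≤-trans (+-mono-≤ h≤r h≤r) r≤)))
      Across : ℕ → List (Fin n) → List (Fin n) → Set
      Across h as bs = ∀ {u w} → u ∈ as → w ∈ bs → u ≢ w × Link G x r h u w
      Unique-++⁻ʳ : ∀ xs {ys : List (Fin n)} → Unique (xs ++ ys) → Unique ys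
      Unique-++⁻ʳ []       u       = u
      Unique-++⁻ʳ (_ ∷ xs) (_ ∷ u) = Unique-++⁻ʳ xs u
      finish : ∀ {u v} h pre as bs post → h ≤ r → Across h (pre ++ as) (bs ++ post) → 1 ≤ length as → 1 ≤ length bs →
               length as + length bs ≡ suc (suc m) ∸ (h + h) → Path (Adj G) u v ((pre ++ as) ++ (bs ++ post)) →
               Unique ((pre ++ as) ++ (bs ++ post)) → All (Lev G x r) ((pre ++ as) ++ (bs ++ post)) → HasCycle G (suc m)
      finish h pre as bs post h≤r L la lb lc p uq ls
        with u′ , v′ , u′∈ , v′∈ , q ← infixPath pre as bs post la lb p =
        close G x (as ++ bs) q
          (Unique-++⁻ˡ (as ++ bs) (Unique-++⁻ʳ pre (subst Unique eq uq)))
          (subst (2 ≤_) (sym (trans (length-++ as) lc)) (2≤c h≤r))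
          (All.map (¬Below G x) (All.++⁻ˡ (as ++ bs) (All.++⁻ʳ pre (subst (All (Lev G x r)) eq ls))))
          (proj₂ (L (∈-++⁺ʳ pre u′∈) (∈-++⁺ˡ v′∈)))
          (sym (trans (cong (_+ (h + h)) (trans (length-++ as) lc)) (m∸n+n≡m (≤-trans (+-mono-≤ h≤r h≤r) (≤-trans r≤ (m≤n+m m 2))))))
        where
        eq : (pre ++ as) ++ (bs ++ post) ≡ pre ++ ((as ++ bs) ++ post)
        eq = trans (++-assoc pre as _) (cong (pre ++_) (sym (++-assoc as bs post)))
      go : (∃ λ us → ∃ λ u → ∃ λ v → length us ≡ suc m × Path (Adj G) u v us × AllPairs (λ y z → key G x r y < key G x r z) us × All (Lev G x r) us) → HasCycle G (suc m)
      go ([] , _ , _ , () , _)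
      go (_ ∷ [] , _ , _ , refl , _) = contradiction 1≤m λ ()
      go (u₀ ∷ u₁ ∷ us , _ , _ , len , p , incr@((lt ∷ _) ∷ _) , ls)
        with branch G x r u₀ (u₁ ∷ us) (AllPairs.map <⇒≤ incr) ls (here refl) (λ { refl → <-irrefl refl lt })
      ... | [] , _ , _ , _ , () , _
      ... | y ∷ ys , bs , h , eq , la , lb , 1≤h , h≤r , L
        with pre , as′ , bs′ , post , e , e′ , la′ , lb′ , lc ← trim y ys bs (suc (suc m) ∸ (h + h)) lb (2≤c h≤r)
               (≤-trans (∸-monoʳ-≤ (suc (suc m)) (≤-trans 1≤h (m≤m+n h h)))
                 (≤-reflexive (trans (sym len) (trans (cong length eq) (length-++ (y ∷ ys)))))) =
        finish h pre as′ bs′ post h≤r (subst₂ (Across h) e e′ L) la′ lb′ lc (subst (Path (Adj G) _ _) eq′ p)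
          (subst Unique eq′ (AllPairs.map (λ { lt refl → <-irrefl refl lt }) incr)) (subst (All (Lev G x r)) eq′ ls)
        where
        eq′ : u₀ ∷ u₁ ∷ us ≡ (pre ++ as′) ++ (bs′ ++ post)
        eq′ = trans eq (cong₂ _++_ e e′)

-- Cycles of length at most 4a

module ShortCycles where

  open Counting
  open Graphs
  open TriangleChains
  open Levels
  open import Defs using (Graph; Adj; adj?; symm; irrefl; HasCycle)
  open import Data.Nat.Base
  open import Data.Nat.Properties
  open import Data.Nat.DivMod using (m/n*n≤m; m≡m%n+[m/n]*n; m%n<n)
  open import Data.Nat.Solver using (module +-*-Solver)
  open +-*-Solver using (solve; con; _:+_; _:*_; _:=_)
  open import Data.Fin.Base using (Fin)
  open import Data.List.Base using (List; []; _∷_; _++_; length)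
  open import Data.List.Properties using (length-++)
  open import Data.List.Membership.Propositional using (_∈_; find)
  open import Data.List.Membership.Propositional.Properties using (∈-∃++; ∈-filter⁻)
  open import Data.List.Relation.Unary.Any using (here; there)
  open import Data.List.Relation.Unary.All as All using (All; []; _∷_)
  import Data.List.Relation.Unary.All.Properties as All
  open import Data.List.Relation.Unary.AllPairs using ([]; _∷_)
  open import Data.List.Relation.Unary.Unique.Propositional using (Unique)
  import Data.List.Relation.Unary.Unique.Propositional.Properties as Unique
  open import Data.List.Relation.Binary.Permutation.Propositional using (↭-sym)
  open import Data.List.Relation.Binary.Permutation.Propositional.Properties using (shift; ∈-resp-↭)
  open import Data.Product.Base using (∃; _×_; _,_; proj₁; proj₂)
  open import Data.Sum.Base using (_⊎_; inj₁; inj₂)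
  open import Function.Base using (_∘_; id)
  open import Relation.Binary.PropositionalEquality
  open import Relation.Binary.Definitions using (tri<; tri≈; tri>)
  open import Relation.Nullary using (¬_; Dec; yes; no; contradiction)
  open import Relation.Nullary.Decidable using (_×-dec_; _⊎-dec_)

  module _ {n : ℕ} {E : Fin n → Fin n → Set} (E? : ∀ u v → Dec (E u v))
           (E-sym : ∀ {u v} → E u v → E v u) (E-irrefl : ∀ {v} → ¬ E v v) (μ : ℕ) where

    private
      f : Fin n → Fin n → ℕ
      f u v = bit (E? u v)

      D : List (Fin n) → ℕ
      D Q = sumL (λ u → sumL (f u) Q) Q

      insert : ∀ (g : Fin n → ℕ) ys x zs → sumL g (ys ++ x ∷ zs) ≡ g x + sumL g (ys ++ zs)
      insert g ys x zs = trans (sumL-++ g ys (x ∷ zs)) (trans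
        (solve 3 (λ a b c → a :+ (b :+ c) := b :+ (a :+ c)) refl (sumL g ys) (g x) (sumL g zs)) (cong (g x +_) (sym (sumL-++ g ys zs))))

      f-sym : ∀ u v → f u v ≡ f v u
      f-sym u v = ≤-antisym (bit-mono (E? u v) (E? v u) E-sym) (bit-mono (E? v u) (E? u v) E-sym)

      D-insert : ∀ ys x zs → D (ys ++ x ∷ zs) ≡ sumL (f x) (ys ++ x ∷ zs) + sumL (f x) (ys ++ x ∷ zs) + D (ys ++ zs)
      D-insert ys x zs = begin
        D (ys ++ x ∷ zs)                                        ≡⟨ insert _ ys x zs ⟩
        d + sumL (λ u → sumL (f u) (ys ++ x ∷ zs)) (ys ++ zs)   ≡⟨ cong (d +_) (sumL-cong (ys ++ zs) λ {u} _ → insert (f u) ys x zs) ⟩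
        d + sumL (λ u → f u x + sumL (f u) (ys ++ zs)) (ys ++ zs) ≡⟨ cong (d +_) (sumL-+ (λ u → f u x) _ (ys ++ zs)) ⟩
        d + (sumL (λ u → f u x) (ys ++ zs) + D (ys ++ zs))      ≡⟨ cong (λ z → d + (z + D (ys ++ zs))) (sumL-cong (ys ++ zs) λ {u} _ → f-sym u x) ⟩
        d + (sumL (f x) (ys ++ zs) + D (ys ++ zs))              ≡⟨ cong (λ z → d + (z + D (ys ++ zs))) (sym (trans (insert (f x) ys x zs) (cong (_+ sumL (f x) (ys ++ zs)) (bit-no (E? x x) E-irrefl)))) ⟩
        d + (d + D (ys ++ zs))                                  ≡⟨ +-assoc d d _ ⟨
        d + d + D (ys ++ zs)                                    ∎
        where
        open ≡-Reasoning
        d = sumL (f x) (ys ++ x ∷ zs)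

    -- Deleting a vertex of degree at most μ lowers the degree sum by at most 2μ, so the average
    -- degree stays above 2μ. The strict inequality prevents the set from becoming empty.
    core : ∀ m Q → length Q ≡ m → Unique Q → (μ + μ) * m < sumL (λ u → sumL (λ v → bit (E? u v)) Q) Q →
           ∃ λ K → Unique K × (∀ {v} → v ∈ K → v ∈ Q) × 1 ≤ length K × (∀ {v} → v ∈ K → μ < sumL (λ u → bit (E? v u)) K)
    core zero [] _ _ h = contradiction h λ ()
    core (suc m) Q len uq h with All.all? (λ v → μ <? sumL (f v) Q) Q
    ... | yes all = Q , uq , id , subst (1 ≤_) (sym len) (s≤s z≤n) , All.lookup all
    ... | no ¬all with x , x∈ , ¬μ< ← find (All.¬All⇒Any¬ (λ v → μ <? sumL (f v) Q) Q ¬all)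
      with ys , zs , refl ← ∈-∃++ x∈ =
      let perm = shift x ys zs
          uq′ = Unique-tail (Unique-resp-↭ perm uq)
          K , uK , sub , l , deg = core m (ys ++ zs) (trans (length-++ ys) (suc-injective (trans (sym (trans (length-++ ys) (+-suc (length ys) (length zs)))) len))) uq′ (bound′ ys x zs ¬μ< h)
      in K , uK , (λ v∈ → ∈-resp-↭ (↭-sym perm) (there (sub v∈))) , l , deg
      where
      Unique-tail : ∀ {x} {xs : List (Fin n)} → Unique (x ∷ xs) → Unique xs
      Unique-tail (_ ∷ u) = u
      bound′ : ∀ ys x zs → ¬ μ < sumL (f x) (ys ++ x ∷ zs) → (μ + μ) * suc m < D (ys ++ x ∷ zs) → (μ + μ) * m < D (ys ++ zs)
      bound′ ys x zs ¬μ< h = +-cancelˡ-< (μ + μ) _ _ (begin-strict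
        μ + μ + (μ + μ) * m       ≡⟨ *-suc (μ + μ) m ⟨
        (μ + μ) * suc m           <⟨ h ⟩
        D (ys ++ x ∷ zs)          ≡⟨ D-insert ys x zs ⟩
        sumL (f x) (ys ++ x ∷ zs) + sumL (f x) (ys ++ x ∷ zs) + D (ys ++ zs) ≤⟨ +-monoˡ-≤ _ (+-mono-≤ (≮⇒≥ ¬μ<) (≮⇒≥ ¬μ<)) ⟩
        μ + μ + D (ys ++ zs)      ∎)
        where open ≤-Reasoning

  -- Two involutions of the levels: `swapE` exchanges 2i with 2i + 1, and `swapO` exchanges 2i + 1
  -- with 2i + 2 and fixes 0. Every edge joins equal or neighbouring levels, so it belongs to the
  -- identity or to one of these. Within one such class the level of one end determines the level of
  -- the other.
  swapE : ℕ → ℕ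
  swapE zero          = 1
  swapE (suc zero)    = 0
  swapE (suc (suc l)) = suc (suc (swapE l))

  swapO : ℕ → ℕ
  swapO zero    = 0
  swapO (suc l) = suc (swapE l)

  swapE-invol : ∀ l → swapE (swapE l) ≡ l
  swapE-invol zero          = refl
  swapE-invol (suc zero)    = refl
  swapE-invol (suc (suc l)) = cong (suc ∘ suc) (swapE-invol l)

  swapO-invol : ∀ l → swapO (swapO l) ≡ l
  swapO-invol zero    = refl
  swapO-invol (suc l) = cong suc (swapE-invol l)

  swap-suc : ∀ l → suc l ≡ swapE l ⊎ suc l ≡ swapO l
  swap-suc zero          = inj₁ refl
  swap-suc (suc zero)    = inj₂ refl
  swap-suc (suc (suc l)) with swap-suc l
  ... | inj₁ e = inj₁ (cong (suc ∘ suc) e)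
  swap-suc (suc (suc zero))    | inj₂ ()
  swap-suc (suc (suc (suc l))) | inj₂ e = inj₂ (cong (suc ∘ suc) e)

  swap-near : ∀ {l m} → l ≤ suc m → m ≤ suc l → m ≡ l ⊎ m ≡ swapE l ⊎ m ≡ swapO l
  swap-near {l} {m} h h′ with <-cmp l m
  ... | tri≈ _ e _ = inj₁ (sym e)
  ... | tri< lt _ _ = subst (λ z → z ≡ l ⊎ z ≡ swapE l ⊎ z ≡ swapO l) (≤-antisym lt h′) (inj₂ (swap-suc l))
  ... | tri> _ _ gt with ≤-antisym gt h
  ...   | refl with swap-suc m
  ...     | inj₁ e = inj₂ (inj₁ (trans (sym (swapE-invol m)) (cong swapE (sym e))))
  ...     | inj₂ e = inj₂ (inj₂ (trans (sym (swapO-invol m)) (cong swapO (sym e))))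

  module _ {n : ℕ} {G : Graph n} {a : ℕ} (dense : Dense G a) (1≤a : 1 ≤ a) {d : ℕ} (600a≤d : 600 * a ≤ d)
           (deg : ∀ v → d ≤ # (adj? G v)) (x : Fin n) where

    private
      μ : ℕ
      μ = 9 * a

      ballSize : ℕ → ℕ
      ballSize t = # (ball? G x t)

      module _ (t : ℕ) (few : ballSize (suc t) ≤ 10 * ballSize t) where

        R : ℕ
        R = suc t

        -- The level inside the ball of radius `R`; 0 is a junk value outside.
        lv : Fin n → ℕ
        lv v with ball? G x R v
        ... | yes b = proj₁ (Ball⇒Lev G x R b)
        ... | no _  = 0

        lv-lev : ∀ {v} → Ball G x R v → Lev G x (lv v) v × lv v ≤ R
        lv-lev {v} b with ball? G x R v
        ... | yes b′ = proj₂ (proj₂ (Ball⇒Lev G x R b′)) , proj₁ (proj₂ (Ball⇒Lev G x R b′))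
        ... | no ¬b  = contradiction b ¬b

        Q : List (Fin n)
        Q = elems (ball? G x R)

        lenQ : length Q ≡ ballSize R
        lenQ = length-elems (ball? G x R)

        module _ (pr : ℕ → ℕ) (invol : ∀ l → pr (pr l) ≡ l) where

          E : Fin n → Fin n → Set
          E u v = Adj G u v × lv v ≡ pr (lv u)

          E? : ∀ u v → Dec (E u v)
          E? u v = adj? G u v ×-dec (lv v ≟ pr (lv u))

          total : ℕ
          total = sumL (λ u → sumL (λ v → bit (E? u v)) Q) Q

          coreDeg : ∀ K → Unique K → (∀ {v} → v ∈ K → μ < sumL (λ u → bit (E? v u)) K) →
                    ∀ {v} → v ∈ K → μ ≤ # (λ u → E? v u ×-dec (u ∈? K))
          coreDeg K uK degK {v} v∈ = ≤-trans (<⇒≤ (degK v∈)) (≤-trans (≤-reflexive (sym (length-filter (E? v) K)))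
            (length≤# _ (Unique.filter⁺ (E? v) uK) (All.tabulate λ u∈ → let p , q = ∈-filter⁻ (E? v) {xs = K} u∈ in q , p)))

          module _ {ℓ w : ℕ} (ℓ≤4a : ℓ ≤ 4 * a) (3≤ℓ : 3 ≤ ℓ) (ℓ≤4w : ℓ ≤ 4 * w) (4w≤ : 4 * w ≤ ℓ + 3) (short : w + w + (R + R) ≤ ℓ) where

            module _ (K : List (Fin n)) (uK : Unique K) (K⊆Q : ∀ {v} → v ∈ K → v ∈ Q)
                     (degK : ∀ {v} → v ∈ K → μ < sumL (λ u → bit (E? v u)) K)
                     (v₀ : Fin n) (v₀∈ : v₀ ∈ K) (λ≤ : lv v₀ ≤ pr (lv v₀)) where

              -- The level prescribed after τ steps of the chain: it alternates between the level of
              -- `v₀` and its partner. Since `v₀` lies on the lower side, the chain never drops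
              -- below its level, and links through lower levels avoid the chain.
              alt : ℕ → ℕ
              alt zero    = lv v₀
              alt (suc τ) = pr (alt τ)

              alt≥ : ∀ τ → lv v₀ ≤ alt τ × lv v₀ ≤ pr (alt τ)
              alt≥ zero    = ≤-refl , λ≤
              alt≥ (suc τ) = proj₂ (alt≥ τ) , subst (lv v₀ ≤_) (sym (invol (alt τ))) (proj₁ (alt≥ τ))

              alt-even : ∀ w → alt (w + w) ≡ lv v₀
              alt-even zero    = refl
              alt-even (suc w) = trans (cong (pr ∘ alt) (+-suc w w)) (trans (invol _) (alt-even w))

              Good : ℕ → Fin n → Set
              Good τ v = v ∈ K × lv v ≡ alt τ

              good? : ∀ τ v → Dec (Good τ v)
              good? τ v = (v ∈? K) ×-dec (lv v ≟ alt τ)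

              goodDeg : ∀ τ v → Good τ v → μ ≤ # (λ u → adj? G v u ×-dec good? (suc τ) u)
              goodDeg τ v (v∈ , e) = ≤-trans (coreDeg K uK degK v∈) (#-mono _ _ λ u ((vu , e′) , u∈) → vu , u∈ , trans e′ (cong pr e))

              K-lev : ∀ {v} → v ∈ K → Lev G x (lv v) v
              K-lev v∈ = proj₁ (lv-lev (∈-elems⁻ (ball? G x R) (K⊆Q v∈)))

              good-¬Below : ∀ {τ v} → Good τ v → ¬ Below G x (lv v₀) v
              good-¬Below {τ} (v∈ , e) (s , s< , l) = <-irrefl refl (<-≤-trans s<
                (≤-trans (proj₁ (alt≥ τ)) (≤-reflexive (trans (sym e) (Lev-unique G x (K-lev v∈) l)))))

              room : 1 + (w + w + (w + w)) + a ≤ μ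
              room = begin
                1 + (w + w + (w + w)) + a   ≡⟨ solve 2 (λ w a → con 1 :+ (w :+ w :+ (w :+ w)) :+ a := con 1 :+ con 4 :* w :+ a) refl w a ⟩
                1 + 4 * w + a               ≤⟨ +-monoˡ-≤ a (s≤s (≤-trans 4w≤ (+-monoˡ-≤ 3 ℓ≤4a))) ⟩
                1 + (4 * a + 3) + a         ≡⟨ solve 1 (λ a → con 1 :+ (con 4 :* a :+ con 3) :+ a := con 5 :* a :+ con 4 :* con 1) refl a ⟩
                5 * a + 4 * 1               ≤⟨ +-monoʳ-≤ (5 * a) (*-monoʳ-≤ 4 1≤a) ⟩
                5 * a + 4 * a               ≡⟨ *-distribʳ-+ a 5 4 ⟨
                9 * a                       ∎
                where open ≤-Reasoning

              1≤w : 1 ≤ w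
              1≤w = n≢0⇒n>0 λ w≡0 → contradiction (≤-trans 3≤ℓ (subst (λ z → ℓ ≤ 4 * z) w≡0 ℓ≤4w)) λ ()

              h≤R : ∀ {h} → h ≤ lv v₀ → h ≤ R
              h≤R h≤ = ≤-trans h≤ (proj₂ (lv-lev (∈-elems⁻ (ball? G x R) (K⊆Q v₀∈))))

              -- After an even number of triangles the chain is back in the level of `v₀`, so its
              -- two ends have a link. The cycle has 2w + ρ + 2h vertices, where the number ρ of
              -- visited apices is free between 0 and 2w; this reaches ℓ because 2w + 2R ≤ ℓ ≤ 4w
              -- and h ≤ R.
              finish : ∀ ps h → length ps ≡ w + w → IsChain (Adj G) v₀ ps → Unique (v₀ ∷ flat ps) →
                       All (λ u → ∃ λ τ → Good τ u) (v₀ ∷ flat ps) → h ≤ lv v₀ → Link G x (lv v₀) h v₀ (lastVertex v₀ ps) → HasCycle G ℓ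
              finish ps h len ch uq gs h≤ L = close G x (walk ρ v₀ ps) (walk-path ρ v₀ ps ch) (walk-unique ρ v₀ ps uq)
                  (subst (2 ≤_) (sym lenW) (s≤s (≤-trans (≤-trans 1≤w (m≤m+n w w)) s≤)))
                  (All.tabulate λ y∈ → let τ , g = All.lookup gs (walk⊆ ρ v₀ ps y∈) in good-¬Below {τ} g) L
                  (sym (trans (cong (_+ (h + h)) lenW) (cong suc (m∸n+n≡m 2h≤))))
                where
                open ≤-Reasoning
                2h≤ : h + h ≤ ℓ
                2h≤ = ≤-trans (+-mono-≤ (h≤R h≤) (h≤R h≤)) (≤-trans (m≤n+m _ (w + w)) short)
                s≤ : w + w ≤ ℓ ∸ (h + h)
                s≤ = m+n≤o⇒m≤o∸n (w + w) (≤-trans (+-monoʳ-≤ (w + w) (+-mono-≤ (h≤R h≤) (h≤R h≤))) short)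
                ρ : ℕ
                ρ = ℓ ∸ (h + h) ∸ (w + w)
                ρ≤ : ρ ≤ length ps
                ρ≤ = begin
                  ρ                    ≤⟨ ∸-monoˡ-≤ (w + w) (≤-trans (m∸n≤m ℓ (h + h)) ℓ≤4w) ⟩
                  4 * w ∸ (w + w)      ≡⟨ cong (_∸ (w + w)) (solve 1 (λ w → con 4 :* w := w :+ w :+ (w :+ w)) refl w) ⟩
                  w + w + (w + w) ∸ (w + w) ≡⟨ m+n∸n≡m (w + w) (w + w) ⟩
                  w + w                ≡⟨ len ⟨
                  length ps            ∎
                lenW : length (walk ρ v₀ ps) ≡ suc (ℓ ∸ (h + h))
                lenW = trans (length-walk ρ v₀ ps ρ≤) (cong suc (trans (cong (_+ ρ) len) (m+[n∸m]≡n s≤)))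

              fromCore : HasCycle G ℓ
              fromCore
                with ps , len , ch , uq , av , gs , gl , gl′ ← chain {G = G} dense good? μ goodDeg (w + w) 0 v₀ (v₀ ∷ []) (v₀∈ , refl) room
                with uq′ ← All.map (λ u∉ v≡u → u∉ (here (sym v≡u))) av ∷ uq
                with h , 1≤h , h≤ , L ← link G x (lv v₀) (K-lev v₀∈)
                       (subst (λ z → Lev G x z (lastVertex v₀ ps)) (trans gl′ (trans (cong alt (+-identityʳ (w + w))) (alt-even w))) (K-lev gl))
                       (λ e → lastVertex≢ {ps = ps} uq′ (subst (1 ≤_) (sym len) (≤-trans 1≤w (m≤m+n w w))) (sym e)) =
                finish ps h len ch uq′ ((0 , v₀∈ , refl) ∷ gs) h≤ L

            withCore : (μ + μ) * length Q < total → HasCycle G ℓ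
            withCore h with core E? (λ (uv , e) → symm G uv , sym (trans (cong pr e) (invol _))) (λ (vv , _) → irrefl G vv) μ
                              (length Q) Q refl (elems-unique (ball? G x R)) h
            ... | [] , _ , _ , () , _
            ... | K@(v ∷ _) , uK , sub , _ , degK with lv v ≤? pr (lv v)
            ...   | yes le = fromCore K uK sub degK v (here refl) le
            -- The head of `K` lies on the upper of the two levels. Its degree in the core is
            -- positive, and any neighbour in the same class of edges lies on the lower level.
            ...   | no ¬le with u , (_ , e) , u∈ ← #-find _ (≤-trans (≤-trans 1≤a (m≤n*m a 9)) (coreDeg K uK degK (here refl))) =
                    fromCore K uK sub degK u u∈ (subst₂ _≤_ (sym e) (sym (trans (cong pr e) (invol _))) (<⇒≤ (≰⇒> ¬le)))

        total-adj : ℕ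
        total-adj = sumL (λ u → sumL (λ v → bit (adj? G u v)) Q) Q

        -- Vertices of the ball of radius t have all their neighbours in the next ball, so they
        -- contribute their full degree.
        total-adj≥ : ballSize t * d ≤ total-adj
        total-adj≥ = begin
          ballSize t * d                                              ≡⟨ ∑-*ʳ d _ ⟨
          ∑ (λ u → bit (ball? G x t u) * d)                           ≤⟨ ∑-mono pt ⟩
          ∑ (λ u → bit (ball? G x R u) * sumL (λ v → bit (adj? G u v)) Q) ≡⟨ sumL-elems (ball? G x R) _ ⟨
          total-adj                                                   ∎
          where
          open ≤-Reasoning
          pt : ∀ u → bit (ball? G x t u) * d ≤ bit (ball? G x R u) * sumL (λ v → bit (adj? G u v)) Q
          pt u = go (ball? G x t u)
            where
            inside : Ball G x t u → ∀ v → bit (adj? G u v) ≤ bit (ball? G x R v) * bit (adj? G u v)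
            inside b v with adj? G u v
            ... | no _   = z≤n
            ... | yes uv = ≤-reflexive (sym (trans (*-identityʳ _) (bit-yes (ball? G x R v) (inj₂ (u , b , uv)))))
            go : (b? : Dec (Ball G x t u)) → bit b? * d ≤ bit (ball? G x R u) * sumL (λ v → bit (adj? G u v)) Q
            go (no _)  = z≤n
            go (yes b) = *-mono-≤ {1} {bit (ball? G x R u)} (≤-reflexive (sym (bit-yes (ball? G x R u) (inj₁ b)))) (begin
              d                                                 ≤⟨ deg u ⟩
              # (adj? G u)                                      ≤⟨ ∑-mono (inside b) ⟩
              ∑ (λ v → bit (ball? G x R v) * bit (adj? G u v))  ≡⟨ sumL-elems (ball? G x R) _ ⟨
              sumL (λ v → bit (adj? G u v)) Q                   ∎)

        total-split : total-adj ≤ total id (λ _ → refl) + (total swapE swapE-invol + total swapO swapO-invol)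
        total-split = ≤-trans (sumL-mono Q λ {u} u∈ → ≤-trans (sumL-mono Q λ {v} v∈ → pt u∈ v∈)
            (≤-reflexive (trans (sumL-+ _ _ Q) (cong (sumL (λ v → bit (E? id (λ _ → refl) u v)) Q +_) (sumL-+ _ _ Q)))))
          (≤-reflexive (trans (sumL-+ _ _ Q) (cong (total id (λ _ → refl) +_) (sumL-+ _ _ Q))))
          where
          pt : ∀ {u v} → u ∈ Q → v ∈ Q →
               bit (adj? G u v) ≤ bit (E? id (λ _ → refl) u v) + (bit (E? swapE swapE-invol u v) + bit (E? swapO swapO-invol u v))
          pt {u} {v} u∈ v∈ = ≤-trans (bit-⊎ e₀ (e₁ ⊎-dec e₂) (adj? G u v) types) (+-monoʳ-≤ (bit e₀) (bit-⊎ e₁ e₂ (e₁ ⊎-dec e₂) id))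
            where
            e₀ = E? id (λ _ → refl) u v
            e₁ = E? swapE swapE-invol u v
            e₂ = E? swapO swapO-invol u v
            lev : ∀ {v} → v ∈ Q → Lev G x (lv v) v
            lev v∈ = proj₁ (lv-lev (∈-elems⁻ (ball? G x R) v∈))
            types : Adj G u v → E id (λ _ → refl) u v ⊎ E swapE swapE-invol u v ⊎ E swapO swapO-invol u v
            types uv with swap-near (Lev-step G x (symm G uv) (lev v∈) (lev u∈)) (Lev-step G x uv (lev u∈) (lev v∈))
            ... | inj₁ e        = inj₁ (uv , e)
            ... | inj₂ (inj₁ e) = inj₂ (inj₁ (uv , e))
            ... | inj₂ (inj₂ e) = inj₂ (inj₂ (uv , e))

        -- Let b be the size of the ball of radius t. The degree sum in the next ball is at least
        -- 600ab. If each of the three classes of edges contributed at most 2μ = 18a per vertex,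
        -- then with at most 10b vertices the sum would be at most 3 · 18a · 10b = 540ab. So one
        -- class has a core. This is where 600 comes from.
        denseBall : ∀ {ℓ w} → ℓ ≤ 4 * a → 3 ≤ ℓ → ℓ ≤ 4 * w → 4 * w ≤ ℓ + 3 → w + w + (R + R) ≤ ℓ → HasCycle G ℓ
        denseBall {ℓ} {w} h₁ h₂ h₃ h₄ h₅ with (μ + μ) * length Q <? total id (λ _ → refl)
                                   | (μ + μ) * length Q <? total swapE swapE-invol
                                   | (μ + μ) * length Q <? total swapO swapO-invol
        ... | yes h | _     | _     = withCore id (λ _ → refl) {ℓ} {w} h₁ h₂ h₃ h₄ h₅ h
        ... | no _  | yes h | _     = withCore swapE swapE-invol {ℓ} {w} h₁ h₂ h₃ h₄ h₅ h
        ... | no _  | no _  | yes h = withCore swapO swapO-invol {ℓ} {w} h₁ h₂ h₃ h₄ h₅ h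
        ... | no p  | no q  | no r  = contradiction (begin-strict
          540 * a * b                          <⟨ *-monoˡ-< b {{>-nonZero 1≤b}} (*-monoˡ-< a {{>-nonZero 1≤a}} {540} {600} (m<m+n 540 {60} (s≤s z≤n))) ⟩
          600 * a * b                          ≤⟨ *-monoˡ-≤ b 600a≤d ⟩
          d * b                                ≡⟨ *-comm d b ⟩
          b * d                                ≤⟨ total-adj≥ ⟩
          total-adj                            ≤⟨ total-split ⟩
          _                                    ≤⟨ +-mono-≤ (≮⇒≥ p) (+-mono-≤ (≮⇒≥ q) (≮⇒≥ r)) ⟩
          c + (c + c)                          ≡⟨ solve 2 (λ a q → let c = (con 9 :* a :+ con 9 :* a) :* q in c :+ (c :+ c) := con 54 :* a :* q) refl a (length Q) ⟩
          54 * a * length Q                    ≤⟨ *-monoʳ-≤ (54 * a) (≤-trans (≤-reflexive lenQ) few) ⟩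
          54 * a * (10 * b)                    ≡⟨ solve 2 (λ a b → con 54 :* a :* (con 10 :* b) := con 540 :* a :* b) refl a b ⟩
          540 * a * b                          ∎) (<-irrefl refl)
          where
          open ≤-Reasoning
          b = ballSize t
          c = (μ + μ) * length Q
          1≤b : 1 ≤ b
          1≤b = #-∃ (ball? G x t) x (Ball-mono G x z≤n refl)

      ball₁ : 600 * a ≤ ballSize 1
      ball₁ = ≤-trans 600a≤d (≤-trans (deg x) (#-mono (adj? G x) (ball? G x 1) λ v xv → inj₂ (x , refl , xv)))

      lev₁ : d ≤ # (lev? G x 1)
      lev₁ = ≤-trans (deg x) (#-mono (adj? G x) (lev? G x 1) λ v xv → inj₂ (x , refl , xv) , λ { refl → irrefl G xv })

      -- Ten-fold growth gives an exponential bound, but a linear one suffices: the level has to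
      -- exceed ℓa, where ℓ is about ten times the radius.
      growth : ∀ r → (∀ t → t < suc r → 10 * ballSize t < ballSize (suc t)) → suc r * (600 * a) ≤ ballSize (suc r)
      growth zero    _ = ≤-trans (≤-reflexive (+-identityʳ _)) ball₁
      growth (suc r) h = begin
        (2 + r) * (600 * a)             ≤⟨ *-monoˡ-≤ (600 * a) (≤-trans (≤-reflexive (+-comm 2 r)) (≤-trans (m≤m+n (r + 2) (9 * r + 8)) (≤-reflexive (solve 1 (λ r → r :+ con 2 :+ (con 9 :* r :+ con 8) := con 10 :* (con 1 :+ r)) refl r)))) ⟩
        10 * suc r * (600 * a)          ≡⟨ *-assoc 10 (suc r) (600 * a) ⟩
        10 * (suc r * (600 * a))        ≤⟨ *-monoʳ-≤ 10 (growth r λ t t< → h t (m<n⇒m<1+n t<)) ⟩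
        10 * ballSize (suc r)           ≤⟨ <⇒≤ (h (suc r) ≤-refl) ⟩
        ballSize (2 + r)                ∎
        where open ≤-Reasoning

      -- The ball of radius r + 1 makes up less than a tenth of the next one, so the new level has
      -- at least nine times its size. The factor 30 + 10r exceeds ℓ when ⌊ℓ/10⌋ = r + 2.
      wide : ∀ r → (∀ t → t < 2 + r → 10 * ballSize t < ballSize (suc t)) → (30 + 10 * r) * a ≤ # (lev? G x (2 + r))
      wide r h = +-cancelʳ-≤ (ballSize (suc r)) _ _ (begin
        (30 + 10 * r) * a + b           ≤⟨ +-monoˡ-≤ b (*-monoˡ-≤ a (≤-trans (m≤m+n (30 + 10 * r) (5370 + 5390 * r)) (≤-reflexive (solve 1 (λ r → con 30 :+ con 10 :* r :+ (con 5370 :+ con 5390 :* r) := con 5400 :* (con 1 :+ r)) refl r)))) ⟩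
        5400 * suc r * a + b            ≡⟨ cong (_+ b) (solve 2 (λ r a → con 5400 :* (con 1 :+ r) :* a := con 9 :* ((con 1 :+ r) :* (con 600 :* a))) refl r a) ⟩
        9 * (suc r * (600 * a)) + b     ≤⟨ +-monoˡ-≤ b (*-monoʳ-≤ 9 (growth r λ t t< → h t (m<n⇒m<1+n t<))) ⟩
        9 * b + b                       ≡⟨ +-comm (9 * b) b ⟩
        10 * b                          ≤⟨ <⇒≤ (h (suc r) ≤-refl) ⟩
        ballSize (2 + r)                ≤⟨ #-⊎ (lev? G x (2 + r)) (ball? G x (suc r)) (ball? G x (2 + r)) split ⟩
        # (lev? G x (2 + r)) + b        ∎)
        where
        open ≤-Reasoning
        b = ballSize (suc r)
        split : ∀ v → Ball G x (2 + r) v → Lev G x (2 + r) v ⊎ Ball G x (suc r) v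
        split v p with ball? G x (suc r) v
        ... | yes q = inj₂ q
        ... | no q  = inj₁ (p , q)

    -- Take the radius ⌊ℓ/10⌋. If some ball up to there fails to grow ten-fold, the next ball is
    -- dense compared with its size and a triangle chain inside it closes up; otherwise the last
    -- level is wide enough for an increasing path. For ℓ below 20 the neighbourhood of the root is
    -- wide enough already.
    shortCycle : ∀ ℓ → 3 ≤ ℓ → ℓ ≤ 4 * a → HasCycle G ℓ
    shortCycle (suc m) (s≤s 2≤m) ℓ≤4a with suc m <? 20
    ... | yes m<19 = wideLevel {G = G} dense x 1 m (<⇒≤ 2≤m) 2≤m (begin-strict
        m * a              <⟨ *-monoˡ-< a {{>-nonZero 1≤a}} (<-trans (n<1+n m) m<19) ⟩
        20 * a             ≤⟨ *-monoˡ-≤ a (m≤m+n 20 580) ⟩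
        600 * a            ≤⟨ 600a≤d ⟩
        d                  ≤⟨ lev₁ ⟩
        # (lev? G x 1)     ∎)
      where open ≤-Reasoning
    ... | no m≥19 = go (ℓ / 10) refl
      where
      open ≤-Reasoning
      ℓ = suc m
      w = (ℓ + 3) / 4
      10r≤ℓ : ℓ / 10 * 10 ≤ ℓ
      10r≤ℓ = m/n*n≤m ℓ 10
      ℓ<10r+10 : ℓ < ℓ / 10 * 10 + 10
      ℓ<10r+10 = subst (_< ℓ / 10 * 10 + 10) (sym (m≡m%n+[m/n]*n ℓ 10)) (subst (_< ℓ / 10 * 10 + 10) (+-comm (ℓ / 10 * 10) (ℓ % 10)) (+-monoʳ-< (ℓ / 10 * 10) (m%n<n ℓ 10)))
      4w : ℓ + 3 ≡ (ℓ + 3) % 4 + w * 4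
      4w = m≡m%n+[m/n]*n (ℓ + 3) 4
      ℓ≤4w : ℓ ≤ 4 * w
      ℓ≤4w = +-cancelʳ-≤ 3 ℓ (4 * w) (≤-trans (≤-reflexive 4w) (≤-trans (+-monoˡ-≤ (w * 4) (≤-pred (m%n<n (ℓ + 3) 4))) (≤-reflexive (trans (+-comm 3 (w * 4)) (cong (_+ 3) (*-comm w 4))))))
      4w≤ : 4 * w ≤ ℓ + 3
      4w≤ = ≤-trans (≤-reflexive (*-comm 4 w)) (m/n*n≤m (ℓ + 3) 4)
      go : ∀ r → ℓ / 10 ≡ r → HasCycle G ℓ
      go 0 e = contradiction (subst (λ z → ℓ < z * 10 + 10) e ℓ<10r+10) λ ℓ<10 → m≥19 (≤-trans ℓ<10 (m≤m+n 10 10))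
      go 1 e = contradiction (subst (λ z → ℓ < z * 10 + 10) e ℓ<10r+10) m≥19
      go (suc (suc r)) e with anyUpTo? (λ t → ballSize (suc t) ≤? 10 * ballSize t) (2 + r)
      ... | yes (t , t< , few) = denseBall t few {ℓ} {w} ℓ≤4a (s≤s 2≤m) ℓ≤4w 4w≤ (*-cancelˡ-≤ 2 (begin
        2 * (w + w + (suc t + suc t))     ≡⟨ solve 2 (λ w t → con 2 :* (w :+ w :+ (t :+ t)) := con 4 :* w :+ con 4 :* t) refl w (suc t) ⟩
        4 * w + 4 * suc t                 ≤⟨ +-mono-≤ 4w≤ (*-monoʳ-≤ 4 t<) ⟩
        ℓ + 3 + 4 * (2 + r)               ≤⟨ ≤-trans (m≤m+n _ (9 + 6 * r)) (≤-reflexive (solve 2 (λ l r → l :+ con 3 :+ con 4 :* (con 2 :+ r) :+ (con 9 :+ con 6 :* r) := l :+ (con 2 :+ r) :* con 10) refl ℓ r)) ⟩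
        ℓ + (2 + r) * 10                  ≤⟨ +-monoʳ-≤ ℓ (subst (λ z → z * 10 ≤ ℓ) e 10r≤ℓ) ⟩
        ℓ + ℓ                             ≡⟨ solve 1 (λ l → l :+ l := con 2 :* l) refl ℓ ⟩
        2 * ℓ                             ∎))
      ... | no none = wideLevel {G = G} dense x (2 + r) m (<⇒≤ 2≤m)
        (≤-pred (≤-trans (≤-trans (m≤m+n _ (15 + 8 * r)) (≤-reflexive (solve 1 (λ r → con 1 :+ ((con 2 :+ r) :+ (con 2 :+ r)) :+ (con 15 :+ con 8 :* r) := (con 2 :+ r) :* con 10) refl r))) (subst (λ z → z * 10 ≤ ℓ) e 10r≤ℓ)))
        (begin-strict
          m * a                     <⟨ *-monoˡ-< a {{>-nonZero 1≤a}} (<-trans (n<1+n m) (subst (λ z → ℓ < z * 10 + 10) e ℓ<10r+10)) ⟩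
          ((2 + r) * 10 + 10) * a   ≡⟨ cong (_* a) (solve 1 (λ r → (con 2 :+ r) :* con 10 :+ con 10 := con 30 :+ con 10 :* r) refl r) ⟩
          (30 + 10 * r) * a         ≤⟨ wide r (λ t t< → ≰⇒> λ le → none (t , t< , le)) ⟩
          # (lev? G x (2 + r))      ∎)

-- Cycles of length between 4a and n/2

module MediumCycles where

  open Counting
  open Graphs
  open TriangleChains
  open import Defs using (Graph; Adj; adj?; symm; HasCycle)
  open import Data.Nat.Base
  open import Data.Nat.Properties
  open import Data.Nat.Solver using (module +-*-Solver)
  open +-*-Solver using (solve; con; _:+_; _:*_; _:=_)
  open import Data.Unit.Base using (⊤; tt)
  open import Data.Fin.Base using (Fin)
  import Data.Fin.Properties as Fin
  open import Data.List.Base using (List; []; _∷_; _++_; length; map; reverse; lookup)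
  open import Data.List.Properties using (length-++; length-map; length-reverse)
  open import Data.List.Membership.Propositional using (_∈_; _∉_)
  open import Data.List.Membership.Propositional.Properties using (∈-map⁺; ∈-map⁻; ∈-lookup)
  open import Data.List.Relation.Unary.Any as Any using (here; there)
  open import Data.List.Relation.Unary.Any.Properties using (lookup-index)
  open import Data.List.Relation.Unary.All as All using (All; []; _∷_)
  import Data.List.Relation.Unary.All.Properties as All
  open import Data.List.Relation.Unary.AllPairs using ([]; _∷_)
  open import Data.List.Relation.Unary.Unique.Propositional using (Unique)
  import Data.List.Relation.Unary.Unique.Propositional.Properties as Unique
  open import Data.List.Relation.Binary.Permutation.Propositional using (↭-sym)
  open import Data.List.Relation.Binary.Permutation.Propositional.Properties using (↭-reverse; ∈-resp-↭)
  open import Data.Product.Base using (∃; _×_; _,_; proj₂)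
  open import Function.Base using (_∘_)
  open import Relation.Binary.PropositionalEquality
  open import Relation.Nullary using (yes; no; contradiction)
  open import Relation.Nullary.Decidable using (_×-dec_; ¬?)

  spanning : ∀ {m} (C : List (Fin m)) → Unique C → length C ≡ m → ∀ i → i ∈ C
  spanning {m} C uq len i with i ∈? C
  ... | yes i∈ = i∈
  ... | no i∉  = contradiction (begin-strict
    m                                ≡⟨ len ⟨
    length C                         ≤⟨ length≤# (λ j → ¬? (j Fin.≟ i)) uq (All.tabulate λ j∈ j≡i → i∉ (subst (_∈ C) j≡i j∈)) ⟩
    # (λ j → ¬? (j Fin.≟ i))         <⟨ m<m+n _ (≤-reflexive (sym (#-singleton i))) ⟩
    # (λ j → ¬? (j Fin.≟ i)) + # (Fin._≟ i) ≤⟨ #-disjoint (λ j → ¬? (j Fin.≟ i)) (Fin._≟ i) (λ _ → yes tt) (λ _ _ → tt) (λ _ _ → tt) (λ _ p q → p q) ⟩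
    # {m} {λ _ → ⊤} (λ _ → yes tt)   ≤⟨ #≤n {m} {λ _ → ⊤} (λ _ → yes tt) ⟩
    m                                ∎) (<-irrefl refl)
    where open ≤-Reasoning

  -- With 2a triangles the walks between the ends take 2a + 1 consecutive lengths, as many as the
  -- window in which `shrinkTo` can place the other part of the cycle.
  record Gadget {n : ℕ} (G : Graph n) (a : ℕ) : Set where
    field
      v₀     : Fin n
      ps     : List (Fin n × Fin n)
      size   : length ps ≡ a + a
      chained : IsChain (Adj G) v₀ ps
      unique : Unique (v₀ ∷ flat ps)
    vertices : List (Fin n)
    vertices = v₀ ∷ flat ps
    length-vertices : length vertices ≡ 1 + 4 * a
    length-vertices = cong suc (trans (length-flat ps) (trans (cong₂ _+_ size size) (solve 1 (λ a → a :+ a :+ (a :+ a) := con 4 :* a) refl a)))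
    outside : List (Fin n)
    outside = elems (_∉? vertices)

  module _ {n : ℕ} {G : Graph n} {a : ℕ} (dense : Dense G a) {d : ℕ} (deg : ∀ v → d ≤ # (adj? G v)) where

    gadget : Fin n → 1 + 5 * a ≤ d → Gadget G a
    gadget x h with ps , len , ch , uq , av , _ ← chain {G = G} dense {λ _ _ → ⊤} (λ _ _ → yes tt) d
                      (λ t v _ → ≤-trans (deg v) (#-mono _ _ λ u vu → vu , tt)) (a + a) 0 x (x ∷ []) tt
                      (≤-trans (≤-reflexive (solve 1 (λ a → con 1 :+ (a :+ a :+ (a :+ a)) :+ a := con 1 :+ con 5 :* a) refl a)) h) =
      record { v₀ = x ; ps = ps ; size = len ; chained = ch ; unique = All.map (λ u∉ x≡u → u∉ (here (sym x≡u))) av ∷ uq }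

    module _ {H : Graph n} (G⊆H : ∀ {u v} → Adj G u v → Adj H u v) (g : Gadget G a) (h : 3 + 4 * a ≤ d) where
      open Gadget g

      private
        U = vertices
        y = lastVertex v₀ ps

        neighbour : ∀ v (used : List (Fin n)) → length used ≤ 2 + 4 * a → ∃ λ u → Adj G v u × u ∉ used
        neighbour v used l = #-find (λ u → adj? G v u ×-dec (u ∉? used))
          (+-cancelʳ-≤ (length used) 1 _ (≤-trans (s≤s l) (≤-trans h (≤-trans (deg v) (#-avoid (adj? G v) used)))))

        outside∌ : ∀ {v} → v ∈ outside → v ∉ U
        outside∌ = ∈-elems⁻ (_∉? U)

        n≤ : n ≤ length outside + (1 + 4 * a)
        n≤ = begin
          n                                        ≡⟨ #-all {n} {λ _ → ⊤} (λ _ → yes tt) (λ _ → tt) ⟨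
          # {n} {λ _ → ⊤} (λ _ → yes tt)           ≤⟨ #-avoid (λ _ → yes tt) U ⟩
          # (λ i → yes tt ×-dec (i ∉? U)) + length U ≤⟨ +-mono-≤ (#-mono _ (_∉? U) λ _ → proj₂) (≤-reflexive length-vertices) ⟩
          # (_∉? U) + (1 + 4 * a)                  ≡⟨ cong (_+ (1 + 4 * a)) (length-elems (_∉? U)) ⟨
          length outside + (1 + 4 * a)             ∎
          where open ≤-Reasoning

        -- The cycle runs through `xs` from `i` to `j` and returns along the chain. The chain visits
        -- as many apices as `xs` falls short of ℓ - (1 + 2a).
        assemble : ∀ {i j xs ℓ} → Adj G v₀ i → Adj G y j → Path (Adj H) i j xs → Unique xs → (∀ {z} → z ∈ xs → z ∈ outside) →
                   3 ≤ ℓ → length xs + (1 + (a + a)) ≤ ℓ → ℓ ≤ length xs + (1 + 4 * a) → HasCycle H ℓ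
        assemble {i} {j} {xs} {ℓ} v₀i yj p uq sub 3≤ℓ lo hi = subst (HasCycle H) len
          (mkCycle {G = H} (xs ++ reverse W) (subst (3 ≤_) (sym len) 3≤ℓ)
            (Unique.++⁺ uq (Unique-resp-↭ (↭-sym (↭-reverse W)) (walk-unique ρ v₀ ps unique))
              λ (z∈ , z∈′) → outside∌ (sub z∈) (walk⊆ ρ v₀ ps (∈-resp-↭ (↭-reverse W) z∈′)))
            (Path-++ p (symm H (G⊆H yj)) (Path-reverse (symm H) (Path-mono G⊆H (walk-path ρ v₀ ps chained)))) (G⊆H v₀i))
          where
          b = length xs + (1 + (a + a))
          ρ = ℓ ∸ b
          W = walk ρ v₀ ps
          ρ≤ : ρ ≤ length ps
          ρ≤ = ≤-trans (∸-monoˡ-≤ b hi) (≤-reflexive (trans (cong (_∸ b) (solve 2 (λ x a → x :+ (con 1 :+ con 4 :* a) := x :+ (con 1 :+ (a :+ a)) :+ (a :+ a)) refl (length xs) a))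
            (trans (m+n∸m≡n b (a + a)) (sym size))))
          len : length (xs ++ reverse W) ≡ ℓ
          len = begin
            length (xs ++ reverse W)              ≡⟨ trans (length-++ xs) (cong (length xs +_) (length-reverse W)) ⟩
            length xs + length W                  ≡⟨ cong (length xs +_) (trans (length-walk ρ v₀ ps ρ≤) (cong (λ z → suc (z + ρ)) size)) ⟩
            length xs + suc (a + a + ρ)           ≡⟨ solve 3 (λ x a r → x :+ (con 1 :+ (a :+ r)) := x :+ (con 1 :+ a) :+ r) refl (length xs) (a + a) ρ ⟩
            b + ρ                                 ≡⟨ m+[n∸m]≡n lo ⟩
            ℓ                                     ∎
            where open ≡-Reasoning

        module _ (C : List (Fin (length outside))) where

          covered : Unique C → length C ≡ length outside → ∀ {i} → i ∉ U → i ∈ map (lookup outside) C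
          covered uq len i∉ = subst (_∈ map (lookup outside) C) (sym (lookup-index i∈)) (∈-map⁺ (lookup outside) (spanning C uq len (Any.index i∈)))
            where i∈ = ∈-elems⁺ (_∉? U) i∉

          inside : ∀ {z} → z ∈ map (lookup outside) C → z ∈ outside
          inside z∈ with k , _ , refl ← ∈-map⁻ (lookup outside) z∈ = ∈-lookup k

          -- The chain supplies between 1 + 2a and 1 + 4a vertices, so the arc has to be shortened
          -- to between ℓ - (1 + 4a) and ℓ - (1 + 2a) vertices. This window has exactly the width
          -- that `shrinkTo` needs.
          fromArc : ∀ {i j xs ℓ} → Adj G v₀ i → Adj G y j → 3 ≤ ℓ → 1 + 4 * a ≤ ℓ → ℓ + ℓ ≤ 2 + n →
                    Path (Adj H) i j xs → Unique xs → All (_∈ map (lookup outside) C) xs → 2 + length outside ≤ length xs + length xs → HasCycle H ℓ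
          fromArc {xs = xs} {ℓ} v₀i yj 3≤ℓ lo hi p uq al big =
            let ys , q , uq′ , sub , l , l′ = shrinkTo {G = G} dense {H} G⊆H lo′ hi′ a+a≤ lo′+ p uq lo′≤ in
            assemble v₀i yj q uq′ (λ z∈ → inside (All.lookup al (sub z∈))) 3≤ℓ (m≤o∸n⇒m+n≤o (length ys) (≤-trans 1+2a≤ lo) l′)
              (≤-trans (m≤n+m∸n ℓ (1 + 4 * a)) (≤-trans (≤-reflexive (+-comm (1 + 4 * a) lo′)) (+-monoˡ-≤ (1 + 4 * a) l)))
            where
            open ≤-Reasoning
            hi′ = ℓ ∸ (1 + (a + a))
            lo′ = ℓ ∸ (1 + 4 * a)
            1+2a≤ : 1 + (a + a) ≤ 1 + 4 * a
            1+2a≤ = s≤s (≤-trans (m≤m+n (a + a) (a + a)) (≤-reflexive (solve 1 (λ a → a :+ a :+ (a :+ a) := con 4 :* a) refl a)))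
            a+a≤ : a + a ≤ hi′
            a+a≤ = m+n≤o⇒m≤o∸n (a + a) (≤-trans (≤-reflexive (solve 1 (λ a → a :+ a :+ (con 1 :+ (a :+ a)) := con 1 :+ con 4 :* a) refl a)) lo)
            lo′+ : lo′ + (a + a) ≤ suc hi′
            lo′+ = m≤n⇒m≤1+n (m+n≤o⇒m≤o∸n (lo′ + (a + a)) (≤-reflexive (trans
              (solve 2 (λ l a → l :+ (a :+ a) :+ (con 1 :+ (a :+ a)) := l :+ (con 1 :+ con 4 :* a)) refl lo′ a) (m∸n+n≡m lo))))
            lo′≤ : lo′ ≤ length xs
            lo′≤ = *-cancelˡ-≤ 2 (+-cancelʳ-≤ (2 * (1 + 4 * a)) _ _ (begin
              2 * lo′ + 2 * (1 + 4 * a)                    ≡⟨ *-distribˡ-+ 2 lo′ (1 + 4 * a) ⟨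
              2 * (lo′ + (1 + 4 * a))                      ≡⟨ cong (2 *_) (m∸n+n≡m lo) ⟩
              2 * ℓ                                        ≡⟨ solve 1 (λ l → con 2 :* l := l :+ l) refl ℓ ⟩
              ℓ + ℓ                                        ≤⟨ hi ⟩
              2 + n                                        ≤⟨ +-monoʳ-≤ 2 n≤ ⟩
              2 + (length outside + (1 + 4 * a))           ≡⟨ +-assoc 2 (length outside) (1 + 4 * a) ⟨
              2 + length outside + (1 + 4 * a)             ≤⟨ +-mono-≤ big (m≤n*m (1 + 4 * a) 2) ⟩
              length xs + length xs + 2 * (1 + 4 * a)      ≡⟨ cong (_+ 2 * (1 + 4 * a)) (solve 1 (λ l → l :+ l := con 2 :* l) refl (length xs)) ⟩
              2 * length xs + 2 * (1 + 4 * a)              ∎))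

      -- Together the arcs of the Hamilton cycle between `i` and `j` have 2 + `length outside`
      -- vertices, so the longer one has at least half of them. By 2ℓ ≤ 2 + n this is no less than ℓ
      -- - (1 + 4a), and the arc can be shortened into the window.
      midCycle : HasCycle (pull (lookup outside) H) (length outside) → ∀ ℓ → 3 ≤ ℓ → 1 + 4 * a ≤ ℓ → ℓ + ℓ ≤ 2 + n → HasCycle H ℓ
      midCycle c ℓ 3≤ℓ lo hi
        with C , len , uq , u , v , p , r ← cyclePath {G = pull (lookup outside) H} c
        with i , v₀i , i∉ ← neighbour v₀ U (≤-trans (≤-reflexive length-vertices) (n≤1+n _))
        with j , yj , j∉ ← neighbour y (i ∷ U) (s≤s (≤-reflexive length-vertices))
        with P , Q , pP , pQ , uP , uQ , aP , aQ , lenPQ ← arcs (symm H) (Path-map (lookup outside) p) r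
               (Unique.map⁺ (lookup-injective (elems-unique (_∉? U))) uq)
               (covered C uq len i∉) (covered C uq len (j∉ ∘ there)) (λ i≡j → j∉ (here (sym i≡j)))
        with lenC ← trans lenPQ (cong (2 +_) (trans (length-map (lookup outside) C) len))
        with length P ≤? length Q
      ... | yes le = fromArc C v₀i yj 3≤ℓ lo hi pQ uQ aQ (≤-trans (≤-reflexive (sym lenC)) (+-monoˡ-≤ (length Q) le))
      ... | no gt  = fromArc C v₀i yj 3≤ℓ lo hi pP uP aP (≤-trans (≤-reflexive (sym lenC)) (+-monoʳ-≤ (length P) (<⇒≤ (≰⇒> gt))))

-- Expectations, and the passage from rational to real probabilities

module Expectation where

  open import Defs using (ℝ; seq; IsProbability; Eventually; Graph; _∪_; edgeGraph; pairs; 𝔼; 𝟙; AAS[_∪𝔾_⊨_]; dist; dist-+; dist-*; dist-sym; dist-between; *-mono; *-mono₂; *-nonNeg; +-nonNeg; ≤-+ʳ; 0≤1; scale; fromℕ; fromℕ-nonNeg)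
  open import Data.Nat.Base as ℕ using (ℕ; zero; suc)
  import Data.Nat.Properties as ℕP
  open import Data.Rational.Base
  open import Data.Rational.Properties
  open import Data.Rational.Solver using (module +-*-Solver)
  open +-*-Solver using (solve; con; _:+_; _:*_; _:-_; :-_; _:=_)
  open import Data.List.Base using (List; []; _∷_)
  open import Data.List.Membership.Propositional using (_∈_)
  open import Data.List.Relation.Unary.Any using (here; there)
  open import Data.List.Relation.Unary.All as All using (All)
  open import Data.List.Relation.Unary.AllPairs using ([]; _∷_)
  open import Data.List.Relation.Unary.Unique.Propositional using (Unique)
  open import Data.Product.Base using (∃; _×_; _,_)
  open import Data.Sum.Base using (inj₁; inj₂)
  open import Function.Base using (_∘_)
  open import Relation.Binary.PropositionalEquality
  open import Relation.Nullary using (Dec; yes; no)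

  -- The expectation for rational p, where the order is decidable. All estimates are made for it and
  -- reach `𝔼` through `aas`.
  𝔼q : ∀ {A : Set} → ℚ → List A → (List A → ℚ) → ℚ
  𝔼q p []       f = f []
  𝔼q p (x ∷ xs) f = p * 𝔼q p xs (f ∘ (x ∷_)) + (1ℚ - p) * 𝔼q p xs f

  ind : ∀ {P : Set} → Dec P → ℚ
  ind (yes _) = 1ℚ
  ind (no _)  = 0ℚ

  0≤ind : ∀ {P : Set} (d : Dec P) → 0ℚ ≤ ind d
  0≤ind (yes _) = 0≤1
  0≤ind (no _)  = ≤-refl

  ind≤1 : ∀ {P : Set} (d : Dec P) → ind d ≤ 1ℚ
  ind≤1 (yes _) = ≤-refl
  ind≤1 (no _)  = 0≤1

  pow : ℚ → ℕ → ℚ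
  pow x zero    = 1ℚ
  pow x (suc n) = x * pow x n

  ∏ : ∀ {A : Set} → (A → ℚ) → List A → ℚ
  ∏ w []       = 1ℚ
  ∏ w (x ∷ xs) = w x * ∏ w xs

  ∑q : ∀ {A : Set} → (A → ℚ) → List A → ℚ
  ∑q f []       = 0ℚ
  ∑q f (x ∷ xs) = f x + ∑q f xs

  ≤⇒0≤- : ∀ {a b} → a ≤ b → 0ℚ ≤ b - a
  ≤⇒0≤- {a} {b} h = subst (_≤ b - a) (+-inverseʳ a) (+-monoˡ-≤ (- a) h)

  0≤-⇒≤ : ∀ {a b} → 0ℚ ≤ b - a → a ≤ b
  0≤-⇒≤ {a} {b} h = subst₂ _≤_ (+-identityˡ a) (solve 2 (λ a b → b :- a :+ a := b) refl a b) (+-monoˡ-≤ a h)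

  module _ {A : Set} {p : ℚ} (0≤p : 0ℚ ≤ p) (p≤1 : p ≤ 1ℚ) where

    private
      0≤1-p : 0ℚ ≤ 1ℚ - p
      0≤1-p = ≤⇒0≤- p≤1

    𝔼-mono : ∀ (xs : List A) {f g} → (∀ F → f F ≤ g F) → 𝔼q p xs f ≤ 𝔼q p xs g
    𝔼-mono []       h = h []
    𝔼-mono (x ∷ xs) h = +-mono-≤ (*-mono 0≤p (𝔼-mono xs (h ∘ (x ∷_)))) (*-mono 0≤1-p (𝔼-mono xs h))

    -- The probabilistic method: of the two branches at an entry, one is not worse than their convex
    -- combination. The outcome inherits distinctness from the full list.
    attained : ∀ (xs : List A) f → ∃ λ F → f F ≤ 𝔼q p xs f × (∀ {y} → y ∈ F → y ∈ xs) × (Unique xs → Unique F)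
    attained []       f = [] , ≤-refl , (λ y∈ → y∈) , λ u → u
    attained (x ∷ xs) f with F , hF , sub , uq ← attained xs (f ∘ (x ∷_)) | F′ , hF′ , sub′ , uq′ ← attained xs f
                        with f (x ∷ F) ≤? f F′
    ... | yes le = x ∷ F , ≤-trans (≤-reflexive (solve 2 (λ p a → a := p :* a :+ (con 1ℚ :- p) :* a) refl p (f (x ∷ F))))
                     (+-mono-≤ (*-mono 0≤p hF) (*-mono 0≤1-p (≤-trans le hF′))) ,
                   (λ { (here e) → here e ; (there y∈) → there (sub y∈) }) ,
                   λ { (x∉ ∷ u) → All.tabulate (λ y∈ → All.lookup x∉ (sub y∈)) ∷ uq u }
    ... | no ¬le = F′ , ≤-trans (≤-reflexive (solve 2 (λ p a → a := p :* a :+ (con 1ℚ :- p) :* a) refl p (f F′)))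
                     (+-mono-≤ (*-mono 0≤p (≤-trans (<⇒≤ (≰⇒> ¬le)) hF)) (*-mono 0≤1-p hF′)) ,
                   (λ y∈ → there (sub′ y∈)) , λ { (_ ∷ u) → uq′ u }

  private
    shift-arg : ∀ w s c → w + s - c ≡ s - (c - w)
    shift-arg = solve 3 (λ w s c → w :+ s :- c := s :- (c :- w)) refl

    square-step : ∀ p w s c v → p * ((p * s - (c - w)) * (p * s - (c - w)) + p * (1ℚ - p) * v) + (1ℚ - p) * ((p * s - c) * (p * s - c) + p * (1ℚ - p) * v)
                  ≡ (p * (w + s) - c) * (p * (w + s) - c) + p * (1ℚ - p) * (w * w + v)
    square-step p w s c v = begin
      p * ((p * s - (c - w)) * (p * s - (c - w)) + k * v) + (1ℚ - p) * (S * S + k * v)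
        ≡⟨ cong (λ z → p * (z * z + k * v) + (1ℚ - p) * (S * S + k * v)) (solve 3 (λ t c w → t :- (c :- w) := (t :- c) :+ w) refl (p * s) c w) ⟩
      p * ((S + w) * (S + w) + k * v) + (1ℚ - p) * (S * S + k * v)
        ≡⟨ solve 4 (λ p a b k → p :* (a :+ k) :+ (con 1ℚ :- p) :* (b :+ k) := p :* a :+ (con 1ℚ :- p) :* b :+ k) refl p ((S + w) * (S + w)) (S * S) (k * v) ⟩
      p * ((S + w) * (S + w)) + (1ℚ - p) * (S * S) + k * v
        ≡⟨ cong (_+ k * v) (solve 3 (λ p S w → p :* ((S :+ w) :* (S :+ w)) :+ (con 1ℚ :- p) :* (S :* S) := (S :+ p :* w) :* (S :+ p :* w) :+ p :* (con 1ℚ :- p) :* (w :* w)) refl p S w) ⟩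
      (S + p * w) * (S + p * w) + k * (w * w) + k * v
        ≡⟨ trans (+-assoc ((S + p * w) * (S + p * w)) (k * (w * w)) (k * v)) (cong ((S + p * w) * (S + p * w) +_) (sym (*-distribˡ-+ k (w * w) v))) ⟩
      (S + p * w) * (S + p * w) + k * (w * w + v)
        ≡⟨ cong (λ z → z * z + k * (w * w + v)) (solve 4 (λ p w s c → (p :* s :- c) :+ p :* w := p :* (w :+ s) :- c) refl p w s c) ⟩
      (p * (w + s) - c) * (p * (w + s) - c) + k * (w * w + v) ∎
      where
      open ≡-Reasoning
      k = p * (1ℚ - p)
      S = p * s - c

  module _ {A : Set} (p : ℚ) where

    𝔼-cong : ∀ (xs : List A) {f g} → (∀ F → f F ≡ g F) → 𝔼q p xs f ≡ 𝔼q p xs g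
    𝔼-cong []       h = h []
    𝔼-cong (x ∷ xs) h = cong₂ (λ a b → p * a + (1ℚ - p) * b) (𝔼-cong xs (h ∘ (x ∷_))) (𝔼-cong xs h)

    𝔼-const : ∀ (xs : List A) c → 𝔼q p xs (λ _ → c) ≡ c
    𝔼-const []       c = refl
    𝔼-const (x ∷ xs) c rewrite 𝔼-const xs c = solve 2 (λ p a → p :* a :+ (con 1ℚ :- p) :* a := a) refl p c

    𝔼-+ : ∀ (xs : List A) f g → 𝔼q p xs (λ F → f F + g F) ≡ 𝔼q p xs f + 𝔼q p xs g
    𝔼-+ []       f g = refl
    𝔼-+ (x ∷ xs) f g rewrite 𝔼-+ xs (f ∘ (x ∷_)) (g ∘ (x ∷_)) | 𝔼-+ xs f g =
      solve 5 (λ p a b c d → p :* (a :+ b) :+ (con 1ℚ :- p) :* (c :+ d) := (p :* a :+ (con 1ℚ :- p) :* c) :+ (p :* b :+ (con 1ℚ :- p) :* d)) refl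
        p (𝔼q p xs (f ∘ (x ∷_))) (𝔼q p xs (g ∘ (x ∷_))) (𝔼q p xs f) (𝔼q p xs g)

    𝔼-* : ∀ (xs : List A) c f → 𝔼q p xs (λ F → c * f F) ≡ c * 𝔼q p xs f
    𝔼-* []       c f = refl
    𝔼-* (x ∷ xs) c f rewrite 𝔼-* xs c (f ∘ (x ∷_)) | 𝔼-* xs c f =
      solve 4 (λ p c a b → p :* (c :* a) :+ (con 1ℚ :- p) :* (c :* b) := c :* (p :* a :+ (con 1ℚ :- p) :* b)) refl
        p c (𝔼q p xs (f ∘ (x ∷_))) (𝔼q p xs f)

    𝔼-∑ : ∀ {B : Set} (xs : List A) (cs : List B) (f : B → List A → ℚ) → 𝔼q p xs (λ F → ∑q (λ c → f c F) cs) ≡ ∑q (λ c → 𝔼q p xs (f c)) cs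
    𝔼-∑ xs []       f = 𝔼-const xs 0ℚ
    𝔼-∑ xs (c ∷ cs) f = trans (𝔼-+ xs (f c) _) (cong (𝔼q p xs (f c) +_) (𝔼-∑ xs cs f))

    -- Independence of the entries: each one contributes the factor `w x` with probability p and the
    -- factor 1 otherwise, and the mean of a product of independent factors is the product of their
    -- means.
    𝔼-∏ : ∀ (xs : List A) w → 𝔼q p xs (∏ w) ≡ ∏ (λ x → p * w x + (1ℚ - p)) xs
    𝔼-∏ []       w = refl
    𝔼-∏ (x ∷ xs) w rewrite 𝔼-* xs (w x) (∏ w) | 𝔼-∏ xs w =
      solve 3 (λ p w e → p :* (w :* e) :+ (con 1ℚ :- p) :* e := (p :* w :+ (con 1ℚ :- p)) :* e) refl p (w x) (∏ (λ x → p * w x + (1ℚ - p)) xs)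

    -- Squared bias plus the variance of a sum of independent terms. The centre `c` is arbitrary
    -- because the induction moves the weight of the first entry into it.
    𝔼-square : ∀ (xs : List A) w c → 𝔼q p xs (λ F → (∑q w F - c) * (∑q w F - c)) ≡
               (p * ∑q w xs - c) * (p * ∑q w xs - c) + p * (1ℚ - p) * ∑q (λ x → w x * w x) xs
    𝔼-square []       w c = trans (cong (λ z → (z - c) * (z - c)) (sym (*-zeroʳ p)))
      (sym (trans (cong (((p * 0ℚ - c) * (p * 0ℚ - c)) +_) (*-zeroʳ (p * (1ℚ - p)))) (+-identityʳ ((p * 0ℚ - c) * (p * 0ℚ - c)))))
    𝔼-square (x ∷ xs) w c = trans (cong₂ (λ a b → p * a + (1ℚ - p) * b)
        (trans (𝔼-cong xs λ F → cong (λ z → z * z) (shift-arg (w x) (∑q w F) c)) (𝔼-square xs w (c - w x)))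
        (𝔼-square xs w c))
      (square-step p (w x) (∑q w xs) c (∑q (λ x → w x * w x) xs))

  seq-𝔼 : ∀ {A : Set} (p : ℝ) (xs : List A) f m → seq (𝔼 p xs f) m ≡ 𝔼q (seq p m) xs (λ F → seq (f F) m)
  seq-𝔼 p []       f m = refl
  seq-𝔼 p (x ∷ xs) f m = cong₂ (λ a b → seq p m * a + (1ℚ - seq p m) * b) (seq-𝔼 p xs (f ∘ (x ∷_)) m) (seq-𝔼 p xs f m)

  seq-𝟙 : ∀ {P : Set} (d : Dec P) m → seq (𝟙 d) m ≡ ind d
  seq-𝟙 (yes _) m = refl
  seq-𝟙 (no _)  m = refl

  private
    2ℚ 3ℚ 5ℚ : ℚ
    2ℚ = fromℕ 2
    3ℚ = fromℕ 3
    5ℚ = fromℕ 5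

  ∣1-p∣ : ∀ {p} → ∣ p ∣ ≤ 2ℚ → ∣ 1ℚ - p ∣ ≤ 3ℚ
  ∣1-p∣ {p} h = ≤-trans (∣p+q∣≤∣p∣+∣q∣ 1ℚ (- p)) (≤-trans (+-monoʳ-≤ 1ℚ (subst (_≤ 2ℚ) (sym (∣-p∣≡∣p∣ p)) h)) (≤-reflexive refl))

  𝔼-bound : ∀ {A : Set} (xs : List A) → ∃ λ B → 0ℚ ≤ B × ∀ {p} → ∣ p ∣ ≤ 2ℚ → ∀ f → (∀ F → ∣ f F ∣ ≤ 1ℚ) → ∣ 𝔼q p xs f ∣ ≤ B
  𝔼-bound []       = 1ℚ , 0≤1 , λ _ f h → h []
  𝔼-bound (x ∷ xs) with B , 0≤B , hB ← 𝔼-bound xs = 5ℚ * B , *-nonNeg (fromℕ-nonNeg 5) 0≤B , λ {p} hp f hf → begin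
    ∣ p * 𝔼q p xs (f ∘ (x ∷_)) + (1ℚ - p) * 𝔼q p xs f ∣            ≤⟨ ∣p+q∣≤∣p∣+∣q∣ (p * 𝔼q p xs (f ∘ (x ∷_))) _ ⟩
    ∣ p * 𝔼q p xs (f ∘ (x ∷_)) ∣ + ∣ (1ℚ - p) * 𝔼q p xs f ∣        ≡⟨ cong₂ _+_ (∣p*q∣≡∣p∣*∣q∣ p _) (∣p*q∣≡∣p∣*∣q∣ (1ℚ - p) _) ⟩
    ∣ p ∣ * ∣ 𝔼q p xs (f ∘ (x ∷_)) ∣ + ∣ 1ℚ - p ∣ * ∣ 𝔼q p xs f ∣  ≤⟨ +-mono-≤ (*-mono₂ (0≤∣p∣ p) hp (0≤∣p∣ _) (hB hp _ (hf ∘ (x ∷_))))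
                                                                               (*-mono₂ (0≤∣p∣ (1ℚ - p)) (∣1-p∣ hp) (0≤∣p∣ _) (hB hp f hf)) ⟩
    2ℚ * B + 3ℚ * B                                                ≡⟨ *-distribʳ-+ B 2ℚ 3ℚ ⟨
    5ℚ * B                                                         ∎
    where open ≤-Reasoning

  -- The rational approximations of a number in [0, 1] may leave this interval, where the
  -- expectation is no longer monotone. They have to be clamped, and this bounds the error. The
  -- bound 2 on |p| covers all approximations within distance 1 of the interval.
  𝔼-lip : ∀ {A : Set} (xs : List A) → ∃ λ L → 0ℚ ≤ L × ∀ {p q} → ∣ p ∣ ≤ 2ℚ → ∣ q ∣ ≤ 2ℚ → ∀ f → (∀ F → ∣ f F ∣ ≤ 1ℚ) →
          dist (𝔼q p xs f) (𝔼q q xs f) ≤ L * dist p q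
  𝔼-lip [] = 0ℚ , ≤-refl , λ {p} {q} _ _ f _ → ≤-reflexive (trans (cong ∣_∣ (+-inverseʳ (f []))) (sym (*-zeroˡ (dist p q))))
  𝔼-lip (x ∷ xs) with L , 0≤L , hL ← 𝔼-lip xs | B , 0≤B , hB ← 𝔼-bound xs =
    5ℚ * L + 2ℚ * B , +-nonNeg (*-nonNeg (fromℕ-nonNeg 5) 0≤L) (*-nonNeg (fromℕ-nonNeg 2) 0≤B) , λ {p} {q} hp hq f hf →
    let g = f ∘ (x ∷_)
        hg = hf ∘ (x ∷_)
        D = dist p q
        D′ : dist (1ℚ - p) (1ℚ - q) ≡ D
        D′ = trans (cong ∣_∣ (solve 2 (λ p q → (con 1ℚ :- p) :- (con 1ℚ :- q) := :- (p :- q)) refl p q)) (∣-p∣≡∣p∣ (p - q))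
    in begin
      dist (p * 𝔼q p xs g + (1ℚ - p) * 𝔼q p xs f) (q * 𝔼q q xs g + (1ℚ - q) * 𝔼q q xs f)
        ≤⟨ dist-+ (p * 𝔼q p xs g) _ (q * 𝔼q q xs g) _ ⟩
      dist (p * 𝔼q p xs g) (q * 𝔼q q xs g) + dist ((1ℚ - p) * 𝔼q p xs f) ((1ℚ - q) * 𝔼q q xs f)
        ≤⟨ +-mono-≤ (dist-* p (𝔼q p xs g) q (𝔼q q xs g)) (dist-* (1ℚ - p) (𝔼q p xs f) (1ℚ - q) (𝔼q q xs f)) ⟩
      ∣ p ∣ * dist (𝔼q p xs g) (𝔼q q xs g) + ∣ 𝔼q q xs g ∣ * D + (∣ 1ℚ - p ∣ * dist (𝔼q p xs f) (𝔼q q xs f) + ∣ 𝔼q q xs f ∣ * dist (1ℚ - p) (1ℚ - q))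
        ≤⟨ +-mono-≤ (+-mono-≤ (*-mono₂ (0≤∣p∣ p) hp (0≤∣p∣ _) (hL hp hq g hg)) (*-mono₂ (0≤∣p∣ _) (hB hq g hg) (0≤∣p∣ _) ≤-refl))
                    (+-mono-≤ (*-mono₂ (0≤∣p∣ _) (∣1-p∣ hp) (0≤∣p∣ _) (hL hp hq f hf)) (*-mono₂ (0≤∣p∣ _) (hB hq f hf) (0≤∣p∣ _) (≤-reflexive D′))) ⟩
      2ℚ * (L * D) + B * D + (3ℚ * (L * D) + B * D)
        ≡⟨ solve 3 (λ L B D → con 2ℚ :* (L :* D) :+ B :* D :+ (con 3ℚ :* (L :* D) :+ B :* D) := (con 5ℚ :* L :+ con 2ℚ :* B) :* D) refl L B D ⟩
      (5ℚ * L + 2ℚ * B) * D ∎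
    where open ≤-Reasoning

  clamp : ℚ → ℚ
  clamp q = 0ℚ ⊔ (q ⊓ 1ℚ)

  0≤clamp : ∀ q → 0ℚ ≤ clamp q
  0≤clamp q = p≤p⊔q 0ℚ (q ⊓ 1ℚ)

  clamp≤1 : ∀ q → clamp q ≤ 1ℚ
  clamp≤1 q = ⊔-lub 0≤1 (p⊓q≤q q 1ℚ)

  clamp-near : ∀ {q e} → 0ℚ ≤ q + e → q ≤ 1ℚ + e → 0ℚ ≤ e → dist q (clamp q) ≤ e
  clamp-near {q} {e} h₀ h₁ 0≤e with ≤-total q 1ℚ
  ... | inj₂ 1≤q = subst (λ z → dist q z ≤ e) (sym eq) (dist-between 1≤q h₁)
    where
    eq : clamp q ≡ 1ℚ
    eq = trans (cong (0ℚ ⊔_) (p≥q⇒p⊓q≡q 1≤q)) (p≤q⇒p⊔q≡q 0≤1)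
  ... | inj₁ q≤1 with ≤-total 0ℚ q
  ...   | inj₁ 0≤q = subst (_≤ e) (sym (trans (cong (dist q) eq) (cong ∣_∣ (+-inverseʳ q)))) 0≤e
    where
    eq : clamp q ≡ q
    eq = trans (cong (0ℚ ⊔_) (p≤q⇒p⊓q≡p q≤1)) (p≤q⇒p⊔q≡q 0≤q)
  ...   | inj₂ q≤0 = subst (λ z → dist q z ≤ e) (sym eq) (subst (_≤ e) (dist-sym 0ℚ q) (dist-between q≤0 h₀))
    where
    eq : clamp q ≡ 0ℚ
    eq = trans (cong (0ℚ ⊔_) (p≤q⇒p⊓q≡p q≤1)) (p≥q⇒p⊔q≡p q≤0)

  probability : ∀ {n} {P : Graph n → Set} → Graph n → ℚ → (∀ H → Dec (P H)) → ℚ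
  probability {n} G q P? = 𝔼q q (pairs n) λ F → ind (P? (G ∪ edgeGraph F))

  probability≤1 : ∀ {n} {P : Graph n → Set} (G : Graph n) {q} (P? : ∀ H → Dec (P H)) → 0ℚ ≤ q → q ≤ 1ℚ → probability G q P? ≤ 1ℚ
  probability≤1 {n} G {q} P? 0≤q q≤1 = ≤-trans (𝔼-mono 0≤q q≤1 (pairs n) λ F → ind≤1 (P? (G ∪ edgeGraph F))) (≤-reflexive (𝔼-const q (pairs n) 1ℚ))

  ⊓-pos : ∀ {a b} → 0ℚ < a → 0ℚ < b → 0ℚ < a ⊓ b
  ⊓-pos {a} {b} 0<a 0<b with ≤-total a b
  ... | inj₁ a≤b = subst (0ℚ <_) (sym (p≤q⇒p⊓q≡p a≤b)) 0<a
  ... | inj₂ b≤a = subst (0ℚ <_) (sym (p≥q⇒p⊓q≡q b≤a)) 0<b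

  private
    near : ∀ {a b e} → dist a b ≤ e → a ≤ b + e
    near {a} {b} {e} h = ≤-trans (≤-reflexive (solve 2 (λ a b → a := b :+ (a :- b)) refl a b)) (+-monoʳ-≤ b (≤-trans (p≤∣p∣ (a - b)) h))
      where
      p≤∣p∣ : ∀ p → p ≤ ∣ p ∣
      p≤∣p∣ p with ≤-total 0ℚ p
      ... | inj₁ 0≤p = ≤-reflexive (sym (0≤p⇒∣p∣≡p 0≤p))
      ... | inj₂ p≤0 = ≤-trans p≤0 (0≤∣p∣ p)

  module _ {P : ∀ {n} → Graph n → Set} (P? : ∀ {n} (H : Graph n) → Dec (P H)) where

    -- The real probability is approximated by the rational ones at the clamped approximations of p.
    approximate : ∀ {n} (G : Graph n) (p : ℝ) → IsProbability p → ∀ ε → 0ℚ < ε →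
      ∃ λ N → ∀ m → N ℕ.≤ m → dist (seq (𝔼 p (pairs n) λ F → 𝟙 (P? (G ∪ edgeGraph F))) m) (probability G (clamp (seq p m)) P?) ≤ ε
    approximate {n} G p (0≤p , p≤1) ε 0<ε =
      let L , 0≤L , lip = 𝔼-lip (pairs n)
          η , 0<η , eq = scale (1ℚ + L) (<-≤-trans (positive⁻¹ 1ℚ) (≤-+ʳ 0≤L)) 0<ε
          e = η ⊓ 1ℚ
          0<e = ⊓-pos 0<η (positive⁻¹ 1ℚ)
          N₀ , h₀ = 0≤p e 0<e
          N₁ , h₁ = p≤1 e 0<e
      in N₀ ℕ.⊔ N₁ , λ m N≤m →
      let q = seq p m
          d = clamp-near {q} {e} (h₀ m (ℕP.m⊔n≤o⇒m≤o N₀ N₁ N≤m)) (h₁ m (ℕP.m⊔n≤o⇒n≤o N₀ N₁ N≤m)) (<⇒≤ 0<e)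
      in begin
        dist (seq (𝔼 p (pairs n) λ F → 𝟙 (P? (G ∪ edgeGraph F))) m) (probability G (clamp q) P?)
          ≡⟨ cong (λ z → dist z (probability G (clamp q) P?)) (trans (seq-𝔼 p (pairs n) _ m) (𝔼-cong q (pairs n) λ F → seq-𝟙 (P? (G ∪ edgeGraph F)) m)) ⟩
        dist (probability G q P?) (probability G (clamp q) P?)
          ≤⟨ lip (∣q∣≤2 q d (p⊓q≤q η 1ℚ)) (∣c∣≤2 q) _ (λ F → ∣ind∣ (P? (G ∪ edgeGraph F))) ⟩
        L * dist q (clamp q)
          ≤⟨ *-mono₂ 0≤L (≤-trans (≤-+ʳ 0≤1) (≤-reflexive (+-comm L 1ℚ))) (0≤∣p∣ (q - clamp q)) (≤-trans d (p⊓q≤p η 1ℚ)) ⟩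
        (1ℚ + L) * η
          ≡⟨ eq ⟩
        ε ∎
      where
      open ≤-Reasoning
      ∣ind∣ : ∀ {Q : Set} (d : Dec Q) → ∣ ind d ∣ ≤ 1ℚ
      ∣ind∣ (yes _) = ≤-refl
      ∣ind∣ (no _)  = 0≤1
      ∣c∣≤1 : ∀ q → ∣ clamp q ∣ ≤ 1ℚ
      ∣c∣≤1 q = ≤-trans (≤-reflexive (0≤p⇒∣p∣≡p (0≤clamp q))) (clamp≤1 q)
      1≤2 : 1ℚ ≤ 2ℚ
      1≤2 = ≤-+ʳ {1ℚ} 0≤1
      ∣c∣≤2 : ∀ q → ∣ clamp q ∣ ≤ 2ℚ
      ∣c∣≤2 q = ≤-trans (∣c∣≤1 q) 1≤2
      ∣q∣≤2 : ∀ q {e} → dist q (clamp q) ≤ e → e ≤ 1ℚ → ∣ q ∣ ≤ 2ℚ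
      ∣q∣≤2 q {e} d e≤1 = begin
        ∣ q ∣                             ≡⟨ cong ∣_∣ (solve 2 (λ q c → q := c :+ (q :- c)) refl q (clamp q)) ⟩
        ∣ clamp q + (q - clamp q) ∣       ≤⟨ ∣p+q∣≤∣p∣+∣q∣ (clamp q) (q - clamp q) ⟩
        ∣ clamp q ∣ + dist q (clamp q)    ≤⟨ +-mono-≤ (∣c∣≤1 q) (≤-trans d e≤1) ⟩
        1ℚ + 1ℚ                           ≡⟨⟩
        2ℚ                                ∎

    -- `Rel n q` expresses what the bound on the real number p n implies for its clamped
    -- approximations. The lower estimate is uniform over all rational q with `Rel n q`, because p n
    -- is visible only through such q. The upper estimate holds for every probability.
    aas : (G : ∀ n → Graph n) (p : ℕ → ℝ) → (∀ n → IsProbability (p n)) → (Rel : ℕ → ℚ → Set) →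
          Eventually (λ n → ∃ λ M → ∀ m → M ℕ.≤ m → Rel n (clamp (seq (p n) m))) →
          (∀ η → 0ℚ < η → Eventually λ n → ∀ q → 0ℚ ≤ q → q ≤ 1ℚ → Rel n q → 1ℚ - η ≤ probability (G n) q P?) →
          AAS[ G ∪𝔾 p ⊨ P? ]
    aas G p isP Rel (N₁ , rel) lower ε (η , 0<η , M₀ , hε) with N₂ , low ← lower η 0<η =
      N₁ ℕ.⊔ N₂ , λ n N≤n → lowerBound n N≤n , upperBound n
      where
      Pr : ∀ n → ℕ → ℚ
      Pr n m = seq (𝔼 (p n) (pairs n) λ F → 𝟙 (P? (G n ∪ edgeGraph F))) m
      open ≤-Reasoning
      lowerBound : ∀ n → N₁ ℕ.⊔ N₂ ℕ.≤ n → ∀ e → 0ℚ < e → ∃ λ N → ∀ m → N ℕ.≤ m → 1ℚ - seq ε m ≤ Pr n m + e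
      lowerBound n N≤n e 0<e =
        let M₁ , h₁ = rel n (ℕP.m⊔n≤o⇒m≤o N₁ N₂ N≤n)
            M₂ , h₂ = approximate (G n) (p n) (isP n) e 0<e
        in M₀ ℕ.⊔ (M₁ ℕ.⊔ M₂) , λ m M≤m →
        let M≤m′ = ℕP.m⊔n≤o⇒n≤o M₀ (M₁ ℕ.⊔ M₂) M≤m
            q = clamp (seq (p n) m)
        in begin
          1ℚ - seq ε m              ≤⟨ +-monoʳ-≤ 1ℚ (neg-antimono-≤ (subst (_≤ seq ε m) (+-identityˡ η) (hε m (ℕP.m⊔n≤o⇒m≤o M₀ _ M≤m)))) ⟩
          1ℚ - η                    ≤⟨ low n (ℕP.m⊔n≤o⇒n≤o N₁ N₂ N≤n) q (0≤clamp (seq (p n) m)) (clamp≤1 (seq (p n) m)) (h₁ m (ℕP.m⊔n≤o⇒m≤o M₁ M₂ M≤m′)) ⟩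
          probability (G n) q P?    ≤⟨ near (subst (_≤ e) (dist-sym (Pr n m) (probability (G n) q P?)) (h₂ m (ℕP.m⊔n≤o⇒n≤o M₁ M₂ M≤m′))) ⟩
          Pr n m + e                ∎
      upperBound : ∀ n e → 0ℚ < e → ∃ λ N → ∀ m → N ℕ.≤ m → Pr n m ≤ 1ℚ + seq ε m + e
      upperBound n e 0<e =
        let M , h = approximate (G n) (p n) (isP n) e 0<e
        in M₀ ℕ.⊔ M , λ m M≤m → begin
          Pr n m                                                 ≤⟨ near (h m (ℕP.m⊔n≤o⇒n≤o M₀ M M≤m)) ⟩
          probability (G n) (clamp (seq (p n) m)) P? + e         ≤⟨ +-monoˡ-≤ e (probability≤1 (G n) P? (0≤clamp (seq (p n) m)) (clamp≤1 (seq (p n) m))) ⟩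
          1ℚ + e                                                 ≤⟨ +-monoˡ-≤ e (≤-+ʳ {1ℚ} (≤-trans (<⇒≤ 0<η) (subst (_≤ seq ε m) (+-identityˡ η) (hε m (ℕP.m⊔n≤o⇒m≤o M₀ M M≤m))))) ⟩
          1ℚ + seq ε m + e                                       ∎

-- Powers, sums and Chebyshev's inequality over the rationals

module RationalBounds where

  open Counting using (∑; bit; sumL; sumL-filter; sumL-cartesian; sumL-allFin; ∑-cong; ∑-+; ∑-swap)
  open Expectation
  open import Defs using (fromℕ; fromℕ-suc; fromℕ-nonNeg; fromℕ-mono; *-mono; *-mono₂; *-nonNeg; +-nonNeg; ≤-+ʳ; 0≤1; pairs)
  open import Data.Nat.Base as ℕ using (ℕ; zero; suc)
  import Data.Nat.Properties as ℕP
  open import Data.Nat.Solver using () renaming (module +-*-Solver to ℕS)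
  open import Data.Rational.Base
  open import Data.Rational.Properties
  open import Data.Rational.Solver using (module +-*-Solver)
  open +-*-Solver using (solve; con; _:+_; _:*_; _:-_; :-_; _:=_)
  open import Data.Fin.Base using (Fin)
  import Data.Fin.Properties as Fin
  open import Data.List.Base using (List; []; _∷_; length; allFin; cartesianProduct)
  open import Data.List.Membership.Propositional using (_∈_)
  open import Data.List.Relation.Unary.Any using (here; there)
  open import Data.Product.Base using (_,_)
  open import Data.Sum.Base using (inj₁; inj₂)
  open import Function.Base using (_∘_)
  open import Relation.Binary.PropositionalEquality
  open import Relation.Nullary using (Dec; yes; no; contradiction)
  open import Relation.Nullary.Decidable using (¬?)

  fromℕ-+ : ∀ m n → fromℕ (m ℕ.+ n) ≡ fromℕ m + fromℕ n
  fromℕ-+ zero    n = sym (+-identityˡ (fromℕ n))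
  fromℕ-+ (suc m) n = trans (fromℕ-suc (m ℕ.+ n)) (trans (cong (1ℚ +_) (fromℕ-+ m n))
    (trans (sym (+-assoc 1ℚ (fromℕ m) (fromℕ n))) (cong (_+ fromℕ n) (sym (fromℕ-suc m)))))

  fromℕ-* : ∀ m n → fromℕ (m ℕ.* n) ≡ fromℕ m * fromℕ n
  fromℕ-* zero    n = sym (*-zeroˡ (fromℕ n))
  fromℕ-* (suc m) n = trans (fromℕ-+ n (m ℕ.* n)) (trans (cong (fromℕ n +_) (fromℕ-* m n))
    (trans (solve 2 (λ m n → n :+ m :* n := (con 1ℚ :+ m) :* n) refl (fromℕ m) (fromℕ n)) (cong (_* fromℕ n) (sym (fromℕ-suc m)))))

  fromℕ-cancel : ∀ {m n} → fromℕ m ≤ fromℕ n → m ℕ.≤ n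
  fromℕ-cancel {m} {n} h with m ℕP.≤? n
  ... | yes le = le
  ... | no gt  = contradiction (≤-trans (subst (_≤ fromℕ m) (fromℕ-suc n) (fromℕ-mono (ℕP.≰⇒> gt))) h) λ le → <-irrefl refl (<-≤-trans n<1+n le)
    where
    n<1+n : fromℕ n < 1ℚ + fromℕ n
    n<1+n = subst (_< 1ℚ + fromℕ n) (+-identityˡ (fromℕ n)) (+-monoˡ-< (fromℕ n) (positive⁻¹ 1ℚ))

  -- Inequalities between reals hold for their approximations only up to an error; between integers
  -- an error of one half is harmless.
  fromℕ-cancel-½ : ∀ {m n} → fromℕ m ≤ fromℕ n + ½ → m ℕ.≤ n
  fromℕ-cancel-½ {m} {n} h = ℕP.≤-pred (ℕP.*-cancelˡ-< 2 m (suc n) (ℕP.≤-<-trans (fromℕ-cancel (begin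
    fromℕ (2 ℕ.* m)              ≡⟨ fromℕ-* 2 m ⟩
    fromℕ 2 * fromℕ m            ≤⟨ *-mono (fromℕ-nonNeg 2) h ⟩
    fromℕ 2 * (fromℕ n + ½)      ≡⟨ *-distribˡ-+ (fromℕ 2) (fromℕ n) ½ ⟩
    fromℕ 2 * fromℕ n + 1ℚ       ≡⟨ cong (_+ 1ℚ) (fromℕ-* 2 n) ⟨
    fromℕ (2 ℕ.* n) + fromℕ 1    ≡⟨ fromℕ-+ (2 ℕ.* n) 1 ⟨
    fromℕ (2 ℕ.* n ℕ.+ 1)        ∎)) (ℕP.≤-reflexive (ℕS.solve 1 (λ n → ℕS.con 1 ℕS.:+ (ℕS.con 2 ℕS.:* n ℕS.:+ ℕS.con 1) ℕS.:= ℕS.con 2 ℕS.:* (ℕS.con 1 ℕS.:+ n)) refl n))))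
    where open ≤-Reasoning

  *-cancelˡ-≤ : ∀ {c a b} → 0ℚ < c → c * a ≤ c * b → a ≤ b
  *-cancelˡ-≤ {c} 0<c = *-cancelˡ-≤-pos c {{positive 0<c}}

  *-monoʳ : ∀ {a b c} → 0ℚ ≤ c → a ≤ b → a * c ≤ b * c
  *-monoʳ {c = c} 0≤c = *-monoʳ-≤-nonNeg c {{nonNegative 0≤c}}

  pow-nonNeg : ∀ {x} n → 0ℚ ≤ x → 0ℚ ≤ pow x n
  pow-nonNeg zero    h = 0≤1
  pow-nonNeg (suc n) h = *-nonNeg h (pow-nonNeg n h)

  pow-mono : ∀ {x y} n → 0ℚ ≤ x → x ≤ y → pow x n ≤ pow y n
  pow-mono zero    0≤x h = ≤-refl
  pow-mono (suc n) 0≤x h = *-mono₂ 0≤x h (pow-nonNeg n 0≤x) (pow-mono n 0≤x h)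

  pow-+ : ∀ x m n → pow x (m ℕ.+ n) ≡ pow x m * pow x n
  pow-+ x zero    n = sym (*-identityˡ (pow x n))
  pow-+ x (suc m) n = trans (cong (x *_) (pow-+ x m n)) (sym (*-assoc x (pow x m) (pow x n)))

  pow-* : ∀ x m n → pow x (m ℕ.* n) ≡ pow (pow x n) m
  pow-* x zero    n = refl
  pow-* x (suc m) n = trans (pow-+ x n (m ℕ.* n)) (cong (pow x n *_) (pow-* x m n))

  pow-distrib : ∀ x y n → pow (x * y) n ≡ pow x n * pow y n
  pow-distrib x y zero    = refl
  pow-distrib x y (suc n) = trans (cong (x * y *_) (pow-distrib x y n))
    (solve 4 (λ x y a b → x :* y :* (a :* b) := x :* a :* (y :* b)) refl x y (pow x n) (pow y n))

  pow-one : ∀ n → pow 1ℚ n ≡ 1ℚ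
  pow-one zero    = refl
  pow-one (suc n) = trans (*-identityˡ (pow 1ℚ n)) (pow-one n)

  pow≤1 : ∀ {x} n → 0ℚ ≤ x → x ≤ 1ℚ → pow x n ≤ 1ℚ
  pow≤1 {x} n 0≤x h = ≤-trans (pow-mono n 0≤x h) (≤-reflexive (pow-one n))

  pow-antitone : ∀ {x m n} → 0ℚ ≤ x → x ≤ 1ℚ → m ℕ.≤ n → pow x n ≤ pow x m
  pow-antitone {x} {n = n} 0≤x x≤1 ℕ.z≤n = pow≤1 n 0≤x x≤1
  pow-antitone 0≤x x≤1 (ℕ.s≤s h) = *-mono 0≤x (pow-antitone 0≤x x≤1 h)

  fromℕ-pow : ∀ b n → fromℕ (b ℕ.^ n) ≡ pow (fromℕ b) n
  fromℕ-pow b zero    = refl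
  fromℕ-pow b (suc n) = trans (fromℕ-* b (b ℕ.^ n)) (cong (fromℕ b *_) (fromℕ-pow b n))

  bernoulli : ∀ {q} n → 0ℚ ≤ q → 1ℚ + fromℕ n * q ≤ pow (1ℚ + q) n
  bernoulli {q} zero 0≤q = ≤-reflexive (trans (cong (1ℚ +_) (*-zeroˡ q)) (+-identityʳ 1ℚ))
  bernoulli {q} (suc n) 0≤q = begin
    1ℚ + fromℕ (suc n) * q               ≡⟨ cong (λ z → 1ℚ + z * q) (fromℕ-suc n) ⟩
    1ℚ + (1ℚ + N) * q                    ≤⟨ ≤-+ʳ (*-nonNeg (*-nonNeg 0≤q (fromℕ-nonNeg n)) 0≤q) ⟩
    1ℚ + (1ℚ + N) * q + q * N * q        ≡⟨ solve 2 (λ N q → con 1ℚ :+ (con 1ℚ :+ N) :* q :+ q :* N :* q := (con 1ℚ :+ q) :* (con 1ℚ :+ N :* q)) refl N q ⟩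
    (1ℚ + q) * (1ℚ + N * q)              ≤⟨ *-mono (+-nonNeg 0≤1 0≤q) (bernoulli n 0≤q) ⟩
    pow (1ℚ + q) (suc n)                 ∎
    where
    open ≤-Reasoning
    N = fromℕ n

  bernoulli⁻ : ∀ {q} n → 0ℚ ≤ q → q ≤ 1ℚ → 1ℚ - fromℕ n * q ≤ pow (1ℚ - q) n
  bernoulli⁻ {q} zero 0≤q q≤1 = ≤-reflexive (trans (cong (λ z → 1ℚ - z) (*-zeroˡ q)) (+-identityʳ 1ℚ))
  bernoulli⁻ {q} (suc n) 0≤q q≤1 = begin
    1ℚ - fromℕ (suc n) * q               ≡⟨ cong (λ z → 1ℚ - z * q) (fromℕ-suc n) ⟩
    1ℚ - (1ℚ + N) * q                    ≤⟨ ≤-+ʳ (*-nonNeg (*-nonNeg 0≤q (fromℕ-nonNeg n)) 0≤q) ⟩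
    1ℚ - (1ℚ + N) * q + q * N * q        ≡⟨ solve 2 (λ N q → con 1ℚ :- (con 1ℚ :+ N) :* q :+ q :* N :* q := (con 1ℚ :- q) :* (con 1ℚ :- N :* q)) refl N q ⟩
    (1ℚ - q) * (1ℚ - N * q)              ≤⟨ *-mono (≤⇒0≤- q≤1) (bernoulli⁻ n 0≤q q≤1) ⟩
    pow (1ℚ - q) (suc n)                 ∎
    where
    open ≤-Reasoning
    N = fromℕ n

  module _ {A : Set} where

    ∑q-mono : ∀ {f g : A → ℚ} xs → (∀ {x} → x ∈ xs → f x ≤ g x) → ∑q f xs ≤ ∑q g xs
    ∑q-mono []       h = ≤-refl
    ∑q-mono (x ∷ xs) h = +-mono-≤ (h (here refl)) (∑q-mono xs (h ∘ there))

    ∑q-const : ∀ c (xs : List A) → ∑q (λ _ → c) xs ≡ fromℕ (length xs) * c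
    ∑q-const c []       = sym (*-zeroˡ c)
    ∑q-const c (x ∷ xs) = trans (cong (c +_) (∑q-const c xs)) (trans
      (solve 2 (λ c n → c :+ n :* c := (con 1ℚ :+ n) :* c) refl c (fromℕ (length xs))) (cong (_* c) (sym (fromℕ-suc (length xs)))))

    ∑q-fromℕ : ∀ (w : A → ℕ) xs → ∑q (fromℕ ∘ w) xs ≡ fromℕ (sumL w xs)
    ∑q-fromℕ w []       = refl
    ∑q-fromℕ w (x ∷ xs) = trans (cong (fromℕ (w x) +_) (∑q-fromℕ w xs)) (sym (fromℕ-+ (w x) (sumL w xs)))

    ∑q-nonNeg : ∀ {f : A → ℚ} xs → (∀ x → 0ℚ ≤ f x) → 0ℚ ≤ ∑q f xs
    ∑q-nonNeg []       h = ≤-refl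
    ∑q-nonNeg (x ∷ xs) h = +-nonNeg (h x) (∑q-nonNeg xs h)

    ∑q-* : ∀ c (f : A → ℚ) xs → ∑q (λ x → c * f x) xs ≡ c * ∑q f xs
    ∑q-* c f []       = sym (*-zeroʳ c)
    ∑q-* c f (x ∷ xs) = trans (cong (c * f x +_) (∑q-* c f xs)) (sym (*-distribˡ-+ c (f x) (∑q f xs)))

    ∑q-cong : ∀ {f g : A → ℚ} xs → (∀ {x} → x ∈ xs → f x ≡ g x) → ∑q f xs ≡ ∑q g xs
    ∑q-cong []       h = refl
    ∑q-cong (x ∷ xs) h = cong₂ _+_ (h (here refl)) (∑q-cong xs (h ∘ there))

    ∑q-term : ∀ {f : A → ℚ} {xs x} → (∀ x → 0ℚ ≤ f x) → x ∈ xs → f x ≤ ∑q f xs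
    ∑q-term {f} {y ∷ xs} h (here refl) = ≤-+ʳ (∑q-nonNeg xs h)
    ∑q-term {f} {y ∷ xs} h (there x∈)  = ≤-trans (∑q-term h x∈) (≤-trans (≤-+ʳ (h y)) (≤-reflexive (+-comm (∑q f xs) (f y))))

    -- Combined with `𝔼-∏`, this evaluates the probability that the random sublist contains no entry
    -- from `Z`: the entries of `Z` give 1 - p and all others give 1.
    ∏-01 : ∀ {Z : A → Set} (z? : ∀ x → Dec (Z x)) p xs →
           ∏ (λ x → p * ind (¬? (z? x)) + (1ℚ - p)) xs ≡ pow (1ℚ - p) (sumL (λ x → bit (z? x)) xs)
    ∏-01 z? p [] = refl
    ∏-01 z? p (x ∷ xs) with z? x
    ... | yes _ = cong₂ _*_ (trans (cong (_+ (1ℚ - p)) (*-zeroʳ p)) (+-identityˡ (1ℚ - p))) (∏-01 z? p xs)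
    ... | no _  = trans (cong₂ _*_ (trans (cong (_+ (1ℚ - p)) (*-identityʳ p)) (solve 1 (λ p → p :+ (con 1ℚ :- p) := con 1ℚ) refl p)) (∏-01 z? p xs)) (*-identityˡ _)

  ind-¬ : ∀ {P : Set} (d : Dec P) → ind (¬? d) ≡ 1ℚ - ind d
  ind-¬ (yes _) = refl
  ind-¬ (no _)  = refl

  square-nonNeg : ∀ x → 0ℚ ≤ x * x
  square-nonNeg x with ≤-total 0ℚ x
  ... | inj₁ h = *-nonNeg h h
  ... | inj₂ h = ≤-trans (*-nonNeg h′ h′) (≤-reflexive (solve 1 (λ x → (:- x) :* (:- x) := x :* x) refl x))
    where h′ = neg-antimono-≤ h

  module _ {A : Set} {p : ℚ} (0≤p : 0ℚ ≤ p) (p≤1 : p ≤ 1ℚ) where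

    -- On the event `D` the sum exceeds its mean by at least d, so d² times the indicator is at most
    -- the squared deviation, and the factor 1 - p of the variance is estimated by 1.
    chebyshev : ∀ (xs : List A) (w : A → ℚ) {D : List A → Set} (d? : ∀ F → Dec (D F)) {t d} → 0ℚ ≤ d →
                p * ∑q w xs + d ≤ t → (∀ F → D F → t ≤ ∑q w F) →
                d * d * 𝔼q p xs (λ F → ind (d? F)) ≤ p * ∑q (λ x → w x * w x) xs
    chebyshev xs w d? {t} {d} 0≤d h hD = begin
      d * d * 𝔼q p xs (λ F → ind (d? F))           ≡⟨ 𝔼-* p xs (d * d) _ ⟨
      𝔼q p xs (λ F → d * d * ind (d? F))           ≤⟨ 𝔼-mono 0≤p p≤1 xs pointwise ⟩
      𝔼q p xs (λ F → (∑q w F - c) * (∑q w F - c))  ≡⟨ 𝔼-square p xs w c ⟩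
      (c - c) * (c - c) + p * (1ℚ - p) * V         ≡⟨ solve 3 (λ c p V → (c :- c) :* (c :- c) :+ p :* (con 1ℚ :- p) :* V := (con 1ℚ :- p) :* (p :* V)) refl c p V ⟩
      (1ℚ - p) * (p * V)                           ≤⟨ *-monoʳ (*-nonNeg 0≤p (∑q-nonNeg xs λ x → square-nonNeg (w x))) 1-p≤1 ⟩
      1ℚ * (p * V)                                 ≡⟨ *-identityˡ (p * V) ⟩
      p * V                                        ∎
      where
      open ≤-Reasoning
      c = p * ∑q w xs
      V = ∑q (λ x → w x * w x) xs
      1-p≤1 : 1ℚ - p ≤ 1ℚ
      1-p≤1 = ≤-trans (+-monoʳ-≤ 1ℚ (neg-antimono-≤ 0≤p)) (≤-reflexive (+-identityʳ 1ℚ))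
      pointwise : ∀ F → d * d * ind (d? F) ≤ (∑q w F - c) * (∑q w F - c)
      pointwise F with d? F
      ... | no _   = ≤-trans (≤-reflexive (*-zeroʳ (d * d))) (square-nonNeg (∑q w F - c))
      ... | yes dF = ≤-trans (≤-reflexive (*-identityʳ (d * d))) (*-mono₂ 0≤d d≤ 0≤d d≤)
        where
        d≤ : d ≤ ∑q w F - c
        d≤ = subst (_≤ ∑q w F - c) (solve 2 (λ c d → c :+ d :- c := d) refl c d) (+-monoˡ-≤ (- c) (≤-trans h (hD F dF)))

  -- Each unordered pair is listed once, in increasing order. Exchanging the variables in the second
  -- half of the sum gives a sum over all ordered pairs, with a weight that is 0 on the diagonal and
  -- 1 elsewhere.
  pairSum : ∀ {n} (h : Fin n → Fin n → ℕ) →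
            sumL (λ (u , v) → h u v ℕ.+ h v u) (pairs n) ≡ ∑ (λ u → ∑ (λ v → (bit (u Fin.<? v) ℕ.+ bit (v Fin.<? u)) ℕ.* h u v))
  pairSum {n} h = begin
    sumL (λ (u , v) → h u v ℕ.+ h v u) (pairs n)
      ≡⟨ sumL-filter (λ (i , j) → i Fin.<? j) _ (cartesianProduct (allFin n) (allFin n)) ⟩
    sumL (λ (u , v) → L u v ℕ.* (h u v ℕ.+ h v u)) (cartesianProduct (allFin n) (allFin n))
      ≡⟨ sumL-cartesian _ (allFin n) (allFin n) ⟩
    sumL (λ u → sumL (λ v → L u v ℕ.* (h u v ℕ.+ h v u)) (allFin n)) (allFin n)
      ≡⟨ trans (sumL-allFin _) (∑-cong λ u → sumL-allFin _) ⟩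
    ∑ (λ u → ∑ (λ v → L u v ℕ.* (h u v ℕ.+ h v u)))
      ≡⟨ ∑-cong (λ u → trans (∑-cong λ v → ℕP.*-distribˡ-+ (L u v) (h u v) (h v u)) (∑-+ (λ v → L u v ℕ.* h u v) (λ v → L u v ℕ.* h v u))) ⟩
    ∑ (λ u → ∑ (λ v → L u v ℕ.* h u v) ℕ.+ ∑ (λ v → L u v ℕ.* h v u))
      ≡⟨ ∑-+ (λ u → ∑ (λ v → L u v ℕ.* h u v)) (λ u → ∑ (λ v → L u v ℕ.* h v u)) ⟩
    ∑ (λ u → ∑ (λ v → L u v ℕ.* h u v)) ℕ.+ ∑ (λ u → ∑ (λ v → L u v ℕ.* h v u))
      ≡⟨ cong (∑ (λ u → ∑ (λ v → L u v ℕ.* h u v)) ℕ.+_) (∑-swap (λ u v → L u v ℕ.* h v u)) ⟩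
    ∑ (λ u → ∑ (λ v → L u v ℕ.* h u v)) ℕ.+ ∑ (λ u → ∑ (λ v → L v u ℕ.* h u v))
      ≡⟨ ∑-+ (λ u → ∑ (λ v → L u v ℕ.* h u v)) (λ u → ∑ (λ v → L v u ℕ.* h u v)) ⟨
    ∑ (λ u → ∑ (λ v → L u v ℕ.* h u v) ℕ.+ ∑ (λ v → L v u ℕ.* h u v))
      ≡⟨ ∑-cong (λ u → trans (sym (∑-+ (λ v → L u v ℕ.* h u v) (λ v → L v u ℕ.* h u v))) (∑-cong λ v → sym (ℕP.*-distribʳ-+ (h u v) (L u v) (L v u)))) ⟩
    ∑ (λ u → ∑ (λ v → (L u v ℕ.+ L v u) ℕ.* h u v)) ∎
    where
    open ≡-Reasoning
    L : Fin n → Fin n → ℕ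
    L u v = bit (u Fin.<? v)

-- A large independent set with few neighbours: part (c)

module PartC where

  open Counting
  open Graphs
  open Expectation
  open RationalBounds hiding (*-cancelˡ-≤)
  open RationalBounds using () renaming (*-cancelˡ-≤ to *-cancelˡ-≤q)
  import Defs as D
  open import Defs using (ℝ; seq; ι; nat; _/ℕ_; recip; Eventually; IsProbability; AAS[_∪𝔾_⊨_]; _⟶∞; archimedean′; fromℕ-pos; scale; recip-cancel; recip-nonNeg; Graph; Adj; adj?; symm; irrefl; _∪_; edgeGraph; Hamiltonian; hamiltonian?; nonHamiltonian?; δ; α; Independent; pairs; fromℕ; fromℕ-mono; fromℕ-nonNeg; *-mono; *-mono₂; *-nonNeg; +-nonNeg; 0≤1; ≤-+ʳ)
  open import Data.Nat.Base
  open import Data.Nat.Properties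
  open import Data.Nat.Solver using (module +-*-Solver)
  open +-*-Solver using (solve; con; _:+_; _:*_; _:=_)
  open import Data.Rational.Base as ℚ using (ℚ; 0ℚ; 1ℚ)
  import Data.Rational.Properties as ℚP
  open import Data.Rational.Solver using () renaming (module +-*-Solver to ℚS)
  open import Data.Unit.Base using (⊤; tt)
  open import Data.Fin.Base as Fin using (Fin; zero; suc; toℕ; fromℕ<)
  import Data.Fin.Properties as Fin
  import Data.Fin.Subset as Subset
  import Data.Fin.Subset.Properties as Subset?
  open import Data.Fin.Subset using (Subset; ∣_∣)
  open import Data.List.Base using (List; length; allFin)
  open import Data.List.Membership.Propositional using (_∈_)
  open import Data.List.Relation.Unary.Unique.Propositional using (Unique)
  open import Data.Product.Base using (∃; _×_; _,_; proj₁; proj₂)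
  open import Data.Sum.Base using (_⊎_; inj₁; inj₂)
  open import Function.Base using (_∘_)
  open import Relation.Binary.PropositionalEquality
  open import Relation.Nullary using (¬_; Dec; yes; no; contradiction)
  open import Relation.Nullary.Decidable using (_×-dec_; _⊎-dec_; ¬?)

  opaque
    unfolding ∑

    #-below : ∀ {n} a → a ≤ n → # {n} (λ v → toℕ v <? a) ≡ a
    #-below {n}     zero    _       = trans (∑-cong {n} λ v → bit-no (toℕ v <? 0) λ ()) (trans (∑-const n 0) (*-zeroʳ n))
    #-below {suc n} (suc a) (s≤s h) = cong suc (trans (∑-cong {n} eq) (#-below {n} a h))
      where
      eq : ∀ (v : Fin n) → bit (suc (toℕ v) <? suc a) ≡ bit (toℕ v <? a)
      eq v = ≤-antisym (bit-mono (suc (toℕ v) <? suc a) (toℕ v <? a) ≤-pred) (bit-mono (toℕ v <? a) (suc (toℕ v) <? suc a) s≤s)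

  module _ {X : Set} {R : X → X → Set} {A S Bad : X → Set} (A? : ∀ x → Dec (A x)) (S? : ∀ x → Dec (S x)) (Bad? : ∀ x → Dec (Bad x))
           (next : ∀ {x y} → R x y → A x → S y ⊎ Bad x) where

    private
      step-count : ∀ {x y} → R x y → bit (A? x) ≤ bit (S? y) + bit (Bad? x)
      step-count {x} {y} r = bit-⊎ (S? y) (Bad? x) (A? x) (next r)

    -- Each vertex of `A` charges its successor if that lies in `S`, and otherwise itself as bad.
    -- The terms for `u` and `w` correct for the shift by one along the path; on a cycle `w` is `u`
    -- and they cancel.
    walkCount : ∀ {u v w xs} → Path R u v xs → R v w →
                sumL (λ x → bit (A? x)) xs + bit (S? u) ≤ sumL (λ x → bit (S? x)) xs + sumL (λ x → bit (Bad? x)) xs + bit (S? w)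
    walkCount {u} {w = w} end r = ≤-trans (+-monoˡ-≤ (bit (S? u)) (≤-trans (≤-reflexive (+-identityʳ _)) (step-count r)))
      (≤-reflexive (solve 3 (λ a b c → b :+ c :+ a := a :+ con 0 :+ (c :+ con 0) :+ b) refl (bit (S? u)) (bit (S? w)) (bit (Bad? u))))
    walkCount {u} {w = w} (step {w = u′} {xs = xs} r p) r′ = begin
      bit (A? u) + ΣA + bit (S? u)                        ≤⟨ +-monoˡ-≤ (bit (S? u)) (+-monoˡ-≤ ΣA (step-count r)) ⟩
      bit (S? u′) + bit (Bad? u) + ΣA + bit (S? u)        ≡⟨ solve 4 (λ a b c d → a :+ b :+ c :+ d := (c :+ a) :+ b :+ d) refl (bit (S? u′)) (bit (Bad? u)) ΣA (bit (S? u)) ⟩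
      (ΣA + bit (S? u′)) + bit (Bad? u) + bit (S? u)      ≤⟨ +-monoˡ-≤ (bit (S? u)) (+-monoˡ-≤ (bit (Bad? u)) (walkCount p r′)) ⟩
      (ΣS + ΣB + bit (S? w)) + bit (Bad? u) + bit (S? u)  ≡⟨ solve 5 (λ a b c d e → (a :+ b :+ c) :+ d :+ e := (e :+ a) :+ (d :+ b) :+ c) refl ΣS ΣB (bit (S? w)) (bit (Bad? u)) (bit (S? u)) ⟩
      (bit (S? u) + ΣS) + (bit (Bad? u) + ΣB) + bit (S? w) ∎
      where
      open ≤-Reasoning
      ΣA = sumL (λ x → bit (A? x)) xs
      ΣS = sumL (λ x → bit (S? x)) xs
      ΣB = sumL (λ x → bit (Bad? x)) xs

  #≤sumL : ∀ {n} {A : Fin n → Set} (A? : ∀ v → Dec (A v)) C → Unique C → length C ≡ n → # A? ≤ sumL (λ x → bit (A? x)) C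
  #≤sumL {n} A? C uq len = +-cancelʳ-≤ (# (λ v → ¬? (A? v))) _ _ (begin
    # A? + # (λ v → ¬? (A? v))                                    ≤⟨ #-disjoint A? (λ v → ¬? (A? v)) (λ _ → yes tt) (λ _ _ → tt) (λ _ _ → tt) (λ _ p q → q p) ⟩
    # {n} {λ _ → ⊤} (λ _ → yes tt)                                ≤⟨ #≤n {n} {λ _ → ⊤} (λ _ → yes tt) ⟩
    n                                                             ≡⟨ trans (*-identityʳ (length C)) len ⟨
    length C * 1                                                  ≡⟨ sumL-const 1 C ⟨
    sumL (λ _ → 1) C                                              ≡⟨ sumL-cong C (λ {x} _ → one x) ⟨
    sumL (λ x → bit (A? x) + bit (¬? (A? x))) C                   ≡⟨ sumL-+ (λ x → bit (A? x)) (λ x → bit (¬? (A? x))) C ⟩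
    sumL (λ x → bit (A? x)) C + sumL (λ x → bit (¬? (A? x))) C    ≤⟨ +-monoʳ-≤ _ (sumL-unique _ uq) ⟩
    sumL (λ x → bit (A? x)) C + # (λ v → ¬? (A? v))               ∎)
    where
    open ≤-Reasoning
    one : ∀ x → bit (A? x) + bit (¬? (A? x)) ≡ 1
    one x with A? x
    ... | yes _ = refl
    ... | no _  = refl

  module _ (n a s : ℕ) where

    A S : Fin n → Set
    A v = toℕ v < a
    S v = a ≤ toℕ v × toℕ v < a + s

    A? : ∀ v → Dec (A v)
    A? v = toℕ v <? a

    S? : ∀ v → Dec (S v)
    S? v = (a ≤? toℕ v) ×-dec (toℕ v <? a + s)

    sideGraph : Graph n
    sideGraph = record
      { Adj    = λ u v → u ≢ v × ((¬ A u × ¬ A v) ⊎ (A u × S v) ⊎ (S u × A v))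
      ; adj?   = λ u v → ¬? (u Fin.≟ v) ×-dec ((¬? (A? u) ×-dec ¬? (A? v)) ⊎-dec (A? u ×-dec S? v) ⊎-dec (S? u ×-dec A? v))
      ; symm   = λ { (ne , inj₁ (p , q)) → ne ∘ sym , inj₁ (q , p)
                   ; (ne , inj₂ (inj₁ (p , q))) → ne ∘ sym , inj₂ (inj₂ (q , p))
                   ; (ne , inj₂ (inj₂ (p , q))) → ne ∘ sym , inj₂ (inj₁ (q , p)) }
      ; irrefl = λ (ne , _) → ne refl
      }

    module _ (room : a + s < n) where

      private
        a≤n : a ≤ n
        a≤n = ≤-trans (m≤m+n a s) (<⇒≤ room)

      #A : # A? ≡ a
      #A = #-below a a≤n

      #S≥ : s ≤ # S?
      #S≥ = +-cancelˡ-≤ a s _ (begin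
        a + s                                ≡⟨ #-below (a + s) (<⇒≤ room) ⟨
        # {n} (λ v → toℕ v <? a + s)         ≤⟨ #-⊎ A? S? (λ v → toℕ v <? a + s) split ⟩
        # A? + # S?                          ≡⟨ cong (_+ # S?) #A ⟩
        a + # S?                             ∎)
        where
        open ≤-Reasoning
        split : ∀ v → toℕ v < a + s → A v ⊎ S v
        split v h with A? v
        ... | yes p = inj₁ p
        ... | no p  = inj₂ (≮⇒≥ p , h)

      #S≤ : # S? ≤ s
      #S≤ = +-cancelˡ-≤ a _ s (≤-trans (≤-reflexive (cong (_+ # S?) (sym #A)))
        (≤-trans (#-disjoint A? S? (λ v → toℕ v <? a + s) (λ v h → <-≤-trans h (m≤m+n a s)) (λ v → proj₂) (λ v h (h′ , _) → <⇒≱ h h′))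
          (≤-reflexive (#-below (a + s) (<⇒≤ room)))))

      last : Fin n
      last = fromℕ< room

      -- Outside `A` there is a clique, which adds one vertex at most; the vertex `last`, outside
      -- `A` and `S`, can indeed be added to `A`. For this reason `A` is given k - 1 vertices.
      α-side : α sideGraph ≡ suc a
      α-side = ≤-antisym (α≤ sideGraph upper) (≤-trans lower (≤-trans (≤-reflexive (sym (∣S∣≡# I))) (∣S∣≤α sideGraph I-ind)))
        where
        open ≤-Reasoning
        upper : ∀ T → Independent sideGraph T → ∣ T ∣ ≤ suc a
        upper T ind = begin
          ∣ T ∣                                                    ≡⟨ ∣S∣≡# T ⟩
          # (Subset?._∈? T)                                        ≤⟨ #-⊎ A? rest? (Subset?._∈? T) split ⟩
          # A? + # rest?                                           ≤⟨ +-mono-≤ (≤-reflexive #A) one ⟩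
          a + 1                                                    ≡⟨ +-comm a 1 ⟩
          suc a                                                    ∎
          where
          rest? = λ v → (v Subset?.∈? T) ×-dec ¬? (A? v)
          split : ∀ v → v Subset.∈ T → A v ⊎ (v Subset.∈ T × ¬ A v)
          split v v∈ with A? v
          ... | yes p = inj₁ p
          ... | no p  = inj₂ (v∈ , p)
          one : # rest? ≤ 1
          one with # rest? ≤? 0
          ... | yes h = ≤-trans h z≤n
          ... | no h with v , v∈ , ¬Av ← #-find rest? (≰⇒> h) =
            ≤-trans (#-mono rest? (Fin._≟ v) same) (≤-reflexive (#-singleton v))
            where
            same : ∀ u → u Subset.∈ T × ¬ A u → u ≡ v
            same u (u∈ , ¬Au) with u Fin.≟ v
            ... | yes e = e
            ... | no ne = contradiction (ne , inj₁ (¬Au , ¬Av)) (ind u v u∈ v∈)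
        I? : ∀ v → Dec (A v ⊎ v ≡ last)
        I? v = A? v ⊎-dec (v Fin.≟ last)
        I : Subset n
        I = fromPred I?
        ¬A-last : ¬ A last
        ¬A-last h = <⇒≱ h (≤-trans (m≤m+n a s) (≤-reflexive (sym (Fin.toℕ-fromℕ< room))))
        ¬S-last : ¬ S last
        ¬S-last (_ , h) = <-irrefl (Fin.toℕ-fromℕ< room) h
        I-ind : Independent sideGraph I
        I-ind u v u∈ v∈ = go (fromPred⁻ I? u∈) (fromPred⁻ I? v∈)
          where
          go : A u ⊎ u ≡ last → A v ⊎ v ≡ last → ¬ Adj sideGraph u v
          go (inj₁ p)    _        (_ , inj₁ (q , _)) = q p
          go (inj₂ _)    (inj₁ p) (_ , inj₁ (_ , q)) = q p
          go (inj₂ refl) (inj₂ refl) (ne , _)        = ne refl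
          go _ (inj₁ p)    (_ , inj₂ (inj₁ (_ , q))) = <⇒≱ p (proj₁ q)
          go _ (inj₂ refl) (_ , inj₂ (inj₁ (_ , q))) = ¬S-last q
          go (inj₁ p)    _ (_ , inj₂ (inj₂ (q , _))) = <⇒≱ p (proj₁ q)
          go (inj₂ refl) _ (_ , inj₂ (inj₂ (q , _))) = ¬S-last q
        lower : suc a ≤ # (Subset?._∈? I)
        lower = begin
          suc a                        ≡⟨ +-comm 1 a ⟩
          a + 1                        ≡⟨ cong₂ _+_ #A (#-singleton last) ⟨
          # A? + # (Fin._≟ last)       ≤⟨ #-disjoint A? (Fin._≟ last) (Subset?._∈? I) (λ v p → fromPred⁺ I? (inj₁ p)) (λ v p → fromPred⁺ I? (inj₂ p)) (λ { v p refl → ¬A-last p }) ⟩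
          # (Subset?._∈? I)            ∎

      δ-side : a + suc s ≤ n → s ≤ δ sideGraph
      δ-side room′ = ≤δ sideGraph (≤-trans (m≤n+m s a) (<⇒≤ room)) λ v → deg v
        where
        open ≤-Reasoning
        deg : ∀ v → s ≤ # (adj? sideGraph v)
        deg v = go (A? v)
         where
         go : Dec (A v) → s ≤ # (adj? sideGraph v)
         go (yes Av) = ≤-trans #S≥ (#-mono S? (adj? sideGraph v) λ u Su → (λ { refl → <⇒≱ Av (proj₁ Su) }) , inj₂ (inj₁ (Av , Su)))
         go (no ¬Av) = +-cancelˡ-≤ (suc a) s _ (begin
          suc a + s                                               ≡⟨ +-suc a s ⟨
          a + suc s                                               ≤⟨ room′ ⟩
          n                                                       ≡⟨ #-all {n} {λ _ → ⊤} (λ _ → yes tt) (λ _ → tt) ⟨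
          # {n} {λ _ → ⊤} (λ _ → yes tt)                          ≤⟨ #-⊎ (λ u → A? u ⊎-dec (u Fin.≟ v)) (adj? sideGraph v) (λ _ → yes tt) split ⟩
          # (λ u → A? u ⊎-dec (u Fin.≟ v)) + # (adj? sideGraph v) ≤⟨ +-monoˡ-≤ _ (≤-trans (#-⊎ A? (Fin._≟ v) _ λ _ p → p) (≤-reflexive (trans (cong₂ _+_ #A (#-singleton v)) (+-comm a 1)))) ⟩
          suc a + # (adj? sideGraph v)                            ∎)
          where
          split : ∀ u → ⊤ → (A u ⊎ u ≡ v) ⊎ Adj sideGraph v u
          split u _ with A? u | u Fin.≟ v
          ... | yes p | _     = inj₁ (inj₁ p)
          ... | no _  | yes e = inj₁ (inj₂ e)
          ... | no p  | no ne = inj₂ (ne ∘ sym , inj₁ (¬Av , p))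

      -- The number of ends in `A`: an edge inside `A` can make both of its ends bad, so counting
      -- edges would not be enough.
      weight : Fin n × Fin n → ℕ
      weight (u , v) = bit (A? u) + bit (A? v)

      ham⇒weight : ∀ F → Hamiltonian (sideGraph ∪ edgeGraph F) → a ≤ s + sumL weight F
      ham⇒weight F c with C , len , uq , u , v , p , r ← cyclePath {G = sideGraph ∪ edgeGraph F} c = begin
        a                                              ≡⟨ #A ⟨
        # A?                                           ≤⟨ #≤sumL A? C uq len ⟩
        sumL (λ x → bit (A? x)) C                      ≤⟨ +-cancelʳ-≤ (bit (S? u)) _ _ (walkCount A? S? Bad? (λ {x} {y} → next {x} {y}) p r) ⟩
        sumL (λ x → bit (S? x)) C + sumL (λ x → bit (Bad? x)) C ≤⟨ +-mono-≤ (≤-trans (sumL-unique _ uq) #S≤) (sumL-unique _ uq) ⟩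
        s + # Bad?                                     ≤⟨ +-monoʳ-≤ s (≤-trans (∑-mono bad≤) (≤-reflexive swap)) ⟩
        s + sumL weight F                              ∎
        where
        open ≤-Reasoning
        H = sideGraph ∪ edgeGraph F
        Bad : Fin n → Set
        Bad x = A x × ∃ λ y → Adj (edgeGraph F) x y
        Bad? : ∀ x → Dec (Bad x)
        Bad? x = A? x ×-dec Fin.any? λ y → adj? (edgeGraph F) x y
        next : ∀ {x y} → Adj H x y → A x → S y ⊎ Bad x
        next (inj₁ (_ , inj₁ (¬Ax , _)))       Ax = contradiction Ax ¬Ax
        next (inj₁ (_ , inj₂ (inj₁ (_ , Sy)))) Ax = inj₁ Sy
        next (inj₁ (_ , inj₂ (inj₂ (Sx , _)))) Ax = contradiction (proj₁ Sx) (<⇒≱ Ax)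
        next {y = y} (inj₂ xy)                 Ax = inj₂ (Ax , y , xy)
        inc : Fin n → Fin n × Fin n → ℕ
        inc x (u , v) = bit (x Fin.≟ u) * bit (A? x) + bit (x Fin.≟ v) * bit (A? x)
        bad≤ : ∀ x → bit (Bad? x) ≤ sumL (inc x) F
        bad≤ x with Bad? x
        ... | no _ = z≤n
        ... | yes (Ax , y , _ , inj₁ e∈) = ≤-trans (≤-trans (≤-reflexive (sym (cong₂ _*_ (bit-yes (x Fin.≟ x) refl) (bit-yes (A? x) Ax)))) (m≤m+n _ _)) (sumL-term (inc x) e∈)
        ... | yes (Ax , y , _ , inj₂ e∈) = ≤-trans (≤-trans (≤-reflexive (sym (cong₂ _*_ (bit-yes (x Fin.≟ x) refl) (bit-yes (A? x) Ax)))) (m≤n+m _ _)) (sumL-term (inc x) e∈)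
        swap : ∑ (λ x → sumL (inc x) F) ≡ sumL weight F
        swap = trans (sym (sumL-allFin _)) (trans (sumL-swap inc (allFin n) F) (sumL-cong F λ { {u , v} _ →
          trans (sumL-allFin _) (trans (∑-+ _ _) (cong₂ _+_ (∑-delta (λ x → bit (A? x)) u) (∑-delta (λ x → bit (A? x)) v))) }))

      weight-total : sumL weight (pairs n) ≤ n * a
      weight-total = begin
        sumL weight (pairs n)                                                 ≡⟨ pairSum (λ u v → bit (A? u)) ⟩
        ∑ (λ u → ∑ (λ v → (bit (u Fin.<? v) + bit (v Fin.<? u)) * bit (A? u))) ≤⟨ ∑-mono (λ u → ∑-mono λ v → ≤-trans (*-monoˡ-≤ (bit (A? u)) (excl u v)) (≤-reflexive (+-identityʳ _))) ⟩
        ∑ (λ u → ∑ {n} (λ v → bit (A? u)))                                    ≡⟨ ∑-cong (λ u → ∑-const n (bit (A? u))) ⟩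
        ∑ (λ u → n * bit (A? u))                                              ≡⟨ ∑-*ˡ n _ ⟩
        n * # A?                                                              ≡⟨ cong (n *_) #A ⟩
        n * a                                                                 ∎
        where
        open ≤-Reasoning
        excl : ∀ u v → bit (u Fin.<? v) + bit (v Fin.<? u) ≤ 1
        excl u v = bit-disjoint (u Fin.<? v) (v Fin.<? u) (yes tt) (λ _ → tt) (λ _ → tt) <-asym

      weight≤2 : ∀ e → weight e ≤ 2
      weight≤2 (u , v) = +-mono-≤ (bit≤1 (A? u)) (bit≤1 (A? v))

      private
        w : Fin n × Fin n → ℚ
        w = fromℕ ∘ weight

        W : ℚ
        W = ∑q w (pairs n)

      module _ {q : ℚ} {k : ℕ} (30≤k : 30 ≤ k) (a≤k : a ≤ k) (t≥ : 10 * k ≤ 20 * (a ∸ s) + 30) (0≤q : 0ℚ ℚ.≤ q) (q≤1 : q ℚ.≤ 1ℚ)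
               (small : fromℕ (20 * n) ℚ.* q ℚ.≤ fromℕ 7) where

        private
          open ℚP.≤-Reasoning
          K d h : ℚ
          K = fromℕ k
          d = recip 10 ℚ.* K
          h = 𝔼q q (pairs n) (λ F → ind (hamiltonian? (sideGraph ∪ edgeGraph F)))

          0≤K : 0ℚ ℚ.≤ K
          0≤K = fromℕ-nonNeg k

          0<K : 0ℚ ℚ.< K
          0<K = ℚP.<-≤-trans (fromℕ-pos 0) (fromℕ-mono (≤-trans (s≤s z≤n) 30≤k))

          20qW : fromℕ 20 ℚ.* (q ℚ.* W) ℚ.≤ fromℕ 7 ℚ.* K
          20qW = begin
            fromℕ 20 ℚ.* (q ℚ.* W)                         ≡⟨ cong (λ z → fromℕ 20 ℚ.* (q ℚ.* z)) (∑q-fromℕ weight (pairs n)) ⟩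
            fromℕ 20 ℚ.* (q ℚ.* fromℕ (sumL weight (pairs n))) ≤⟨ *-mono (fromℕ-nonNeg 20) (*-mono 0≤q (fromℕ-mono weight-total)) ⟩
            fromℕ 20 ℚ.* (q ℚ.* fromℕ (n * a))             ≡⟨ cong (λ z → fromℕ 20 ℚ.* (q ℚ.* z)) (fromℕ-* n a) ⟩
            fromℕ 20 ℚ.* (q ℚ.* (fromℕ n ℚ.* fromℕ a))     ≡⟨ ℚS.solve 4 (λ t q n a → t ℚS.:* (q ℚS.:* (n ℚS.:* a)) ℚS.:= t ℚS.:* n ℚS.:* q ℚS.:* a) refl (fromℕ 20) q (fromℕ n) (fromℕ a) ⟩
            fromℕ 20 ℚ.* fromℕ n ℚ.* q ℚ.* fromℕ a         ≡⟨ cong (λ z → z ℚ.* q ℚ.* fromℕ a) (fromℕ-* 20 n) ⟨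
            fromℕ (20 * n) ℚ.* q ℚ.* fromℕ a               ≤⟨ *-mono₂ (*-nonNeg (fromℕ-nonNeg (20 * n)) 0≤q) small (fromℕ-nonNeg a) (fromℕ-mono a≤k) ⟩
            fromℕ 7 ℚ.* K                                  ∎

          -- In units of k/20, the mean of the weight is at most 7 and the deviation d = k/10 is 2.
          -- The threshold a - s is at least (10k - 30)/20, which is at least 9 units once k ≥ 30.
          mean : q ℚ.* W ℚ.+ d ℚ.≤ fromℕ (a ∸ s)
          mean = *-cancelˡ-≤q (fromℕ-pos 19) (begin
            fromℕ 20 ℚ.* (q ℚ.* W ℚ.+ d)                   ≡⟨ ℚP.*-distribˡ-+ (fromℕ 20) (q ℚ.* W) d ⟩
            fromℕ 20 ℚ.* (q ℚ.* W) ℚ.+ fromℕ 20 ℚ.* d      ≤⟨ ℚP.+-mono-≤ 20qW (ℚP.≤-reflexive (sym (ℚP.*-assoc (fromℕ 20) (recip 10) K))) ⟩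
            fromℕ 7 ℚ.* K ℚ.+ fromℕ 2 ℚ.* K                ≡⟨ trans (sym (ℚP.*-distribʳ-+ K (fromℕ 7) (fromℕ 2))) (sym (fromℕ-* 9 k)) ⟩
            fromℕ (9 * k)                                  ≤⟨ fromℕ-mono (+-cancelʳ-≤ 30 _ _ (≤-trans (+-monoʳ-≤ (9 * k) 30≤k) (≤-trans (≤-reflexive (+-comm (9 * k) k)) t≥))) ⟩
            fromℕ (20 * (a ∸ s))                           ≡⟨ fromℕ-* 20 (a ∸ s) ⟩
            fromℕ 20 ℚ.* fromℕ (a ∸ s)                     ∎)

          squares : q ℚ.* ∑q (λ x → w x ℚ.* w x) (pairs n) ℚ.≤ q ℚ.* (fromℕ 2 ℚ.* W)
          squares = *-mono 0≤q (ℚP.≤-trans (∑q-mono (pairs n) λ {e} _ → *-monoʳ (fromℕ-nonNeg (weight e)) (fromℕ-mono (weight≤2 e)))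
            (ℚP.≤-reflexive (∑q-* (fromℕ 2) w (pairs n))))

        -- Chebyshev's inequality with d² = k²/100. The squares of the weights sum to at most 2W,
        -- since a weight is at most 2, and 2qW ≤ 7k/10; the quotient is 70/k.
        probHam : K ℚ.* h ℚ.≤ fromℕ 70
        probHam = *-cancelˡ-≤q 0<K (begin
          K ℚ.* (K ℚ.* h)                                  ≡⟨ trans (sym (ℚP.*-assoc K K h)) (sym (ℚP.*-identityˡ (K ℚ.* K ℚ.* h))) ⟩
          (fromℕ 100 ℚ.* (recip 10 ℚ.* recip 10)) ℚ.* (K ℚ.* K ℚ.* h) ≡⟨ ℚS.solve 4 (λ c r K h → (c ℚS.:* (r ℚS.:* r)) ℚS.:* (K ℚS.:* K ℚS.:* h) ℚS.:= c ℚS.:* ((r ℚS.:* K) ℚS.:* (r ℚS.:* K) ℚS.:* h)) refl (fromℕ 100) (recip 10) K h ⟩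
          fromℕ 100 ℚ.* (d ℚ.* d ℚ.* h)                    ≤⟨ *-mono (fromℕ-nonNeg 100) (ℚP.≤-trans (chebyshev 0≤q q≤1 (pairs n) w (λ F → hamiltonian? (sideGraph ∪ edgeGraph F)) (*-nonNeg (recip-nonNeg 10) 0≤K) mean enough) squares) ⟩
          fromℕ 100 ℚ.* (q ℚ.* (fromℕ 2 ℚ.* W))            ≡⟨ ℚS.solve 2 (λ q W → ℚS.con (fromℕ 100) ℚS.:* (q ℚS.:* (ℚS.con (fromℕ 2) ℚS.:* W)) ℚS.:= ℚS.con (fromℕ 10) ℚS.:* (ℚS.con (fromℕ 20) ℚS.:* (q ℚS.:* W))) refl q W ⟩
          fromℕ 10 ℚ.* (fromℕ 20 ℚ.* (q ℚ.* W))            ≤⟨ *-mono (fromℕ-nonNeg 10) 20qW ⟩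
          fromℕ 10 ℚ.* (fromℕ 7 ℚ.* K)                     ≡⟨ trans (sym (ℚP.*-assoc (fromℕ 10) (fromℕ 7) K)) (ℚP.*-comm (fromℕ 70) K) ⟩
          K ℚ.* fromℕ 70                                   ∎)
          where
          enough : ∀ F → Hamiltonian (sideGraph ∪ edgeGraph F) → fromℕ (a ∸ s) ℚ.≤ ∑q w F
          enough F c = ℚP.≤-trans (fromℕ-mono (m≤n+o⇒m∸n≤o a s (ham⇒weight F c))) (ℚP.≤-reflexive (sym (∑q-fromℕ weight F)))

  nonHam-lower : ∀ {n} (G : Graph n) {q η} → 𝔼q q (pairs n) (λ F → ind (hamiltonian? (G ∪ edgeGraph F))) ℚ.≤ η → 1ℚ ℚ.- η ℚ.≤ probability G q nonHamiltonian?
  nonHam-lower {n} G {q} {η} h = ℚP.≤-trans (ℚP.+-monoʳ-≤ 1ℚ (ℚP.neg-antimono-≤ h)) (ℚP.≤-reflexive (sym (begin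
    probability G q nonHamiltonian?                             ≡⟨ 𝔼-cong q (pairs n) (λ F → trans (ind-¬ (hamiltonian? (G ∪ edgeGraph F))) (cong (1ℚ ℚ.+_) (neg-1* (I F)))) ⟩
    𝔼q q (pairs n) (λ F → 1ℚ ℚ.+ (ℚ.- 1ℚ) ℚ.* I F)              ≡⟨ 𝔼-+ q (pairs n) (λ _ → 1ℚ) _ ⟩
    𝔼q q (pairs n) (λ _ → 1ℚ) ℚ.+ 𝔼q q (pairs n) (λ F → (ℚ.- 1ℚ) ℚ.* I F) ≡⟨ cong₂ ℚ._+_ (𝔼-const q (pairs n) 1ℚ) (𝔼-* q (pairs n) (ℚ.- 1ℚ) I) ⟩
    1ℚ ℚ.+ (ℚ.- 1ℚ) ℚ.* 𝔼q q (pairs n) I                        ≡⟨ cong (1ℚ ℚ.+_) (sym (neg-1* (𝔼q q (pairs n) I))) ⟩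
    1ℚ ℚ.- 𝔼q q (pairs n) I                                     ∎)))
    where
    open ≡-Reasoning
    I : List (Fin n × Fin n) → ℚ
    I F = ind (hamiltonian? (G ∪ edgeGraph F))
    neg-1* : ∀ x → ℚ.- x ≡ (ℚ.- 1ℚ) ℚ.* x
    neg-1* = ℚS.solve 1 (λ x → ℚS.:- x ℚS.:= ℚS.con (ℚ.- 1ℚ) ℚS.:* x) refl

  clamp≤ : ∀ {q b} → 0ℚ ℚ.≤ b → q ℚ.≤ b → clamp q ℚ.≤ b
  clamp≤ {q} 0≤b q≤b = ℚP.⊔-lub 0≤b (ℚP.≤-trans (ℚP.p⊓q≤p q 1ℚ) q≤b)

  halve : ∀ {k n} → nat k D.≤ nat n /ℕ 2 → 2 * k ≤ n
  halve {k} {n} h with N , hN ← h (recip 4) (ℚP.positive⁻¹ (recip 4)) = fromℕ-cancel-½ (begin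
    fromℕ (2 * k)                                          ≡⟨ fromℕ-* 2 k ⟩
    fromℕ 2 ℚ.* fromℕ k                                    ≤⟨ *-mono (fromℕ-nonNeg 2) (hN N ≤-refl) ⟩
    fromℕ 2 ℚ.* (fromℕ n ℚ.* recip 2 ℚ.+ recip 4)          ≡⟨ ℚS.solve 1 (λ n → ℚS.con (fromℕ 2) ℚS.:* (n ℚS.:* ℚS.con (recip 2) ℚS.:+ ℚS.con (recip 4)) ℚS.:= n ℚS.:+ ℚS.con ℚ.½) refl (fromℕ n) ⟩
    fromℕ n ℚ.+ ℚ.½                                        ∎)
    where open ℚP.≤-Reasoning

  halve⁻ : ∀ {k d} → k ≤ 2 * d → nat k /ℕ 2 D.≤ nat d
  halve⁻ {k} {d} h ε 0<ε = 0 , λ _ _ → begin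
    fromℕ k ℚ.* recip 2                  ≤⟨ *-monoʳ (recip-nonNeg 2) (fromℕ-mono h) ⟩
    fromℕ (2 * d) ℚ.* recip 2            ≡⟨ cong (ℚ._* recip 2) (fromℕ-* 2 d) ⟩
    fromℕ 2 ℚ.* fromℕ d ℚ.* recip 2      ≡⟨ ℚS.solve 1 (λ d → ℚS.con (fromℕ 2) ℚS.:* d ℚS.:* ℚS.con (recip 2) ℚS.:= d) refl (fromℕ d) ⟩
    fromℕ d                              ≤⟨ ≤-+ʳ (ℚP.<⇒≤ 0<ε) ⟩
    fromℕ d ℚ.+ ε                        ∎
    where open ℚP.≤-Reasoning

  -- At p = 1/(3n) the left side is 20/3. The remaining 1/3 up to 7 pays for the approximation of p.
  smallQ : ∀ n {p : ℝ} → 1 ≤ n → p D.≤ ι 1ℚ /ℕ (3 * n) → ∃ λ M → ∀ m → M ≤ m → fromℕ (20 * n) ℚ.* clamp (seq p m) ℚ.≤ fromℕ 7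
  smallQ (suc n) {p} _ h =
    let e , 0<e , eq = scale (c ℚ.* N) (ℚP.<-≤-trans (fromℕ-pos 0) (ℚP.≤-trans (fromℕ-mono {1} {20 * suc n} (s≤s z≤n)) (ℚP.≤-reflexive (fromℕ-* 20 (suc n))))) (ℚP.positive⁻¹ (recip 3))
        M , hM = h e 0<e
    in M , λ m M≤m → begin
      fromℕ (20 * suc n) ℚ.* clamp (seq p m)    ≡⟨ cong (ℚ._* clamp (seq p m)) (fromℕ-* 20 (suc n)) ⟩
      c ℚ.* N ℚ.* clamp (seq p m)               ≤⟨ *-mono (*-nonNeg (fromℕ-nonNeg 20) (fromℕ-nonNeg (suc n)))
                                                     (clamp≤ {seq p m} (+-nonNeg (*-nonNeg 0≤1 (recip-nonNeg (3 * suc n))) (ℚP.<⇒≤ 0<e)) (hM m M≤m)) ⟩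
      c ℚ.* N ℚ.* (1ℚ ℚ.* r ℚ.+ e)              ≡⟨ ℚS.solve 4 (λ c N r e → c ℚS.:* N ℚS.:* (ℚS.con 1ℚ ℚS.:* r ℚS.:+ e) ℚS.:= c ℚS.:* (N ℚS.:* r) ℚS.:+ c ℚS.:* N ℚS.:* e) refl c N r e ⟩
      c ℚ.* (N ℚ.* r) ℚ.+ c ℚ.* N ℚ.* e         ≡⟨ cong₂ (λ a b → c ℚ.* a ℚ.+ b) (trans (cong (λ z → N ℚ.* recip z) (*-comm 3 (suc n))) (recip-cancel n 2)) eq ⟩
      c ℚ.* recip 3 ℚ.+ recip 3                 ≡⟨⟩
      fromℕ 7                                   ∎
    where
    open ℚP.≤-Reasoning
    c N r : ℚ
    c = fromℕ 20
    N = fromℕ (suc n)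
    r = recip (3 * suc n)

  private
    arith : ∀ a n → 2 * suc a ≤ n → a + suc ⌈ suc a /2⌉ ≤ n × 10 * suc a ≤ 20 * (a ∸ ⌈ suc a /2⌉) + 30 × suc a ≤ 2 * ⌈ suc a /2⌉
    arith a n h = ≤-trans (+-monoʳ-≤ a (s≤s s≤)) (≤-trans (≤-reflexive (solve 1 (λ a → a :+ (con 1 :+ (con 1 :+ a)) := con 2 :* (con 1 :+ a)) refl a)) h) , b , c
      where
      open ≤-Reasoning
      s = ⌈ suc a /2⌉
      f = ⌊ suc a /2⌋
      f+s : f + s ≡ suc a
      f+s = ⌊n/2⌋+⌈n/2⌉≡n (suc a)
      s≤ : s ≤ suc a
      s≤ = ⌈n/2⌉≤n (suc a)
      c : suc a ≤ 2 * s
      c = ≤-trans (≤-reflexive (sym f+s)) (≤-trans (+-monoˡ-≤ s (⌊n/2⌋≤⌈n/2⌉ (suc a))) (≤-reflexive (cong (s +_) (sym (+-identityʳ s)))))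
      2s≤ : 2 * s ≤ 2 + a
      2s≤ = ≤-trans (≤-reflexive (cong (s +_) (+-identityʳ s))) (≤-trans (+-monoˡ-≤ s (⌊n/2⌋-mono (n≤1+n (2 + a)))) (≤-reflexive (cong suc f+s)))
      b : 10 * suc a ≤ 20 * (a ∸ s) + 30
      b = +-cancelʳ-≤ (20 * s) _ _ (begin
        10 * suc a + 20 * s               ≡⟨ cong (10 * suc a +_) (*-assoc 10 2 s) ⟩
        10 * suc a + 10 * (2 * s)         ≤⟨ +-monoʳ-≤ (10 * suc a) (*-monoʳ-≤ 10 2s≤) ⟩
        10 * suc a + 10 * (2 + a)         ≡⟨ solve 1 (λ a → con 10 :* (con 1 :+ a) :+ con 10 :* (con 2 :+ a) := con 20 :* a :+ con 30) refl a ⟩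
        20 * a + 30                       ≤⟨ +-monoˡ-≤ 30 (*-monoʳ-≤ 20 (m≤n+m∸n a s)) ⟩
        20 * (s + (a ∸ s)) + 30           ≡⟨ solve 2 (λ s d → con 20 :* (s :+ d) :+ con 30 := con 20 :* d :+ con 30 :+ con 20 :* s) refl s (a ∸ s) ⟩
        20 * (a ∸ s) + 30 + 20 * s        ∎)

  private
    sideGraph′ : ∀ n → ℕ → Graph n
    sideGraph′ n k = sideGraph n (pred k) ⌈ k /2⌉

    room : ∀ a n → 2 * suc a ≤ n → a + ⌈ suc a /2⌉ < n
    room a n h = ≤-trans (≤-reflexive (sym (+-suc a ⌈ suc a /2⌉))) (proj₁ (arith a n h))

    α-δ : ∀ n k → 30 ≤ k → 2 * k ≤ n → α (sideGraph′ n k) ≡ k × nat k /ℕ 2 D.≤ nat (δ (sideGraph′ n k))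
    α-δ n (suc a) _ h = α-side n a ⌈ suc a /2⌉ (room a n h) ,
      halve⁻ {suc a} {δ (sideGraph′ n (suc a))}
        (≤-trans (proj₂ (proj₂ (arith a n h))) (*-monoʳ-≤ 2 (δ-side n a ⌈ suc a /2⌉ (room a n h) (proj₁ (arith a n h)))))

    unlikely : ∀ n k q {η} → 30 ≤ k → 2 * k ≤ n → 0ℚ ℚ.≤ q → q ℚ.≤ 1ℚ → fromℕ (20 * n) ℚ.* q ℚ.≤ fromℕ 7 → fromℕ 70 ℚ.≤ fromℕ k ℚ.* η →
               𝔼q q (pairs n) (λ F → ind (hamiltonian? (sideGraph′ n k ∪ edgeGraph F))) ℚ.≤ η
    unlikely n (suc a) q {η} 30≤ h 0≤q q≤1 rel 70≤ = *-cancelˡ-≤q {fromℕ (suc a)} {𝔼q q (pairs n) (λ F → ind (hamiltonian? (sideGraph′ n (suc a) ∪ edgeGraph F)))} {η} (fromℕ-pos a)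
      (ℚP.≤-trans (probHam n a ⌈ suc a /2⌉ (room a n h) {q} {suc a} 30≤ (n≤1+n a) (proj₁ (proj₂ (arith a n h))) 0≤q q≤1 rel) 70≤)

  partC : (k : ℕ → ℕ) → Eventually (λ n → nat (k n) D.≤ nat n /ℕ 2) → k ⟶∞ →
    ∃ λ (H : ∀ n → Graph n) → Eventually (λ n → α (H n) ≡ k n × nat (k n) /ℕ 2 D.≤ nat (δ (H n))) ×
      ((p : ℕ → ℝ) → (∀ n → IsProbability (p n)) → Eventually (λ n → p n D.≤ ι 1ℚ /ℕ (3 * n)) → AAS[ H ∪𝔾 p ⊨ nonHamiltonian? ])
  partC k (N₀ , half) k→∞ = let N₁ , 30≤ = k→∞ 30 in
    (λ n → sideGraph′ n (k n)) ,
    (N₀ ⊔ N₁ , λ n N≤n → α-δ n (k n) (30≤ n (m⊔n≤o⇒n≤o N₀ N₁ N≤n)) (halve {k n} {n} (half n (m⊔n≤o⇒m≤o N₀ N₁ N≤n)))) ,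
    λ p isP (N₂ , small) → aas {P = λ H → ¬ Hamiltonian H} nonHamiltonian? (λ n → sideGraph′ n (k n)) p isP (λ n q → fromℕ (20 * n) ℚ.* q ℚ.≤ fromℕ 7)
      (N₂ ⊔ 1 , λ n N≤n → smallQ n {p n} (m⊔n≤o⇒n≤o N₂ 1 N≤n) (small n (m⊔n≤o⇒m≤o N₂ 1 N≤n)))
      (tail N₁ 30≤)
    where
    tail : ∀ N₁ → (∀ n → N₁ ≤ n → 30 ≤ k n) → ∀ η → 0ℚ ℚ.< η → Eventually λ n → ∀ q → 0ℚ ℚ.≤ q → q ℚ.≤ 1ℚ → fromℕ (20 * n) ℚ.* q ℚ.≤ fromℕ 7 →
           1ℚ ℚ.- η ℚ.≤ probability (sideGraph′ n (k n)) q nonHamiltonian?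
    tail N₁ 30≤ η 0<η = let M , 70≤ = archimedean′ (fromℕ 70) 0<η
                            N₃ , big = k→∞ M in (N₀ ⊔ N₁) ⊔ N₃ , λ n N≤n q 0≤q q≤1 rel →
      nonHam-lower (sideGraph′ n (k n)) {q} {η} (unlikely n (k n) q {η} (30≤ n (m⊔n≤o⇒n≤o N₀ N₁ (m⊔n≤o⇒m≤o (N₀ ⊔ N₁) N₃ N≤n)))
        (halve {k n} {n} (half n (m⊔n≤o⇒m≤o N₀ N₁ (m⊔n≤o⇒m≤o (N₀ ⊔ N₁) N₃ N≤n)))) 0≤q q≤1 rel
        (ℚP.≤-trans 70≤ (*-monoʳ (ℚP.<⇒≤ 0<η) (fromℕ-mono (big n (m⊔n≤o⇒n≤o (N₀ ⊔ N₁) N₃ N≤n))))))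

-- Bounds for the exponential series and the logarithm

module ExpLogBounds where

  open Expectation using (≤⇒0≤-)
  open RationalBounds
  open import Defs using (expTerm; expSum; expTerm-nonNeg; expTerm-suc; harmonic; harmonic-≥; harmonic-≤; logSeq; logSeq-up; logSeq-down; telescope; recip; recip-nonNeg; recip-cancel; fromℕ; fromℕ-suc; fromℕ-nonNeg; fromℕ-pos; fromℕ-mono; fromℕ*recip; *-mono; *-mono₂; *-nonNeg; +-nonNeg; ≤-+ʳ; 0≤1)
  open import Data.Nat.Base as ℕ using (ℕ; zero; suc)
  import Data.Nat.Properties as ℕP
  open import Data.Rational.Base
  open import Data.Rational.Properties
  open import Data.Rational.Solver using (module +-*-Solver)
  open +-*-Solver using (solve; con; _:+_; _:*_; _:-_; :-_; _:=_)
  open import Data.Product.Base using (∃; _×_; _,_; proj₁; proj₂)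
  open import Function.Base using (_∘_)
  open import Relation.Binary.PropositionalEquality
  open import Relation.Nullary using (yes; no)

  private
    T : ℚ → ℕ → ℚ
    T = expTerm

    u : ℕ → ℚ
    u i = recip (suc i)

    -- This is (1 + i) · u i = 1 in disguise.
    weights : ∀ s i → T s (suc i) * u (suc i) + T s i * s * u (suc i) ≡ T s (suc i)
    weights s i = begin
      T s (suc i) * v + T s i * s * v                          ≡⟨ cong (λ z → T s (suc i) * v + z * v) (trans (*-comm (T s i) s) (sym (expTerm-suc s i))) ⟩
      T s (suc i) * v + fromℕ (suc i) * T s (suc i) * v        ≡⟨ solve 3 (λ t v n → t :* v :+ n :* t :* v := t :* ((con 1ℚ :+ n) :* v)) refl (T s (suc i)) v (fromℕ (suc i)) ⟩
      T s (suc i) * ((1ℚ + fromℕ (suc i)) * v)                 ≡⟨ cong (λ z → T s (suc i) * (z * v)) (sym (fromℕ-suc (suc i))) ⟩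
      T s (suc i) * (fromℕ (suc (suc i)) * v)                  ≡⟨ cong (T s (suc i) *_) (fromℕ*recip (suc i)) ⟩
      T s (suc i) * 1ℚ                                         ≡⟨ *-identityʳ _ ⟩
      T s (suc i)                                              ∎
      where
      open ≡-Reasoning
      v = u (suc i)

  -- The first two terms of the binomial expansion of (q + r)^(i+1) / (i+1)!.
  expTerm-lower : ∀ {q r} → 0ℚ ≤ q → 0ℚ ≤ r → ∀ i → expTerm q (suc i) + r * expTerm q i ≤ expTerm (q + r) (suc i)
  expTerm-lower {q} {r} 0≤q 0≤r zero = ≤-reflexive (solve 2 (λ q r → con 1ℚ :* q :* con (u 0) :+ r :* con 1ℚ := con 1ℚ :* (q :+ r) :* con (u 0)) refl q r)
  expTerm-lower {q} {r} 0≤q 0≤r (suc i) = begin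
    T q (suc (suc i)) + r * T q (suc i)
      ≡⟨ cong (λ z → T q (suc (suc i)) + r * z) (sym (weights q i)) ⟩
    t * q * v + r * (t * v + t′ * q * v)
      ≤⟨ ≤-+ʳ (*-nonNeg (*-nonNeg (*-nonNeg 0≤r 0≤r) (expTerm-nonNeg 0≤q i)) (recip-nonNeg (suc (suc i)))) ⟩
    t * q * v + r * (t * v + t′ * q * v) + r * r * t′ * v
      ≡⟨ solve 5 (λ t t′ q r v → t :* q :* v :+ r :* (t :* v :+ t′ :* q :* v) :+ r :* r :* t′ :* v := (t :+ r :* t′) :* (q :+ r) :* v) refl t t′ q r v ⟩
    (t + r * t′) * (q + r) * v
      ≤⟨ *-monoʳ (recip-nonNeg (suc (suc i))) (*-monoʳ (+-nonNeg 0≤q 0≤r) (expTerm-lower 0≤q 0≤r i)) ⟩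
    T (q + r) (suc (suc i)) ∎
    where
    open ≤-Reasoning
    t = T q (suc i)
    t′ = T q i
    v = u (suc i)

  -- Convexity of x^(i+1) / (i+1)!: the tangent at q + r runs below the graph at q.
  expTerm-upper : ∀ {q r} → 0ℚ ≤ q → 0ℚ ≤ r → ∀ i → expTerm (q + r) (suc i) - r * expTerm (q + r) i ≤ expTerm q (suc i)
  expTerm-upper {q} {r} 0≤q 0≤r zero = ≤-reflexive (solve 2 (λ q r → con 1ℚ :* (q :+ r) :* con (u 0) :- r :* con 1ℚ := con 1ℚ :* q :* con (u 0)) refl q r)
  expTerm-upper {q} {r} 0≤q 0≤r (suc i) = begin
    T s (suc (suc i)) - r * T s (suc i)
      ≡⟨ cong (λ z → T s (suc (suc i)) - r * z) (sym (weights s i)) ⟩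
    t * s * v - r * (t * v + t′ * s * v)
      ≤⟨ ≤-+ʳ (*-nonNeg (*-nonNeg (*-nonNeg 0≤r 0≤r) (expTerm-nonNeg (+-nonNeg 0≤q 0≤r) i)) (recip-nonNeg (suc (suc i)))) ⟩
    t * s * v - r * (t * v + t′ * s * v) + r * r * t′ * v
      ≡⟨ solve 5 (λ t t′ q r v → t :* (q :+ r) :* v :- r :* (t :* v :+ t′ :* (q :+ r) :* v) :+ r :* r :* t′ :* v := (t :- r :* t′) :* q :* v) refl t t′ q r v ⟩
    (t - r * t′) * q * v
      ≤⟨ *-monoʳ (recip-nonNeg (suc (suc i))) (*-monoʳ 0≤q (expTerm-upper 0≤q 0≤r i)) ⟩
    T q (suc (suc i)) ∎
    where
    open ≤-Reasoning
    s = q + r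
    t = T s (suc i)
    t′ = T s i
    v = u (suc i)

  expSum-lower : ∀ {q r} → 0ℚ ≤ q → 0ℚ ≤ r → ∀ N → expSum q (suc N) + r * expSum q N ≤ expSum (q + r) (suc N)
  expSum-lower {q} {r} 0≤q 0≤r zero = ≤-reflexive (trans (cong (expSum q 1 +_) (*-zeroʳ r)) (+-identityʳ (expSum q 1)))
  expSum-lower {q} {r} 0≤q 0≤r (suc N) = begin
    expSum q (suc N) + T q (suc N) + r * (expSum q N + T q N)
      ≡⟨ solve 5 (λ a b r c d → a :+ b :+ r :* (c :+ d) := (a :+ r :* c) :+ (b :+ r :* d)) refl (expSum q (suc N)) (T q (suc N)) r (expSum q N) (T q N) ⟩
    (expSum q (suc N) + r * expSum q N) + (T q (suc N) + r * T q N)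
      ≤⟨ +-mono-≤ (expSum-lower 0≤q 0≤r N) (expTerm-lower 0≤q 0≤r N) ⟩
    expSum (q + r) (suc N) + T (q + r) (suc N) ∎
    where open ≤-Reasoning

  -- exp r ≥ 1 + r in a form for truncated series; multiplication by the linear factor raises the
  -- degree by one, hence the additional term on the right.
  expSum-grow : ∀ {q r} → 0ℚ ≤ q → 0ℚ ≤ r → ∀ N → expSum q N * (1ℚ + r) ≤ expSum (q + r) (suc N)
  expSum-grow {q} {r} 0≤q 0≤r N = begin
    expSum q N * (1ℚ + r)                 ≡⟨ solve 2 (λ e r → e :* (con 1ℚ :+ r) := e :+ r :* e) refl (expSum q N) r ⟩
    expSum q N + r * expSum q N           ≤⟨ +-monoˡ-≤ (r * expSum q N) (≤-+ʳ {expSum q N} (expTerm-nonNeg 0≤q N)) ⟩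
    expSum q (suc N) + r * expSum q N     ≤⟨ expSum-lower 0≤q 0≤r N ⟩
    expSum (q + r) (suc N)                ∎
    where open ≤-Reasoning

  -- `expSum-grow` with r = 1, j times: a doubling costs 1 in the exponent and one term of the
  -- series. The weak bound 2 instead of e keeps everything in powers of two.
  expSum-double : ∀ {q} → 0ℚ ≤ q → ∀ N j → expSum q N * fromℕ (2 ℕ.^ j) ≤ expSum (q + fromℕ j) (j ℕ.+ N)
  expSum-double {q} 0≤q N zero = ≤-reflexive (trans (*-identityʳ (expSum q N)) (cong (λ z → expSum z N) (sym (+-identityʳ q))))
  expSum-double {q} 0≤q N (suc j) = begin
    expSum q N * fromℕ (2 ℕ.* 2 ℕ.^ j)              ≡⟨ cong (expSum q N *_) (trans (fromℕ-* 2 (2 ℕ.^ j)) (*-comm (fromℕ 2) (fromℕ (2 ℕ.^ j)))) ⟩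
    expSum q N * (fromℕ (2 ℕ.^ j) * fromℕ 2)        ≡⟨ *-assoc (expSum q N) (fromℕ (2 ℕ.^ j)) (fromℕ 2) ⟨
    expSum q N * fromℕ (2 ℕ.^ j) * (1ℚ + 1ℚ)        ≤⟨ *-monoʳ (+-nonNeg 0≤1 0≤1) (expSum-double 0≤q N j) ⟩
    expSum (q + fromℕ j) (j ℕ.+ N) * (1ℚ + 1ℚ)      ≤⟨ expSum-grow (+-nonNeg 0≤q (fromℕ-nonNeg j)) 0≤1 (j ℕ.+ N) ⟩
    expSum (q + fromℕ j + 1ℚ) (suc j ℕ.+ N)         ≡⟨ cong (λ z → expSum z (suc j ℕ.+ N)) (trans (+-assoc q (fromℕ j) 1ℚ) (cong (q +_) (trans (+-comm (fromℕ j) 1ℚ) (sym (fromℕ-suc j))))) ⟩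
    expSum (q + fromℕ (suc j)) (suc j ℕ.+ N)        ∎
    where open ≤-Reasoning

  expTerm-mono : ∀ {q s} → 0ℚ ≤ q → q ≤ s → ∀ i → expTerm q i ≤ expTerm s i
  expTerm-mono 0≤q h zero    = ≤-refl
  expTerm-mono 0≤q h (suc i) = *-monoʳ (recip-nonNeg (suc i)) (*-mono₂ (expTerm-nonNeg 0≤q i) (expTerm-mono 0≤q h i) 0≤q h)

  expSum-mono : ∀ {q s} → 0ℚ ≤ q → q ≤ s → ∀ N → expSum q N ≤ expSum s N
  expSum-mono 0≤q h zero    = ≤-refl
  expSum-mono 0≤q h (suc N) = +-mono-≤ (expSum-mono 0≤q h N) (expTerm-mono 0≤q h N)

  expSum-len : ∀ {q} → 0ℚ ≤ q → ∀ {M N} → M ℕ.≤ N → expSum q M ≤ expSum q N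
  expSum-len {q} 0≤q {M} h = go (ℕP.≤⇒≤′ h)
    where
    go : ∀ {N} → M ℕ.≤′ N → expSum q M ≤ expSum q N
    go ℕ.≤′-refl     = ≤-refl
    go (ℕ.≤′-step {n} h) = ≤-trans (go h) (≤-+ʳ (expTerm-nonNeg 0≤q n))

  -- exp (-r) ≥ 1 - r for truncated series, obtained by summing the tangent inequalities of the
  -- terms.
  expSum-shrink : ∀ {q r} → 0ℚ ≤ q → 0ℚ ≤ r → ∀ N → expSum (q + r) N - r * expSum (q + r) N ≤ expSum q N
  expSum-shrink {q} {r} 0≤q 0≤r zero = ≤-reflexive (trans (cong (λ z → 0ℚ - z) (*-zeroʳ r)) refl)
  expSum-shrink {q} {r} 0≤q 0≤r (suc N) = ≤-trans (+-monoʳ-≤ (expSum s (suc N)) (neg-antimono-≤ (*-mono 0≤r (expSum-len 0≤s (ℕP.n≤1+n N))))) (go N)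
    where
    open ≤-Reasoning
    s = q + r
    0≤s = +-nonNeg 0≤q 0≤r
    go : ∀ N → expSum s (suc N) - r * expSum s N ≤ expSum q (suc N)
    go zero = ≤-reflexive (trans (cong (λ z → expSum s 1 - z) (*-zeroʳ r)) refl)
    go (suc N) = begin
      expSum s (suc N) + T s (suc N) - r * (expSum s N + T s N)
        ≡⟨ solve 5 (λ a b r c d → a :+ b :- r :* (c :+ d) := (a :- r :* c) :+ (b :- r :* d)) refl (expSum s (suc N)) (T s (suc N)) r (expSum s N) (T s N) ⟩
      (expSum s (suc N) - r * expSum s N) + (T s (suc N) - r * T s N)
        ≤⟨ +-mono-≤ (go N) (expTerm-upper 0≤q 0≤r N) ⟩
      expSum q (suc N) + T q (suc N) ∎

  harmonic-mono : ∀ {m n} → m ℕ.≤ n → harmonic m ≤ harmonic n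
  harmonic-mono {m} h = go (ℕP.≤⇒≤′ h)
    where
    go : ∀ {n} → m ℕ.≤′ n → harmonic m ≤ harmonic n
    go ℕ.≤′-refl         = ≤-refl
    go (ℕ.≤′-step {n} h) = ≤-trans (go h) (≤-+ʳ (recip-nonNeg (suc n)))

  expSum-0 : ∀ N → expSum 0ℚ N ≤ 1ℚ
  expSum-0 zero          = 0≤1
  expSum-0 (suc zero)    = ≤-refl
  expSum-0 (suc (suc N)) = ≤-trans (≤-reflexive (trans (cong (λ z → expSum 0ℚ (suc N) + z * u N) (*-zeroʳ (T 0ℚ N)))
    (trans (cong (expSum 0ℚ (suc N) +_) (*-zeroˡ (u N))) (+-identityʳ (expSum 0ℚ (suc N)))))) (expSum-0 (suc N))

  -- Because exp (1/i) ≤ i/(i-1).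
  exp-harmonic : ∀ m N j → expSum (harmonic (j ℕ.+ suc m) - harmonic (suc m)) N * fromℕ (suc m) ≤ fromℕ (j ℕ.+ suc m)
  exp-harmonic m N zero = ≤-trans (*-monoʳ (fromℕ-nonNeg (suc m)) (≤-trans (≤-reflexive (cong (λ z → expSum z N) (+-inverseʳ (harmonic (suc m))))) (expSum-0 N)))
    (≤-reflexive (*-identityˡ (fromℕ (suc m))))
  exp-harmonic m N (suc j) = *-cancelˡ-≤ 0<M′ (begin
    M′ * (E′ * M)                            ≡⟨ cong (_* (E′ * M)) M′≡ ⟩
    (fromℕ (suc K) - 1ℚ) * (E′ * M)          ≡⟨ cong (λ z → (fromℕ (suc K) - z) * (E′ * M)) (sym (fromℕ*recip K)) ⟩
    (K₁ - K₁ * r) * (E′ * M)                 ≡⟨ solve 4 (λ K r E M → (K :- K :* r) :* (E :* M) := K :* ((E :- r :* E) :* M)) refl K₁ r E′ M ⟩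
    K₁ * ((E′ - r * E′) * M)                 ≤⟨ *-mono (fromℕ-nonNeg (suc K)) (*-monoʳ (fromℕ-nonNeg (suc m)) shrink) ⟩
    K₁ * (E * M)                             ≤⟨ *-mono (fromℕ-nonNeg (suc K)) (exp-harmonic m N j) ⟩
    K₁ * M′                                  ≡⟨ *-comm K₁ M′ ⟩
    M′ * K₁                                  ∎)
    where
    open ≤-Reasoning
    K = j ℕ.+ suc m
    M = fromℕ (suc m)
    M′ = fromℕ K
    K₁ = fromℕ (suc K)
    r = recip (suc K)
    h = harmonic K - harmonic (suc m)
    h′ = harmonic K + recip (suc K) - harmonic (suc m)
    E = expSum h N
    E′ = expSum h′ N
    M′≡ : M′ ≡ K₁ - 1ℚ
    M′≡ = trans (solve 1 (λ k → k := con 1ℚ :+ k :- con 1ℚ) refl M′) (cong (_- 1ℚ) (sym (fromℕ-suc K)))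
    0<M′ : 0ℚ < M′
    0<M′ = <-≤-trans (fromℕ-pos 0) (fromℕ-mono (ℕP.≤-trans (ℕ.s≤s ℕ.z≤n) (ℕP.m≤n+m (suc m) j)))
    0≤h : 0ℚ ≤ h
    0≤h = ≤⇒0≤- (harmonic-mono (ℕP.m≤n+m (suc m) j))
    shrink : E′ - r * E′ ≤ E
    shrink = subst (λ z → expSum z N - r * expSum z N ≤ E) (solve 3 (λ a b c → a :- b :+ c := a :+ c :- b) refl (harmonic K) (harmonic (suc m)) r)
      (expSum-shrink 0≤h (recip-nonNeg (suc K)) N)

  -- `logSeq` is a lower Riemann sum for log n, so its exponential stays below n for every mesh and
  -- every truncation.
  exp-log : ∀ n m N → expSum (logSeq (suc n) m) N ≤ fromℕ (suc n)
  exp-log n m N = *-cancelˡ-≤ (fromℕ-pos m) (begin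
    fromℕ (suc m) * expSum (logSeq (suc n) m) N       ≡⟨ *-comm (fromℕ (suc m)) _ ⟩
    expSum (logSeq (suc n) m) N * fromℕ (suc m)       ≡⟨ cong (λ z → expSum (harmonic z - harmonic (suc m)) N * fromℕ (suc m)) (ℕP.+-comm (suc m) (n ℕ.* suc m)) ⟩
    expSum (harmonic (n ℕ.* suc m ℕ.+ suc m) - harmonic (suc m)) N * fromℕ (suc m) ≤⟨ exp-harmonic m N (n ℕ.* suc m) ⟩
    fromℕ (n ℕ.* suc m ℕ.+ suc m)                     ≡⟨ cong fromℕ (ℕP.+-comm (n ℕ.* suc m) (suc m)) ⟩
    fromℕ (suc n ℕ.* suc m)                           ≡⟨ trans (fromℕ-* (suc n) (suc m)) (*-comm (fromℕ (suc n)) (fromℕ (suc m))) ⟩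
    fromℕ (suc m) * fromℕ (suc n)                     ∎)
    where open ≤-Reasoning

  1≤2^ : ∀ l → 1 ℕ.≤ 2 ℕ.^ l
  1≤2^ l = ℕP.m^n>0 2 l

  floorLog : ∀ n → 1 ℕ.≤ n → ∃ λ l → 2 ℕ.^ l ℕ.≤ n × n ℕ.< 2 ℕ.^ suc l
  floorLog (suc zero)    _ = 0 , ℕP.≤-refl , ℕ.s≤s (ℕ.s≤s ℕ.z≤n)
  floorLog (suc (suc n)) _ with l , lo , hi ← floorLog (suc n) (ℕ.s≤s ℕ.z≤n) with suc (suc n) ℕP.<? 2 ℕ.^ suc l
  ... | yes h = l , ℕP.m≤n⇒m≤1+n lo , h
  ... | no h  = suc l , ℕP.≮⇒≥ h , ℕP.≤-<-trans hi (ℕP.^-monoʳ-< 2 (ℕ.s≤s (ℕ.s≤s ℕ.z≤n)) (ℕP.n<1+n (suc l)))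

  private
    half-block : ∀ x → 1 ℕ.≤ x → harmonic x + ½ ≤ harmonic (x ℕ.+ x) × harmonic (x ℕ.+ x) ≤ harmonic x + 1ℚ
    half-block (suc y) _ =
      ≤-trans (≤-reflexive (cong (harmonic (suc y) +_) (sym (trans (cong (λ z → fromℕ (suc y) * recip z) eq) (recip-cancel y 1)))))
        (harmonic-≥ (suc y) (suc y) (y ℕ.+ suc y) ℕP.≤-refl) ,
      ≤-trans (harmonic-≤ (suc y) (suc y) y (ℕP.n≤1+n y)) (≤-reflexive (cong (harmonic (suc y) +_) (fromℕ*recip y)))
      where
      eq : suc y ℕ.+ suc y ≡ suc y ℕ.* 2
      eq = sym (trans (ℕP.*-comm (suc y) 2) (cong (suc y ℕ.+_) (ℕP.+-identityʳ (suc y))))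

  -- The block of reciprocals between 2^l and 2^(l+1) contributes at least 1/2 and at most 1.
  harmonic-2^ : ∀ l → 1ℚ + fromℕ l * ½ ≤ harmonic (2 ℕ.^ l) × harmonic (2 ℕ.^ l) ≤ 1ℚ + fromℕ l
  harmonic-2^ zero = ≤-refl , ≤-refl
  harmonic-2^ (suc l) with lo , hi ← harmonic-2^ l | lo′ , hi′ ← half-block (2 ℕ.^ l) (1≤2^ l) =
    (begin
      1ℚ + fromℕ (suc l) * ½             ≡⟨ cong (λ z → 1ℚ + z * ½) (fromℕ-suc l) ⟩
      1ℚ + (1ℚ + fromℕ l) * ½            ≡⟨ solve 1 (λ l → con 1ℚ :+ (con 1ℚ :+ l) :* con ½ := con 1ℚ :+ l :* con ½ :+ con ½) refl (fromℕ l) ⟩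
      1ℚ + fromℕ l * ½ + ½               ≤⟨ +-monoˡ-≤ ½ lo ⟩
      harmonic (2 ℕ.^ l) + ½             ≤⟨ lo′ ⟩
      harmonic (2 ℕ.^ l ℕ.+ 2 ℕ.^ l)     ≡⟨ cong harmonic eq ⟩
      harmonic (2 ℕ.^ suc l)             ∎) ,
    (begin
      harmonic (2 ℕ.^ suc l)             ≡⟨ cong harmonic eq ⟨
      harmonic (2 ℕ.^ l ℕ.+ 2 ℕ.^ l)     ≤⟨ hi′ ⟩
      harmonic (2 ℕ.^ l) + 1ℚ            ≤⟨ +-monoˡ-≤ 1ℚ hi ⟩
      1ℚ + fromℕ l + 1ℚ                  ≡⟨ trans (+-assoc 1ℚ (fromℕ l) 1ℚ) (cong (1ℚ +_) (trans (+-comm (fromℕ l) 1ℚ) (sym (fromℕ-suc l)))) ⟩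
      1ℚ + fromℕ (suc l)                 ∎)
    where
    open ≤-Reasoning
    eq : 2 ℕ.^ l ℕ.+ 2 ℕ.^ l ≡ 2 ℕ.^ suc l
    eq = cong (2 ℕ.^ l ℕ.+_) (sym (ℕP.+-identityʳ (2 ℕ.^ l)))

  -- Refining the mesh increases `logSeq` by at most 1 in total, and for mesh 1 it is a harmonic
  -- number minus 1. So log n is compared with the binary logarithm l up to constants, uniformly in
  -- the approximation index m.
  logSeq-bounds : ∀ n l m → 2 ℕ.^ l ℕ.≤ suc n → suc n ℕ.< 2 ℕ.^ suc l →
                  fromℕ l * ½ ≤ logSeq (suc n) m × logSeq (suc n) m ≤ fromℕ (2 ℕ.+ l)
  logSeq-bounds n l m lo hi =
    (begin
      fromℕ l * ½                          ≡⟨ solve 1 (λ l → l := con 1ℚ :+ l :- con 1ℚ) refl (fromℕ l * ½) ⟩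
      1ℚ + fromℕ l * ½ - 1ℚ                ≤⟨ +-monoˡ-≤ (- 1ℚ) (≤-trans (proj₁ (harmonic-2^ l)) (harmonic-mono (ℕP.≤-trans lo (ℕP.≤-reflexive (sym (ℕP.*-identityʳ (suc n))))))) ⟩
      logSeq (suc n) 0                     ≤⟨ proj₁ tel ⟩
      logSeq (suc n) m                     ∎) ,
    (begin
      logSeq (suc n) m                     ≤⟨ proj₂ tel ⟩
      logSeq (suc n) 0 + 1ℚ                ≡⟨ solve 1 (λ h → h :- con 1ℚ :+ con 1ℚ := h) refl (harmonic (suc n ℕ.* 1)) ⟩
      harmonic (suc n ℕ.* 1)               ≤⟨ harmonic-mono (ℕP.≤-trans (ℕP.≤-reflexive (ℕP.*-identityʳ (suc n))) (ℕP.<⇒≤ hi)) ⟩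
      harmonic (2 ℕ.^ suc l)               ≤⟨ proj₂ (harmonic-2^ (suc l)) ⟩
      1ℚ + fromℕ (suc l)                   ≡⟨ fromℕ-suc (suc l) ⟨
      fromℕ (2 ℕ.+ l)                      ∎)
    where
    open ≤-Reasoning
    tel = telescope (logSeq (suc n)) (recip ∘ suc) (recip-nonNeg ∘ suc) 0 (λ m _ → logSeq-up n m) (λ m _ → logSeq-down n m) m ℕ.z≤n

-- Disjoint cliques and the second moment method

module BlockGraphs where

  open Counting
  open Graphs
  open Expectation
  open RationalBounds renaming (*-cancelˡ-≤ to *-cancelˡ-≤q)
  open PartC using (#-below; S; S?; #S≥; #S≤)
  open MediumCycles using (spanning)
  open import Defs using (Graph; Adj; adj?; symm; irrefl; _∪_; edgeGraph; Hamiltonian; hamiltonian?; δ; α; Independent; pairs; fromℕ; fromℕ-mono; *-mono; *-mono₂; *-nonNeg; +-nonNeg; ≤-+ʳ)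
  open import Data.Nat.Base
  open import Data.Nat.Properties
  open import Data.Nat.DivMod using (m/n*n≤m; m≡m%n+[m/n]*n; m%n<n)
  open import Data.Nat.Solver using (module +-*-Solver)
  open +-*-Solver using (solve; con; _:+_; _:*_; _:=_)
  open import Data.Rational.Base as ℚ using (ℚ; 0ℚ; 1ℚ)
  import Data.Rational.Properties as ℚP
  open import Data.Rational.Solver using () renaming (module +-*-Solver to ℚS)
  open import Data.Unit.Base using (⊤; tt)
  open import Data.Fin.Base as Fin using (Fin; toℕ; fromℕ<)
  import Data.Fin.Properties as Fin
  import Data.Fin.Subset as Subset
  import Data.Fin.Subset.Properties as Subset?
  open import Data.Fin.Subset using (Subset; ∣_∣)
  open import Data.List.Base using (List; []; _∷_; length; allFin; map)
  open import Data.List.Properties using (length-map; length-tabulate)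
  open import Data.List.Membership.Propositional using (_∈_; find; lose)
  open import Data.List.Relation.Unary.Any as Any using (here; there)
  open import Data.List.Relation.Unary.All as All using (All; []; _∷_)
  open import Data.List.Relation.Unary.AllPairs using ([]; _∷_)
  open import Data.List.Relation.Unary.Unique.Propositional using (Unique)
  open import Data.List.Membership.Propositional.Properties using (∈-map⁻)
  import Data.List.Relation.Unary.Unique.Propositional.Properties as Unique
  open import Data.Product.Base using (_×_; _,_; proj₁; proj₂)
  open import Data.Sum.Base using (_⊎_; inj₁; inj₂)
  open import Function.Base using (_∘_)
  open import Relation.Binary.PropositionalEquality
  open import Relation.Nullary using (¬_; Dec; yes; no; contradiction)
  open import Relation.Nullary.Decidable using (_×-dec_; _⊎-dec_; ¬?)

  m<[1+m/n]*n : ∀ m k → m < suc (m / suc k) * suc k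
  m<[1+m/n]*n m k = subst (_< suc (m / suc k) * suc k) (sym (m≡m%n+[m/n]*n m (suc k))) (+-monoˡ-< (m / suc k * suc k) (m%n<n m (suc k)))

  module _ {A : Set} where

    ∑q-+ : ∀ (f g : A → ℚ) xs → ∑q (λ x → f x ℚ.+ g x) xs ≡ ∑q f xs ℚ.+ ∑q g xs
    ∑q-+ f g []       = refl
    ∑q-+ f g (x ∷ xs) = trans (cong (f x ℚ.+ g x ℚ.+_) (∑q-+ f g xs))
      (ℚS.solve 4 (λ a b c d → a ℚS.:+ b ℚS.:+ (c ℚS.:+ d) ℚS.:= a ℚS.:+ c ℚS.:+ (b ℚS.:+ d)) refl (f x) (g x) (∑q f xs) (∑q g xs))

    𝔼-linear : ∀ p (xs : List A) w → 𝔼q p xs (∑q w) ≡ p ℚ.* ∑q w xs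
    𝔼-linear p []       w = sym (ℚP.*-zeroʳ p)
    𝔼-linear p (x ∷ xs) w = trans (cong₂ (λ a b → p ℚ.* a ℚ.+ (1ℚ ℚ.- p) ℚ.* b)
        (trans (𝔼-+ p xs (λ _ → w x) (∑q w)) (cong₂ ℚ._+_ (𝔼-const p xs (w x)) (𝔼-linear p xs w))) (𝔼-linear p xs w))
      (ℚS.solve 3 (λ p w s → p ℚS.:* (w ℚS.:+ p ℚS.:* s) ℚS.:+ (ℚS.con 1ℚ ℚS.:- p) ℚS.:* (p ℚS.:* s) ℚS.:= p ℚS.:* (w ℚS.:+ s)) refl p (w x) (∑q w xs))

    ∏-zero : ∀ {w : A → ℚ} {x xs} → x ∈ xs → w x ≡ 0ℚ → ∏ w xs ≡ 0ℚ
    ∏-zero {w} {x} {_ ∷ xs} (here refl) e = trans (cong (ℚ._* ∏ w xs) e) (ℚP.*-zeroˡ (∏ w xs))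
    ∏-zero {w} {x} {y ∷ xs} (there x∈) e  = trans (cong (w y ℚ.*_) (∏-zero {w} x∈ e)) (ℚP.*-zeroʳ (w y))

  ind≡fromℕ : ∀ {P : Set} (d : Dec P) → ind d ≡ fromℕ (bit d)
  ind≡fromℕ (yes _) = refl
  ind≡fromℕ (no _)  = refl

  ∑q-delta : ∀ {c} (i : Fin c) {y} → 0ℚ ℚ.≤ y → ∀ {js} → Unique js → ∑q (λ j → ind (i Fin.≟ j) ℚ.* y) js ℚ.≤ y
  ∑q-delta i 0≤y [] = 0≤y
  ∑q-delta i {y} 0≤y {j ∷ js} (j∉ ∷ u) with i Fin.≟ j
  ... | no _     = ℚP.≤-trans (ℚP.≤-reflexive (trans (cong (ℚ._+ ∑q (λ j → ind (i Fin.≟ j) ℚ.* y) js) (ℚP.*-zeroˡ y)) (ℚP.+-identityˡ _))) (∑q-delta i 0≤y u)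
  ... | yes refl = ℚP.≤-reflexive (trans (cong₂ ℚ._+_ (ℚP.*-identityˡ y) (trans (∑q-cong js none) (trans (∑q-const 0ℚ js) (ℚP.*-zeroʳ (fromℕ (length js)))))) (ℚP.+-identityʳ y))
    where
    none : ∀ {j′} → j′ ∈ js → ind (i Fin.≟ j′) ℚ.* y ≡ 0ℚ
    none {j′} j∈ with i Fin.≟ j′
    ... | yes refl = contradiction refl (All.lookup j∉ j∈)
    ... | no _     = ℚP.*-zeroˡ y

  -- c blocks of size k + 1 at the beginning of Fin n; all other vertices have block number c.
  module _ (n k c : ℕ) where

    private
      b : ℕ
      b = suc k

    block : Fin n → ℕ
    block v = toℕ v / b ⊓ c

    block≤c : ∀ v → block v ≤ c
    block≤c v = m⊓n≤n (toℕ v / b) c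

    blockGraph : Graph n
    blockGraph = record
      { Adj    = λ u v → u ≢ v × block u ≡ block v
      ; adj?   = λ u v → ¬? (u Fin.≟ v) ×-dec (block u ≟ block v)
      ; symm   = λ (ne , e) → ne ∘ sym , sym e
      ; irrefl = λ (ne , _) → ne refl
      }

    module _ (room : suc c * b ≤ n) where

      private
        inBlock : ∀ {i} → i < c → ∀ v → S n (i * b) b v → block v ≡ i
        inBlock {i} i<c v (lo , hi) = trans (cong (_⊓ c) eq) (m≤n⇒m⊓n≡m (<⇒≤ i<c))
          where
          eq : toℕ v / b ≡ i
          eq = ≤-antisym (≤-pred (*-cancelʳ-< b (toℕ v / b) (suc i) (≤-<-trans (m/n*n≤m (toℕ v) b) (<-≤-trans hi (≤-reflexive (+-comm (i * b) b))))))
                         (≤-pred (*-cancelʳ-< b i (suc (toℕ v / b)) (≤-<-trans lo (m<[1+m/n]*n (toℕ v) k))))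

        inBlock⁻ : ∀ {i} → i < c → ∀ v → block v ≡ i → S n (i * b) b v
        inBlock⁻ {i} i<c v e = subst (λ z → z * b ≤ toℕ v) eq (m/n*n≤m (toℕ v) b) ,
            <-≤-trans (m<[1+m/n]*n (toℕ v) k) (≤-reflexive (trans (cong (λ z → suc z * b) eq) (+-comm b (i * b))))
          where
          eq : toℕ v / b ≡ i
          eq with ≤-total (toℕ v / b) c
          ... | inj₁ h = trans (sym (m≤n⇒m⊓n≡m h)) e
          ... | inj₂ h = contradiction (trans (sym e) (m≥n⇒m⊓n≡n h)) (<⇒≢ i<c)

        rest : ∀ v → ¬ toℕ v < c * b → block v ≡ c
        rest v h = m≥n⇒m⊓n≡n (≤-pred (*-cancelʳ-< b c (suc (toℕ v / b)) (≤-<-trans (≮⇒≥ h) (m<[1+m/n]*n (toℕ v) k))))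

        fits : ∀ {i} → i < c → i * b + b < n
        fits {i} i<c = <-≤-trans (≤-<-trans (≤-trans (≤-reflexive (+-comm (i * b) b)) (*-monoˡ-≤ b i<c)) (m<n+m (c * b) (s≤s z≤n))) room

      block? : ∀ i v → Dec (block v ≡ i)
      block? i v = block v ≟ i

      #block : ∀ {i} → i < c → # (block? i) ≡ b
      #block {i} i<c = ≤-antisym
        (≤-trans (#-mono (block? i) (S? n (i * b) b) (inBlock⁻ i<c)) (#S≤ n (i * b) b (fits i<c)))
        (≤-trans (#S≥ n (i * b) b (fits i<c)) (#-mono (S? n (i * b) b) (block? i) (inBlock i<c)))

      Z : Fin n → Set
      Z v = toℕ v < c * b

      Z? : ∀ v → Dec (Z v)
      Z? v = toℕ v <? c * b

      #Z : # Z? ≡ c * b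
      #Z = #-below (c * b) (≤-trans (m≤n+m (c * b) b) room)

      #rest : b ≤ # (block? c)
      #rest = +-cancelˡ-≤ (c * b) b _ (begin
        c * b + b                              ≡⟨ +-comm (c * b) b ⟩
        suc c * b                              ≤⟨ room ⟩
        n                                      ≡⟨ #-all {n} {λ _ → ⊤} (λ _ → yes tt) (λ _ → tt) ⟨
        # {n} {λ _ → ⊤} (λ _ → yes tt)         ≤⟨ #-⊎ Z? (block? c) (λ _ → yes tt) split ⟩
        # Z? + # (block? c)                    ≡⟨ cong (_+ # (block? c)) #Z ⟩
        c * b + # (block? c)                   ∎)
        where
        open ≤-Reasoning
        split : ∀ v → ⊤ → Z v ⊎ block v ≡ c
        split v _ with Z? v
        ... | yes p = inj₁ p
        ... | no p  = inj₂ (rest v p)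

      private
        #block-nbrs : ∀ v → # (block? (block v)) ≡ suc (# (adj? blockGraph v))
        #block-nbrs v = ≤-antisym
          (≤-trans (#-⊎ (Fin._≟ v) (adj? blockGraph v) (block? (block v)) split) (≤-reflexive (cong (_+ # (adj? blockGraph v)) (#-singleton v))))
          (≤-trans (≤-reflexive (cong (_+ # (adj? blockGraph v)) (sym (#-singleton v))))
            (#-disjoint (Fin._≟ v) (adj? blockGraph v) (block? (block v)) (λ { u refl → refl }) (λ u (_ , e) → sym e) (λ u e (ne , _) → ne (sym e))))
          where
          split : ∀ u → block u ≡ block v → u ≡ v ⊎ Adj blockGraph v u
          split u e with u Fin.≟ v
          ... | yes p = inj₁ p
          ... | no p  = inj₂ (p ∘ sym , sym e)

        #block≥ : ∀ v → b ≤ # (block? (block v))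
        #block≥ v with m≤n⇒m<n∨m≡n (block≤c v)
        ... | inj₁ lt = ≤-reflexive (sym (#block lt))
        ... | inj₂ eq = subst (λ z → b ≤ # (block? z)) (sym eq) #rest

        1≤n : 1 ≤ n
        1≤n = ≤-trans (s≤s z≤n) room

      δ-block : 1 ≤ c → δ blockGraph ≡ k
      δ-block 1≤c = ≤-antisym
        (subst (δ blockGraph ≤_) (suc-injective (trans (sym (#block-nbrs v₀)) (trans (cong (λ z → # (block? z)) b₀) (#block 1≤c)))) (δ≤# blockGraph v₀))
        (≤δ blockGraph (≤-trans (n≤1+n k) (≤-trans (m≤m+n b (c * b)) room)) λ v → ≤-pred (≤-trans (#block≥ v) (≤-reflexive (#block-nbrs v))))
        where
        v₀ : Fin n
        v₀ = fromℕ< 1≤n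
        b₀ : block v₀ ≡ 0
        b₀ = inBlock 1≤c v₀ (z≤n , subst (_< 0 * b + b) (sym (Fin.toℕ-fromℕ< 1≤n)) (s≤s z≤n))

      α-block : α blockGraph ≤ suc c
      α-block = α≤ blockGraph λ T ind → begin
        ∣ T ∣                                  ≡⟨ ∣S∣≡# T ⟩
        # (Subset?._∈? T)                      ≡⟨ length-elems (Subset?._∈? T) ⟨
        length (elems (Subset?._∈? T))         ≡⟨ length-map f (elems (Subset?._∈? T)) ⟨
        length (map f (elems (Subset?._∈? T))) ≤⟨ length≤# (λ _ → yes tt) (distinct T ind (elems-unique (Subset?._∈? T)) (All.tabulate (∈-elems⁻ (Subset?._∈? T)))) (All.tabulate λ _ → tt) ⟩
        # {suc c} {λ _ → ⊤} (λ _ → yes tt)     ≤⟨ #≤n {suc c} {λ _ → ⊤} (λ _ → yes tt) ⟩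
        suc c                                  ∎
        where
        open ≤-Reasoning
        f : Fin n → Fin (suc c)
        f v = fromℕ< (s≤s (block≤c v))
        f-block : ∀ {u v} → f u ≡ f v → block u ≡ block v
        f-block {u} {v} e = trans (sym (Fin.toℕ-fromℕ< (s≤s (block≤c u)))) (trans (cong toℕ e) (Fin.toℕ-fromℕ< (s≤s (block≤c v))))
        distinct : ∀ T → Independent blockGraph T → ∀ {xs} → Unique xs → All (Subset._∈ T) xs → Unique (map f xs)
        distinct T ind [] [] = []
        distinct T ind {x ∷ xs} (x∉ ∷ u) (x∈ ∷ al) = All.tabulate new ∷ distinct T ind u al
          where
          new : ∀ {y} → y ∈ map f xs → f x ≢ y
          new y∈ e with z , z∈ , refl ← ∈-map⁻ f y∈ = ind x z x∈ (All.lookup al z∈) (All.lookup x∉ z∈ , f-block {x} {z} e)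

      -- Only pairs towards the vertices outside `Z`, which lie in the last block, count for block
      -- i. For distinct small blocks these sets of pairs are disjoint, which makes the events
      -- independent; pairs between two small blocks would spoil this and are treated separately as
      -- `Inner`.
      Cross : ℕ → Fin n × Fin n → Set
      Cross i (u , v) = (block u ≡ i × ¬ Z v) ⊎ (block v ≡ i × ¬ Z u)

      cross? : ∀ i e → Dec (Cross i e)
      cross? i (u , v) = (block? i u ×-dec ¬? (Z? v)) ⊎-dec (block? i v ×-dec ¬? (Z? u))

      Inner : Fin n × Fin n → Set
      Inner (u , v) = Z u × Z v

      inner? : ∀ e → Dec (Inner e)
      inner? (u , v) = Z? u ×-dec Z? v

      cross-disjoint : ∀ {i j} → i < c → j < c → ∀ e → Cross i e → Cross j e → i ≡ j
      cross-disjoint _   _   (u , v) (inj₁ (p , _)) (inj₁ (q , _)) = trans (sym p) q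
      cross-disjoint _   _   (u , v) (inj₂ (p , _)) (inj₂ (q , _)) = trans (sym p) q
      cross-disjoint i<c j<c (u , v) (inj₁ (p , ¬v)) (inj₂ (q , _)) = contradiction (trans (sym q) (rest v ¬v)) (<⇒≢ j<c)
      cross-disjoint i<c j<c (u , v) (inj₂ (p , ¬u)) (inj₁ (q , _)) = contradiction (trans (sym q) (rest u ¬u)) (<⇒≢ j<c)

      #cross : ∀ {i} → i < c → sumL (λ e → bit (cross? i e)) (pairs n) ≤ b * n
      #cross {i} i<c = begin
        sumL (λ e → bit (cross? i e)) (pairs n)
          ≤⟨ sumL-mono (pairs n) (λ { {u , v} _ → bit-⊎ (block? i u) (block? i v) (cross? i (u , v)) λ { (inj₁ (p , _)) → inj₁ p ; (inj₂ (p , _)) → inj₂ p } }) ⟩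
        sumL (λ (u , v) → bit (block? i u) + bit (block? i v)) (pairs n)
          ≡⟨ pairSum (λ u v → bit (block? i u)) ⟩
        ∑ (λ u → ∑ (λ v → (bit (u Fin.<? v) + bit (v Fin.<? u)) * bit (block? i u)))
          ≤⟨ ∑-mono (λ u → ∑-mono λ v → ≤-trans (*-monoˡ-≤ (bit (block? i u)) (bit-disjoint (u Fin.<? v) (v Fin.<? u) (yes tt) (λ _ → tt) (λ _ → tt) <-asym)) (≤-reflexive (+-identityʳ _))) ⟩
        ∑ (λ u → ∑ {n} (λ v → bit (block? i u)))
          ≡⟨ trans (∑-cong λ u → trans (∑-const n (bit (block? i u))) (*-comm n _)) (trans (∑-*ʳ n _) (cong (_* n) (#block i<c))) ⟩
        b * n ∎
        where open ≤-Reasoning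

      #inner : sumL (λ e → bit (inner? e)) (pairs n) ≤ c * b * (c * b)
      #inner = begin
        sumL (λ e → bit (inner? e)) (pairs n)
          ≤⟨ sumL-mono (pairs n) (λ { {u , v} _ → m≤m+n (bit (inner? (u , v))) (bit (inner? (v , u))) }) ⟩
        sumL (λ (u , v) → bit (inner? (u , v)) + bit (inner? (v , u))) (pairs n)
          ≡⟨ pairSum (λ u v → bit (inner? (u , v))) ⟩
        ∑ (λ u → ∑ (λ v → (bit (u Fin.<? v) + bit (v Fin.<? u)) * bit (inner? (u , v))))
          ≤⟨ ∑-mono (λ u → ∑-mono λ v → ≤-trans (*-monoˡ-≤ (bit (inner? (u , v))) (bit-disjoint (u Fin.<? v) (v Fin.<? u) (yes tt) (λ _ → tt) (λ _ → tt) <-asym)) (≤-trans (≤-reflexive (+-identityʳ _)) (both u v))) ⟩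
        ∑ (λ u → ∑ (λ v → bit (Z? u) * bit (Z? v)))
          ≡⟨ trans (∑-cong λ u → ∑-*ˡ (bit (Z? u)) (λ v → bit (Z? v))) (trans (∑-*ʳ (# Z?) (λ u → bit (Z? u))) (cong₂ _*_ #Z #Z)) ⟩
        c * b * (c * b) ∎
        where
        open ≤-Reasoning
        both : ∀ u v → bit (inner? (u , v)) ≤ bit (Z? u) * bit (Z? v)
        both u v with Z? u | Z? v
        ... | yes _ | yes _ = ≤-refl
        ... | yes _ | no _  = z≤n
        ... | no _  | _     = z≤n

      -- An edge that leaves block i would be an edge of `F` that is inner or crosses at i. So no
      -- path leaves the block, whereas a Hamilton cycle visits both block i and the last block.
      isolated : ∀ {i} → i < c → ∀ F → (∀ {e} → e ∈ F → ¬ Inner e) → (∀ {e} → e ∈ F → ¬ Cross i e) → ¬ Hamiltonian (blockGraph ∪ edgeGraph F)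
      isolated {i} i<c F noInner noCross cyc =
        let C , len , uq , u , v , p , r = cyclePath {G = H} cyc
            x , inI = #-find (block? i) (subst (1 ≤_) (sym (#block i<c)) (s≤s z≤n))
            y , inC = #-find (block? c) (≤-trans (s≤s z≤n) #rest)
        in <⇒≢ i<c (trans (sym (proj₁ (same p (spanning C uq len y)) (proj₂ (same p (spanning C uq len x)) inI))) inC)
        where
        H = blockGraph ∪ edgeGraph F
        Zi : ∀ v → block v ≡ i → Z v
        Zi v e with Z? v
        ... | yes z = z
        ... | no ¬z = contradiction (trans (sym e) (rest v ¬z)) (<⇒≢ i<c)
        hit : ∀ {u v} → block u ≡ i → (u , v) ∈ F ⊎ (v , u) ∈ F → ∀ {A : Set} → A
        hit {u} {v} e uv with Z? v | uv
        ... | yes z | inj₁ e∈ = contradiction (Zi u e , z) (noInner e∈)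
        ... | yes z | inj₂ e∈ = contradiction (z , Zi u e) (noInner e∈)
        ... | no ¬z | inj₁ e∈ = contradiction (inj₁ (e , ¬z)) (noCross e∈)
        ... | no ¬z | inj₂ e∈ = contradiction (inj₂ (e , ¬z)) (noCross e∈)
        move : ∀ {u v} → Adj H u v → block u ≡ i → block v ≡ i
        move (inj₁ (_ , e))  e′ = trans (sym e) e′
        move (inj₂ (_ , uv)) e′ = hit e′ uv
        same : ∀ {u v xs z} → Path (Adj H) u v xs → z ∈ xs → (block u ≡ i → block z ≡ i) × (block z ≡ i → block u ≡ i)
        same end        (here refl) = (λ e → e) , λ e → e
        same (step r p) (here refl) = (λ e → e) , λ e → e
        same (step r p) (there z∈)  = let f , g = same p z∈ in (λ e → f (move r e)) , λ e → move (symm H r) (g e)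

      module _ {q : ℚ} (0≤q : 0ℚ ℚ.≤ q) (q≤1 : q ℚ.≤ 1ℚ) where

        private
          open ℚP.≤-Reasoning
          E = 𝔼q q (pairs n)
          0≤1-q = ≤⇒0≤- q≤1

          -- The event that no edge of `F` crosses at block i, written as a product over the edges
          -- so that `𝔼-∏` applies to it and to products of two such events.
          Y : Fin c → List (Fin n × Fin n) → ℚ
          Y i = ∏ (λ e → ind (¬? (cross? (toℕ i) e)))

          X : List (Fin n × Fin n) → ℚ
          X F = ∑q (λ i → Y i F) (allFin c)

          x : Fin c → ℚ
          x i = pow (1ℚ ℚ.- q) (sumL (λ e → bit (cross? (toℕ i) e)) (pairs n))

          EY : ∀ i → E (Y i) ≡ x i
          EY i = trans (𝔼-∏ q (pairs n) _) (∏-01 (cross? (toℕ i)) q (pairs n))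

          0≤x : ∀ i → 0ℚ ℚ.≤ x i
          0≤x i = pow-nonNeg (sumL (λ e → bit (cross? (toℕ i) e)) (pairs n)) 0≤1-q

          μ : ℚ
          μ = ∑q x (allFin c)

          EX : E X ≡ μ
          EX = trans (𝔼-∑ q (pairs n) (allFin c) Y) (∑q-cong (allFin c) λ {i} _ → EY i)

          ∏-* : ∀ {A : Set} (f g : A → ℚ) xs → ∏ f xs ℚ.* ∏ g xs ≡ ∏ (λ e → f e ℚ.* g e) xs
          ∏-* f g []       = refl
          ∏-* f g (y ∷ xs) = trans (ℚS.solve 4 (λ a b c d → a ℚS.:* b ℚS.:* (c ℚS.:* d) ℚS.:= a ℚS.:* c ℚS.:* (b ℚS.:* d)) refl (f y) (∏ f xs) (g y) (∏ g xs)) (cong (f y ℚ.* g y ℚ.*_) (∏-* f g xs))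

          ∏-cong : ∀ {A : Set} {f g : A → ℚ} → (∀ e → f e ≡ g e) → ∀ xs → ∏ f xs ≡ ∏ g xs
          ∏-cong h []       = refl
          ∏-cong h (y ∷ xs) = cong₂ ℚ._*_ (h y) (∏-cong h xs)

          idem : ∀ {P : Set} (d : Dec P) → ind d ℚ.* ind d ≡ ind d
          idem (yes _) = refl
          idem (no _)  = refl

          factor : ∀ {P Q : Set} (d : Dec P) (d′ : Dec Q) → (P → Q → 1 ≤ 0) →
                   q ℚ.* (ind (¬? d) ℚ.* ind (¬? d′)) ℚ.+ (1ℚ ℚ.- q) ≡ (q ℚ.* ind (¬? d) ℚ.+ (1ℚ ℚ.- q)) ℚ.* (q ℚ.* ind (¬? d′) ℚ.+ (1ℚ ℚ.- q))
          factor (yes p) (yes p′) h = contradiction (h p p′) λ ()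
          factor (yes p) (no _)  h = ℚS.solve 1 (λ q → q ℚS.:* (ℚS.con 0ℚ ℚS.:* ℚS.con 1ℚ) ℚS.:+ (ℚS.con 1ℚ ℚS.:- q) ℚS.:= (q ℚS.:* ℚS.con 0ℚ ℚS.:+ (ℚS.con 1ℚ ℚS.:- q)) ℚS.:* (q ℚS.:* ℚS.con 1ℚ ℚS.:+ (ℚS.con 1ℚ ℚS.:- q))) refl q
          factor (no _)  (yes _) h = ℚS.solve 1 (λ q → q ℚS.:* (ℚS.con 1ℚ ℚS.:* ℚS.con 0ℚ) ℚS.:+ (ℚS.con 1ℚ ℚS.:- q) ℚS.:= (q ℚS.:* ℚS.con 1ℚ ℚS.:+ (ℚS.con 1ℚ ℚS.:- q)) ℚS.:* (q ℚS.:* ℚS.con 0ℚ ℚS.:+ (ℚS.con 1ℚ ℚS.:- q))) refl q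
          factor (no _)  (no _)  h = ℚS.solve 1 (λ q → q ℚS.:* (ℚS.con 1ℚ ℚS.:* ℚS.con 1ℚ) ℚS.:+ (ℚS.con 1ℚ ℚS.:- q) ℚS.:= (q ℚS.:* ℚS.con 1ℚ ℚS.:+ (ℚS.con 1ℚ ℚS.:- q)) ℚS.:* (q ℚS.:* ℚS.con 1ℚ ℚS.:+ (ℚS.con 1ℚ ℚS.:- q))) refl q

          -- For i ≠ j the events depend on disjoint sets of pairs, so the expectation factorises
          -- entry by entry. On the diagonal an indicator equals its square.
          EYY : ∀ i j → E (λ F → Y i F ℚ.* Y j F) ℚ.≤ x i ℚ.* x j ℚ.+ ind (i Fin.≟ j) ℚ.* x i
          EYY i j with i Fin.≟ j
          ... | yes refl = begin
            E (λ F → Y i F ℚ.* Y i F)             ≡⟨ 𝔼-cong q (pairs n) (λ F → trans (∏-* _ _ F) (∏-cong (λ e → idem (¬? (cross? (toℕ i) e))) F)) ⟩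
            E (Y i)                               ≡⟨ EY i ⟩
            x i                                   ≡⟨ ℚP.*-identityˡ (x i) ⟨
            1ℚ ℚ.* x i                            ≤⟨ ≤-+ʳ (*-nonNeg (0≤x i) (0≤x i)) ⟩
            1ℚ ℚ.* x i ℚ.+ x i ℚ.* x i            ≡⟨ ℚP.+-comm (1ℚ ℚ.* x i) (x i ℚ.* x i) ⟩
            x i ℚ.* x i ℚ.+ 1ℚ ℚ.* x i            ∎
          ... | no i≢j = begin
            E (λ F → Y i F ℚ.* Y j F)             ≡⟨ 𝔼-cong q (pairs n) (λ F → ∏-* _ _ F) ⟩
            E (∏ (λ e → ind (¬? (cross? (toℕ i) e)) ℚ.* ind (¬? (cross? (toℕ j) e)))) ≡⟨ 𝔼-∏ q (pairs n) _ ⟩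
            ∏ (λ e → q ℚ.* (ind (¬? (cross? (toℕ i) e)) ℚ.* ind (¬? (cross? (toℕ j) e))) ℚ.+ (1ℚ ℚ.- q)) (pairs n)
              ≡⟨ trans (∏-cong (λ e → factor (cross? (toℕ i) e) (cross? (toℕ j) e) λ p p′ → contradiction (Fin.toℕ-injective (cross-disjoint (Fin.toℕ<n i) (Fin.toℕ<n j) e p p′)) i≢j) (pairs n)) (sym (∏-* _ _ (pairs n))) ⟩
            ∏ (λ e → q ℚ.* ind (¬? (cross? (toℕ i) e)) ℚ.+ (1ℚ ℚ.- q)) (pairs n) ℚ.* ∏ (λ e → q ℚ.* ind (¬? (cross? (toℕ j) e)) ℚ.+ (1ℚ ℚ.- q)) (pairs n)
              ≡⟨ cong₂ ℚ._*_ (∏-01 (cross? (toℕ i)) q (pairs n)) (∏-01 (cross? (toℕ j)) q (pairs n)) ⟩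
            x i ℚ.* x j                           ≡⟨ ℚP.+-identityʳ (x i ℚ.* x j) ⟨
            x i ℚ.* x j ℚ.+ 0ℚ                    ≡⟨ cong (x i ℚ.* x j ℚ.+_) (sym (ℚP.*-zeroˡ (x i))) ⟩
            x i ℚ.* x j ℚ.+ 0ℚ ℚ.* x i            ∎

          square : ∀ F → X F ℚ.* X F ≡ ∑q (λ i → ∑q (λ j → Y i F ℚ.* Y j F) (allFin c)) (allFin c)
          square F = trans (sym (∑q-* (X F) (λ i → Y i F) (allFin c)))
            (∑q-cong (allFin c) λ {i} _ → trans (ℚP.*-comm (X F) (Y i F)) (sym (∑q-* (Y i F) (λ j → Y j F) (allFin c))))

          EXX : E (λ F → X F ℚ.* X F) ℚ.≤ μ ℚ.* μ ℚ.+ μ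
          EXX = begin
            E (λ F → X F ℚ.* X F)
              ≡⟨ trans (𝔼-cong q (pairs n) square) (trans (𝔼-∑ q (pairs n) (allFin c) (λ i F → ∑q (λ j → Y i F ℚ.* Y j F) (allFin c)))
                   (∑q-cong (allFin c) λ {i} _ → 𝔼-∑ q (pairs n) (allFin c) (λ j F → Y i F ℚ.* Y j F))) ⟩
            ∑q (λ i → ∑q (λ j → E (λ F → Y i F ℚ.* Y j F)) (allFin c)) (allFin c)
              ≤⟨ ∑q-mono (allFin c) (λ {i} _ → ∑q-mono (allFin c) λ {j} _ → EYY i j) ⟩
            ∑q (λ i → ∑q (λ j → x i ℚ.* x j ℚ.+ ind (i Fin.≟ j) ℚ.* x i) (allFin c)) (allFin c)
              ≤⟨ ∑q-mono (allFin c) (λ {i} _ → ℚP.≤-trans (ℚP.≤-reflexive (∑q-+ _ _ (allFin c)))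
                   (ℚP.+-mono-≤ (ℚP.≤-reflexive (trans (∑q-* (x i) x (allFin c)) (ℚP.*-comm (x i) μ))) (∑q-delta i (0≤x i) (Unique.allFin⁺ c)))) ⟩
            ∑q (λ i → μ ℚ.* x i ℚ.+ x i) (allFin c)
              ≡⟨ trans (∑q-+ (λ i → μ ℚ.* x i) x (allFin c)) (cong (ℚ._+ μ) (∑q-* μ x (allFin c))) ⟩
            μ ℚ.* μ ℚ.+ μ ∎

          variance : E (λ F → (X F ℚ.- μ) ℚ.* (X F ℚ.- μ)) ℚ.≤ μ
          variance = begin
            E (λ F → (X F ℚ.- μ) ℚ.* (X F ℚ.- μ))
              ≡⟨ 𝔼-cong q (pairs n) (λ F → ℚS.solve 2 (λ X m → (X ℚS.:- m) ℚS.:* (X ℚS.:- m) ℚS.:= X ℚS.:* X ℚS.:+ ((ℚS.:- (m ℚS.:+ m)) ℚS.:* X ℚS.:+ m ℚS.:* m)) refl (X F) μ) ⟩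
            E (λ F → X F ℚ.* X F ℚ.+ (ℚ.- (μ ℚ.+ μ) ℚ.* X F ℚ.+ μ ℚ.* μ))
              ≡⟨ trans (𝔼-+ q (pairs n) (λ F → X F ℚ.* X F) _) (cong (E (λ F → X F ℚ.* X F) ℚ.+_) (trans (𝔼-+ q (pairs n) (λ F → ℚ.- (μ ℚ.+ μ) ℚ.* X F) _)
                   (cong₂ ℚ._+_ (trans (𝔼-* q (pairs n) (ℚ.- (μ ℚ.+ μ)) X) (cong (ℚ.- (μ ℚ.+ μ) ℚ.*_) EX)) (𝔼-const q (pairs n) (μ ℚ.* μ))))) ⟩
            E (λ F → X F ℚ.* X F) ℚ.+ (ℚ.- (μ ℚ.+ μ) ℚ.* μ ℚ.+ μ ℚ.* μ)
              ≤⟨ ℚP.+-monoˡ-≤ _ EXX ⟩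
            μ ℚ.* μ ℚ.+ μ ℚ.+ (ℚ.- (μ ℚ.+ μ) ℚ.* μ ℚ.+ μ ℚ.* μ)
              ≡⟨ ℚS.solve 1 (λ m → m ℚS.:* m ℚS.:+ m ℚS.:+ ((ℚS.:- (m ℚS.:+ m)) ℚS.:* m ℚS.:+ m ℚS.:* m) ℚS.:= m) refl μ ⟩
            μ ∎

          I : List (Fin n × Fin n) → ℚ
          I = ∑q (λ e → ind (inner? e))

          0≤I : ∀ F → 0ℚ ℚ.≤ I F
          0≤I F = ∑q-nonNeg F λ e → 0≤ind (inner? e)

          ham : List (Fin n × Fin n) → ℚ
          ham F = ind (hamiltonian? (blockGraph ∪ edgeGraph F))

          0≤μ : 0ℚ ℚ.≤ μ
          0≤μ = ∑q-nonNeg (allFin c) 0≤x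

          -- A Hamilton cycle needs a random edge among the small blocks, and then I ≥ 1; or else a
          -- crossing edge at every small block, and then X = 0 and the squared deviation is μ².
          bound : ∀ F → Hamiltonian (blockGraph ∪ edgeGraph F) → μ ℚ.* μ ℚ.≤ μ ℚ.* μ ℚ.* I F ℚ.+ (X F ℚ.- μ) ℚ.* (X F ℚ.- μ)
          bound F cyc with Any.any? inner? F
          ... | yes any with e , e∈ , ie ← find any = begin
            μ ℚ.* μ                                                      ≡⟨ ℚP.*-identityʳ (μ ℚ.* μ) ⟨
            μ ℚ.* μ ℚ.* 1ℚ                                               ≤⟨ *-mono (*-nonNeg 0≤μ 0≤μ) (ℚP.≤-trans (ℚP.≤-reflexive (sym (one (inner? e) ie))) (∑q-term (λ e → 0≤ind (inner? e)) e∈)) ⟩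
            μ ℚ.* μ ℚ.* I F                                              ≤⟨ ≤-+ʳ (square-nonNeg (X F ℚ.- μ)) ⟩
            μ ℚ.* μ ℚ.* I F ℚ.+ (X F ℚ.- μ) ℚ.* (X F ℚ.- μ)              ∎
            where
            one : ∀ {P : Set} (d : Dec P) → P → ind d ≡ 1ℚ
            one (yes _) _ = refl
            one (no ¬p) p = contradiction p ¬p
          ... | no none = begin
            μ ℚ.* μ                                                      ≡⟨ ℚS.solve 1 (λ m → m ℚS.:* m ℚS.:= (ℚS.con 0ℚ ℚS.:- m) ℚS.:* (ℚS.con 0ℚ ℚS.:- m)) refl μ ⟩
            (0ℚ ℚ.- μ) ℚ.* (0ℚ ℚ.- μ)                                    ≡⟨ cong (λ z → (z ℚ.- μ) ℚ.* (z ℚ.- μ)) (sym X≡0) ⟩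
            (X F ℚ.- μ) ℚ.* (X F ℚ.- μ)                                  ≤⟨ ≤-+ʳ (*-nonNeg (*-nonNeg 0≤μ 0≤μ) (0≤I F)) ⟩
            (X F ℚ.- μ) ℚ.* (X F ℚ.- μ) ℚ.+ μ ℚ.* μ ℚ.* I F              ≡⟨ ℚP.+-comm ((X F ℚ.- μ) ℚ.* (X F ℚ.- μ)) (μ ℚ.* μ ℚ.* I F) ⟩
            μ ℚ.* μ ℚ.* I F ℚ.+ (X F ℚ.- μ) ℚ.* (X F ℚ.- μ)              ∎
            where
            zero-ind : ∀ {P : Set} (d : Dec P) → P → ind (¬? d) ≡ 0ℚ
            zero-ind (yes _) _ = refl
            zero-ind (no ¬p) p = contradiction p ¬p
            Y≡0 : ∀ i → Y i F ≡ 0ℚ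
            Y≡0 i with Any.any? (cross? (toℕ i)) F
            ... | yes any with e , e∈ , ce ← find any = ∏-zero {w = λ e → ind (¬? (cross? (toℕ i) e))} e∈ (zero-ind (cross? (toℕ i) e) ce)
            ... | no none′ = contradiction cyc (isolated (Fin.toℕ<n i) F (λ e∈ ie → none (lose e∈ ie)) (λ e∈ ce → none′ (lose e∈ ce)))
            X≡0 : X F ≡ 0ℚ
            X≡0 = trans (∑q-cong (allFin c) λ {i} _ → Y≡0 i) (trans (∑q-const 0ℚ (allFin c)) (ℚP.*-zeroʳ (fromℕ (length (allFin c)))))

          moment : μ ℚ.* μ ℚ.* E ham ℚ.≤ μ ℚ.* μ ℚ.* E I ℚ.+ μ
          moment = begin
            μ ℚ.* μ ℚ.* E ham                                            ≡⟨ 𝔼-* q (pairs n) (μ ℚ.* μ) ham ⟨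
            E (λ F → μ ℚ.* μ ℚ.* ham F)                                  ≤⟨ 𝔼-mono 0≤q q≤1 (pairs n) pointwise ⟩
            E (λ F → μ ℚ.* μ ℚ.* I F ℚ.+ (X F ℚ.- μ) ℚ.* (X F ℚ.- μ))    ≡⟨ trans (𝔼-+ q (pairs n) (λ F → μ ℚ.* μ ℚ.* I F) _) (cong (ℚ._+ E (λ F → (X F ℚ.- μ) ℚ.* (X F ℚ.- μ))) (𝔼-* q (pairs n) (μ ℚ.* μ) I)) ⟩
            μ ℚ.* μ ℚ.* E I ℚ.+ E (λ F → (X F ℚ.- μ) ℚ.* (X F ℚ.- μ))    ≤⟨ ℚP.+-monoʳ-≤ (μ ℚ.* μ ℚ.* E I) variance ⟩
            μ ℚ.* μ ℚ.* E I ℚ.+ μ                                        ∎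
            where
            pointwise : ∀ F → μ ℚ.* μ ℚ.* ham F ℚ.≤ μ ℚ.* μ ℚ.* I F ℚ.+ (X F ℚ.- μ) ℚ.* (X F ℚ.- μ)
            pointwise F = go (hamiltonian? (blockGraph ∪ edgeGraph F))
              where
              go : (d : Dec (Hamiltonian (blockGraph ∪ edgeGraph F))) → μ ℚ.* μ ℚ.* ind d ℚ.≤ μ ℚ.* μ ℚ.* I F ℚ.+ (X F ℚ.- μ) ℚ.* (X F ℚ.- μ)
              go (yes cyc) = ℚP.≤-trans (ℚP.≤-reflexive (ℚP.*-identityʳ (μ ℚ.* μ))) (bound F cyc)
              go (no _)    = ℚP.≤-trans (ℚP.≤-reflexive (ℚP.*-zeroʳ (μ ℚ.* μ))) (+-nonNeg (*-nonNeg (*-nonNeg 0≤μ 0≤μ) (0≤I F)) (square-nonNeg (X F ℚ.- μ)))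

          EI : E I ℚ.≤ q ℚ.* fromℕ (c * b * (c * b))
          EI = ℚP.≤-trans (ℚP.≤-reflexive (𝔼-linear q (pairs n) (λ e → ind (inner? e)))) (*-mono 0≤q
            (ℚP.≤-trans (ℚP.≤-reflexive (trans (∑q-cong (pairs n) λ {e} _ → ind≡fromℕ (inner? e)) (∑q-fromℕ (λ e → bit (inner? e)) (pairs n)))) (fromℕ-mono #inner)))

          μ≥ : fromℕ c ℚ.* pow (1ℚ ℚ.- q) (b * n) ℚ.≤ μ
          μ≥ = ℚP.≤-trans (ℚP.≤-reflexive (trans (cong (λ z → fromℕ z ℚ.* pow (1ℚ ℚ.- q) (b * n)) (sym (length-tabulate {n = c} (λ i → i)))) (sym (∑q-const (pow (1ℚ ℚ.- q) (b * n)) (allFin c)))))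
            (∑q-mono (allFin c) λ {i} _ → pow-antitone 0≤1-q 1-q≤1 (#cross (Fin.toℕ<n i)))
            where
            1-q≤1 : 1ℚ ℚ.- q ℚ.≤ 1ℚ
            1-q≤1 = ℚP.≤-trans (ℚP.+-monoʳ-≤ 1ℚ (ℚP.neg-antimono-≤ 0≤q)) (ℚP.≤-reflexive (ℚP.+-identityʳ 1ℚ))

        -- Division of `moment` by μ² bounds the probability of a Hamilton cycle by E I + 1/μ. The
        -- number `P` is a lower bound for μ and at most the reciprocal of the bound for E I, so
        -- each summand is at most 1/P.
        probHamBlocks : ∀ {P} → 0ℚ ℚ.< P → P ℚ.≤ fromℕ c ℚ.* pow (1ℚ ℚ.- q) (b * n) → P ℚ.* (q ℚ.* fromℕ (c * b * (c * b))) ℚ.≤ 1ℚ →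
                        P ℚ.* 𝔼q q (pairs n) (λ F → ind (hamiltonian? (blockGraph ∪ edgeGraph F))) ℚ.≤ fromℕ 2
        probHamBlocks {P} 0<P P≤ PI≤1 = *-cancelˡ-≤q {μ ℚ.* μ} 0<μμ (begin
          μ ℚ.* μ ℚ.* (P ℚ.* E ham)               ≡⟨ ℚS.solve 3 (λ m P h → m ℚS.:* m ℚS.:* (P ℚS.:* h) ℚS.:= P ℚS.:* (m ℚS.:* m ℚS.:* h)) refl μ P (E ham) ⟩
          P ℚ.* (μ ℚ.* μ ℚ.* E ham)               ≤⟨ *-mono (ℚP.<⇒≤ 0<P) moment ⟩
          P ℚ.* (μ ℚ.* μ ℚ.* E I ℚ.+ μ)           ≡⟨ ℚS.solve 3 (λ m P i → P ℚS.:* (m ℚS.:* m ℚS.:* i ℚS.:+ m) ℚS.:= m ℚS.:* m ℚS.:* (P ℚS.:* i) ℚS.:+ m ℚS.:* P) refl μ P (E I) ⟩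
          μ ℚ.* μ ℚ.* (P ℚ.* E I) ℚ.+ μ ℚ.* P     ≤⟨ ℚP.+-mono-≤ (*-mono (ℚP.<⇒≤ 0<μμ) (ℚP.≤-trans (*-mono (ℚP.<⇒≤ 0<P) EI) PI≤1)) (*-mono 0≤μ (ℚP.≤-trans P≤ μ≥)) ⟩
          μ ℚ.* μ ℚ.* 1ℚ ℚ.+ μ ℚ.* μ              ≡⟨ ℚS.solve 1 (λ m → m ℚS.:* m ℚS.:* ℚS.con 1ℚ ℚS.:+ m ℚS.:* m ℚS.:= m ℚS.:* m ℚS.:* ℚS.con (fromℕ 2)) refl μ ⟩
          μ ℚ.* μ ℚ.* fromℕ 2                     ∎)
          where
          0<μμ : 0ℚ ℚ.< μ ℚ.* μ
          0<μμ = ℚP.<-≤-trans (ℚP.positive⁻¹ (P ℚ.* P) {{ℚP.pos*pos⇒pos P {{ℚ.positive 0<P}} P {{ℚ.positive 0<P}}}}) (*-mono₂ (ℚP.<⇒≤ 0<P) (ℚP.≤-trans P≤ μ≥) (ℚP.<⇒≤ 0<P) (ℚP.≤-trans P≤ μ≥))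

-- Choice of the parameters for part (b)

module PartB where

  open Expectation
  open RationalBounds renaming (*-cancelˡ-≤ to *-cancelˡ-≤q)
  open ExpLogBounds
  open BlockGraphs
  open PartC using (clamp≤; nonHam-lower)
  import Defs as D
  open import Defs using (ℝ; seq; ι; nat; log; logSeq; expSum; _/ℕ_; _^ʳ_; recip; recip-nonNeg; Eventually; IsProbability; AAS[_∪𝔾_⊨_]; archimedean′; scale; Graph; Hamiltonian; hamiltonian?; nonHamiltonian?; _∪_; edgeGraph; pairs; δ; α; fromℕ; fromℕ-mono; fromℕ-nonNeg; fromℕ-pos; fromℕ*recip; *-mono; *-mono₂; *-nonNeg; +-nonNeg; ≤-+ʳ)
  open import Data.Nat.Base
  open import Data.Nat.Properties
  open import Data.Nat.DivMod using (m/n*n≤m; /-monoˡ-≤; m*n/n≡m)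
  open import Data.Empty using (⊥-elim)
  open import Data.Nat.Solver using (module +-*-Solver)
  open +-*-Solver using (solve; con; _:+_; _:*_; _:=_)
  open import Data.Rational.Base as ℚ using (ℚ; 0ℚ; 1ℚ; ½)
  import Data.Rational.Properties as ℚP
  open import Data.Rational.Solver using () renaming (module +-*-Solver to ℚS)
  open import Data.Product.Base using (∃; _×_; _,_; proj₁; proj₂)
  open import Relation.Binary.PropositionalEquality
  open import Relation.Nullary using (¬_)

  private
    inv : ∀ N → 1 ≤ N → fromℕ N ℚ.* recip N ≡ 1ℚ
    inv (suc N) _ = fromℕ*recip N

    pos : ∀ N → 1 ≤ N → 0ℚ ℚ.< fromℕ N
    pos (suc N) _ = fromℕ-pos N

  n<2^n : ∀ n → n < 2 ^ n
  n<2^n zero    = s≤s z≤n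
  n<2^n (suc n) = ≤-trans (+-mono-≤ (1≤2^ n) (n<2^n n)) (≤-reflexive (cong (2 ^ n +_) (sym (+-identityʳ (2 ^ n)))))

  lg : ℕ → ℕ
  lg zero    = 0
  lg (suc n) = proj₁ (floorLog (suc n) (s≤s z≤n))

  lg-≤ : ∀ n → 2 ^ lg (suc n) ≤ suc n
  lg-≤ n = proj₁ (proj₂ (floorLog (suc n) (s≤s z≤n)))

  lg-< : ∀ n → suc n < 2 ^ suc (lg (suc n))
  lg-< n = proj₂ (proj₂ (floorLog (suc n) (s≤s z≤n)))

  lg-large : ∀ L n → 2 ^ L ≤ n → L ≤ lg n
  lg-large L zero    h = n≤0⇒n≡0 (≤-trans (<⇒≤ (n<2^n L)) h) ▹ z≤n
    where
    _▹_ : L ≡ 0 → 0 ≤ 0 → L ≤ 0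
    e ▹ _ = ≤-reflexive e
  lg-large L (suc n) h = ≤-pred (≰⇒> λ le → <⇒≱ (lg-< n) (≤-trans (^-monoʳ-≤ 2 le) h))

  -- The hypotheses n^ε ≤ k ≤ n^(1-ε) only enter through 2^j ≤ k and k 2^j ≤ n, where j is proportional to log n.
  module _ {ε : ℝ} {e₀ : ℚ} (0<e₀ : 0ℚ ℚ.< e₀) {M₀ : ℕ} (e₀≤ : ∀ m → M₀ ≤ m → e₀ ℚ.≤ seq ε m) (ε≤1 : ∀ m → M₀ ≤ m → seq ε m ℚ.≤ 1ℚ)
           {A : ℕ} (2≤A : fromℕ 2 ℚ.≤ fromℕ A ℚ.* e₀) {n k j : ℕ} (Aj≤ : A * j ≤ lg (suc n)) where

    private
      open ℚP.≤-Reasoning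
      l = lg (suc n)

      L : ℕ → ℚ
      L = logSeq (suc n)

      -- Here ε is at least `e₀` and log n at least l/2, so ε log n is at least `e₀` · A · j / 2.
      -- The choice of A with A · `e₀` ≥ 2 makes this at least j.
      j≤ : ∀ m → M₀ ≤ m → fromℕ j ℚ.≤ seq ε m ℚ.* L m
      j≤ m M₀≤m = begin
        fromℕ j                              ≡⟨ ℚS.solve 1 (λ j → j ℚS.:= ℚS.con (fromℕ 2) ℚS.:* j ℚS.:* ℚS.con ½) refl (fromℕ j) ⟩
        fromℕ 2 ℚ.* fromℕ j ℚ.* ½            ≤⟨ *-monoʳ (ℚP.nonNegative⁻¹ ½) (*-monoʳ (fromℕ-nonNeg j) 2≤A) ⟩
        fromℕ A ℚ.* e₀ ℚ.* fromℕ j ℚ.* ½     ≡⟨ ℚS.solve 3 (λ A e j → A ℚS.:* e ℚS.:* j ℚS.:* ℚS.con ½ ℚS.:= e ℚS.:* (A ℚS.:* j ℚS.:* ℚS.con ½)) refl (fromℕ A) e₀ (fromℕ j) ⟩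
        e₀ ℚ.* (fromℕ A ℚ.* fromℕ j ℚ.* ½)   ≡⟨ cong (λ z → e₀ ℚ.* (z ℚ.* ½)) (fromℕ-* A j) ⟨
        e₀ ℚ.* (fromℕ (A * j) ℚ.* ½)         ≤⟨ *-mono (ℚP.<⇒≤ 0<e₀) (*-monoʳ (ℚP.nonNegative⁻¹ ½) (fromℕ-mono Aj≤)) ⟩
        e₀ ℚ.* (fromℕ l ℚ.* ½)               ≤⟨ *-mono₂ (ℚP.<⇒≤ 0<e₀) (e₀≤ m M₀≤m) (*-nonNeg (fromℕ-nonNeg l) (ℚP.nonNegative⁻¹ ½)) (proj₁ (logSeq-bounds n l m (lg-≤ n) (lg-< n))) ⟩
        seq ε m ℚ.* L m                      ∎

      0≤L : ∀ m → 0ℚ ℚ.≤ L m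
      0≤L m = ℚP.≤-trans (*-nonNeg (fromℕ-nonNeg l) (ℚP.nonNegative⁻¹ ½)) (proj₁ (logSeq-bounds n l m (lg-≤ n) (lg-< n)))

    2^j≤k : (suc n ^ʳ ε) D.≤ nat k → 2 ^ j ≤ k
    2^j≤k h =
      let N , hN = h ½ (ℚP.positive⁻¹ ½)
          -- The index is at least `j` because j doublings, starting from the single term 1, require
          -- j + 1 terms of the series.
          m = M₀ ⊔ (N ⊔ j)
          M₀≤m = m≤m⊔n M₀ (N ⊔ j)
          N≤m = ≤-trans (m≤m⊔n N j) (m≤n⊔m M₀ (N ⊔ j))
          j≤m = ≤-trans (m≤n⊔m N j) (m≤n⊔m M₀ (N ⊔ j))
      in fromℕ-cancel-½ (begin
        fromℕ (2 ^ j)                               ≡⟨ ℚP.*-identityˡ (fromℕ (2 ^ j)) ⟨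
        expSum 0ℚ 1 ℚ.* fromℕ (2 ^ j)               ≤⟨ expSum-double ℚP.≤-refl 1 j ⟩
        expSum (0ℚ ℚ.+ fromℕ j) (j + 1)             ≡⟨ cong (λ z → expSum z (j + 1)) (ℚP.+-identityˡ (fromℕ j)) ⟩
        expSum (fromℕ j) (j + 1)                    ≤⟨ expSum-len (fromℕ-nonNeg j) (≤-trans (≤-reflexive (+-comm j 1)) (s≤s j≤m)) ⟩
        expSum (fromℕ j) (suc m)                    ≤⟨ expSum-mono (fromℕ-nonNeg j) (j≤ m M₀≤m) (suc m) ⟩
        expSum (seq ε m ℚ.* L m) (suc m)            ≤⟨ hN m N≤m ⟩
        fromℕ k ℚ.+ ½                               ∎)

    -- Multiplying n^(1-ε) by 2^j adds j to its exponent, and j ≤ ε log n restores at most exp (log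
    -- n). The error η is chosen so small that it is still 1/2 after the multiplication.
    k2^j≤n : nat k D.≤ (suc n ^ʳ (ι 1ℚ D.- ε)) → k * 2 ^ j ≤ suc n
    k2^j≤n h =
      let η , 0<η , eq = scale (fromℕ (2 ^ j)) (pos (2 ^ j) (1≤2^ j)) (ℚP.positive⁻¹ ½)
          N , hN = h η 0<η
          m = M₀ ⊔ N
          M₀≤m = m≤m⊔n M₀ N
          y = (1ℚ ℚ.- seq ε m) ℚ.* L m
          0≤y = *-nonNeg (≤⇒0≤- (ε≤1 m M₀≤m)) (0≤L m)
      in fromℕ-cancel-½ (begin
        fromℕ (k * 2 ^ j)                                         ≡⟨ fromℕ-* k (2 ^ j) ⟩
        fromℕ k ℚ.* fromℕ (2 ^ j)                                 ≤⟨ *-monoʳ (fromℕ-nonNeg (2 ^ j)) (hN m (m≤n⊔m M₀ N)) ⟩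
        (expSum y (suc m) ℚ.+ η) ℚ.* fromℕ (2 ^ j)                ≡⟨ ℚS.solve 3 (λ e h p → (e ℚS.:+ h) ℚS.:* p ℚS.:= e ℚS.:* p ℚS.:+ p ℚS.:* h) refl (expSum y (suc m)) η (fromℕ (2 ^ j)) ⟩
        expSum y (suc m) ℚ.* fromℕ (2 ^ j) ℚ.+ fromℕ (2 ^ j) ℚ.* η ≤⟨ ℚP.+-mono-≤ (expSum-double 0≤y (suc m) j) (ℚP.≤-reflexive eq) ⟩
        expSum (y ℚ.+ fromℕ j) (j + suc m) ℚ.+ ½                  ≤⟨ ℚP.+-monoˡ-≤ ½ (expSum-mono (+-nonNeg 0≤y (fromℕ-nonNeg j)) (ℚP.≤-trans (ℚP.+-monoʳ-≤ y (j≤ m M₀≤m))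
                                                                       (ℚP.≤-reflexive (ℚS.solve 2 (λ e L → (ℚS.con 1ℚ ℚS.:- e) ℚS.:* L ℚS.:+ e ℚS.:* L ℚS.:= L) refl (seq ε m) (L m)))) (j + suc m)) ⟩
        expSum (L m) (j + suc m) ℚ.+ ½                            ≤⟨ ℚP.+-monoˡ-≤ ½ (exp-log n m (j + suc m)) ⟩
        fromℕ (suc n) ℚ.+ ½                                       ∎)

  module _ {n k g : ℕ} (1≤g : 1 ≤ g) (2^≤k : 2 ^ (8 * g) ≤ k) (k2^≤n : k * 2 ^ (8 * g) ≤ n) where

    private
      -- Each of 4^g small cliques will have no crossing edge with probability at least 2^(-g), so
      -- at least 2^g of them are expected.
      c = 2 ^ (2 * g)
      1≤k : 1 ≤ k
      1≤k = ≤-trans (1≤2^ (8 * g)) 2^≤k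

      suc≤ : ∀ {x} → 1 ≤ x → suc x ≤ 2 * x
      suc≤ {x} h = ≤-trans (+-monoˡ-≤ x h) (≤-reflexive (cong (x +_) (sym (+-identityʳ x))))

      fewer : ∀ {x y} → x ≤ y → 2 ^ x ≤ 2 ^ y
      fewer = ^-monoʳ-≤ 2

    blocksRoom : suc c * suc k ≤ n
    blocksRoom = begin
      suc c * suc k              ≤⟨ *-mono-≤ (suc≤ (1≤2^ (2 * g))) (suc≤ 1≤k) ⟩
      2 * c * (2 * k)            ≡⟨ solve 2 (λ c k → con 2 :* c :* (con 2 :* k) := k :* (con 2 :* (con 2 :* c))) refl c k ⟩
      k * 2 ^ (2 + 2 * g)        ≤⟨ *-monoʳ-≤ k (fewer (≤-trans (+-monoˡ-≤ (2 * g) (*-monoʳ-≤ 2 1≤g)) (≤-trans (m≤m+n (2 * g + 2 * g) (4 * g)) (≤-reflexive (solve 1 (λ g → con 2 :* g :+ con 2 :* g :+ con 4 :* g := con 8 :* g) refl g))))) ⟩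
      k * 2 ^ (8 * g)            ≤⟨ k2^≤n ⟩
      n                          ∎
      where open ≤-Reasoning

    -- This becomes the bound on the independence number, which is at most the number of cliques;
    -- `A₂` will be an integer that is at least the reciprocal of the prescribed constant.
    fewBlocks : ∀ {A₂} → A₂ ≤ g → A₂ * suc c ≤ k
    fewBlocks {A₂} A₂≤g = begin
      A₂ * suc c                     ≤⟨ *-mono-≤ (≤-trans A₂≤g (<⇒≤ (n<2^n g))) (suc≤ (1≤2^ (2 * g))) ⟩
      2 ^ g * 2 ^ (1 + 2 * g)        ≡⟨ ^-distribˡ-+-* 2 g (1 + 2 * g) ⟨
      2 ^ (g + (1 + 2 * g))          ≤⟨ fewer (≤-trans (+-monoʳ-≤ g (+-monoˡ-≤ (2 * g) 1≤g)) (≤-trans (m≤m+n _ (4 * g)) (≤-reflexive (solve 1 (λ g → g :+ (g :+ con 2 :* g) :+ con 4 :* g := con 8 :* g) refl g)))) ⟩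
      2 ^ (8 * g)                    ≤⟨ 2^≤k ⟩
      k                              ∎
      where open ≤-Reasoning

    module _ {q : ℚ} (0≤q : 0ℚ ℚ.≤ q) (q≤1 : q ℚ.≤ 1ℚ) (small : fromℕ 8 ℚ.* (fromℕ (n * k) ℚ.* q) ℚ.≤ fromℕ g) where

      private
        nk = n * k
        g′ = pred g
        -- The exponent (k + 1)n is at most 2nk and is covered by g pieces of length M. Since M q ≤
        -- 1/2, Bernoulli's inequality gives (1 - q)^M ≥ 1/2 for each piece.
        M = suc (2 * nk / suc g′)
        g≡ : suc g′ ≡ g
        g≡ = suc-pred g {{>-nonZero 1≤g}}

        gM≥ : 2 * nk ≤ g * M
        gM≥ = subst (λ z → 2 * nk ≤ z * M) g≡ (≤-trans (<⇒≤ (m<[1+m/n]*n (2 * nk) g′)) (≤-reflexive (*-comm M (suc g′))))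

        1≤n : 1 ≤ n
        1≤n = ≤-trans (*-mono-≤ 1≤k (1≤2^ (8 * g))) k2^≤n

        g≤2nk : g ≤ 2 * nk
        g≤2nk = ≤-trans (<⇒≤ (n<2^n g)) (≤-trans (fewer (m≤n*m g 8)) (≤-trans 2^≤k (≤-trans (≤-trans (≤-reflexive (sym (+-identityʳ k))) (*-monoˡ-≤ k 1≤n)) (m≤n*m nk 2))))

        gM≤ : g * M ≤ 4 * nk
        gM≤ = begin
          g * M                        ≡⟨ cong (_* M) g≡ ⟨
          suc g′ * M                   ≡⟨ trans (*-suc (suc g′) _) (cong (suc g′ +_) (*-comm (suc g′) (2 * nk / suc g′))) ⟩
          suc g′ + 2 * nk / suc g′ * suc g′ ≤⟨ +-mono-≤ (≤-trans (≤-reflexive g≡) g≤2nk) (m/n*n≤m (2 * nk) (suc g′)) ⟩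
          2 * nk + 2 * nk              ≡⟨ solve 1 (λ x → con 2 :* x :+ con 2 :* x := con 4 :* x) refl nk ⟩
          4 * nk                       ∎
          where open ≤-Reasoning

        4nkq : fromℕ (4 * nk) ℚ.* q ℚ.≤ fromℕ g ℚ.* ½
        4nkq = begin
          fromℕ (4 * nk) ℚ.* q                           ≡⟨ cong (ℚ._* q) (fromℕ-* 4 nk) ⟩
          fromℕ 4 ℚ.* fromℕ nk ℚ.* q                     ≡⟨ ℚS.solve 2 (λ x q → ℚS.con (fromℕ 4) ℚS.:* x ℚS.:* q ℚS.:= ℚS.con (fromℕ 8) ℚS.:* (x ℚS.:* q) ℚS.:* ℚS.con ½) refl (fromℕ nk) q ⟩
          fromℕ 8 ℚ.* (fromℕ nk ℚ.* q) ℚ.* ½             ≤⟨ *-monoʳ (ℚP.nonNegative⁻¹ ½) small ⟩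
          fromℕ g ℚ.* ½                                  ∎
          where open ℚP.≤-Reasoning

        Mq≤½ : fromℕ M ℚ.* q ℚ.≤ ½
        Mq≤½ = *-cancelˡ-≤q {fromℕ g} (pos g 1≤g) (ℚP.≤-trans (ℚP.≤-reflexive (trans (sym (ℚP.*-assoc (fromℕ g) (fromℕ M) q)) (cong (ℚ._* q) (sym (fromℕ-* g M)))))
          (ℚP.≤-trans (*-monoʳ 0≤q (fromℕ-mono gM≤)) 4nkq))

        powM : ½ ℚ.≤ pow (1ℚ ℚ.- q) M
        powM = ℚP.≤-trans (ℚP.+-monoʳ-≤ 1ℚ (ℚP.neg-antimono-≤ Mq≤½)) (bernoulli⁻ M 0≤q q≤1)

        1-q≤1 : 1ℚ ℚ.- q ℚ.≤ 1ℚ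
        1-q≤1 = ℚP.≤-trans (ℚP.+-monoʳ-≤ 1ℚ (ℚP.neg-antimono-≤ 0≤q)) (ℚP.≤-reflexive (ℚP.+-identityʳ 1ℚ))

        powN : pow ½ g ℚ.≤ pow (1ℚ ℚ.- q) (suc k * n)
        powN = begin
          pow ½ g                                  ≤⟨ pow-mono g (ℚP.nonNegative⁻¹ ½) powM ⟩
          pow (pow (1ℚ ℚ.- q) M) g                 ≡⟨ pow-* (1ℚ ℚ.- q) g M ⟨
          pow (1ℚ ℚ.- q) (g * M)                   ≤⟨ pow-antitone (≤⇒0≤- q≤1) 1-q≤1 (≤-trans (≤-trans (*-monoˡ-≤ n (suc≤ 1≤k)) (≤-reflexive (trans (*-assoc 2 k n) (cong (2 *_) (*-comm k n))))) gM≥) ⟩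
          pow (1ℚ ℚ.- q) (suc k * n)               ∎
          where open ℚP.≤-Reasoning

        P = fromℕ (2 ^ g)

        P≤ : P ℚ.≤ fromℕ c ℚ.* pow (1ℚ ℚ.- q) (suc k * n)
        P≤ = begin
          P                                              ≡⟨ ℚP.*-identityʳ P ⟨
          P ℚ.* 1ℚ                                       ≡⟨ cong (P ℚ.*_) (trans (sym (pow-one g)) (trans (pow-distrib (fromℕ 2) ½ g) (cong (ℚ._* pow ½ g) (sym (fromℕ-pow 2 g))))) ⟩
          P ℚ.* (P ℚ.* pow ½ g)                          ≡⟨ ℚP.*-assoc P P (pow ½ g) ⟨
          P ℚ.* P ℚ.* pow ½ g                            ≡⟨ cong (ℚ._* pow ½ g) (trans (sym (fromℕ-* (2 ^ g) (2 ^ g))) (cong fromℕ (trans (sym (^-distribˡ-+-* 2 g g)) (cong (λ z → 2 ^ (g + z)) (sym (+-identityʳ g)))))) ⟩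
          fromℕ c ℚ.* pow ½ g                            ≤⟨ *-mono (fromℕ-nonNeg c) powN ⟩
          fromℕ c ℚ.* pow (1ℚ ℚ.- q) (suc k * n)         ∎
          where open ℚP.≤-Reasoning

        cb = c * suc k
        Q = 2 ^ (3 * g)

        -- The exponent 8g splits into 3g + g + 4g: the reserve `Q`, the factor `P` and the square
        -- of the number c of cliques. The reserve absorbs the factor g in 4nkq ≤ g/2.
        count : Q * (2 ^ g * (cb * cb)) ≤ 4 * nk
        count = begin
          Q * (2 ^ g * (cb * cb))                              ≤⟨ *-monoʳ-≤ Q (*-monoʳ-≤ (2 ^ g) (*-mono-≤ cb≤ cb≤)) ⟩
          Q * (2 ^ g * (c * (2 * k) * (c * (2 * k))))          ≡⟨ solve 4 (λ Q p c k → Q :* (p :* (c :* (con 2 :* k) :* (c :* (con 2 :* k)))) := con 4 :* ((k :* (Q :* p :* (c :* c))) :* k)) refl Q (2 ^ g) c k ⟩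
          4 * ((k * (Q * 2 ^ g * (c * c))) * k)                ≡⟨ cong (λ z → 4 * ((k * z) * k)) expo ⟩
          4 * ((k * 2 ^ (8 * g)) * k)                          ≤⟨ *-monoʳ-≤ 4 (*-monoˡ-≤ k k2^≤n) ⟩
          4 * nk                                               ∎
          where
          open ≤-Reasoning
          cb≤ : cb ≤ c * (2 * k)
          cb≤ = *-monoʳ-≤ c (suc≤ 1≤k)
          expo : Q * 2 ^ g * (c * c) ≡ 2 ^ (8 * g)
          expo = trans (cong₂ _*_ (sym (^-distribˡ-+-* 2 (3 * g) g)) (sym (^-distribˡ-+-* 2 (2 * g) (2 * g))))
            (trans (sym (^-distribˡ-+-* 2 (3 * g + g) (2 * g + 2 * g))) (cong (2 ^_) (solve 1 (λ g → con 3 :* g :+ g :+ (con 2 :* g :+ con 2 :* g) := con 8 :* g) refl g)))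

        PI : P ℚ.* (q ℚ.* fromℕ (cb * cb)) ℚ.≤ 1ℚ
        PI = *-cancelˡ-≤q {fromℕ Q} (pos Q (1≤2^ (3 * g))) (begin
          fromℕ Q ℚ.* (P ℚ.* (q ℚ.* fromℕ (cb * cb)))          ≡⟨ ℚS.solve 4 (λ Q P q x → Q ℚS.:* (P ℚS.:* (q ℚS.:* x)) ℚS.:= Q ℚS.:* (P ℚS.:* x) ℚS.:* q) refl (fromℕ Q) P q (fromℕ (cb * cb)) ⟩
          fromℕ Q ℚ.* (P ℚ.* fromℕ (cb * cb)) ℚ.* q            ≡⟨ cong (ℚ._* q) (trans (cong (fromℕ Q ℚ.*_) (sym (fromℕ-* (2 ^ g) (cb * cb)))) (sym (fromℕ-* Q (2 ^ g * (cb * cb))))) ⟩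
          fromℕ (Q * (2 ^ g * (cb * cb))) ℚ.* q                ≤⟨ *-monoʳ 0≤q (fromℕ-mono count) ⟩
          fromℕ (4 * nk) ℚ.* q                                 ≤⟨ 4nkq ⟩
          fromℕ g ℚ.* ½                                        ≤⟨ *-mono (fromℕ-nonNeg g) ½≤1 ⟩
          fromℕ g ℚ.* 1ℚ                                       ≡⟨ ℚP.*-identityʳ (fromℕ g) ⟩
          fromℕ g                                              ≤⟨ fromℕ-mono (≤-trans (<⇒≤ (n<2^n g)) (fewer (m≤n*m g 3))) ⟩
          fromℕ Q                                              ≡⟨ ℚP.*-identityʳ (fromℕ Q) ⟨
          fromℕ Q ℚ.* 1ℚ                                       ∎)
          where
          open ℚP.≤-Reasoning
          ½≤1 : ½ ℚ.≤ 1ℚ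
          ½≤1 = ≤-+ʳ {½} (ℚP.nonNegative⁻¹ ½)

      hamUnlikely : fromℕ g ℚ.* 𝔼q q (pairs n) (λ F → ind (hamiltonian? (blockGraph n k c ∪ edgeGraph F))) ℚ.≤ fromℕ 2
      hamUnlikely = ℚP.≤-trans (*-monoʳ 0≤h (fromℕ-mono (<⇒≤ (n<2^n g)))) (probHamBlocks n k c blocksRoom 0≤q q≤1 (pos (2 ^ g) (1≤2^ g)) P≤ PI)
        where
        0≤h = ℚP.≤-trans (ℚP.≤-reflexive (sym (𝔼-const q (pairs n) 0ℚ))) (𝔼-mono 0≤q q≤1 (pairs n) λ F → 0≤ind (hamiltonian? (blockGraph n k c ∪ edgeGraph F)))

  module _ (A′ : ℕ) where

    private
      A = suc A′
      D = 512 * A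

    grade : ℕ → ℕ
    grade n = lg n / A / 8

    grade-large : ∀ G n → 2 ^ (G * 8 * A) ≤ n → G ≤ grade n
    grade-large G n h = ≤-trans (≤-reflexive (sym (m*n/n≡m G 8))) (/-monoˡ-≤ 8
      (≤-trans (≤-reflexive (sym (m*n/n≡m (G * 8) A))) (/-monoˡ-≤ A (lg-large (G * 8 * A) n h))))

    grade-≤ : ∀ n → A * (8 * grade n) ≤ lg n
    grade-≤ n = ≤-trans (*-monoʳ-≤ A (≤-trans (≤-reflexive (*-comm 8 (grade n))) (m/n*n≤m (lg n / A) 8)))
      (≤-trans (≤-reflexive (*-comm A (lg n / A))) (m/n*n≤m (lg n) A))

    private
      -- The constant 512 collects the losses: 8 from the left side, 4 from 3 + l ≤ 4l, 2 from g + 1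
      -- ≤ 2g, and 8 from the definition of `grade`.
      log-≤ : ∀ n → 1 ≤ grade n → 8 * (3 + lg n) ≤ D * grade n
      log-≤ n 1≤g = begin
        8 * (3 + l)                   ≤⟨ *-monoʳ-≤ 8 (≤-trans (+-monoˡ-≤ l (*-monoʳ-≤ 3 1≤l)) (≤-reflexive (solve 1 (λ l → con 3 :* l :+ l := con 4 :* l) refl l))) ⟩
        8 * (4 * l)                   ≤⟨ *-monoʳ-≤ 8 (*-monoʳ-≤ 4 (<⇒≤ (m<[1+m/n]*n l A′))) ⟩
        8 * (4 * (suc (l / A) * A))   ≤⟨ *-monoʳ-≤ 8 (*-monoʳ-≤ 4 (*-monoˡ-≤ A (m<[1+m/n]*n (l / A) 7))) ⟩
        8 * (4 * (suc g * 8 * A))     ≤⟨ *-monoʳ-≤ 8 (*-monoʳ-≤ 4 (*-monoˡ-≤ A (*-monoˡ-≤ 8 (+-monoˡ-≤ g 1≤g)))) ⟩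
        8 * (4 * ((g + g) * 8 * A))   ≡⟨ solve 2 (λ g A → con 8 :* (con 4 :* ((g :+ g) :* con 8 :* A)) := con 512 :* A :* g) refl g A ⟩
        D * g                         ∎
        where
        open ≤-Reasoning
        l = lg n
        g = grade n
        1≤l : 1 ≤ l
        1≤l = ≤-trans (*-mono-≤ {1} {A} (s≤s z≤n) (*-mono-≤ {1} {8} (s≤s z≤n) 1≤g)) (grade-≤ n)

    -- The number 3 + lg n that arises is the upper bound 2 + lg n for log n, and 1 for the
    -- approximation of p after multiplication by nkD.
    rare : ∀ n k {p : ℝ} → 1 ≤ grade n → 1 ≤ k → p D.≤ ι (recip D) D.* log n /ℕ (n * k) →
           ∃ λ M → ∀ m → M ≤ m → fromℕ 8 ℚ.* (fromℕ (n * k) ℚ.* clamp (seq p m)) ℚ.≤ fromℕ (grade n)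
    rare zero    k ()
    rare n@(suc n′) k {p} 1≤g 1≤k h =
      let e , 0<e , eq = scale (fromℕ (nk * D)) (pos (nk * D) (*-mono-≤ 1≤nk 1≤D)) (ℚP.positive⁻¹ 1ℚ)
          M , hM = h e 0<e
      in M , λ m M≤m →
      let L = logSeq n m
          q = clamp (seq p m)
          lo , hi = logSeq-bounds n′ l m (lg-≤ n′) (lg-< n′)
          0≤L = ℚP.≤-trans (*-nonNeg (fromℕ-nonNeg l) (ℚP.nonNegative⁻¹ ½)) lo
          q≤ : q ℚ.≤ recip D ℚ.* L ℚ.* recip nk ℚ.+ e
          q≤ = clamp≤ {seq p m} (+-nonNeg (*-nonNeg (*-nonNeg (recip-nonNeg D) 0≤L) (recip-nonNeg nk)) (ℚP.<⇒≤ 0<e)) (hM m M≤m)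
      in *-cancelˡ-≤q {fromℕ D} (pos D 1≤D) (begin
        fromℕ D ℚ.* (fromℕ 8 ℚ.* (fromℕ nk ℚ.* q))
          ≡⟨ ℚS.solve 4 (λ D e n q → D ℚS.:* (e ℚS.:* (n ℚS.:* q)) ℚS.:= e ℚS.:* (n ℚS.:* D ℚS.:* q)) refl (fromℕ D) (fromℕ 8) (fromℕ nk) q ⟩
        fromℕ 8 ℚ.* (fromℕ nk ℚ.* fromℕ D ℚ.* q)
          ≤⟨ *-mono (fromℕ-nonNeg 8) (*-mono (*-nonNeg (fromℕ-nonNeg nk) (fromℕ-nonNeg D)) q≤) ⟩
        fromℕ 8 ℚ.* (fromℕ nk ℚ.* fromℕ D ℚ.* (recip D ℚ.* L ℚ.* recip nk ℚ.+ e))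
          ≡⟨ cong (fromℕ 8 ℚ.*_) (ℚS.solve 6 (λ n D r L s e → n ℚS.:* D ℚS.:* (r ℚS.:* L ℚS.:* s ℚS.:+ e) ℚS.:= (n ℚS.:* s) ℚS.:* (D ℚS.:* r) ℚS.:* L ℚS.:+ n ℚS.:* D ℚS.:* e) refl (fromℕ nk) (fromℕ D) (recip D) L (recip nk) e) ⟩
        fromℕ 8 ℚ.* ((fromℕ nk ℚ.* recip nk) ℚ.* (fromℕ D ℚ.* recip D) ℚ.* L ℚ.+ fromℕ nk ℚ.* fromℕ D ℚ.* e)
          ≡⟨ cong₂ (λ a b → fromℕ 8 ℚ.* (a ℚ.* L ℚ.+ b)) (cong₂ ℚ._*_ (inv nk 1≤nk) (inv D 1≤D)) (trans (cong (ℚ._* e) (sym (fromℕ-* nk D))) eq) ⟩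
        fromℕ 8 ℚ.* (1ℚ ℚ.* 1ℚ ℚ.* L ℚ.+ 1ℚ)
          ≡⟨ cong (λ z → fromℕ 8 ℚ.* (z ℚ.+ 1ℚ)) (trans (cong (ℚ._* L) (ℚP.*-identityˡ 1ℚ)) (ℚP.*-identityˡ L)) ⟩
        fromℕ 8 ℚ.* (L ℚ.+ 1ℚ)
          ≤⟨ *-mono (fromℕ-nonNeg 8) (ℚP.+-monoˡ-≤ 1ℚ hi) ⟩
        fromℕ 8 ℚ.* (fromℕ (2 + l) ℚ.+ 1ℚ)
          ≡⟨ cong (fromℕ 8 ℚ.*_) (trans (ℚP.+-comm (fromℕ (2 + l)) 1ℚ) (sym (fromℕ-+ 1 (2 + l)))) ⟩
        fromℕ 8 ℚ.* fromℕ (3 + l)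
          ≡⟨ fromℕ-* 8 (3 + l) ⟨
        fromℕ (8 * (3 + l))
          ≤⟨ fromℕ-mono (log-≤ n 1≤g) ⟩
        fromℕ (D * grade n)
          ≡⟨ fromℕ-* D (grade n) ⟩
        fromℕ D ℚ.* fromℕ (grade n) ∎)
      where
      open ℚP.≤-Reasoning
      l = lg n
      nk = n * k
      1≤nk : 1 ≤ nk
      1≤nk = *-mono-≤ {1} {n} (s≤s z≤n) 1≤k
      1≤D : 1 ≤ D
      1≤D = *-mono-≤ {1} {512} (s≤s z≤n) (s≤s z≤n)

  partB : (ε : ℝ) → ι 0ℚ D.< ε → ε D.< ι ½ → (k : ℕ → ℕ) →
    Eventually (λ n → n ^ʳ ε D.≤ nat (k n) × nat (k n) D.≤ n ^ʳ (ι 1ℚ D.- ε)) →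
    (c : ℝ) → ι 0ℚ D.< c → c D.< ι 1ℚ →
    ∃ λ (c′ : ℝ) → ι 0ℚ D.< c′ ×
    ∃ λ (H : ∀ n → Graph n) →
      Eventually (λ n → δ (H n) ≡ k n × nat (α (H n)) D.≤ c D.* nat (k n)) ×
      ((p : ℕ → ℝ) → (∀ n → IsProbability (p n)) →
        Eventually (λ n → p n D.≤ c′ D.* log n /ℕ (n * k n)) → AAS[ H ∪𝔾 p ⊨ nonHamiltonian? ])
  partB ε (e , 0<e , M₁ , e≤) (e′ , 0<e′ , M₂ , ≤½) k (N₀ , hk) c (f , 0<f , M₃ , f≤) _ =
    let A′ , A′≥ = archimedean′ (fromℕ 2) 0<e
        A₂ , A₂≥ = archimedean′ 1ℚ 0<f
    in main A′ A₂ (ℚP.≤-trans A′≥ (*-monoʳ (ℚP.<⇒≤ 0<e) (fromℕ-mono (n≤1+n A′)))) A₂≥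
    where
    Goal : Set₁
    Goal = ∃ λ (c′ : ℝ) → ι 0ℚ D.< c′ × ∃ λ (H : ∀ n → Graph n) →
      Eventually (λ n → δ (H n) ≡ k n × nat (α (H n)) D.≤ c D.* nat (k n)) ×
      ((p : ℕ → ℝ) → (∀ n → IsProbability (p n)) →
        Eventually (λ n → p n D.≤ c′ D.* log n /ℕ (n * k n)) → AAS[ H ∪𝔾 p ⊨ nonHamiltonian? ])
    main : ∀ A′ A₂ → fromℕ 2 ℚ.≤ fromℕ (suc A′) ℚ.* e → 1ℚ ℚ.≤ fromℕ A₂ ℚ.* f → Goal
    main A′ A₂ A≥ A₂≥ =
      ι (recip D) , (recip D , 0<D , 0 , λ _ _ → ℚP.≤-reflexive (ℚP.+-identityˡ (recip D))) , H ,
      (N₁ , props) , λ p isP (N₂ , small) →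
        aas {P = λ H → ¬ Hamiltonian H} nonHamiltonian? H p isP (λ n q → fromℕ 8 ℚ.* (fromℕ (n * k n) ℚ.* q) ℚ.≤ fromℕ (g n))
          (N₁ ⊔ N₂ , λ n N≤n → let N₁≤n = m⊔n≤o⇒m≤o N₁ N₂ N≤n in
            rare A′ n (k n) {p n} (1≤g n N₁≤n) (1≤k n N₁≤n) (small n (m⊔n≤o⇒n≤o N₁ N₂ N≤n)))
          tail
      where
      D = 512 * suc A′
      0<D : 0ℚ ℚ.< recip D
      0<D = ℚP.positive⁻¹ (recip D) {{ℚP.normalize-pos 1 D}}
      g : ℕ → ℕ
      g = grade A′
      H : ∀ n → Graph n
      H n = blockGraph n (k n) (2 ^ (2 * g n))
      N₁ = N₀ ⊔ 2 ^ (suc A₂ * 8 * suc A′)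
      g≥ : ∀ n → N₁ ≤ n → suc A₂ ≤ g n
      g≥ n h = grade-large A′ (suc A₂) n (m⊔n≤o⇒n≤o N₀ _ h)
      1≤g : ∀ n → N₁ ≤ n → 1 ≤ g n
      1≤g n h = ≤-trans (s≤s z≤n) (g≥ n h)
      powers : ∀ n → N₁ ≤ n → 2 ^ (8 * g n) ≤ k n × k n * 2 ^ (8 * g n) ≤ n
      powers zero    h = ⊥-elim (<⇒≱ (1≤2^ (suc A₂ * 8 * suc A′)) (m⊔n≤o⇒n≤o N₀ _ h))
      powers (suc n) h =
        2^j≤k {ε} {e} 0<e {M₁ ⊔ M₂} ε≥ ε≤1 {suc A′} A≥ {n} {k (suc n)} {8 * g (suc n)} (grade-≤ A′ (suc n)) (proj₁ (hk (suc n) (m⊔n≤o⇒m≤o N₀ _ h))) ,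
        k2^j≤n {ε} {e} 0<e {M₁ ⊔ M₂} ε≥ ε≤1 {suc A′} A≥ {n} {k (suc n)} {8 * g (suc n)} (grade-≤ A′ (suc n)) (proj₂ (hk (suc n) (m⊔n≤o⇒m≤o N₀ _ h)))
        where
        ε≥ : ∀ m → M₁ ⊔ M₂ ≤ m → e ℚ.≤ seq ε m
        ε≥ m M≤m = subst (ℚ._≤ seq ε m) (ℚP.+-identityˡ e) (e≤ m (m⊔n≤o⇒m≤o M₁ M₂ M≤m))
        ε≤1 : ∀ m → M₁ ⊔ M₂ ≤ m → seq ε m ℚ.≤ 1ℚ
        ε≤1 m M≤m = ℚP.≤-trans (≤-+ʳ (ℚP.<⇒≤ 0<e′)) (ℚP.≤-trans (≤½ m (m⊔n≤o⇒n≤o M₁ M₂ M≤m)) (≤-+ʳ {½} (ℚP.nonNegative⁻¹ ½)))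
      1≤k : ∀ n → N₁ ≤ n → 1 ≤ k n
      1≤k n h = ≤-trans (1≤2^ (8 * g n)) (proj₁ (powers n h))
      room : ∀ n → (h : N₁ ≤ n) → suc (2 ^ (2 * g n)) * suc (k n) ≤ n
      room n h = blocksRoom (1≤g n h) (proj₁ (powers n h)) (proj₂ (powers n h))
      props : ∀ n → N₁ ≤ n → δ (H n) ≡ k n × nat (α (H n)) D.≤ c D.* nat (k n)
      props n h = δ-block n (k n) (2 ^ (2 * g n)) (room n h) (1≤2^ (2 * g n)) , λ η 0<η → M₃ , λ m M₃≤m → begin
        fromℕ (α (H n))                                            ≤⟨ fromℕ-mono (α-block n (k n) (2 ^ (2 * g n)) (room n h)) ⟩
        C                                                          ≡⟨ ℚP.*-identityˡ C ⟨
        1ℚ ℚ.* C                                                   ≤⟨ *-monoʳ (fromℕ-nonNeg (suc (2 ^ (2 * g n)))) A₂≥ ⟩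
        fromℕ A₂ ℚ.* f ℚ.* C                                       ≡⟨ ℚS.solve 3 (λ A f C → A ℚS.:* f ℚS.:* C ℚS.:= f ℚS.:* (A ℚS.:* C)) refl (fromℕ A₂) f C ⟩
        f ℚ.* (fromℕ A₂ ℚ.* C)                                     ≡⟨ cong (f ℚ.*_) (fromℕ-* A₂ (suc (2 ^ (2 * g n)))) ⟨
        f ℚ.* fromℕ (A₂ * suc (2 ^ (2 * g n)))                     ≤⟨ *-mono₂ (ℚP.<⇒≤ 0<f) (subst (ℚ._≤ seq c m) (ℚP.+-identityˡ f) (f≤ m M₃≤m)) (fromℕ-nonNeg (A₂ * suc (2 ^ (2 * g n))))
                                                                        (fromℕ-mono (fewBlocks (1≤g n h) (proj₁ (powers n h)) (proj₂ (powers n h)) (≤-trans (n≤1+n A₂) (g≥ n h)))) ⟩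
        seq c m ℚ.* fromℕ (k n)                                    ≤⟨ ≤-+ʳ (ℚP.<⇒≤ 0<η) ⟩
        seq c m ℚ.* fromℕ (k n) ℚ.+ η                              ∎
        where
        open ℚP.≤-Reasoning
        C = fromℕ (suc (2 ^ (2 * g n)))
      tail : ∀ η → 0ℚ ℚ.< η → Eventually λ n → ∀ q → 0ℚ ℚ.≤ q → q ℚ.≤ 1ℚ → fromℕ 8 ℚ.* (fromℕ (n * k n) ℚ.* q) ℚ.≤ fromℕ (g n) →
             1ℚ ℚ.- η ℚ.≤ probability (H n) q nonHamiltonian?
      tail η 0<η =
        let G , 2≤ = archimedean′ (fromℕ 2) 0<η
            N₃ = N₁ ⊔ 2 ^ (G * 8 * suc A′)
        in N₃ , λ n N≤n q 0≤q q≤1 rel →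
          let h = m⊔n≤o⇒m≤o N₁ _ N≤n
          in nonHam-lower (H n) {q} {η} (*-cancelˡ-≤q {fromℕ (g n)} (pos (g n) (1≤g n h))
               (ℚP.≤-trans (hamUnlikely (1≤g n h) (proj₁ (powers n h)) (proj₂ (powers n h)) 0≤q q≤1 rel)
                 (ℚP.≤-trans 2≤ (*-monoʳ (ℚP.<⇒≤ 0<η) (fromℕ-mono (grade-large A′ G n (m⊔n≤o⇒n≤o N₁ _ N≤n)))))))

-- Half of the vertices into which all degrees stay large

module DominatingHalf where

  open Counting
  open Graphs
  open Expectation
  open RationalBounds renaming (*-cancelˡ-≤ to *-cancelˡ-≤q)
  open PartB using (n<2^n)
  open BlockGraphs using (m<[1+m/n]*n)
  open import Defs using (Graph; Adj; adj?; symm; irrefl; fromℕ; fromℕ-mono; fromℕ-nonNeg; fromℕ-pos; *-mono₂; *-nonNeg; +-nonNeg; 0≤1; ≤-+ʳ)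
  open import Data.Nat.Base
  open import Data.Nat.Properties
  open import Data.Nat.DivMod using (m/n*n≤m)
  open import Data.Nat.Solver using (module +-*-Solver)
  open +-*-Solver using (solve; con; _:+_; _:*_; _:=_)
  open import Data.Rational.Base as ℚ using (ℚ; 0ℚ; 1ℚ; ½)
  import Data.Rational.Properties as ℚP
  open import Data.Rational.Solver using () renaming (module +-*-Solver to ℚS)
  open import Data.Unit.Base using (⊤; tt)
  open import Data.Fin.Base using (Fin)
  import Data.Fin.Properties as Fin
  open import Data.List.Base using (List; []; _∷_; _++_; length; allFin; take; concatMap; filter)
  open import Data.List.Properties using (length-++; length-take; length-tabulate)
  open import Data.List.Membership.Propositional using (_∈_; _∉_; find; lose)
  open import Data.List.Membership.Propositional.Properties using (∈-++⁺ˡ; ∈-++⁺ʳ; ∈-allFin; ∈-filter⁺)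
  open import Data.List.Relation.Unary.Any as Any using (here; there)
  open import Data.List.Relation.Unary.All as All using (All; []; _∷_)
  import Data.List.Relation.Unary.All.Properties as All
  open import Data.List.Relation.Unary.AllPairs using ([]; _∷_)
  open import Data.List.Relation.Unary.Unique.Propositional using (Unique)
  import Data.List.Relation.Unary.Unique.Propositional.Properties as Unique
  open import Data.Product.Base using (∃; _×_; _,_)
  open import Data.Sum.Base using (_⊎_; inj₁; inj₂)
  open import Function.Base using (_∘_)
  open import Relation.Binary.PropositionalEquality
  open import Relation.Nullary using (¬_; Dec; yes; no; contradiction)
  open import Relation.Nullary.Decidable using (_×-dec_)

  sumL≡# : ∀ {n} {P : Fin n → Set} (P? : ∀ v → Dec (P v)) xs → # (λ u → P? u ×-dec (u ∈? xs)) ≤ sumL (λ u → bit (P? u)) xs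
  sumL≡# {n} {P} P? xs = ≤-trans (≤-trans (#-mono _ (_∈? filtered) λ u (p , u∈) → ∈-filter⁺ P? u∈ p) (#-∈ filtered)) (≤-reflexive (length-filter P? xs))
    where
    filtered = filter P? xs

  module _ {n : ℕ} {G : Graph n} {a : ℕ} (dense : Dense G a) where

    -- The list of all vertices is scanned once, and a vertex is taken if it has property `P`, is
    -- not yet present and has no neighbour among those taken. Density bounds the size of the
    -- result.
    maximalIndependent : ∀ {P : Fin n → Set} (P? : ∀ v → Dec (P v)) →
      ∃ λ I → length I ≤ a × All P I × (∀ {v} → P v → v ∈ I ⊎ ∃ λ u → u ∈ I × Adj G v u)
    maximalIndependent {P} P? =
      let I , uq , al , ind , max = go (allFin n)
      in I , bounded uq ind , al , λ {v} p → max (∈-allFin v) p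
      where
      bounded : ∀ {I} → Unique I → (∀ {u v} → u ∈ I → v ∈ I → ¬ Adj G u v) → length I ≤ a
      bounded {I} uq ind = ≮⇒≥ λ a< →
        let u , v , u∈ , v∈ , uv = dense (_∈? I) (<-≤-trans a< (length≤# (_∈? I) uq (All.tabulate λ x∈ → x∈)))
        in ind u∈ v∈ uv
      go : ∀ xs → ∃ λ I → Unique I × All P I × (∀ {u v} → u ∈ I → v ∈ I → ¬ Adj G u v) ×
             (∀ {v} → v ∈ xs → P v → v ∈ I ⊎ ∃ λ u → u ∈ I × Adj G v u)
      go [] = [] , [] , [] , (λ ()) , λ ()
      go (x ∷ xs) with I , uq , al , ind , max ← go xs with P? x | Any.any? (adj? G x) I | x ∈? I
      ... | no ¬p | _ | _ = I , uq , al , ind , λ { (here refl) p → contradiction p ¬p ; (there v∈) p → max v∈ p }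
      ... | yes _ | yes any | _ = I , uq , al , ind , λ { (here refl) _ → inj₂ (find any) ; (there v∈) p → max v∈ p }
      ... | yes _ | no _ | yes x∈ = I , uq , al , ind , λ { (here refl) _ → inj₁ x∈ ; (there v∈) p → max v∈ p }
      ... | yes p | no none | no x∉ = x ∷ I , All.tabulate (λ { y∈ refl → x∉ y∈ }) ∷ uq , p ∷ al ,
            (λ { (here refl) (here refl) e → irrefl G e
               ; (here refl) (there v∈) e → none (lose v∈ e)
               ; (there u∈) (here refl) e → none (lose u∈ (symm G e))
               ; (there u∈) (there v∈) e → ind u∈ v∈ e }) ,
            λ { (here refl) _ → inj₁ (here refl) ; (there v∈) p → grow (max v∈ p) }
        where
        grow : ∀ {v} → v ∈ I ⊎ (∃ λ u → u ∈ I × Adj G v u) → v ∈ x ∷ I ⊎ ∃ λ u → u ∈ x ∷ I × Adj G v u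
        grow (inj₁ v∈)            = inj₁ (there v∈)
        grow (inj₂ (u , u∈ , vu)) = inj₂ (u , there u∈ , vu)

    -- A vertex that remains outside has a neighbour in the set of each round, and these neighbours
    -- are distinct because the rounds are disjoint.
    dominating : ∀ s → ∃ λ D → length D ≤ s * a × ∀ {v} → v ∉ D → s ≤ # (λ u → adj? G v u ×-dec (u ∈? D))
    dominating zero    = [] , z≤n , λ _ → z≤n
    dominating (suc s) =
      let D , len , dom = dominating s
          I , lenI , al , max = maximalIndependent (_∉? D)
      in D ++ I , ≤-trans (≤-reflexive (length-++ D)) (≤-trans (+-mono-≤ len lenI) (≤-reflexive (+-comm (s * a) a))) , λ {v} v∉ →
           extend D I dom al max v∉
      where
      extend : ∀ D I → (∀ {v} → v ∉ D → s ≤ # (λ u → adj? G v u ×-dec (u ∈? D))) → All (_∉ D) I →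
               (∀ {v} → v ∉ D → v ∈ I ⊎ ∃ λ u → u ∈ I × Adj G v u) →
               ∀ {v} → v ∉ D ++ I → suc s ≤ # (λ u → adj? G v u ×-dec (u ∈? (D ++ I)))
      extend D I dom al max {v} v∉ with max (v∉ ∘ ∈-++⁺ˡ)
      ... | inj₁ v∈ = contradiction (∈-++⁺ʳ D v∈) v∉
      ... | inj₂ (u , u∈ , vu) = ≤-trans (+-mono-≤ (≤-reflexive (sym (#-singleton u))) (dom (v∉ ∘ ∈-++⁺ˡ)))
        (#-disjoint (Fin._≟ u) (λ w → adj? G v w ×-dec (w ∈? D)) (λ w → adj? G v w ×-dec (w ∈? (D ++ I)))
          (λ { w refl → vu , ∈-++⁺ʳ D u∈ }) (λ w (vw , w∈) → vw , ∈-++⁺ˡ w∈) (λ { w refl (_ , w∈) → All.lookup al u∈ w∈ }))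

    -- A vertex taken in some round need not have neighbours in the later rounds, so s of its own
    -- neighbours are added. This yields the quadratic term of the size.
    smallDominating : ∀ s → (∀ v → s ≤ # (adj? G v)) → ∃ λ W → Unique W × length W ≤ s * a + s * a * s × ∀ v → s ≤ sumL (λ u → bit (adj? G v u)) W
    smallDominating s deg =
      let D , len , dom = dominating s
          U = D ++ concatMap few D
      in elems (_∈? U) , elems-unique (_∈? U) ,
         ≤-trans (≤-trans (≤-reflexive (length-elems (_∈? U))) (#-∈ U))
           (≤-trans (≤-reflexive (length-++ D)) (+-mono-≤ len (≤-trans (lengthFew D) (*-monoˡ-≤ s len)))) ,
         λ v → ≤-trans (enough D dom v) (≤-trans (#-mono _ _ λ u (vu , u∈) → vu , ∈-elems⁺ (_∈? U) u∈) (sumL≡# (adj? G v) (elems (_∈? U))))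
      where
      few : Fin n → List (Fin n)
      few v = take s (elems (adj? G v))
      few-len : ∀ v → length (few v) ≡ s
      few-len v = trans (length-take s (elems (adj? G v))) (m≤n⇒m⊓n≡m (≤-trans (deg v) (≤-reflexive (sym (length-elems (adj? G v))))))
      lengthFew : ∀ D → length (concatMap few D) ≤ length D * s
      lengthFew []      = z≤n
      lengthFew (v ∷ D) = ≤-trans (≤-reflexive (length-++ (few v))) (+-mono-≤ (≤-reflexive (few-len v)) (lengthFew D))
      enough : ∀ D → (∀ {v} → v ∉ D → s ≤ # (λ u → adj? G v u ×-dec (u ∈? D))) → ∀ v → s ≤ # (λ u → adj? G v u ×-dec (u ∈? (D ++ concatMap few D)))
      enough D dom v with v ∈? D
      ... | no v∉  = ≤-trans (dom v∉) (#-mono _ _ λ u (vu , u∈) → vu , ∈-++⁺ˡ u∈)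
      ... | yes v∈ = ≤-trans (≤-reflexive (sym (few-len v))) (length≤# _ (Unique.take⁺ s (elems-unique (adj? G v)))
        (All.tabulate λ {u} u∈ → ∈-elems⁻ (adj? G v) (∈-take s (elems (adj? G v)) u∈) , ∈-++⁺ʳ D (inFew D v∈ u∈)))
        where
        ∈-take : ∀ {A : Set} {x : A} m xs → x ∈ take m xs → x ∈ xs
        ∈-take (suc m) (y ∷ xs) (here e)   = here e
        ∈-take (suc m) (y ∷ xs) (there x∈) = there (∈-take m xs x∈)
        inFew : ∀ D → v ∈ D → ∀ {u} → u ∈ few v → u ∈ concatMap few D
        inFew (_ ∷ D) (here refl) u∈ = ∈-++⁺ˡ u∈
        inFew (d ∷ D) (there v∈)  u∈ = ∈-++⁺ʳ (few d) (inFew D v∈ u∈)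

  private
    wt : ∀ {P : Set} → ℚ → Dec P → ℚ
    wt y (yes _) = y
    wt y (no _)  = 1ℚ

    0≤wt : ∀ {P : Set} {y} → 0ℚ ℚ.≤ y → (d : Dec P) → 0ℚ ℚ.≤ wt y d
    0≤wt h (yes _) = h
    0≤wt h (no _)  = 0≤1

    ∏-wt : ∀ {A : Set} {P : A → Set} (P? : ∀ x → Dec (P x)) y xs → ∏ (λ x → wt y (P? x)) xs ≡ pow y (sumL (λ x → bit (P? x)) xs)
    ∏-wt P? y []       = refl
    ∏-wt P? y (x ∷ xs) with P? x
    ... | yes _ = cong (y ℚ.*_) (∏-wt P? y xs)
    ... | no _  = trans (ℚP.*-identityˡ _) (∏-wt P? y xs)

    ∏-ext : ∀ {A : Set} {f g : A → ℚ} xs → (∀ x → f x ≡ g x) → ∏ f xs ≡ ∏ g xs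
    ∏-ext []       h = refl
    ∏-ext (x ∷ xs) h = cong₂ ℚ._*_ (h x) (∏-ext xs h)

    mix : ∀ {P : Set} y (d : Dec P) → ½ ℚ.* wt y d ℚ.+ (1ℚ ℚ.- ½) ≡ wt (½ ℚ.* y ℚ.+ ½) d
    mix y (yes _) = refl
    mix y (no _)  = refl

    ¾ : ℚ
    ¾ = ½ ℚ.* ½ ℚ.+ ½

    0≤½ : 0ℚ ℚ.≤ ½
    0≤½ = ℚP.nonNegative⁻¹ ½

    0≤¾ : 0ℚ ℚ.≤ ¾
    0≤¾ = ℚP.nonNegative⁻¹ ¾

    ¾-power : ∀ m → 256 * 3 ^ m ≤ 4 ^ m → fromℕ 256 ℚ.* pow ¾ m ℚ.≤ 1ℚ
    ¾-power m h = *-cancelˡ-≤q {fromℕ (4 ^ m)} (ℚP.<-≤-trans (fromℕ-pos 0) (fromℕ-mono (m^n>0 4 m))) (begin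
      fromℕ (4 ^ m) ℚ.* (c ℚ.* pow ¾ m)                ≡⟨ ℚS.solve 3 (λ a b c → a ℚS.:* (b ℚS.:* c) ℚS.:= b ℚS.:* (a ℚS.:* c)) refl (fromℕ (4 ^ m)) c (pow ¾ m) ⟩
      c ℚ.* (fromℕ (4 ^ m) ℚ.* pow ¾ m)                ≡⟨ cong (λ z → c ℚ.* (z ℚ.* pow ¾ m)) (fromℕ-pow 4 m) ⟩
      c ℚ.* (pow (fromℕ 4) m ℚ.* pow ¾ m)              ≡⟨ cong (c ℚ.*_) (trans (sym (pow-distrib (fromℕ 4) ¾ m)) (sym (fromℕ-pow 3 m))) ⟩
      c ℚ.* fromℕ (3 ^ m)                              ≡⟨ fromℕ-* 256 (3 ^ m) ⟨
      fromℕ (256 * 3 ^ m)                              ≤⟨ fromℕ-mono h ⟩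
      fromℕ (4 ^ m)                                    ≡⟨ ℚP.*-identityʳ (fromℕ (4 ^ m)) ⟨
      fromℕ (4 ^ m) ℚ.* 1ℚ                             ∎)
      where
      open ℚP.≤-Reasoning
      c = fromℕ 256

  module _ {n : ℕ} (G : Graph n) {k : ℕ} (deg : ∀ v → k ≤ # (adj? G v)) where

    private
      cnt : Fin n → List (Fin n) → ℕ
      cnt v F = sumL (λ u → bit (adj? G v u)) F

      d : Fin n → ℕ
      d v = # (adj? G v)

      -- (1/2)^(neighbours of v in F) + (1/2)^(neighbours of v outside F)
      cost : Fin n → List (Fin n) → ℚ
      cost v F = ∏ (λ u → wt ½ (adj? G v u)) F ℚ.+ pow ½ (d v) ℚ.* ∏ (λ u → wt (fromℕ 2) (adj? G v u)) F

      E : (List (Fin n) → ℚ) → ℚ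
      E = 𝔼q ½ (allFin n)

      E-wt : ∀ y v → E (∏ (λ u → wt y (adj? G v u))) ≡ pow (½ ℚ.* y ℚ.+ ½) (d v)
      E-wt y v = trans (𝔼-∏ ½ (allFin n) _) (trans (∏-ext (allFin n) λ u → mix y (adj? G v u))
        (trans (∏-wt (adj? G v) (½ ℚ.* y ℚ.+ ½) (allFin n)) (cong (pow (½ ℚ.* y ℚ.+ ½)) (sumL-allFin _))))

      -- A neighbour of v has average weight 3/4 in the first product and 3/2 in the second, and the
      -- factor (1/2)^d reduces the latter to 3/4 per neighbour as well.
      E-cost : ∀ v → E (cost v) ℚ.≤ fromℕ 2 ℚ.* pow ¾ k
      E-cost v = begin
        E (cost v)
          ≡⟨ trans (𝔼-+ ½ (allFin n) _ _) (cong₂ ℚ._+_ (E-wt ½ v) (trans (𝔼-* ½ (allFin n) (pow ½ (d v)) _) (cong (pow ½ (d v) ℚ.*_) (E-wt (fromℕ 2) v)))) ⟩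
        pow ¾ (d v) ℚ.+ pow ½ (d v) ℚ.* pow (½ ℚ.* fromℕ 2 ℚ.+ ½) (d v)
          ≡⟨ cong (pow ¾ (d v) ℚ.+_) (sym (pow-distrib ½ (½ ℚ.* fromℕ 2 ℚ.+ ½) (d v))) ⟩
        pow ¾ (d v) ℚ.+ pow ¾ (d v)
          ≤⟨ ℚP.+-mono-≤ (pow-antitone 0≤¾ (ℚP.≤-trans (ℚP.+-monoʳ-≤ (½ ℚ.* ½) {½} {½} ℚP.≤-refl) ¾≤1) (deg v)) (pow-antitone 0≤¾ ¾≤1 (deg v)) ⟩
        pow ¾ k ℚ.+ pow ¾ k
          ≡⟨ ℚS.solve 1 (λ x → x ℚS.:+ x ℚS.:= ℚS.con (fromℕ 2) ℚS.:* x) refl (pow ¾ k) ⟩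
        fromℕ 2 ℚ.* pow ¾ k ∎
        where
        open ℚP.≤-Reasoning
        ¾≤1 : ¾ ℚ.≤ 1ℚ
        ¾≤1 = ℚP.≤-trans (≤-+ʳ {¾} (*-nonNeg 0≤½ 0≤½)) ℚP.≤-refl

      total : List (Fin n) → ℚ
      total F = ∑q (λ v → cost v F) (allFin n)

      E-total : E total ℚ.≤ fromℕ n ℚ.* (fromℕ 2 ℚ.* pow ¾ k)
      E-total = ℚP.≤-trans (ℚP.≤-reflexive (𝔼-∑ ½ (allFin n) (allFin n) cost)) (ℚP.≤-trans (∑q-mono (allFin n) λ {v} _ → E-cost v)
        (ℚP.≤-reflexive (trans (∑q-const _ (allFin n)) (cong (λ z → fromℕ z ℚ.* (fromℕ 2 ℚ.* pow ¾ k)) (length-tabulate {n = n} (λ i → i))))))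

      0≤∏wt : ∀ {y} → 0ℚ ℚ.≤ y → ∀ v F → 0ℚ ℚ.≤ ∏ (λ u → wt y (adj? G v u)) F
      0≤∏wt h v []      = 0≤1
      0≤∏wt h v (u ∷ F) = *-nonNeg (0≤wt h (adj? G v u)) (0≤∏wt h v F)

      0≤cost : ∀ F v → 0ℚ ℚ.≤ cost v F
      0≤cost F v = +-nonNeg (0≤∏wt 0≤½ v F) (*-nonNeg (pow-nonNeg (d v) 0≤½) (0≤∏wt (fromℕ-nonNeg 2) v F))

    module _ {t : ℕ} (rare : fromℕ n ℚ.* (fromℕ 2 ℚ.* pow ¾ k) ℚ.< pow ½ t) where

      -- Some colour class has a total cost no larger than the mean, hence below 2^(-t). Then each
      -- single cost, and each of its two summands, is below 2^(-t), which forces t neighbours in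
      -- either class.
      split : ∃ λ F → Unique F × (∀ v → t ≤ sumL (λ u → bit (adj? G v u)) F) × (∀ v → t ≤ sumL (λ u → bit (adj? G v u)) (elems (_∉? F)))
      split =
        let F , hF , _ , uq = attained 0≤½ (≤-+ʳ {½} 0≤½) (allFin n) total
            low : ∀ v → cost v F ℚ.< pow ½ t
            low v = ℚP.≤-<-trans (∑q-term {f = λ v → cost v F} (0≤cost F) (∈-allFin v)) (ℚP.≤-<-trans (ℚP.≤-trans hF E-total) rare)
        in F , uq (Unique.allFin⁺ n) , inside F low , outside F (uq (Unique.allFin⁺ n)) low
        where
        ½≤1 : ½ ℚ.≤ 1ℚ
        ½≤1 = ≤-+ʳ {½} 0≤½
        above : ∀ {x} → pow ½ x ℚ.< pow ½ t → t ≤ x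
        above {x} h = ≮⇒≥ λ lt → ℚP.<-irrefl refl (ℚP.<-≤-trans h (pow-antitone 0≤½ ½≤1 (<⇒≤ lt)))
        inside : ∀ F → (∀ v → cost v F ℚ.< pow ½ t) → ∀ v → t ≤ cnt v F
        inside F low v = above (ℚP.≤-<-trans (ℚP.≤-trans (ℚP.≤-reflexive (sym (∏-wt (adj? G v) ½ F))) (≤-+ʳ (*-nonNeg (pow-nonNeg (d v) 0≤½) (0≤∏wt (fromℕ-nonNeg 2) v F)))) (low v))
        cancel : ∀ x y → pow ½ (x + y) ℚ.* pow (fromℕ 2) x ≡ pow ½ y
        cancel x y = trans (cong (ℚ._* pow (fromℕ 2) x) (pow-+ ½ x y))
          (trans (ℚS.solve 3 (λ a b c → a ℚS.:* b ℚS.:* c ℚS.:= a ℚS.:* c ℚS.:* b) refl (pow ½ x) (pow ½ y) (pow (fromℕ 2) x))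
          (trans (cong (ℚ._* pow ½ y) (trans (sym (pow-distrib ½ (fromℕ 2) x)) (pow-one x))) (ℚP.*-identityˡ (pow ½ y))))
        outside : ∀ F → Unique F → (∀ v → cost v F ℚ.< pow ½ t) → ∀ v → t ≤ cnt v (elems (_∉? F))
        outside F uq low v = ≤-trans (above {y} (ℚP.≤-<-trans (begin
            pow ½ y                                                                  ≡⟨ cancel (cnt v F) y ⟨
            pow ½ (cnt v F + y) ℚ.* pow (fromℕ 2) (cnt v F)                          ≡⟨ cong (λ z → pow ½ z ℚ.* pow (fromℕ 2) (cnt v F)) (m+[n∸m]≡n cnt≤) ⟩
            pow ½ (d v) ℚ.* pow (fromℕ 2) (cnt v F)                                  ≡⟨ cong (pow ½ (d v) ℚ.*_) (∏-wt (adj? G v) (fromℕ 2) F) ⟨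
            pow ½ (d v) ℚ.* ∏ (λ u → wt (fromℕ 2) (adj? G v u)) F                    ≤⟨ ≤-+ʳ (0≤∏wt 0≤½ v F) ⟩
            pow ½ (d v) ℚ.* ∏ (λ u → wt (fromℕ 2) (adj? G v u)) F ℚ.+ ∏ (λ u → wt ½ (adj? G v u)) F ≡⟨ ℚP.+-comm (pow ½ (d v) ℚ.* ∏ (λ u → wt (fromℕ 2) (adj? G v u)) F) _ ⟩
            cost v F                                                                 ∎) (low v))) rest
          where
          open ℚP.≤-Reasoning
          cnt≤ : cnt v F ≤ d v
          cnt≤ = sumL-unique (λ u → bit (adj? G v u)) uq
          y = d v ∸ cnt v F
          part : ∀ u → Adj G v u → (Adj G v u × u ∈ F) ⊎ (Adj G v u × u ∉ F)
          part u vu with u ∈? F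
          ... | yes u∈ = inj₁ (vu , u∈)
          ... | no u∉  = inj₂ (vu , u∉)
          rest : y ≤ cnt v (elems (_∉? F))
          rest = m≤n+o⇒m∸n≤o (d v) (cnt v F) (≤-trans (#-⊎ (λ u → adj? G v u ×-dec (u ∈? F)) (λ u → adj? G v u ×-dec (u ∉? F)) (adj? G v) part)
            (+-mono-≤ (sumL≡# (adj? G v) F) (≤-trans (#-mono _ (λ u → adj? G v u ×-dec (u ∈? elems (_∉? F))) λ u (vu , u∉) → vu , ∈-elems⁺ (_∉? F) u∉) (sumL≡# (adj? G v) (elems (_∉? F))))))

  private
    half-list : ∀ {n} (F : List (Fin n)) → Unique F → length F + length (elems (_∉? F)) ≤ n
    half-list {n} F uq = ≤-trans (+-mono-≤ (length≤# (_∈? F) uq (All.tabulate λ x∈ → x∈)) (≤-reflexive (length-elems (_∉? F))))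
      (≤-trans (#-disjoint (_∈? F) (_∉? F) (λ _ → yes tt) (λ _ _ → tt) (λ _ _ → tt) (λ _ p q → q p)) (#≤n {n} {λ _ → ⊤} (λ _ → yes tt)))

    -- It is applied with c = 20 and e = 16, where 8 · 20³ = 64000 is just below 2^16. The premise
    -- 16 ≤ 4t means t ≥ 4; this is why k ≥ 80 is demanded.
    cubic : ∀ c e n k t → 8 * (c * (c * c)) ≤ 2 ^ e → e ≤ 4 * t → k ≤ c * suc t → n < 2 * (k * (k * k)) → 2 * (2 ^ t * (n * 2)) ≤ 256 ^ t
    cubic c e n k t 8c³≤ e≤ hi small = begin
      2 * (2 ^ t * (n * 2))                     ≡⟨ solve 2 (λ p n → con 2 :* (p :* (n :* con 2)) := con 4 :* p :* n) refl (2 ^ t) n ⟩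
      4 * 2 ^ t * n                             ≤⟨ *-monoʳ-≤ (4 * 2 ^ t) (≤-trans (<⇒≤ small) (*-monoʳ-≤ 2 (*-mono-≤ k≤ (*-mono-≤ k≤ k≤)))) ⟩
      4 * 2 ^ t * (2 * (c * p * (c * p * (c * p)))) ≡⟨ solve 2 (λ c p → con 4 :* p :* (con 2 :* (c :* p :* (c :* p :* (c :* p)))) := con 8 :* (c :* (c :* c)) :* (p :* p :* (p :* p))) refl c p ⟩
      8 * (c * (c * c)) * (p * p * (p * p))                 ≤⟨ *-monoˡ-≤ (p * p * (p * p)) 8c³≤ ⟩
      2 ^ e * (p * p * (p * p))                ≡⟨ cong (2 ^ e *_) (trans (cong₂ _*_ (sym (^-distribˡ-+-* 2 t t)) (sym (^-distribˡ-+-* 2 t t))) (sym (^-distribˡ-+-* 2 (t + t) (t + t)))) ⟩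
      2 ^ e * 2 ^ (t + t + (t + t))            ≡⟨ ^-distribˡ-+-* 2 e (t + t + (t + t)) ⟨
      2 ^ (e + (t + t + (t + t)))              ≤⟨ ^-monoʳ-≤ 2 (≤-trans (+-monoˡ-≤ (t + t + (t + t)) e≤) (≤-reflexive (solve 1 (λ t → con 4 :* t :+ (t :+ t :+ (t :+ t)) := con 8 :* t) refl t))) ⟩
      2 ^ (8 * t)                               ≡⟨ ^-*-assoc 2 8 t ⟨
      256 ^ t                                   ∎
      where
      open ≤-Reasoning
      p = 2 ^ t
      k≤ : k ≤ c * p
      k≤ = ≤-trans hi (*-monoʳ-≤ c (n<2^n t))

    -- The k neighbours contain t blocks of m, and each block reduces the expected cost by a factor
    -- 256. It is applied with m = 20, since (3/4)^20 is below 1/256.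
    rare-bound : ∀ m n k t → 256 * 3 ^ m ≤ 4 ^ m → m * t ≤ k → 2 * (2 ^ t * (n * 2)) ≤ 256 ^ t →
                 fromℕ n ℚ.* (fromℕ 2 ℚ.* pow ¾ k) ℚ.< pow ½ t
    rare-bound m n k t h lo small = ℚP.*-cancelˡ-<-nonNeg (fromℕ (2 ^ t)) {{ℚ.nonNegative (fromℕ-nonNeg (2 ^ t))}} (ℚP.≤-<-trans le-half (ℚP.<-≤-trans ½<1 (ℚP.≤-reflexive one)))
      where
      open ℚP.≤-Reasoning
      x = pow ¾ m
      N = 2 ^ t * (n * 2)
      lhs = fromℕ (2 ^ t) ℚ.* (fromℕ n ℚ.* (fromℕ 2 ℚ.* pow ¾ k))
      ¾≤1 : ¾ ℚ.≤ 1ℚ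
      ¾≤1 = ≤-+ʳ {¾} (*-nonNeg 0≤½ 0≤½)
      ½<1 : ½ ℚ.< 1ℚ
      ½<1 = ℚP.<-≤-trans (ℚP.+-monoʳ-< ½ (ℚP.positive⁻¹ ½)) (ℚP.≤-refl {½ ℚ.+ ½})
      one : 1ℚ ≡ fromℕ (2 ^ t) ℚ.* pow ½ t
      one = trans (sym (pow-one t)) (trans (pow-distrib (fromℕ 2) ½ t) (cong (ℚ._* pow ½ t) (sym (fromℕ-pow 2 t))))
      le-half : lhs ℚ.≤ ½
      le-half = *-cancelˡ-≤q {fromℕ 2} (fromℕ-pos 1) (begin
        fromℕ 2 ℚ.* lhs                                  ≡⟨ cong (fromℕ 2 ℚ.*_) (ℚS.solve 4 (λ p n t x → p ℚS.:* (n ℚS.:* (t ℚS.:* x)) ℚS.:= p ℚS.:* (n ℚS.:* t) ℚS.:* x) refl (fromℕ (2 ^ t)) (fromℕ n) (fromℕ 2) (pow ¾ k)) ⟩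
        fromℕ 2 ℚ.* (fromℕ (2 ^ t) ℚ.* (fromℕ n ℚ.* fromℕ 2) ℚ.* pow ¾ k) ≡⟨ cong (λ z → fromℕ 2 ℚ.* (z ℚ.* pow ¾ k)) (trans (cong (fromℕ (2 ^ t) ℚ.*_) (sym (fromℕ-* n 2))) (sym (fromℕ-* (2 ^ t) (n * 2)))) ⟩
        fromℕ 2 ℚ.* (fromℕ N ℚ.* pow ¾ k)                ≡⟨ trans (sym (ℚP.*-assoc (fromℕ 2) (fromℕ N) (pow ¾ k))) (cong (ℚ._* pow ¾ k) (sym (fromℕ-* 2 N))) ⟩
        fromℕ (2 * N) ℚ.* pow ¾ k                        ≤⟨ *-mono₂ (fromℕ-nonNeg (2 * N)) (fromℕ-mono small) (pow-nonNeg k 0≤¾)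
                                                              (ℚP.≤-trans (pow-antitone 0≤¾ ¾≤1 lo) (ℚP.≤-reflexive (trans (cong (pow ¾) (*-comm m t)) (pow-* ¾ t m)))) ⟩
        fromℕ (256 ^ t) ℚ.* pow x t                      ≡⟨ trans (cong (ℚ._* pow x t) (fromℕ-pow 256 t)) (sym (pow-distrib (fromℕ 256) x t)) ⟩
        pow (fromℕ 256 ℚ.* x) t                          ≤⟨ pow≤1 t (*-nonNeg (fromℕ-nonNeg 256) (pow-nonNeg m 0≤¾)) (¾-power m h) ⟩
        1ℚ                                               ∎)

  -- If n is large compared to k, take k/20 disjoint maximal independent sets and repair their vertices;
  -- otherwise colour the vertices randomly with two colours.
  halfDominating : ∀ {n} {G : Graph n} {a k} → Dense G a → a ≤ k → 80 ≤ k → (∀ v → k ≤ # (adj? G v)) →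
                   ∃ λ W → Unique W × 2 * length W ≤ n × ∀ v → k / 20 ≤ sumL (λ u → bit (adj? G v u)) W
  halfDominating {n} {G} {a} {k} dense a≤k 80≤k deg = go (2 * (k * (k * k)) ≤? n)
    where
    t = k / 20
    20t≤k : 20 * t ≤ k
    20t≤k = ≤-trans (≤-reflexive (*-comm 20 t)) (m/n*n≤m k 20)
    Goal : Set
    Goal = ∃ λ W → Unique W × 2 * length W ≤ n × ∀ v → t ≤ sumL (λ u → bit (adj? G v u)) W
    choose : (∃ λ F → Unique F × (∀ v → t ≤ sumL (λ u → bit (adj? G v u)) F) × (∀ v → t ≤ sumL (λ u → bit (adj? G v u)) (elems (_∉? F)))) → Goal
    choose (F , uq , ins , out) with length F ≤? length (elems (_∉? F))
    ... | yes le = F , uq , ≤-trans (≤-trans (≤-reflexive (cong (length F +_) (+-identityʳ _))) (+-monoʳ-≤ (length F) le)) (half-list F uq) , ins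
    ... | no gt  = elems (_∉? F) , elems-unique (_∉? F) ,
      ≤-trans (≤-trans (≤-reflexive (cong (length (elems (_∉? F)) +_) (+-identityʳ _))) (+-monoˡ-≤ _ (<⇒≤ (≰⇒> gt)))) (half-list F uq) , out
    go : Dec (2 * (k * (k * k)) ≤ n) → Goal
    go (yes big) =
      let W , uq , len , dom = smallDominating {G = G} dense t (λ v → ≤-trans t≤k (deg v))
      in W , uq , ≤-trans (*-monoʳ-≤ 2 (≤-trans len size)) big , dom
      where
      open ≤-Reasoning
      t≤k : t ≤ k
      t≤k = ≤-trans (m≤n*m t 20) 20t≤k
      size : t * a + t * a * t ≤ k * (k * k)
      size = begin
        t * a + t * a * t          ≤⟨ +-mono-≤ (*-mono-≤ t≤k a≤k) (*-monoˡ-≤ t (*-monoʳ-≤ t a≤k)) ⟩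
        k * k + t * k * t          ≤⟨ +-monoˡ-≤ (t * k * t) (≤-trans (≤-reflexive (sym (*-identityʳ (k * k)))) (*-monoʳ-≤ (k * k) 1≤19t)) ⟩
        k * k * (19 * t) + t * k * t ≤⟨ +-monoʳ-≤ (k * k * (19 * t)) (≤-trans (*-monoˡ-≤ t (*-monoˡ-≤ k t≤k)) ≤-refl) ⟩
        k * k * (19 * t) + k * k * t ≡⟨ solve 2 (λ k t → k :* k :* (con 19 :* t) :+ k :* k :* t := k :* k :* (con 20 :* t)) refl k t ⟩
        k * k * (20 * t)           ≤⟨ *-monoʳ-≤ (k * k) 20t≤k ⟩
        k * k * k                  ≡⟨ *-assoc k k k ⟩
        k * (k * k)                ∎
        where
        1≤t : 1 ≤ t
        1≤t = n≢0⇒n>0 λ t≡0 → <⇒≱ (<-≤-trans (m<[1+m/n]*n k 19) (≤-trans (≤-reflexive (cong (λ z → suc z * 20) t≡0)) (m≤m+n 20 60))) 80≤k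
        1≤19t : 1 ≤ 19 * t
        1≤19t = ≤-trans 1≤t (m≤n*m t 19)
    go (no small) = choose (split G deg (rare-bound 20 n k t (≤ᵇ⇒≤ (256 * 3 ^ 20) (4 ^ 20) tt) 20t≤k
      (cubic 20 16 n k t (≤ᵇ⇒≤ (8 * (20 * (20 * 20))) (2 ^ 16) tt) (*-monoʳ-≤ 4 4≤t) (≤-trans (<⇒≤ (m<[1+m/n]*n k 19)) (≤-reflexive (*-comm (suc t) 20))) (≰⇒> small))))
      where
      4≤t : 4 ≤ t
      4≤t = ≤-pred (*-cancelʳ-< 20 4 (suc t) (≤-<-trans 80≤k (m<[1+m/n]*n k 19)))

-- Codes for cuts, and the union bound over them

module Cuts where

  open Counting
  open Graphs
  open Expectation
  open RationalBounds renaming (*-cancelˡ-≤ to *-cancelˡ-≤q)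
  open import Defs using (Graph; Adj; adj?; symm; pairs; fromℕ; fromℕ-nonNeg; *-mono; *-nonNeg; 0≤1)
  open import Data.Nat.Base
  open import Data.Nat.Properties
  open import Data.Nat.Solver using (module +-*-Solver)
  open import Data.Rational.Base as ℚ using (ℚ; 0ℚ; 1ℚ)
  import Data.Rational.Properties as ℚP
  open import Data.Fin.Base as Fin using (Fin)
  import Data.Fin.Properties as Fin
  import Data.Fin.Subset as Subset
  import Data.Fin.Subset.Properties as Subset?
  open import Data.Fin.Subset using (Subset)
  open import Data.List.Base using (List; []; _∷_; _++_; length; allFin; map; cartesianProduct; cartesianProductWith; upTo)
  open import Data.List.Properties using (length-++; length-map; length-upTo; length-tabulate)
  open import Data.List.Membership.Propositional using (_∈_; _∉_)
  open import Data.List.Membership.Propositional.Properties using (∈-++⁺ˡ; ∈-++⁺ʳ; ∈-++⁻; ∈-allFin; ∈-upTo⁺; ∈-cartesianProduct⁺; ∈-cartesianProductWith⁺; ∈-∃++)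
  open import Data.List.Relation.Unary.Any as Any using (here; there)
  open import Data.List.Relation.Unary.All as All using (All; []; _∷_)
  import Data.List.Relation.Unary.All.Properties as All
  open import Data.List.Relation.Unary.AllPairs using ([]; _∷_)
  open import Data.List.Relation.Unary.Unique.Propositional using (Unique)
  open import Data.Product.Base using (∃; _×_; _,_)
  open import Data.Sum.Base using (_⊎_; inj₁; inj₂)
  open import Data.Empty using (⊥; ⊥-elim)
  open import Function.Base using (_∘_)
  open import Relation.Binary.PropositionalEquality
  open import Relation.Binary.Definitions using (tri<; tri≈; tri>)
  open import Relation.Nullary using (¬_; Dec; yes; no; contradiction)
  open import Relation.Nullary.Decidable using (_×-dec_; _⊎-dec_; _→-dec_; ¬?)

  unique⊆⇒length≤ : ∀ {A : Set} {xs ys : List A} → Unique xs → (∀ {x} → x ∈ xs → x ∈ ys) → length xs ≤ length ys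
  unique⊆⇒length≤ [] _ = z≤n
  unique⊆⇒length≤ {xs = x ∷ xs} (x∉ ∷ u) sub with as , bs , refl ← ∈-∃++ (sub (here refl)) =
    ≤-trans (s≤s (unique⊆⇒length≤ u λ {y} y∈ → drop-x y∈ (∈-++⁻ as (sub (there y∈)))))
      (≤-reflexive (sym (trans (length-++ as) (trans (+-suc (length as) (length bs)) (cong suc (sym (length-++ as)))))))
    where
    drop-x : ∀ {y} → y ∈ xs → y ∈ as ⊎ y ∈ x ∷ bs → y ∈ as ++ bs
    drop-x y∈ (inj₁ p)           = ∈-++⁺ˡ p
    drop-x y∈ (inj₂ (here refl)) = contradiction refl (All.lookup x∉ y∈)
    drop-x y∈ (inj₂ (there p))   = ∈-++⁺ʳ as p

  module _ {m : ℕ} (Γ : Graph m) where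

    Closed : (Fin m → Set) → Subset m → Set
    Closed S U = ∀ u v → u Subset.∈ U → Adj Γ u v → ¬ S v → v Subset.∈ U

    -- Membership in the least set that contains rs and is closed under adjacency in Γ ∖ S.
    InCl : (Fin m → Set) → List (Fin m) → Fin m → Set
    InCl S rs v = ¬ ∃ λ U → Closed S U × All (Subset._∈ U) rs × v Subset.∉ U

    opaque
      inCl? : ∀ {S : Fin m → Set} → (∀ v → Dec (S v)) → ∀ rs v → Dec (InCl S rs v)
      inCl? S? rs v = ¬? (Subset?.anySubset? λ U →
        (Fin.all? λ u → Fin.all? λ v → (u Subset?.∈? U) →-dec (adj? Γ u v →-dec (¬? (S? v) →-dec (v Subset?.∈? U))))
        ×-dec All.all? (Subset?._∈? U) rs ×-dec ¬? (v Subset?.∈? U))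

    InCl-resp : ∀ {S S′ : Fin m → Set} {rs v} → (∀ u → S u → S′ u) → InCl S′ rs v → InCl S rs v
    InCl-resp f h (U , cl , al , v∉) = h (U , (λ u v u∈ uv ¬S′ → cl u v u∈ uv (¬S′ ∘ f v)) , al , v∉)

    module _ {S : Fin m → Set} (S? : ∀ v → Dec (S v)) where

      InCl-least : ∀ {P : Fin m → Set} (P? : ∀ v → Dec (P v)) {rs} → All P rs → (∀ {u v} → P u → Adj Γ u v → ¬ S v → P v) → ∀ {v} → InCl S rs v → P v
      InCl-least P? al cl {v} h with P? v
      ... | yes p = p
      ... | no ¬p = ⊥-elim (h (fromPred P? , (λ u v u∈ uv ¬S → fromPred⁺ P? (cl (fromPred⁻ P? u∈) uv ¬S)) , All.map (fromPred⁺ P?) al , ¬p ∘ fromPred⁻ P?))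

      InCl-rep : ∀ {rs r} → r ∈ rs → InCl S rs r
      InCl-rep r∈ (U , _ , al , r∉) = r∉ (All.lookup al r∈)

      InCl-step : ∀ {rs u v} → InCl S rs u → Adj Γ u v → ¬ S v → InCl S rs v
      InCl-step {u = u} {v} h uv ¬S (U , cl , al , v∉) with u Subset?.∈? U
      ... | yes u∈ = v∉ (cl u v u∈ uv ¬S)
      ... | no u∉  = h (U , cl , al , u∉)

      InCl-∷ : ∀ {rs r v} → InCl S rs v → InCl S (r ∷ rs) v
      InCl-∷ h (U , cl , _ ∷ al , v∉) = h (U , cl , al , v∉)

      -- Representatives are added greedily; each one contributes its neighbourhood, which is disjoint from the closure so far.
      module _ {U : Fin m → Set} (U? : ∀ v → Dec (U v)) (U¬S : ∀ {v} → U v → ¬ S v) (U-closed : ∀ {u v} → U u → Adj Γ u v → ¬ S v → U v)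
               {g : ℕ} (1≤g : 1 ≤ g) (deg : ∀ v → g ≤ # (λ u → adj? Γ v u ×-dec ¬? (S? u))) where

        private
          size : List (Fin m) → ℕ
          size rs = # (inCl? S? rs)

          grow : ∀ r rs → U r → ¬ InCl S rs r → g + size rs ≤ size (r ∷ rs)
          grow r rs Ur r∉ = ≤-trans (+-monoˡ-≤ (size rs) (deg r))
            (#-disjoint (λ u → adj? Γ r u ×-dec ¬? (S? u)) (inCl? S? rs) (inCl? S? (r ∷ rs))
              (λ u (ru , ¬Su) → InCl-step (InCl-rep (here refl)) ru ¬Su) (λ u → InCl-∷)
              (λ u (ru , ¬Su) u∈ → r∉ (InCl-step u∈ (symm Γ ru) (U¬S Ur))))

          go : ∀ fuel rs → All U rs → length rs * g ≤ size rs → m < size rs + fuel →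
               ∃ λ rs → All U rs × length rs * g ≤ size rs × (∀ {v} → U v → InCl S rs v)
          go zero rs _ _ h = contradiction (≤-trans h (≤-trans (≤-reflexive (+-identityʳ _)) (#≤n (inCl? S? rs)))) (<-irrefl refl)
          go (suc f) rs al len h with Fin.any? (λ v → U? v ×-dec ¬? (inCl? S? rs v))
          ... | yes (v , Uv , v∉) = go f (v ∷ rs) (Uv ∷ al) (≤-trans (+-monoʳ-≤ g len) (grow v rs Uv v∉))
                  (≤-trans h (≤-trans (≤-reflexive (+-suc (size rs) f)) (+-monoˡ-≤ f (≤-trans (+-monoˡ-≤ (size rs) 1≤g) (grow v rs Uv v∉)))))
          ... | no none = rs , al , len , λ {v} Uv → all v Uv
            where
            all : ∀ v → U v → InCl S rs v
            all v Uv with inCl? S? rs v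
            ... | yes p = p
            ... | no p  = contradiction (v , Uv , p) none

        representatives : ∃ λ rs → All U rs × length rs * g ≤ # U? × (∀ {v} → U v → InCl S rs v) × (∀ {v} → InCl S rs v → U v)
        representatives =
          let rs , al , len , cov = go (suc m) [] [] z≤n (≤-trans (n<1+n m) (m≤n+m (suc m) (size [])))
              inU = InCl-least U? al U-closed
          in rs , al , ≤-trans len (#-mono (inCl? S? rs) U? λ v → inU) , cov , inU

  length-cartesianProductWith : ∀ {A B C : Set} (f : A → B → C) xs ys → length (cartesianProductWith f xs ys) ≡ length xs * length ys
  length-cartesianProductWith f []       ys = refl
  length-cartesianProductWith f (x ∷ xs) ys = trans (length-++ (map (f x) ys)) (cong₂ _+_ (length-map (f x) ys) (length-cartesianProductWith f xs ys))

  words : ∀ m → ℕ → List (List (Fin m))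
  words m zero    = [] ∷ []
  words m (suc L) = cartesianProductWith _∷_ (allFin m) (words m L)

  ∈-words : ∀ {m} (xs : List (Fin m)) {L} → length xs ≡ L → xs ∈ words m L
  ∈-words []       refl = here refl
  ∈-words (x ∷ xs) refl = ∈-cartesianProductWith⁺ _∷_ (∈-allFin x) (∈-words xs refl)

  length-words : ∀ m L → length (words m L) ≡ m ^ L
  length-words m zero    = refl
  length-words m (suc L) = trans (length-cartesianProductWith _∷_ (allFin m) (words m L)) (cong₂ _*_ (length-tabulate {n = m} (λ i → i)) (length-words m L))

  #-crossing : ∀ {n} {I O : Fin n → Set} (I? : ∀ v → Dec (I v)) (O? : ∀ v → Dec (O v)) → (∀ {v} → I v → O v → ⊥) →
               # I? * # O? ≤ sumL (λ (u , v) → bit ((I? u ×-dec O? v) ⊎-dec (I? v ×-dec O? u))) (pairs n)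
  #-crossing {n} {I} {O} I? O? disjoint = begin
    # I? * # O?
      ≡⟨ trans (∑-cong λ u → ∑-*ˡ (bit (I? u)) (λ v → bit (O? v))) (∑-*ʳ (# O?) (λ u → bit (I? u))) ⟨
    ∑ (λ u → ∑ (λ v → h u v))
      ≤⟨ ∑-mono (λ u → ∑-mono λ v → apart u v) ⟩
    ∑ (λ u → ∑ (λ v → (bit (u Fin.<? v) + bit (v Fin.<? u)) * h u v))
      ≡⟨ pairSum h ⟨
    sumL (λ (u , v) → h u v + h v u) (pairs n)
      ≤⟨ sumL-mono (pairs n) (λ { {u , v} _ → both u v }) ⟩
    sumL (λ (u , v) → bit ((I? u ×-dec O? v) ⊎-dec (I? v ×-dec O? u))) (pairs n) ∎
    where
    open ≤-Reasoning
    h : Fin n → Fin n → ℕ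
    h u v = bit (I? u) * bit (O? v)
    bits : ∀ {P Q : Set} (p : Dec P) (q : Dec Q) → bit p * bit q ≡ bit (p ×-dec q)
    bits (yes _) (yes _) = refl
    bits (yes _) (no _)  = refl
    bits (no _)  _       = refl
    ≤-multiple : ∀ {k x} → 1 ≤ k → x ≤ k * x
    ≤-multiple {k} {x} 1≤k = ≤-trans (≤-reflexive (sym (+-identityʳ x))) (*-monoˡ-≤ x 1≤k)
    -- The sets are disjoint, so the two vertices differ, and one of the two orders occurs in the
    -- weight of `pairSum`.
    apart : ∀ u v → h u v ≤ (bit (u Fin.<? v) + bit (v Fin.<? u)) * h u v
    apart u v = go (I? u ×-dec O? v) (bits (I? u) (O? v))
      where
      go : (d : Dec (I u × O v)) → h u v ≡ bit d → h u v ≤ (bit (u Fin.<? v) + bit (v Fin.<? u)) * h u v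
      go (no _) eq = ≤-trans (≤-reflexive eq) z≤n
      go (yes (i , o)) eq with Fin.<-cmp u v
      ... | tri< lt _ _   = ≤-multiple (≤-trans (≤-reflexive (sym (bit-yes (u Fin.<? v) lt))) (m≤m+n (bit (u Fin.<? v)) (bit (v Fin.<? u))))
      ... | tri> _ _ gt   = ≤-multiple (≤-trans (≤-reflexive (sym (bit-yes (v Fin.<? u) gt))) (m≤n+m (bit (v Fin.<? u)) (bit (u Fin.<? v))))
      ... | tri≈ _ refl _ = ⊥-elim (disjoint i o)
    both : ∀ u v → h u v + h v u ≤ bit ((I? u ×-dec O? v) ⊎-dec (I? v ×-dec O? u))
    both u v = ≤-trans (≤-reflexive (cong₂ _+_ (bits (I? u) (O? v)) (bits (I? v) (O? u))))
      (bit-disjoint (I? u ×-dec O? v) (I? v ×-dec O? u) ((I? u ×-dec O? v) ⊎-dec (I? v ×-dec O? u)) inj₁ inj₂ (λ (i , _) (_ , o) → disjoint i o))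

  module _ {n m : ℕ} (e : Fin m → Fin n) (e-inj : ∀ {i j} → e i ≡ e j → i ≡ j) (Γ : Graph m) where

    -- A code consists of the representatives `rs` of one half and a word `σ` for the separator. The
    -- word is padded with a representative to reach a fixed length, and removing `rs` undoes the
    -- padding. Decoding uses `Γ` only, so for a fixed code the pairs that must not be edges do not
    -- depend on the random graph.
    CodeS : List (Fin m) → List (Fin m) → Fin m → Set
    CodeS σ rs v = v ∈ σ × v ∉ rs

    codeS? : ∀ σ rs v → Dec (CodeS σ rs v)
    codeS? σ rs v = (v ∈? σ) ×-dec (v ∉? rs)

    In Out : List (Fin m) → List (Fin m) → Fin m → Set
    In σ rs = InCl Γ (CodeS σ rs) rs
    Out σ rs v = ¬ In σ rs v × ¬ CodeS σ rs v

    in? : ∀ σ rs v → Dec (In σ rs v)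
    in? σ rs = inCl? Γ (codeS? σ rs) rs

    out? : ∀ σ rs v → Dec (Out σ rs v)
    out? σ rs v = ¬? (in? σ rs v) ×-dec ¬? (codeS? σ rs v)

    Image : (Fin m → Set) → Fin n → Set
    Image P u = ∃ λ x → e x ≡ u × P x

    opaque
      image? : ∀ {P : Fin m → Set} → (∀ x → Dec (P x)) → ∀ u → Dec (Image P u)
      image? P? u = Fin.any? λ x → (e x Fin.≟ u) ×-dec P? x

    Crossing : List (Fin m) × List (Fin m) → Fin n × Fin n → Set
    Crossing (σ , rs) (u , v) = (Image (In σ rs) u × Image (Out σ rs) v) ⊎ (Image (In σ rs) v × Image (Out σ rs) u)

    crossing? : ∀ c p → Dec (Crossing c p)
    crossing? (σ , rs) (u , v) = (image? (in? σ rs) u ×-dec image? (out? σ rs) v) ⊎-dec (image? (in? σ rs) v ×-dec image? (out? σ rs) u)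

    crossings : List (Fin m) × List (Fin m) → ℕ
    crossings c = sumL (λ p → bit (crossing? c p)) (pairs n)

    crossings≥ : ∀ σ rs → # (in? σ rs) * # (out? σ rs) ≤ crossings (σ , rs)
    crossings≥ σ rs = ≤-trans
      (*-mono-≤ (#-image e e-inj (in? σ rs) (image? (in? σ rs)) λ x p → x , refl , p) (#-image e e-inj (out? σ rs) (image? (out? σ rs)) λ x p → x , refl , p))
      (#-crossing (image? (in? σ rs)) (image? (out? σ rs)) disjoint)
      where
      disjoint : ∀ {u} → Image (In σ rs) u → Image (Out σ rs) u → ⊥
      disjoint (x , ex , p) (y , ey , ¬p , _) = ¬p (subst (In σ rs) (e-inj (trans ex (sym ey))) p)

    -- fail F is the number of codes with many crossing pairs, none of which is in F.
    module _ (B N : ℕ) where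

      codes : ℕ → List (List (Fin m) × List (Fin m))
      codes M = cartesianProduct (words m (B * M)) (words m M)

      term : ℕ → List (Fin m) × List (Fin m) → List (Fin n × Fin n) → ℚ
      term M c F with M * N ≤? crossings c
      ... | yes _ = ∏ (λ p → ind (¬? (crossing? c p))) F
      ... | no _  = 0ℚ

      private
        0≤∏ : ∀ c F → 0ℚ ℚ.≤ ∏ (λ p → ind (¬? (crossing? c p))) F
        0≤∏ c []      = 0≤1
        0≤∏ c (p ∷ F) = *-nonNeg (0≤ind (¬? (crossing? c p))) (0≤∏ c F)

      0≤term : ∀ M c F → 0ℚ ℚ.≤ term M c F
      0≤term M c F with M * N ≤? crossings c
      ... | yes _ = 0≤∏ c F
      ... | no _  = ℚP.≤-refl

      fail : List (Fin n × Fin n) → ℚ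
      fail F = ∑q (λ M → ∑q (λ c → term (suc M) c F) (codes (suc M))) (upTo m)

      fail≥1 : ∀ {M σ rs F} → M < m → length σ ≡ B * suc M → length rs ≡ suc M → suc M * N ≤ crossings (σ , rs) →
               (∀ {p} → p ∈ F → ¬ Crossing (σ , rs) p) → 1ℚ ℚ.≤ fail F
      fail≥1 {M} {σ} {rs} {F} M<m lσ lr many none = ℚP.≤-trans (one (suc M * N ≤? crossings (σ , rs)) refl)
        (ℚP.≤-trans (∑q-term {f = λ c → term (suc M) c F} (λ c → 0≤term (suc M) c F) (∈-cartesianProduct⁺ (∈-words σ lσ) (∈-words rs lr)))
          (∑q-term {f = λ M → ∑q (λ c → term (suc M) c F) (codes (suc M))} (λ M → ∑q-nonNeg (codes (suc M)) λ c → 0≤term (suc M) c F) (∈-upTo⁺ M<m)))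
        where
        allOne : ∀ F → (∀ {p} → p ∈ F → ¬ Crossing (σ , rs) p) → ∏ (λ p → ind (¬? (crossing? (σ , rs) p))) F ≡ 1ℚ
        allOne []      _ = refl
        allOne (p ∷ F) h = trans (cong₂ ℚ._*_ (is-one (crossing? (σ , rs) p) (h (here refl))) (allOne F (h ∘ there))) (ℚP.*-identityˡ 1ℚ)
          where
          is-one : ∀ {P : Set} (d : Dec P) → ¬ P → ind (¬? d) ≡ 1ℚ
          is-one (yes p) ¬p = contradiction p ¬p
          is-one (no _)  _  = refl
        one : (d : Dec (suc M * N ≤ crossings (σ , rs))) → (suc M * N ≤? crossings (σ , rs)) ≡ d → 1ℚ ℚ.≤ term (suc M) (σ , rs) F
        one _ _ with suc M * N ≤? crossings (σ , rs)
        ... | yes _ = ℚP.≤-reflexive (sym (allOne F none))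
        ... | no ¬h = contradiction many ¬h

      module _ {q : ℚ} (0≤q : 0ℚ ℚ.≤ q) (q≤1 : q ℚ.≤ 1ℚ) where

        private
          x = pow (1ℚ ℚ.- q) N
          0≤1-q = ≤⇒0≤- q≤1
          0≤x = pow-nonNeg N 0≤1-q

        E-term : ∀ M c → 𝔼q q (pairs n) (term M c) ℚ.≤ pow x M
        E-term M c with M * N ≤? crossings c
        ... | yes h = ℚP.≤-trans (ℚP.≤-reflexive (trans (𝔼-∏ q (pairs n) _) (∏-01 (crossing? c) q (pairs n))))
                        (ℚP.≤-trans (pow-antitone 0≤1-q 1-q≤1 h) (ℚP.≤-reflexive (pow-* (1ℚ ℚ.- q) M N)))
          where
          1-q≤1 : 1ℚ ℚ.- q ℚ.≤ 1ℚ
          1-q≤1 = ℚP.≤-trans (ℚP.+-monoʳ-≤ 1ℚ (ℚP.neg-antimono-≤ 0≤q)) (ℚP.≤-reflexive (ℚP.+-identityʳ 1ℚ))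
        ... | no _  = ℚP.≤-trans (ℚP.≤-reflexive (𝔼-const q (pairs n) 0ℚ)) (pow-nonNeg M 0≤x)

        length-codes : ∀ M → length (codes M) ≡ (m ^ suc B) ^ M
        length-codes M = trans (length-cartesianProductWith _,_ (words m (B * M)) (words m M))
          (trans (cong₂ _*_ (length-words m (B * M)) (length-words m M))
          (trans (sym (^-distribˡ-+-* m (B * M) M)) (trans (cong (m ^_) (+-comm (B * M) M)) (sym (^-*-assoc m (suc B) M)))))

        -- There are (m^(B+1))^M codes with M representatives, and each occurs with probability at
        -- most x^M. The product is at most y^M, hence at most y, and M takes m values.
        E-fail : ∀ {y} → fromℕ (m ^ suc B) ℚ.* x ℚ.≤ y → y ℚ.≤ 1ℚ → 𝔼q q (pairs n) fail ℚ.≤ fromℕ m ℚ.* y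
        E-fail {y} h y≤1 = begin
          𝔼q q (pairs n) fail
            ≡⟨ trans (𝔼-∑ q (pairs n) (upTo m) (λ M F → ∑q (λ c → term (suc M) c F) (codes (suc M)))) (∑q-cong (upTo m) λ {M} _ → 𝔼-∑ q (pairs n) (codes (suc M)) (term (suc M))) ⟩
          ∑q (λ M → ∑q (λ c → 𝔼q q (pairs n) (term (suc M) c)) (codes (suc M))) (upTo m)
            ≤⟨ ∑q-mono (upTo m) (λ {M} _ → level M) ⟩
          ∑q (λ _ → y) (upTo m)
            ≡⟨ trans (∑q-const y (upTo m)) (cong (λ z → fromℕ z ℚ.* y) (length-upTo m)) ⟩
          fromℕ m ℚ.* y ∎
          where
          open ℚP.≤-Reasoning
          W = fromℕ (m ^ suc B)
          0≤Wx : 0ℚ ℚ.≤ W ℚ.* x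
          0≤Wx = *-nonNeg (fromℕ-nonNeg (m ^ suc B)) 0≤x
          level : ∀ M → ∑q (λ c → 𝔼q q (pairs n) (term (suc M) c)) (codes (suc M)) ℚ.≤ y
          level M = begin
            ∑q (λ c → 𝔼q q (pairs n) (term (suc M) c)) (codes (suc M))  ≤⟨ ∑q-mono (codes (suc M)) (λ {c} _ → E-term (suc M) c) ⟩
            ∑q (λ _ → pow x (suc M)) (codes (suc M))                    ≡⟨ trans (∑q-const _ (codes (suc M))) (cong (λ z → fromℕ z ℚ.* pow x (suc M)) (length-codes (suc M))) ⟩
            fromℕ ((m ^ suc B) ^ suc M) ℚ.* pow x (suc M)               ≡⟨ trans (cong (ℚ._* pow x (suc M)) (fromℕ-pow (m ^ suc B) (suc M))) (sym (pow-distrib W x (suc M))) ⟩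
            pow (W ℚ.* x) (suc M)                                       ≤⟨ *-mono 0≤Wx (pow≤1 M 0≤Wx (ℚP.≤-trans h y≤1)) ⟩
            W ℚ.* x ℚ.* 1ℚ                                              ≡⟨ ℚP.*-identityʳ (W ℚ.* x) ⟩
            W ℚ.* x                                                     ≤⟨ h ⟩
            y                                                           ∎

-- From a violation of toughness to a code

module Components where

  open Counting
  open Graphs
  open Cuts
  open import Defs using (Graph; Adj; adj?; irrefl; edgeGraph; ComponentCount)
  open import Data.Nat.Base
  open import Data.Nat.Properties
  open import Data.Nat.Solver using (module +-*-Solver)
  open +-*-Solver using (solve; con; _:+_; _:*_; _:=_)
  open import Data.Rational.Base as ℚ using (1ℚ)
  open import Data.Unit.Base using (⊤; tt)
  open import Data.Fin.Base as Fin using (Fin; toℕ; fromℕ<)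
  import Data.Fin.Properties as Fin
  import Data.Fin.Subset as Subset
  import Data.Fin.Subset.Properties as Subset?
  open import Data.Fin.Subset using (Subset; ∣_∣)
  open import Data.List.Base using (List; []; _∷_; _++_; length; allFin; map; replicate)
  open import Data.List.Properties using (length-++; length-map; length-replicate; length-tabulate)
  open import Data.List.Membership.Propositional using (_∈_; _∉_)
  open import Data.List.Membership.Propositional.Properties using (∈-++⁺ˡ; ∈-++⁻; ∈-map⁺; ∈-map⁻)
  open import Data.List.Relation.Unary.Any using (here; there)
  open import Data.List.Relation.Unary.All as All using (All; []; _∷_)
  import Data.List.Relation.Unary.Unique.Propositional.Properties as Unique
  open import Data.Product.Base using (∃; _×_; _,_; proj₁; proj₂)
  open import Data.Sum.Base as Sum using (_⊎_; inj₁; inj₂)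
  open import Function.Base using (_∘_)
  open import Function.Bundles using (Equivalence)
  open import Relation.Binary.Construct.Closure.ReflexiveTransitive using (ε; _◅_)
  open import Relation.Binary.PropositionalEquality
  open import Relation.Nullary using (¬_; Dec; yes; no; contradiction)
  open import Relation.Nullary.Decidable using (_×-dec_; _⊎-dec_; ¬?)

  -- Components enter through a function that is constant along the edges outside `S`; on `S` itself
  -- its values are arbitrary.
  record Labelling {m : ℕ} (H : Graph m) (S : Subset m) (c : ℕ) : Set where
    field
      label    : Fin m → Fin c
      constant : ∀ {u v} → u Subset.∉ S → v Subset.∉ S → Adj H u v → label u ≡ label v
      attained : ∀ i → ∃ λ v → v Subset.∉ S × label v ≡ i

  -- Proofs of v ∉ S are definitionally equal, so a label depends on the vertex only.
  labelling : ∀ {m} {H : Graph m} {S c} → ComponentCount H S c → 1 ≤ c → Labelling H S c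
  labelling {m} {H} {S} {c} C 1≤c = record { label = label ; constant = constant ; attained = attained }
    where
    open ComponentCount C
    pick : ∀ v → Dec (v Subset.∈ S) → Fin c
    pick v (yes _)  = fromℕ< 1≤c
    pick v (no v∉) = component (v , v∉)
    label : Fin m → Fin c
    label v = pick v (v Subset?.∈? S)
    spec : ∀ v (v∉ : v Subset.∉ S) → label v ≡ component (v , v∉)
    spec v v∉ = go (v Subset?.∈? S)
      where
      go : (d : Dec (v Subset.∈ S)) → pick v d ≡ component (v , v∉)
      go (yes v∈) = contradiction v∈ v∉
      go (no _)   = refl
    constant : ∀ {u v} → u Subset.∉ S → v Subset.∉ S → Adj H u v → label u ≡ label v
    constant {u} {v} u∉ v∉ uv = trans (spec u u∉) (trans (Equivalence.from (separates (u , u∉) (v , v∉)) (uv ◅ ε)) (sym (spec v v∉)))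
    attained : ∀ i → ∃ λ v → v Subset.∉ S × label v ≡ i
    attained i = let (v , v∉) , eq = surjective i in v , v∉ , trans (spec v v∉) eq

  module _ {n m : ℕ} (e : Fin m → Fin n) (e-inj : ∀ {i j} → e i ≡ e j → i ≡ j) {Γ H : Graph m} {F : List (Fin n × Fin n)}
           (Γ⊆H : ∀ {u v} → Adj Γ u v → Adj H u v) (F⊆H : ∀ {u v} → Adj (edgeGraph F) (e u) (e v) → Adj H u v)
           {T a s g z : ℕ} (dense : Dense Γ a) (deg : ∀ v → s ≤ # (adj? Γ v)) (1≤g : 1 ≤ g) (large : T * a + g ≤ s) (room : 2 * z + T * a ≤ m)
           {S : Subset m} {c : ℕ} where

    private
      S? = Subset?._∈? S

      module Half (L : Labelling H S c) (∣S∣≤Ta : ∣ S ∣ ≤ T * a) (outside : ∀ v → g ≤ # (λ u → adj? Γ v u ×-dec ¬? (S? u)))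
                  {A : Fin c → Set} (A? : ∀ i → Dec (A i)) where
        open Labelling L

        U Z : Fin m → Set
        U v = v Subset.∉ S × A (label v)
        Z v = v Subset.∉ S × ¬ A (label v)

        U? : ∀ v → Dec (U v)
        U? v = ¬? (S? v) ×-dec A? (label v)

        Z? : ∀ v → Dec (Z v)
        Z? v = ¬? (S? v) ×-dec ¬? (A? (label v))

        -- Since `S` has at most Ta vertices, the two halves together have at least 2z, and `Z` is
        -- the larger one.
        z≤#Z : # U? ≤ # Z? → z ≤ # Z?
        z≤#Z U≤Z = *-cancelˡ-≤ 2 (+-cancelʳ-≤ (T * a) (2 * z) (2 * # Z?) (begin
          2 * z + T * a           ≤⟨ room ⟩
          m                       ≡⟨ #-all {P = λ _ → ⊤} (λ _ → yes tt) (λ _ → tt) ⟨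
          # {m} {λ _ → ⊤} (λ _ → yes tt)  ≤⟨ #-⊎ {Q = Subset._∈ S} UZ? S? (λ _ → yes tt) (λ v _ → inSorUZ v) ⟩
          # UZ? + # S?            ≤⟨ +-mono-≤ (#-⊎ U? Z? UZ? (λ _ p → p)) (≤-trans (≤-reflexive (sym (∣S∣≡# S))) ∣S∣≤Ta) ⟩
          # U? + # Z? + T * a     ≤⟨ +-monoˡ-≤ (T * a) (+-monoˡ-≤ (# Z?) U≤Z) ⟩
          # Z? + # Z? + T * a     ≡⟨ cong (_+ T * a) (cong (# Z? +_) (sym (+-identityʳ (# Z?)))) ⟩
          2 * # Z? + T * a        ∎))
          where
          open ≤-Reasoning
          UZ? : ∀ v → Dec (U v ⊎ Z v)
          UZ? v = U? v ⊎-dec Z? v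
          inSorUZ : ∀ v → (U v ⊎ Z v) ⊎ v Subset.∈ S
          inSorUZ v with S? v | A? (label v)
          ... | yes v∈ | _     = inj₂ v∈
          ... | no v∉  | yes p = inj₁ (inj₁ (v∉ , p))
          ... | no v∉  | no p  = inj₁ (inj₂ (v∉ , p))

        -- Closures do not change labels, so each of the h components of the half contains a
        -- representative and M ≥ h. Hence `S` fits into a word with 3T letters per representative.
        -- The half has at least Mg vertices and the rest at least z, which gives the required
        -- number of crossing pairs.
        fails : ∀ {h} (f : Fin h → Fin c) → (∀ {i j} → f i ≡ f j → i ≡ j) → (∀ j → A (f j)) → 1 ≤ h → ∣ S ∣ ≤ T * 3 * h → # U? ≤ # Z? →
                1ℚ ℚ.≤ fail e e-inj Γ (T * 3) (g * z) F
        fails {h} f f-inj A-f 1≤h ∣S∣≤ U≤Z with representatives Γ S? U? proj₁ U-closed 1≤g outside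
          where
          U-closed : ∀ {u v} → U u → Adj Γ u v → v Subset.∉ S → U v
          U-closed (u∉ , Au) uv v∉ = v∉ , subst A (constant u∉ v∉ (Γ⊆H uv)) Au
        ... | rs , al , len , cov , inU = go rs refl
          where
          M = length rs
          hit : ∀ {v} → U v → label v ∈ map label rs
          hit Uv = proj₂ (InCl-least Γ S? {P = λ v → v Subset.∉ S × label v ∈ map label rs} (λ v → ¬? (S? v) ×-dec (label v ∈? map label rs))
            (All.tabulate λ r∈ → proj₁ (All.lookup al r∈) , ∈-map⁺ label r∈)
            (λ { (u∉ , p) uv v∉ → v∉ , subst (_∈ map label rs) (constant u∉ v∉ (Γ⊆H uv)) p }) (cov Uv))
          h≤M : h ≤ M
          h≤M = ≤-trans (≤-reflexive (sym (trans (length-map f (allFin h)) (length-tabulate {n = h} (λ i → i)))))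
            (≤-trans (unique⊆⇒length≤ (Unique.map⁺ f-inj (Unique.allFin⁺ h)) f⊆) (≤-reflexive (length-map label rs)))
            where
            f⊆ : ∀ {i} → i ∈ map f (allFin h) → i ∈ map label rs
            f⊆ i∈ with j , _ , refl ← ∈-map⁻ f i∈ with v , v∉ , eq ← attained (f j) =
              subst (_∈ map label rs) eq (hit (v∉ , subst A (sym eq) (A-f j)))
          go : ∀ rs′ → rs ≡ rs′ → 1ℚ ℚ.≤ fail e e-inj Γ (T * 3) (g * z) F
          go [] refl = contradiction (≤-trans 1≤h h≤M) λ ()
          go (r ∷ rs′) refl = fail≥1 e e-inj Γ (T * 3) (g * z) {length rs′} {σ} {rs} {F} M<m lσ refl many none
            where
            open ≤-Reasoning
            -- The word is filled up with the representative `r`, which lies outside `S` and is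
            -- removed again by the decoding.
            pad = T * 3 * M ∸ ∣ S ∣
            σ = elems S? ++ replicate pad r
            lσ : length σ ≡ T * 3 * M
            lσ = trans (length-++ (elems S?)) (trans (cong₂ _+_ (trans (length-elems S?) (sym (∣S∣≡# S))) (length-replicate pad))
                   (m+[n∸m]≡n (≤-trans ∣S∣≤ (*-monoʳ-≤ (T * 3) h≤M))))
            M<m : M ≤ m
            M<m = ≤-trans (≤-trans (≤-reflexive (sym (*-identityʳ M))) (*-monoʳ-≤ M 1≤g)) (≤-trans len (#≤n U?))
            ∈-replicate : ∀ k {v} → v ∈ replicate k r → v ≡ r
            ∈-replicate (suc k) (here eq) = eq
            ∈-replicate (suc k) (there p) = ∈-replicate k p
            code⇒S : ∀ v → CodeS e e-inj Γ σ rs v → v Subset.∈ S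
            code⇒S v (v∈ , v∉) with ∈-++⁻ (elems S?) v∈
            ... | inj₁ p = ∈-elems⁻ S? p
            ... | inj₂ p = contradiction (here (∈-replicate pad p)) v∉
            S⇒code : ∀ v → v Subset.∈ S → CodeS e e-inj Γ σ rs v
            S⇒code v v∈ = ∈-++⁺ˡ (∈-elems⁺ S? v∈) , λ v∈rs → proj₁ (All.lookup al v∈rs) v∈
            U⇒In : ∀ v → U v → In e e-inj Γ σ rs v
            U⇒In v Uv = InCl-resp Γ code⇒S (cov Uv)
            In⇒U : ∀ v → In e e-inj Γ σ rs v → U v
            In⇒U v p = inU (InCl-resp Γ S⇒code p)
            Z⇒Out : ∀ v → Z v → Out e e-inj Γ σ rs v
            Z⇒Out v (v∉ , ¬A) = (λ p → ¬A (proj₂ (In⇒U v p))) , λ p → v∉ (code⇒S v p)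
            Out⇒Z : ∀ v → Out e e-inj Γ σ rs v → Z v
            Out⇒Z v (¬In , ¬code) = (λ v∈ → ¬code (S⇒code v v∈)) , λ Av → ¬In (U⇒In v ((λ v∈ → ¬code (S⇒code v v∈)) , Av))
            many : M * (g * z) ≤ crossings e e-inj Γ (σ , rs)
            many = begin
              M * (g * z)                                            ≡⟨ *-assoc M g z ⟨
              M * g * z                                              ≤⟨ *-mono-≤ len (z≤#Z U≤Z) ⟩
              # U? * # Z?                                            ≤⟨ *-mono-≤ (#-mono U? (in? e e-inj Γ σ rs) U⇒In) (#-mono Z? (out? e e-inj Γ σ rs) Z⇒Out) ⟩
              # (in? e e-inj Γ σ rs) * # (out? e e-inj Γ σ rs)       ≤⟨ crossings≥ e e-inj Γ σ rs ⟩
              crossings e e-inj Γ (σ , rs)                           ∎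
            apart : ∀ {x y} → U x → Z y → ¬ Adj (edgeGraph F) (e x) (e y)
            apart (x∉ , Ax) (y∉ , ¬Ay) xy = ¬Ay (subst A (constant x∉ y∉ (F⊆H xy)) Ax)
            distinct : ∀ {x y} → U x → Z y → e x ≢ e y
            distinct (_ , Ax) (_ , ¬Ay) eq = ¬Ay (subst (A ∘ label) (e-inj eq) Ax)
            none : ∀ {p} → p ∈ F → ¬ Crossing e e-inj Γ (σ , rs) p
            none p∈ (inj₁ ((x , refl , i) , (y , refl , o))) = apart (In⇒U x i) (Out⇒Z y o) (distinct (In⇒U x i) (Out⇒Z y o) , inj₁ p∈)
            none p∈ (inj₂ ((x , refl , i) , (y , refl , o))) = apart (In⇒U x i) (Out⇒Z y o) (distinct (In⇒U x i) (Out⇒Z y o) , inj₂ p∈)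

    -- The components split into two halves of nearly equal number; the half with fewer vertices has many representatives and no edge to the other one.
    notTough⇒fail : ComponentCount H S c → 2 ≤ c → ∣ S ∣ < T * c → 1ℚ ℚ.≤ fail e e-inj Γ (T * 3) (g * z) F
    notTough⇒fail C 2≤c ∣S∣< = Sum.[ lower , upper ] (≤-total (# (Lo.U?)) (# (Lo.Z?)))
      where
      L : Labelling H S c
      L = labelling C (≤-trans (s≤s z≤n) 2≤c)
      open Labelling L
      -- One vertex from each component gives an independent set of `Γ`. This bounds the size of `S`
      -- by Ta, so that each vertex keeps g neighbours outside `S`.
      c≤a : c ≤ a
      c≤a = ≮⇒≥ λ a<c →
        let u , v , (i , ui) , (j , vj) , uv = dense rep? (<-≤-trans a<c (≤-trans (≤-reflexive (sym (#-all {c} {λ _ → ⊤} (λ _ → yes tt) (λ _ → tt))))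
                                                 (#-image rep rep-inj (λ _ → yes tt) rep? λ i _ → i , refl)))
            rij = subst₂ (Adj Γ) (sym ui) (sym vj) uv
            i≡j = trans (sym (proj₂ (proj₂ (attained i)))) (trans (constant (proj₁ (proj₂ (attained i))) (proj₁ (proj₂ (attained j))) (Γ⊆H rij)) (proj₂ (proj₂ (attained j))))
        in irrefl Γ (subst (λ j → Adj Γ (rep i) (rep j)) (sym i≡j) rij)
        where
        rep : Fin c → Fin m
        rep i = proj₁ (attained i)
        rep-inj : ∀ {i j} → rep i ≡ rep j → i ≡ j
        rep-inj {i} {j} eq = trans (sym (proj₂ (proj₂ (attained i)))) (trans (cong label eq) (proj₂ (proj₂ (attained j))))
        rep? : ∀ v → Dec (∃ λ i → rep i ≡ v)
        rep? v = Fin.any? λ i → rep i Fin.≟ v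
      ∣S∣≤Ta : ∣ S ∣ ≤ T * a
      ∣S∣≤Ta = ≤-trans (<⇒≤ ∣S∣<) (*-monoʳ-≤ T c≤a)
      outside : ∀ v → g ≤ # (λ u → adj? Γ v u ×-dec ¬? (S? u))
      outside v = +-cancelˡ-≤ (T * a) g _ (≤-trans large (≤-trans (deg v) (≤-trans (#-⊎ out S? (adj? Γ v) split)
        (≤-trans (+-monoʳ-≤ (# out) (≤-trans (≤-reflexive (sym (∣S∣≡# S))) ∣S∣≤Ta)) (≤-reflexive (+-comm (# out) (T * a)))))))
        where
        out : ∀ u → Dec (Adj Γ v u × ¬ (u Subset.∈ S))
        out u = adj? Γ v u ×-dec ¬? (S? u)
        split : ∀ u → Adj Γ v u → (Adj Γ v u × ¬ (u Subset.∈ S)) ⊎ u Subset.∈ S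
        split u vu with S? u
        ... | yes p = inj₂ p
        ... | no p  = inj₁ (vu , p)
      h = ⌊ c /2⌋
      1≤h : 1 ≤ h
      1≤h = ⌊n/2⌋-mono 2≤c
      -- With equality for c = 3. This is the origin of the factor 3 in the length T * 3 of the
      -- words.
      ≤3⌊/2⌋ : ∀ {c} → 2 ≤ c → c ≤ 3 * ⌊ c /2⌋
      ≤3⌊/2⌋ (s≤s (s≤s {n = d} z≤n)) = from2 d
        where
        from2 : ∀ d → 2 + d ≤ 3 * suc ⌊ d /2⌋
        from2 0 = s≤s (s≤s z≤n)
        from2 1 = s≤s (s≤s (s≤s z≤n))
        from2 (suc (suc d)) = ≤-trans (s≤s (s≤s (from2 d)))
          (≤-trans (n≤1+n _) (≤-reflexive (solve 1 (λ x → con 3 :+ con 3 :* (con 1 :+ x) := con 3 :* (con 2 :+ x)) refl ⌊ d /2⌋)))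
      ∣S∣≤ : ∣ S ∣ ≤ T * 3 * h
      ∣S∣≤ = ≤-trans (<⇒≤ ∣S∣<) (≤-trans (*-monoʳ-≤ T (≤3⌊/2⌋ 2≤c)) (≤-reflexive (sym (*-assoc T 3 h))))
      h+h≤c : h + h ≤ c
      h+h≤c = ≤-trans (+-monoʳ-≤ h (⌊n/2⌋≤⌈n/2⌉ c)) (≤-reflexive (⌊n/2⌋+⌈n/2⌉≡n c))
      A? : (i : Fin c) → Dec (toℕ i < h)
      A? i = toℕ i <? h
      module Lo = Half L ∣S∣≤Ta outside A?
      module Hi = Half L ∣S∣≤Ta outside (λ i → ¬? (A? i))
      shift-< : ∀ (j : Fin h) → h + toℕ j < c
      shift-< j = <-≤-trans (+-monoʳ-< h (Fin.toℕ<n j)) h+h≤c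
      lo-< : ∀ (j : Fin h) → toℕ j < c
      lo-< j = ≤-<-trans (m≤n+m (toℕ j) h) (shift-< j)
      lower : # Lo.U? ≤ # Lo.Z? → _
      lower = Lo.fails (λ j → fromℕ< (lo-< j))
        (λ {i} {j} eq → Fin.toℕ-injective (trans (sym (Fin.toℕ-fromℕ< (lo-< i))) (trans (cong toℕ eq) (Fin.toℕ-fromℕ< (lo-< j)))))
        (λ j → subst (_< h) (sym (Fin.toℕ-fromℕ< (lo-< j))) (Fin.toℕ<n j)) 1≤h ∣S∣≤
      upper : # Lo.Z? ≤ # Lo.U? → _
      upper Z≤U = Hi.fails (λ j → fromℕ< (shift-< j))
        (λ {i} {j} eq → Fin.toℕ-injective (+-cancelˡ-≡ h _ _ (trans (sym (Fin.toℕ-fromℕ< (shift-< i))) (trans (cong toℕ eq) (Fin.toℕ-fromℕ< (shift-< j))))))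
        (λ j lt → <⇒≱ lt (≤-trans (m≤m+n h (toℕ j)) (≤-reflexive (sym (Fin.toℕ-fromℕ< (shift-< j)))))) 1≤h ∣S∣≤
        (≤-trans Z≤U (#-mono Lo.U? Hi.Z? λ v (v∉ , Av) → v∉ , λ ¬A → ¬A Av))

-- Pancyclicity for rational probabilities

module Pancyclic where

  open Counting
  open Graphs
  open ShortCycles using (shortCycle)
  open MediumCycles using (Gadget; gadget; midCycle)
  open Expectation
  open RationalBounds renaming (*-cancelˡ-≤ to *-cancelˡ-≤q)
  open DominatingHalf using (halfDominating)
  open Cuts
  open BlockGraphs using (m<[1+m/n]*n)
  open Components using (notTough⇒fail)
  open import Defs using (Graph; adj?; _∪_; edgeGraph; pairs; ComponentCount; Hamiltonian; HasCycle; Pancyclic; pancyclic?; fromℕ; fromℕ-mono; fromℕ-nonNeg; fromℕ-pos; *-mono)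
  open import Data.Nat.Base
  open import Data.Nat.Properties
  open import Data.Nat.DivMod using (m/n*n≤m; /-monoˡ-≤)
  open import Data.Nat.Solver using (module +-*-Solver)
  open +-*-Solver using (solve; con; _:+_; _:*_; _:=_)
  open import Data.Rational.Base as ℚ using (ℚ; 0ℚ; 1ℚ)
  import Data.Rational.Properties as ℚP
  open import Data.Rational.Solver using () renaming (module +-*-Solver to ℚS)
  open import Data.Unit.Base using (⊤; tt)
  open import Data.Fin.Base using (Fin)
  open import Data.Fin.Subset using (∣_∣)
  open import Data.List.Base using (List; _∷_; _++_; length; lookup; map; take; upTo)
  open import Data.List.Properties using (length-++; length-map; length-take; length-upTo)
  open import Data.List.Membership.Propositional using (_∈_)
  open import Data.List.Membership.Propositional.Properties using (∈-map⁺; ∈-upTo⁺)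
  open import Data.List.Relation.Unary.Any using (here; there)
  open import Data.List.Relation.Unary.All as All using (All)
  open import Data.List.Relation.Unary.Unique.Propositional using (Unique)
  import Data.List.Relation.Unary.Unique.Propositional.Properties as Unique
  open import Data.Product.Base using (_×_; _,_; proj₁; proj₂)
  open import Data.Sum.Base using (_⊎_; inj₁; inj₂)
  open import Function.Base using (case_of_)
  open import Relation.Binary.PropositionalEquality
  open import Relation.Nullary using (¬_; Dec; yes; no; contradiction)
  open import Relation.Nullary.Decidable using (_×-dec_)

  0≤fail : ∀ {n m} (e : Fin m → Fin n) (e-inj : ∀ {i j} → e i ≡ e j → i ≡ j) (Γ : Graph m) B N F → 0ℚ ℚ.≤ fail e e-inj Γ B N F
  0≤fail {m = m} e e-inj Γ B N F = ∑q-nonNeg (upTo m) λ M → ∑q-nonNeg (codes e e-inj Γ B N (suc M)) λ c → 0≤term e e-inj Γ B N (suc M) c F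

  -- Markov's inequality: where the property fails, the nonnegative variable `X` is at least 1.
  probability≥ : ∀ {n} {P : Graph n → Set} (G : Graph n) (P? : ∀ H → Dec (P H)) {q η} → 0ℚ ℚ.≤ q → q ℚ.≤ 1ℚ → (X : List (Fin n × Fin n) → ℚ) →
                 (∀ F → 0ℚ ℚ.≤ X F) → (∀ F → ¬ 1ℚ ℚ.≤ X F → P (G ∪ edgeGraph F)) → 𝔼q q (pairs n) X ℚ.≤ η → 1ℚ ℚ.- η ℚ.≤ probability G q P?
  probability≥ {n} G P? {q} {η} 0≤q q≤1 X 0≤X good E≤η = begin
    1ℚ ℚ.- η                                                              ≤⟨ ℚP.+-monoʳ-≤ 1ℚ (ℚP.neg-antimono-≤ E≤η) ⟩
    1ℚ ℚ.- E                                                              ≡⟨ cong (1ℚ ℚ.+_) (neg-1* E) ⟩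
    1ℚ ℚ.+ (ℚ.- 1ℚ) ℚ.* E                                                 ≡⟨ cong₂ ℚ._+_ (𝔼-const q (pairs n) 1ℚ) (𝔼-* q (pairs n) (ℚ.- 1ℚ) X) ⟨
    𝔼q q (pairs n) (λ _ → 1ℚ) ℚ.+ 𝔼q q (pairs n) (λ F → (ℚ.- 1ℚ) ℚ.* X F) ≡⟨ 𝔼-+ q (pairs n) (λ _ → 1ℚ) (λ F → (ℚ.- 1ℚ) ℚ.* X F) ⟨
    𝔼q q (pairs n) (λ F → 1ℚ ℚ.+ (ℚ.- 1ℚ) ℚ.* X F)                        ≤⟨ 𝔼-mono 0≤q q≤1 (pairs n) pointwise ⟩
    probability G q P?                                                    ∎
    where
    open ℚP.≤-Reasoning
    E = 𝔼q q (pairs n) X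
    neg-1* : ∀ x → ℚ.- x ≡ (ℚ.- 1ℚ) ℚ.* x
    neg-1* = ℚS.solve 1 (λ x → ℚS.:- x ℚS.:= ℚS.con (ℚ.- 1ℚ) ℚS.:* x) refl
    pointwise : ∀ F → 1ℚ ℚ.+ (ℚ.- 1ℚ) ℚ.* X F ℚ.≤ ind (P? (G ∪ edgeGraph F))
    pointwise F = ℚP.≤-trans (ℚP.≤-reflexive (cong (1ℚ ℚ.+_) (sym (neg-1* (X F))))) (go (P? (G ∪ edgeGraph F)))
      where
      go : (d : Dec _) → 1ℚ ℚ.- X F ℚ.≤ ind d
      go (yes _) = ℚP.≤-trans (ℚP.+-monoʳ-≤ 1ℚ (ℚP.neg-antimono-≤ (0≤X F))) (ℚP.≤-reflexive (ℚP.+-identityʳ 1ℚ))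
      go (no ¬p) = case 1ℚ ℚP.≤? X F of λ where
        (yes 1≤X) → ℚP.≤-trans (ℚP.+-monoʳ-≤ 1ℚ (ℚP.neg-antimono-≤ 1≤X)) (ℚP.≤-reflexive (ℚP.+-inverseʳ 1ℚ))
        (no ¬1≤X) → contradiction (good F ¬1≤X) ¬p

  module _ {n : ℕ} (G : Graph n) {a : ℕ} (dense : Dense G a) (T s g z : ℕ) (1≤g : 1 ≤ g) (large : T * a + g ≤ s) (room : 2 * (2 * z + T * a) ≤ n) where

    -- A vertex set that is to carry a Hamilton cycle. The degree condition concerns all vertices of
    -- `G` and not only the members, so it survives when vertices are added.
    record Host : Set where
      field
        members : List (Fin n)
        unique  : Unique members
        mindeg  : ∀ v → s ≤ sumL (λ u → bit (adj? G v u)) members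
        half    : n ≤ 2 * length members

    failure : Host → List (Fin n × Fin n) → ℚ
    failure W = fail (lookup members) (lookup-injective unique) (pull (lookup members) G) (T * 3) (g * z)
      where open Host W

    0≤failure : ∀ W F → 0ℚ ℚ.≤ failure W F
    0≤failure W = 0≤fail (lookup members) (lookup-injective unique) (pull (lookup members) G) (T * 3) (g * z)
      where open Host W

    module _ (ham : ∀ m (H : Graph m) → 3 ≤ m → (∀ S c → ComponentCount H S c → c ≤ 1 ⊎ T * c ≤ ∣ S ∣) → Hamiltonian H) (5≤n : 5 ≤ n) where

      hostHamiltonian : ∀ W F → ¬ 1ℚ ℚ.≤ failure W F → HasCycle (pull (lookup (Host.members W)) (G ∪ edgeGraph F)) (length (Host.members W))
      hostHamiltonian W F ok = ham (length members) (pull (lookup members) (G ∪ edgeGraph F)) 3≤ tough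
        where
        open Host W
        3≤ : 3 ≤ length members
        3≤ = ≰⇒> λ le → <⇒≱ 5≤n (≤-trans half (*-monoʳ-≤ 2 le))
        deg : ∀ i → s ≤ # (adj? (pull (lookup members) G) i)
        deg i = ≤-trans (mindeg (lookup members i)) (≤-reflexive (sym (sumL-lookup (λ u → bit (adj? G (lookup members i) u)) members)))
        tough : ∀ S c → ComponentCount (pull (lookup members) (G ∪ edgeGraph F)) S c → c ≤ 1 ⊎ T * c ≤ ∣ S ∣
        tough S c C = go (c ≤? 1) (T * c ≤? ∣ S ∣)
          where
          go : Dec (c ≤ 1) → Dec (T * c ≤ ∣ S ∣) → c ≤ 1 ⊎ T * c ≤ ∣ S ∣
          go (yes c≤1) _        = inj₁ c≤1
          go (no _)    (yes le) = inj₂ le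
          go (no c≰1)  (no nle) = contradiction
            (notTough⇒fail (lookup members) (lookup-injective unique) {pull (lookup members) G} {pull (lookup members) (G ∪ edgeGraph F)} {F} inj₁ inj₂
              {T} {a} {s} {g} {z} (Dense-pull (lookup members) (lookup-injective unique) {G} {a} dense) deg 1≤g large
              (*-cancelˡ-≤ 2 (≤-trans room half)) C (≰⇒> c≰1) (≰⇒> nle))
            ok

    module _ {q : ℚ} (0≤q : 0ℚ ℚ.≤ q) (q≤1 : q ℚ.≤ 1ℚ) (1≤n : 1 ≤ n) (tiny : fromℕ (n ^ (4 + T * 3)) ℚ.* pow (1ℚ ℚ.- q) (g * z) ℚ.≤ 1ℚ) where

      private
        x = pow (1ℚ ℚ.- q) (g * z)
        0≤x : 0ℚ ℚ.≤ x
        0≤x = pow-nonNeg (g * z) (≤⇒0≤- q≤1)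
        scaled : ∀ {b} → b ≤ n ^ (4 + T * 3) → fromℕ b ℚ.* x ℚ.≤ 1ℚ
        scaled b≤ = ℚP.≤-trans (*-monoʳ 0≤x (fromℕ-mono b≤)) tiny
        instance
          n≢0 : NonZero n
          n≢0 = >-nonZero 1≤n

      -- The exponent 4 + 3T consists of 1 for the number of values of M, 1 + 3T for the letters of
      -- a code, and 2 for the factor n² on the left; the latter pays for at most n hosts and for a
      -- bound that still tends to 0.
      E-failure : ∀ W → fromℕ (n * n) ℚ.* 𝔼q q (pairs n) (failure W) ℚ.≤ 1ℚ
      E-failure W = begin
        fromℕ (n * n) ℚ.* 𝔼q q (pairs n) (failure W)
          ≤⟨ *-mono (fromℕ-nonNeg (n * n)) (E-fail (lookup members) (lookup-injective unique) (pull (lookup members) G) (T * 3) (g * z) 0≤q q≤1 ℚP.≤-refl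
               (scaled (≤-trans (^-monoˡ-≤ (suc (T * 3)) m≤n) (^-monoʳ-≤ n (m≤n+m (suc (T * 3)) 3))))) ⟩
        fromℕ (n * n) ℚ.* (fromℕ m ℚ.* (fromℕ (m ^ suc (T * 3)) ℚ.* x))
          ≡⟨ ℚS.solve 4 (λ a b c d → a ℚS.:* (b ℚS.:* (c ℚS.:* d)) ℚS.:= a ℚS.:* (b ℚS.:* c) ℚS.:* d) refl (fromℕ (n * n)) (fromℕ m) (fromℕ (m ^ suc (T * 3))) x ⟩
        fromℕ (n * n) ℚ.* (fromℕ m ℚ.* fromℕ (m ^ suc (T * 3))) ℚ.* x
          ≡⟨ cong (ℚ._* x) (trans (fromℕ-* (n * n) (m ^ (2 + T * 3))) (cong (fromℕ (n * n) ℚ.*_) (fromℕ-* m (m ^ suc (T * 3))))) ⟨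
        fromℕ (n * n * m ^ (2 + T * 3)) ℚ.* x
          ≤⟨ scaled (≤-trans (*-monoʳ-≤ (n * n) (^-monoˡ-≤ (2 + T * 3) m≤n)) (≤-reflexive (*-assoc n n _))) ⟩
        1ℚ ∎
        where
        open ℚP.≤-Reasoning
        open Host W
        m = length members
        m≤n : m ≤ n
        m≤n = ≤-trans (length≤# {P = λ _ → ⊤} (λ _ → yes tt) unique (All.tabulate λ _ → tt)) (#≤n {P = λ _ → ⊤} (λ _ → yes tt))

      E-failures : ∀ Ws → length Ws ≤ n → fromℕ n ℚ.* 𝔼q q (pairs n) (λ F → ∑q (λ W → failure W F) Ws) ℚ.≤ 1ℚ
      E-failures Ws len = *-cancelˡ-≤q {fromℕ n} (pos 1≤n) (begin
        fromℕ n ℚ.* (fromℕ n ℚ.* 𝔼q q (pairs n) (λ F → ∑q (λ W → failure W F) Ws))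
          ≡⟨ trans (sym (ℚP.*-assoc (fromℕ n) (fromℕ n) _)) (cong (ℚ._* 𝔼q q (pairs n) (λ F → ∑q (λ W → failure W F) Ws)) (sym (fromℕ-* n n))) ⟩
        fromℕ (n * n) ℚ.* 𝔼q q (pairs n) (λ F → ∑q (λ W → failure W F) Ws)
          ≡⟨ trans (cong (fromℕ (n * n) ℚ.*_) (𝔼-∑ q (pairs n) Ws failure)) (sym (∑q-* (fromℕ (n * n)) (λ W → 𝔼q q (pairs n) (failure W)) Ws)) ⟩
        ∑q (λ W → fromℕ (n * n) ℚ.* 𝔼q q (pairs n) (failure W)) Ws
          ≤⟨ ∑q-mono Ws (λ {W} _ → E-failure W) ⟩
        ∑q (λ _ → 1ℚ) Ws
          ≡⟨ ∑q-const 1ℚ Ws ⟩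
        fromℕ (length Ws) ℚ.* 1ℚ
          ≤⟨ *-monoʳ (ℚP.nonNegative⁻¹ 1ℚ) (fromℕ-mono len) ⟩
        fromℕ n ℚ.* 1ℚ ∎)
        where
        open ℚP.≤-Reasoning
        pos : ∀ {n} → 1 ≤ n → 0ℚ ℚ.< fromℕ n
        pos (s≤s {n = n} _) = fromℕ-pos n

  module _ {n : ℕ} (G : Graph n) {a k T : ℕ} (dense : Dense G a) (deg : ∀ v → k ≤ # (adj? G v)) (1≤a : 1 ≤ a) (80≤k : 80 ≤ k) (600a≤k : 600 * a ≤ k)
           (1≤T : 1 ≤ T) (2Ta≤s : 2 * (T * a) ≤ k / 20) (k≤n : k ≤ n) (v : Fin n)
           (ham : ∀ m (H : Graph m) → 3 ≤ m → (∀ S c → ComponentCount H S c → c ≤ 1 ⊎ T * c ≤ ∣ S ∣) → Hamiltonian H) where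

    private
      open ≤-Reasoning
      s = k / 20
      -- What a degree s into the host retains after the removal of at most Ta vertices; by 2Ta ≤ s
      -- this is at least half of s.
      g = s ∸ T * a
      -- A host has at least n/2 vertices. After the removal of at most Ta of them, the larger of
      -- two halves still has n/8.
      z = n / 8
      Ta≤s : T * a ≤ s
      Ta≤s = ≤-trans (m≤n*m (T * a) 2) 2Ta≤s
      1≤Ta : 1 ≤ T * a
      1≤Ta = *-mono-≤ 1≤T 1≤a
      1≤g : 1 ≤ g
      1≤g = +-cancelˡ-≤ (T * a) 1 g (begin
        T * a + 1      ≤⟨ +-monoʳ-≤ (T * a) (≤-trans 1≤Ta (m≤m+n (T * a) 0)) ⟩
        2 * (T * a)    ≤⟨ 2Ta≤s ⟩
        s              ≡⟨ m+[n∸m]≡n Ta≤s ⟨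
        T * a + g      ∎)
      large : T * a + g ≤ s
      large = ≤-reflexive (m+[n∸m]≡n Ta≤s)
      20s≤k : s * 20 ≤ k
      20s≤k = m/n*n≤m k 20
      8z≤n : z * 8 ≤ n
      8z≤n = m/n*n≤m n 8
      room : 2 * (2 * z + T * a) ≤ n
      room = *-cancelˡ-≤ 2 (begin
        2 * (2 * (2 * z + T * a))    ≡⟨ solve 2 (λ z t → con 2 :* (con 2 :* (con 2 :* z :+ t)) := z :* con 8 :+ con 2 :* (con 2 :* t)) refl z (T * a) ⟩
        z * 8 + 2 * (2 * (T * a))    ≤⟨ +-mono-≤ 8z≤n (begin
          2 * (2 * (T * a))            ≤⟨ *-monoʳ-≤ 2 2Ta≤s ⟩
          2 * s                        ≤⟨ *-monoˡ-≤ s {2} {20} (s≤s (s≤s z≤n)) ⟩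
          20 * s                       ≡⟨ *-comm 20 s ⟩
          s * 20                       ≤⟨ ≤-trans 20s≤k k≤n ⟩
          n                            ≡⟨ +-identityʳ n ⟨
          n + 0                        ∎) ⟩
        2 * n                        ∎)
      small : 2 * (1 + 4 * a) ≤ k
      small = begin
        2 * (1 + 4 * a)   ≤⟨ *-monoʳ-≤ 2 (+-monoˡ-≤ (4 * a) 1≤a) ⟩
        2 * (a + 4 * a)   ≡⟨ solve 1 (λ a → con 2 :* (a :+ con 4 :* a) := con 10 :* a) refl a ⟩
        10 * a            ≤⟨ *-monoˡ-≤ a {10} {600} (m≤m+n 10 590) ⟩
        600 * a           ≤⟨ 600a≤k ⟩
        k                 ∎
    private module Hosts (gad : Gadget G a) (W₀ : List (Fin n)) (W₀-props : Unique W₀ × 2 * length W₀ ≤ n × ∀ v → k / 20 ≤ sumL (λ u → bit (adj? G v u)) W₀) where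
      open Gadget gad using (vertices; outside; length-vertices)
      rest = elems (_∉? W₀)

      n≤rest : ∀ U → n ≤ length (elems (_∉? U)) + length U
      n≤rest U = begin
        n                                          ≡⟨ #-all {n} {λ _ → ⊤} (λ _ → yes tt) (λ _ → tt) ⟨
        # {n} {λ _ → ⊤} (λ _ → yes tt)             ≤⟨ #-avoid (λ _ → yes tt) U ⟩
        # (λ i → yes tt ×-dec (i ∉? U)) + length U ≤⟨ +-monoˡ-≤ (length U) (#-mono _ (_∉? U) λ _ → proj₂) ⟩
        # (_∉? U) + length U                       ≡⟨ cong (_+ length U) (length-elems (_∉? U)) ⟨
        length (elems (_∉? U)) + length U          ∎

      HostG : Set
      HostG = Host G {a} dense T s g z 1≤g large room

      outer : HostG
      outer = record { members = outside ; unique = elems-unique (_∉? vertices) ; mindeg = mindeg ; half = half }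
        where
        mindeg : ∀ v → s ≤ sumL (λ u → bit (adj? G v u)) outside
        mindeg v = +-cancelʳ-≤ (1 + 4 * a) s _ (≤-trans s+≤k (≤-trans (deg v) (begin
          # (adj? G v)                                               ≤⟨ #-avoid (adj? G v) vertices ⟩
          # (λ u → adj? G v u ×-dec (u ∉? vertices)) + length vertices ≡⟨ cong₂ _+_ (∑-cong λ u → bits (adj? G v u) (u ∉? vertices)) length-vertices ⟩
          ∑ (λ u → bit (u ∉? vertices) * bit (adj? G v u)) + (1 + 4 * a) ≡⟨ cong (_+ (1 + 4 * a)) (sumL-elems (_∉? vertices) (λ u → bit (adj? G v u))) ⟨
          sumL (λ u → bit (adj? G v u)) outside + (1 + 4 * a)        ∎)))
          where
          bits : ∀ {P Q : Set} (p : Dec P) (q : Dec Q) → bit (p ×-dec q) ≡ bit q * bit p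
          bits (yes _) (yes _) = refl
          bits (no _)  (yes _) = refl
          bits (yes _) (no _)  = refl
          bits (no _)  (no _)  = refl
          s+≤k : s + (1 + 4 * a) ≤ k
          s+≤k = *-cancelˡ-≤ 2 (begin
            2 * (s + (1 + 4 * a))       ≡⟨ *-distribˡ-+ 2 s (1 + 4 * a) ⟩
            2 * s + 2 * (1 + 4 * a)     ≤⟨ +-mono-≤ (≤-trans (≤-trans (*-monoˡ-≤ s {2} {20} (s≤s (s≤s z≤n))) (≤-reflexive (*-comm 20 s))) 20s≤k) small ⟩
            k + k                       ≡⟨ cong (k +_) (sym (+-identityʳ k)) ⟩
            2 * k                       ∎)
        half : n ≤ 2 * length outside
        half = +-cancelʳ-≤ n n (2 * length outside) (begin
          n + n                                        ≡⟨ cong (n +_) (sym (+-identityʳ n)) ⟩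
          2 * n                                        ≤⟨ *-monoʳ-≤ 2 (n≤rest vertices) ⟩
          2 * (length outside + length vertices)       ≡⟨ trans (cong (λ x → 2 * (length outside + x)) length-vertices) (*-distribˡ-+ 2 (length outside) (1 + 4 * a)) ⟩
          2 * length outside + 2 * (1 + 4 * a)         ≤⟨ +-monoʳ-≤ (2 * length outside) (≤-trans small k≤n) ⟩
          2 * length outside + n                       ∎)

      -- Any further vertices may be added to `W₀`, as they do not lower degrees into the set. Its
      -- size is adjusted to ℓ, so that a Hamilton cycle of the host is a cycle of length ℓ.
      extend : ℕ → List (Fin n)
      extend ℓ = W₀ ++ take (ℓ ∸ length W₀) rest

      length-extend : ∀ ℓ → n ≤ 2 * ℓ → ℓ ≤ n → length (extend ℓ) ≡ ℓ
      length-extend ℓ n≤2ℓ ℓ≤n = trans (length-++ W₀) (trans (cong (length W₀ +_) (trans (length-take (ℓ ∸ length W₀) rest) (m≤n⇒m⊓n≡m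
          (≤-trans (∸-monoˡ-≤ (length W₀) (≤-trans ℓ≤n (n≤rest W₀))) (≤-reflexive (m+n∸n≡m (length rest) (length W₀)))))))
        (m+[n∸m]≡n {length W₀} {ℓ} (*-cancelˡ-≤ {length W₀} {ℓ} 2 (≤-trans (proj₁ (proj₂ W₀-props)) n≤2ℓ))))

      2[n-i]≥n : ∀ {i} → 2 * i ≤ n → n ≤ 2 * (n ∸ i)
      2[n-i]≥n {i} 2i≤n = ≤-trans (m+n≤o⇒m≤o∸n n (+-monoʳ-≤ n (≤-trans 2i≤n (m≤m+n n 0)))) (≤-reflexive (sym (*-distribˡ-∸ 2 n i)))

      inner : ∀ ℓ → n ≤ 2 * ℓ → ℓ ≤ n → HostG
      inner ℓ n≤2ℓ ℓ≤n = record
        { members = extend ℓ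
        ; unique  = Unique.++⁺ (proj₁ W₀-props) (Unique.take⁺ (ℓ ∸ length W₀) (elems-unique (_∉? W₀)))
                      λ (x∈ , x∈′) → ∈-elems⁻ (_∉? W₀) (∈-take (ℓ ∸ length W₀) rest x∈′) x∈
        ; mindeg  = λ v → ≤-trans (proj₂ (proj₂ W₀-props) v) (≤-trans (m≤m+n _ (sumL (λ u → bit (adj? G v u)) (take (ℓ ∸ length W₀) rest))) (≤-reflexive (sym (sumL-++ (λ u → bit (adj? G v u)) W₀ _))))
        ; half    = ≤-trans n≤2ℓ (≤-reflexive (cong (2 *_) (sym (length-extend ℓ n≤2ℓ ℓ≤n))))
        }
        where
        ∈-take : ∀ j xs {x : Fin n} → x ∈ take j xs → x ∈ xs
        ∈-take (suc j) (y ∷ xs) (here eq) = here eq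
        ∈-take (suc j) (y ∷ xs) (there p) = there (∈-take j xs p)

      -- The index i stands for the length n - i. The host `outer` is a junk value for indices above
      -- n/2.
      byDec : ∀ i → Dec (2 * i ≤ n) → HostG
      byDec i (yes h) = inner (n ∸ i) (2[n-i]≥n {i} h) (m∸n≤m n i)
      byDec i (no _)  = outer

      byIndex : ℕ → HostG
      byIndex i = byDec i (2 * i ≤? n)

      members-byDec : ∀ i (d : Dec (2 * i ≤ n)) → 2 * i ≤ n → Host.members (byDec i d) ≡ extend (n ∸ i)
      members-byDec i (yes _) _ = refl
      members-byDec i (no ¬h) h = contradiction h ¬h

      hosts : List HostG
      hosts = outer ∷ map byIndex (upTo (suc ⌊ n /2⌋))

      total : List (Fin n × Fin n) → ℚ
      total F = ∑q (λ W → failure G {a} dense T s g z 1≤g large room W F) hosts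

      5≤n : 5 ≤ n
      5≤n = ≤-trans (≤-trans (m≤m+n 5 75) 80≤k) k≤n

      few : length hosts ≤ n
      few = ≤-trans (≤-reflexive (cong suc (trans (length-map byIndex (upTo (suc ⌊ n /2⌋))) (length-upTo (suc ⌊ n /2⌋)))))
        (≤-trans (≤-trans (+-monoˡ-≤ ⌊ n /2⌋ (≤-trans (n≤1+n 2) (⌈n/2⌉-mono 5≤n))) (≤-reflexive (+-comm ⌈ n /2⌉ ⌊ n /2⌋))) (≤-reflexive (⌊n/2⌋+⌈n/2⌉≡n n)))

      pancyclic : ∀ F → ¬ 1ℚ ℚ.≤ total F → Pancyclic (G ∪ edgeGraph F)
      pancyclic F ok ℓ 3≤ℓ ℓ≤n = go (ℓ ≤? 4 * a) (ℓ + ℓ ≤? 2 + n)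
        where
        H = G ∪ edgeGraph F
        cycle : ∀ {W} → W ∈ hosts → HasCycle (pull (lookup (Host.members W)) H) (length (Host.members W))
        cycle {W} W∈ = hostHamiltonian G {a} dense T s g z 1≤g large room ham 5≤n W F λ 1≤ → ok (ℚP.≤-trans 1≤
          (∑q-term {f = λ W → failure G {a} dense T s g z 1≤g large room W F} (λ W → 0≤failure G {a} dense T s g z 1≤g large room W F) W∈))
        long : n < ℓ + ℓ → HasCycle H ℓ
        long n<2ℓ = subst (HasCycle H) (trans (cong length members≡) (length-extend ℓ n≤2ℓ ℓ≤n))
          (pull-cycle (lookup (Host.members W)) (lookup-injective (Host.unique W)) H (cycle W∈))
          where
          n≤2ℓ : n ≤ 2 * ℓ
          n≤2ℓ = ≤-trans (<⇒≤ n<2ℓ) (+-monoʳ-≤ ℓ (m≤m+n ℓ 0))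
          i = n ∸ ℓ
          W = byIndex i
          2i≤n : 2 * i ≤ n
          2i≤n = ≤-trans (≤-reflexive (*-distribˡ-∸ 2 n ℓ)) (≤-trans (∸-monoʳ-≤ (2 * n) n≤2ℓ) (≤-reflexive (trans (m+n∸m≡n n (n + 0)) (+-identityʳ n))))
          members≡ : Host.members W ≡ extend ℓ
          members≡ = trans (members-byDec i (2 * i ≤? n) 2i≤n) (cong extend (m∸[m∸n]≡n ℓ≤n))
          W∈ : W ∈ hosts
          W∈ = there (∈-map⁺ byIndex (∈-upTo⁺ (s≤s (≤-trans (≤-reflexive (trans (n≡⌊n+n/2⌋ i) (cong ⌊_/2⌋ (cong (i +_) (sym (+-identityʳ i)))))) (⌊n/2⌋-mono 2i≤n)))))
        go : Dec (ℓ ≤ 4 * a) → Dec (ℓ + ℓ ≤ 2 + n) → HasCycle H ℓ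
        go (yes h) _ = shortCycle {G = H} (λ P? lt → let u , v , pu , pv , uv = dense P? lt in u , v , pu , pv , inj₁ uv) 1≤a 600a≤k
          (λ v → ≤-trans (deg v) (#-mono (adj? G v) (adj? H v) λ _ → inj₁)) v ℓ 3≤ℓ h
        go (no h) (yes h′) = midCycle dense deg {H} inj₁ gad (≤-trans 3+≤ small) (cycle (here refl)) ℓ 3≤ℓ (≰⇒> h) h′
          where
          3+≤ : 3 + 4 * a ≤ 2 * (1 + 4 * a)
          3+≤ = begin
            2 + (1 + 4 * a)            ≤⟨ +-monoʳ-≤ 2 (+-monoˡ-≤ (4 * a) (≤-trans 1≤a (m≤n*m a 4))) ⟩
            2 + (4 * a + 4 * a)        ≡⟨ solve 1 (λ b → con 2 :+ (b :+ b) := con 2 :* (con 1 :+ b)) refl (4 * a) ⟩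
            2 * (1 + 4 * a)            ∎
        go (no h) (no h′) = long (≤-trans (n≤1+n (suc n)) (<⇒≤ (≰⇒> h′)))

      -- From z = ⌊n/8⌋ follows n ≤ 16z, and from s = ⌊k/20⌋ follows k ≤ 40s, where rounding costs a
      -- factor 2 each time; finally s ≤ 2g.
      many : n * k ≤ 1280 * (g * z)
      many = begin
        n * k                        ≤⟨ *-mono-≤ n≤16z k≤80g ⟩
        16 * z * (80 * g)            ≡⟨ solve 2 (λ z g → con 16 :* z :* (con 80 :* g) := con 1280 :* (g :* z)) refl z g ⟩
        1280 * (g * z)               ∎
        where
        double : ∀ m d → 1 ≤ m / suc d → m ≤ m / suc d * suc d + m / suc d * suc d
        double m d 1≤ = ≤-trans (<⇒≤ (m<[1+m/n]*n m d)) (+-monoˡ-≤ (m / suc d * suc d) (≤-trans (≤-reflexive (sym (+-identityʳ (suc d)))) (*-monoˡ-≤ (suc d) 1≤)))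
        s≤2g : s ≤ g + g
        s≤2g = begin
          s          ≡⟨ m+[n∸m]≡n Ta≤s ⟨
          T * a + g  ≤⟨ +-monoˡ-≤ g (+-cancelˡ-≤ (T * a) (T * a) g (≤-trans (+-monoʳ-≤ (T * a) (m≤m+n (T * a) 0)) (≤-trans 2Ta≤s (≤-reflexive (sym (m+[n∸m]≡n Ta≤s)))))) ⟩
          g + g      ∎
        k≤80g : k ≤ 80 * g
        k≤80g = begin
          k                                  ≤⟨ double k 19 (≤-trans 1≤Ta Ta≤s) ⟩
          s * 20 + s * 20                    ≤⟨ +-mono-≤ (*-monoˡ-≤ 20 s≤2g) (*-monoˡ-≤ 20 s≤2g) ⟩
          (g + g) * 20 + (g + g) * 20        ≡⟨ solve 1 (λ g → (g :+ g) :* con 20 :+ (g :+ g) :* con 20 := con 80 :* g) refl g ⟩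
          80 * g                             ∎
        n≤16z : n ≤ 16 * z
        n≤16z = begin
          n                                  ≤⟨ double n 7 (/-monoˡ-≤ {8} {n} 8 (≤-trans (≤-trans (m≤m+n 8 72) 80≤k) k≤n)) ⟩
          z * 8 + z * 8                      ≡⟨ solve 1 (λ z → z :* con 8 :+ z :* con 8 := con 16 :* z) refl z ⟩
          16 * z                             ∎

      likely : ∀ {q η} → 0ℚ ℚ.≤ q → q ℚ.≤ 1ℚ → (∀ N → n * k ≤ 1280 * N → fromℕ (n ^ (4 + T * 3)) ℚ.* pow (1ℚ ℚ.- q) N ℚ.≤ 1ℚ) → 1ℚ ℚ.≤ fromℕ n ℚ.* η →
                        1ℚ ℚ.- η ℚ.≤ probability G q pancyclic?
      likely {q} {η} 0≤q q≤1 tiny 1≤nη = probability≥ G pancyclic? 0≤q q≤1 total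
        (λ F → ∑q-nonNeg hosts λ W → 0≤failure G {a} dense T s g z 1≤g large room W F) pancyclic
        (*-cancelˡ-≤q {fromℕ n} (ℚP.<-≤-trans (ℚP.positive⁻¹ 1ℚ) (fromℕ-mono {1} {n} 1≤n))
          (ℚP.≤-trans (E-failures G {a} dense T s g z 1≤g large room 0≤q q≤1 1≤n (tiny (g * z) many) hosts few) 1≤nη))
        where
        1≤n : 1 ≤ n
        1≤n = ≤-trans (s≤s z≤n) 5≤n

    pancyclicLikely : ∀ {q η} → 0ℚ ℚ.≤ q → q ℚ.≤ 1ℚ → (∀ N → n * k ≤ 1280 * N → fromℕ (n ^ (4 + T * 3)) ℚ.* pow (1ℚ ℚ.- q) N ℚ.≤ 1ℚ) → 1ℚ ℚ.≤ fromℕ n ℚ.* η →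
                      1ℚ ℚ.- η ℚ.≤ probability G q pancyclic?
    pancyclicLikely = Hosts.likely
      (gadget dense deg v (begin
        1 + 5 * a         ≤⟨ +-monoˡ-≤ (5 * a) 1≤a ⟩
        6 * a             ≤⟨ *-monoˡ-≤ a {6} {600} (m≤m+n 6 594) ⟩
        600 * a           ≤⟨ 600a≤k ⟩
        k                 ∎))
      (proj₁ W) (proj₂ W)
      where
      W = halfDominating {n} {G} {a} {k} dense (≤-trans (m≤n*m a 600) 600a≤k) 80≤k deg

-- Constants and real probabilities for part (a)

module PartA where

  open Counting
  open Graphs
  open Expectation
  open RationalBounds renaming (*-cancelˡ-≤ to *-cancelˡ-≤q)
  open ExpLogBounds using (logSeq-bounds)
  open PartB using (lg; lg-≤; lg-<; lg-large)
  open BlockGraphs using (m<[1+m/n]*n)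
  open Pancyclic using (pancyclicLikely)
  import Defs as D
  open import Defs using (ℝ; seq; ι; nat; log; logSeq; _/ℕ_; recip; Eventually; IsProbability; AAS[_∪𝔾_⊨_]; archimedean; archimedean′; bound; scale; cauchy; Graph; adj?; Tough; ComponentCount; Hamiltonian; Pancyclic; pancyclic?; δ; α; fromℕ; fromℕ-mono; fromℕ-nonNeg; fromℕ-pos; fromℕ*recip; *-mono; *-nonNeg; ≤-+ʳ)
  open import Data.Nat.Base
  open import Data.Nat.Properties
  open import Data.Nat.DivMod using (m/n*n≤m; /-monoˡ-≤; m*n/n≡m)
  open import Data.Nat.Solver using (module +-*-Solver)
  open +-*-Solver using (solve; con; _:+_; _:*_; _:=_)
  open import Data.Rational.Base as ℚ using (ℚ; 0ℚ; 1ℚ; ½)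
  import Data.Rational.Properties as ℚP
  open import Data.Rational.Solver using () renaming (module +-*-Solver to ℚS)
  open import Data.Fin.Base using (Fin; fromℕ<)
  open import Data.Fin.Subset using (∣_∣; ⁅_⁆)
  open import Data.Fin.Subset.Properties using (∣⁅x⁆∣≡1; x∈⁅y⁆⇒x≡y)
  open import Data.Product.Base using (∃; _×_; _,_; proj₁)
  open import Data.Sum.Base using (_⊎_; inj₁; inj₂)
  open import Relation.Binary.PropositionalEquality

  private
    pos : ∀ {N} → 1 ≤ N → 0ℚ ℚ.< fromℕ N
    pos (s≤s {n = N} _) = fromℕ-pos N

  -- Cutting N into R pieces M with M q ≥ 1 gives (1 + q)^N ≥ 2^R, and (1 - q)(1 + q) ≤ 1.
  pow-decay : ∀ {q N} R → 0ℚ ℚ.≤ q → q ℚ.≤ 1ℚ → fromℕ (2 * suc R) ℚ.≤ fromℕ N ℚ.* q → fromℕ (2 ^ suc R) ℚ.* pow (1ℚ ℚ.- q) N ℚ.≤ 1ℚ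
  pow-decay {q} {N} R 0≤q q≤1 h = begin
    fromℕ (2 ^ suc R) ℚ.* pow (1ℚ ℚ.- q) N           ≡⟨ cong (ℚ._* pow (1ℚ ℚ.- q) N) (fromℕ-pow 2 (suc R)) ⟩
    pow (fromℕ 2) (suc R) ℚ.* pow (1ℚ ℚ.- q) N       ≤⟨ *-monoʳ (pow-nonNeg N 0≤1-q) (pow-mono (suc R) (fromℕ-nonNeg 2) two) ⟩
    pow (pow (1ℚ ℚ.+ q) M) (suc R) ℚ.* pow (1ℚ ℚ.- q) N ≡⟨ cong (ℚ._* pow (1ℚ ℚ.- q) N) (pow-* (1ℚ ℚ.+ q) (suc R) M) ⟨
    pow (1ℚ ℚ.+ q) (suc R * M) ℚ.* pow (1ℚ ℚ.- q) N  ≤⟨ *-mono (pow-nonNeg (suc R * M) (D.+-nonNeg D.0≤1 0≤q)) (pow-antitone 0≤1-q 1-q≤1 RM≤N) ⟩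
    pow (1ℚ ℚ.+ q) (suc R * M) ℚ.* pow (1ℚ ℚ.- q) (suc R * M) ≡⟨ pow-distrib (1ℚ ℚ.+ q) (1ℚ ℚ.- q) (suc R * M) ⟨
    pow ((1ℚ ℚ.+ q) ℚ.* (1ℚ ℚ.- q)) (suc R * M)      ≤⟨ pow≤1 (suc R * M) (*-nonNeg (D.+-nonNeg D.0≤1 0≤q) 0≤1-q) prod≤1 ⟩
    1ℚ                                               ∎
    where
    open ℚP.≤-Reasoning
    M = N / suc R
    0≤1-q = ≤⇒0≤- q≤1
    1-q≤1 : 1ℚ ℚ.- q ℚ.≤ 1ℚ
    1-q≤1 = ℚP.≤-trans (ℚP.+-monoʳ-≤ 1ℚ (ℚP.neg-antimono-≤ 0≤q)) (ℚP.≤-reflexive (ℚP.+-identityʳ 1ℚ))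
    RM≤N : suc R * M ≤ N
    RM≤N = ≤-trans (≤-reflexive (*-comm (suc R) M)) (m/n*n≤m N (suc R))
    2R≤N : 2 * suc R ≤ N
    2R≤N = fromℕ-cancel (ℚP.≤-trans h (ℚP.≤-trans (*-mono (fromℕ-nonNeg N) q≤1) (ℚP.≤-reflexive (ℚP.*-identityʳ (fromℕ N)))))
    1≤M : 1 ≤ M
    1≤M = ≤-trans (≤-reflexive (sym (m*n/n≡m 1 (suc R)))) (/-monoˡ-≤ {1 * suc R} {N} (suc R) (≤-trans (*-monoˡ-≤ (suc R) {1} {2} (s≤s z≤n)) 2R≤N))
    N≤ : N ≤ suc R * (2 * M)
    N≤ = ≤-trans (<⇒≤ (m<[1+m/n]*n N R)) (≤-trans (*-monoˡ-≤ (suc R) (+-monoˡ-≤ M 1≤M))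
           (≤-reflexive (solve 2 (λ M R → (M :+ M) :* R := R :* (con 2 :* M)) refl M (suc R))))
    1≤Mq : 1ℚ ℚ.≤ fromℕ M ℚ.* q
    1≤Mq = *-cancelˡ-≤q {fromℕ (2 * suc R)} (pos {2 * suc R} (s≤s z≤n)) (begin
      fromℕ (2 * suc R) ℚ.* 1ℚ                ≡⟨ ℚP.*-identityʳ _ ⟩
      fromℕ (2 * suc R)                       ≤⟨ h ⟩
      fromℕ N ℚ.* q                           ≤⟨ *-monoʳ 0≤q (fromℕ-mono (≤-trans N≤ (≤-reflexive (solve 2 (λ M R → R :* (con 2 :* M) := con 2 :* R :* M) refl M (suc R))))) ⟩
      fromℕ (2 * suc R * M) ℚ.* q             ≡⟨ trans (cong (ℚ._* q) (fromℕ-* (2 * suc R) M)) (ℚP.*-assoc (fromℕ (2 * suc R)) (fromℕ M) q) ⟩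
      fromℕ (2 * suc R) ℚ.* (fromℕ M ℚ.* q)   ∎)
    two : fromℕ 2 ℚ.≤ pow (1ℚ ℚ.+ q) M
    two = ℚP.≤-trans (ℚP.≤-trans (ℚP.≤-reflexive (fromℕ-+ 1 1)) (ℚP.+-monoʳ-≤ 1ℚ 1≤Mq)) (bernoulli M 0≤q)
    prod≤1 : (1ℚ ℚ.+ q) ℚ.* (1ℚ ℚ.- q) ℚ.≤ 1ℚ
    prod≤1 = begin
      (1ℚ ℚ.+ q) ℚ.* (1ℚ ℚ.- q)   ≡⟨ ℚS.solve 1 (λ q → (ℚS.con 1ℚ ℚS.:+ q) ℚS.:* (ℚS.con 1ℚ ℚS.:- q) ℚS.:= ℚS.con 1ℚ ℚS.:- q ℚS.:* q) refl q ⟩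
      1ℚ ℚ.- q ℚ.* q              ≤⟨ ℚP.+-monoʳ-≤ 1ℚ (ℚP.neg-antimono-≤ (*-nonNeg 0≤q 0≤q)) ⟩
      1ℚ ℚ.- 0ℚ                   ≡⟨ ℚP.+-identityʳ 1ℚ ⟩
      1ℚ                          ∎

  1≤α : ∀ {n} (G : Graph n) → Fin n → 1 ≤ α G
  1≤α G v = ≤-trans (≤-reflexive (sym (∣⁅x⁆∣≡1 v))) (∣S∣≤α G {⁅ v ⁆} λ u w u∈ w∈ uw →
    D.irrefl G (subst₂ (D.Adj G) (x∈⁅y⁆⇒x≡y v u∈) (x∈⁅y⁆⇒x≡y v w∈) uw))

  -- With E = (4 + 3T) copies of n to beat, D = n k and c₁ = 4 K, K = 1280 · 4 E, one has q D ≥ K log₂ n.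
  module _ (E K : ℕ) (K≡ : K ≡ 1280 * (4 * E)) (1≤E : 1 ≤ E) where

    -- As n < 2^(lg n + 1) ≤ 2^(2 lg n), the power n^E is at most 2^R with R = 2 E lg n. By
    -- `pow-decay` this is beaten as soon as N q ≥ 2R, and N is at least nk/1280: hence K = 1280 ·
    -- 4E.
    tinyPower : ∀ {n k q} → 1 ≤ lg n → 0ℚ ℚ.≤ q → q ℚ.≤ 1ℚ → fromℕ (K * lg n) ℚ.≤ fromℕ (n * k) ℚ.* q →
                ∀ N → n * k ≤ 1280 * N → fromℕ (n ^ E) ℚ.* pow (1ℚ ℚ.- q) N ℚ.≤ 1ℚ
    tinyPower {zero} ()
    tinyPower {n@(suc n′)} {k} {q} 1≤l 0≤q q≤1 h N many = go (2 * (l * E)) refl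
      where
      open ℚP.≤-Reasoning
      l = lg n
      Nq : fromℕ (2 * (2 * (l * E))) ℚ.≤ fromℕ N ℚ.* q
      Nq = *-cancelˡ-≤q {fromℕ 1280} (fromℕ-pos 1279) (begin
        fromℕ 1280 ℚ.* fromℕ (2 * (2 * (l * E)))  ≡⟨ fromℕ-* 1280 (2 * (2 * (l * E))) ⟨
        fromℕ (1280 * (2 * (2 * (l * E))))        ≡⟨ cong fromℕ (trans (rearrange 1280 l E) (cong (_* l) (sym K≡))) ⟩
        fromℕ (K * l)                             ≤⟨ h ⟩
        fromℕ (n * k) ℚ.* q                       ≤⟨ *-monoʳ 0≤q (fromℕ-mono many) ⟩
        fromℕ (1280 * N) ℚ.* q                    ≡⟨ trans (cong (ℚ._* q) (fromℕ-* 1280 N)) (ℚP.*-assoc (fromℕ 1280) (fromℕ N) q) ⟩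
        fromℕ 1280 ℚ.* (fromℕ N ℚ.* q)            ∎)
        where
        rearrange : ∀ c l E → c * (2 * (2 * (l * E))) ≡ c * (4 * E) * l
        rearrange = solve 3 (λ c l E → c :* (con 2 :* (con 2 :* (l :* E))) := c :* (con 4 :* E) :* l) refl
      n^E≤ : n ^ E ≤ 2 ^ (2 * (l * E))
      n^E≤ = ≤-trans (^-monoˡ-≤ E (<⇒≤ (lg-< n′))) (≤-trans (≤-reflexive (^-*-assoc 2 (suc l) E)) (^-monoʳ-≤ 2
        (≤-trans (*-monoˡ-≤ E (+-monoˡ-≤ l 1≤l)) (≤-reflexive (solve 2 (λ l E → (l :+ l) :* E := con 2 :* (l :* E)) refl l E)))))
      go : ∀ R → R ≡ 2 * (l * E) → fromℕ (n ^ E) ℚ.* pow (1ℚ ℚ.- q) N ℚ.≤ 1ℚ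
      go zero    eq = ⊥-elim (<⇒≱ (≤-trans (*-mono-≤ 1≤l 1≤E) (m≤n*m (l * E) 2)) (≤-reflexive (sym eq)))
        where open import Data.Empty using (⊥-elim)
      go (suc R) eq = ℚP.≤-trans (*-monoʳ (pow-nonNeg N (≤⇒0≤- q≤1)) (fromℕ-mono (≤-trans n^E≤ (≤-reflexive (cong (2 ^_) (sym eq))))))
        (pow-decay {q} {N} R 0≤q q≤1 (subst (λ R → fromℕ (2 * R) ℚ.≤ fromℕ N ℚ.* q) (sym eq) Nq))

    -- The factor 4 is spent twice: one half because log n is only known to be at least lg n / 2,
    -- the other to absorb the approximation error, which is 1 after multiplication by nk and
    -- therefore at most K lg n.
    frequent : ∀ n k {p} → IsProbability p → 1 ≤ lg n → 1 ≤ k → ι (fromℕ (4 * K)) D.* log n /ℕ (n * k) D.≤ p →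
               ∃ λ M → ∀ m → M ≤ m → fromℕ (K * lg n) ℚ.≤ fromℕ (n * k) ℚ.* clamp (seq p m)
    frequent zero k isP () _ _
    frequent n@(suc n′) k {p} (_ , p≤1) 1≤l 1≤k lower =
      let ε , 0<ε , Dε≡½ = scale (fromℕ D) (pos 1≤D) (ℚP.positive⁻¹ ½)
          M₁ , h₁ = lower ε 0<ε
          M₂ , h₂ = p≤1 ε 0<ε
      in M₁ ⊔ M₂ , λ m M≤m → bounded ε 0<ε Dε≡½ m (h₁ m (m⊔n≤o⇒m≤o M₁ M₂ M≤m)) (h₂ m (m⊔n≤o⇒n≤o M₁ M₂ M≤m))
      where
      open ℚP.≤-Reasoning
      D = n * k
      l = lg n
      1≤D : 1 ≤ D
      1≤D = *-mono-≤ {1} {n} (s≤s z≤n) 1≤k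
      1≤K : 1 ≤ K
      1≤K = ≤-trans (≤-trans 1≤E (≤-trans (m≤n*m E 4) (m≤n*m (4 * E) 1280))) (≤-reflexive (sym K≡))
      D*recip : fromℕ D ℚ.* recip D ≡ 1ℚ
      D*recip = go D 1≤D
        where
        go : ∀ D → 1 ≤ D → fromℕ D ℚ.* recip D ≡ 1ℚ
        go (suc D) _ = fromℕ*recip D
      clamp≥ : ∀ x ε → 0ℚ ℚ.≤ ε → x ℚ.≤ 1ℚ ℚ.+ ε → x ℚ.≤ clamp x ℚ.+ ε
      clamp≥ x ε 0≤ε x≤ = ℚP.≤-trans (go (ℚP.≤-total x 1ℚ)) (ℚP.+-monoˡ-≤ ε (ℚP.p≤q⊔p 0ℚ (x ℚ.⊓ 1ℚ)))
        where
        go : x ℚ.≤ 1ℚ ⊎ 1ℚ ℚ.≤ x → x ℚ.≤ x ℚ.⊓ 1ℚ ℚ.+ ε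
        go (inj₁ x≤1) = ℚP.≤-trans (ℚP.≤-reflexive (sym (ℚP.p≤q⇒p⊓q≡p x≤1))) (≤-+ʳ 0≤ε)
        go (inj₂ 1≤x) = ℚP.≤-trans x≤ (ℚP.≤-reflexive (cong (ℚ._+ ε) (sym (ℚP.p≥q⇒p⊓q≡q 1≤x))))
      bounded : ∀ ε → 0ℚ ℚ.< ε → fromℕ D ℚ.* ε ≡ ½ → ∀ m → fromℕ (4 * K) ℚ.* logSeq n m ℚ.* recip D ℚ.≤ seq p m ℚ.+ ε → seq p m ℚ.≤ 1ℚ ℚ.+ ε →
                fromℕ (K * l) ℚ.≤ fromℕ D ℚ.* clamp (seq p m)
      bounded ε 0<ε Dε≡½ m lo hi = 0≤-⇒≤ (begin
        0ℚ                                         ≤⟨ ≤⇒0≤- (ℚP.≤-trans (fromℕ-mono {1} {K * l} (*-mono-≤ 1≤K 1≤l)) (≤-+ʳ {fromℕ (K * l)} ℚP.≤-refl)) ⟩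
        fromℕ (K * l) ℚ.+ 0ℚ ℚ.- 1ℚ                ≡⟨ ℚS.solve 1 (λ x → x ℚS.:+ ℚS.con 0ℚ ℚS.:- ℚS.con 1ℚ ℚS.:= (x ℚS.:+ x) ℚS.:- ℚS.con 1ℚ ℚS.:- x) refl (fromℕ (K * l)) ⟩
        fromℕ (K * l) ℚ.+ fromℕ (K * l) ℚ.- 1ℚ ℚ.- fromℕ (K * l) ≤⟨ ℚP.+-monoˡ-≤ (ℚ.- fromℕ (K * l)) (ℚP.≤-trans (ℚP.+-monoˡ-≤ (ℚ.- 1ℚ) twice) (ℚP.≤-reflexive (ℚS.solve 1 (λ x → x ℚS.:+ ℚS.con 1ℚ ℚS.:- ℚS.con 1ℚ ℚS.:= x) refl (fromℕ D ℚ.* Q)))) ⟩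
        fromℕ D ℚ.* Q ℚ.- fromℕ (K * l)            ∎)
        where
        Q = clamp (seq p m)
        twice : fromℕ (K * l) ℚ.+ fromℕ (K * l) ℚ.≤ fromℕ D ℚ.* Q ℚ.+ 1ℚ
        twice = begin
          fromℕ (K * l) ℚ.+ fromℕ (K * l)                   ≡⟨ trans (sym (fromℕ-+ (K * l) (K * l))) (halve K l) ⟩
          fromℕ (4 * K) ℚ.* (fromℕ l ℚ.* ½)                 ≤⟨ *-mono (fromℕ-nonNeg (4 * K)) (proj₁ (logSeq-bounds n′ l m (lg-≤ n′) (lg-< n′))) ⟩
          fromℕ (4 * K) ℚ.* logSeq n m                      ≡⟨ trans (cong (ℚ._* X) D*recip) (ℚP.*-identityˡ X) ⟨
          fromℕ D ℚ.* recip D ℚ.* X                         ≡⟨ ℚS.solve 3 (λ d r x → d ℚS.:* r ℚS.:* x ℚS.:= d ℚS.:* (x ℚS.:* r)) refl (fromℕ D) (recip D) X ⟩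
          fromℕ D ℚ.* (X ℚ.* recip D)                       ≤⟨ *-mono (fromℕ-nonNeg D) (ℚP.≤-trans lo (ℚP.+-monoˡ-≤ ε (clamp≥ (seq p m) ε (ℚP.<⇒≤ 0<ε) hi))) ⟩
          fromℕ D ℚ.* (Q ℚ.+ ε ℚ.+ ε)                       ≡⟨ ℚS.solve 3 (λ d q e → d ℚS.:* (q ℚS.:+ e ℚS.:+ e) ℚS.:= d ℚS.:* q ℚS.:+ (d ℚS.:* e ℚS.:+ d ℚS.:* e)) refl (fromℕ D) Q ε ⟩
          fromℕ D ℚ.* Q ℚ.+ (fromℕ D ℚ.* ε ℚ.+ fromℕ D ℚ.* ε) ≡⟨ cong (fromℕ D ℚ.* Q ℚ.+_) (cong₂ ℚ._+_ Dε≡½ Dε≡½) ⟩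
          fromℕ D ℚ.* Q ℚ.+ 1ℚ                              ∎
          where
          X = fromℕ (4 * K) ℚ.* logSeq n m
          halve : ∀ K l → fromℕ (K * l + K * l) ≡ fromℕ (4 * K) ℚ.* (fromℕ l ℚ.* ½)
          halve K l = trans (fromℕ-+ (K * l) (K * l)) (trans (cong₂ ℚ._+_ (fromℕ-* K l) (fromℕ-* K l))
            (trans (ℚS.solve 2 (λ K l → K ℚS.:* l ℚS.:+ K ℚS.:* l ℚS.:= ℚS.con (fromℕ 4) ℚS.:* K ℚS.:* (l ℚS.:* ℚS.con ½)) refl (fromℕ K) (fromℕ l))
              (cong (ℚ._* (fromℕ l ℚ.* ½)) (sym (fromℕ-* 4 K)))))

  private
    multiple : ∀ C a k → ι (fromℕ a) D.≤ ι (recip (suc C)) D.* nat k → suc C * a ≤ k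
    multiple C a k h =
      let ε , 0<ε , eq = scale (fromℕ (suc C)) (fromℕ-pos C) (ℚP.positive⁻¹ ½)
          M , hM = h ε 0<ε
      in fromℕ-cancel-½ (begin
        fromℕ (suc C * a)                                               ≡⟨ fromℕ-* (suc C) a ⟩
        fromℕ (suc C) ℚ.* fromℕ a                                       ≤⟨ *-mono (fromℕ-nonNeg (suc C)) (hM M ≤-refl) ⟩
        fromℕ (suc C) ℚ.* (recip (suc C) ℚ.* fromℕ k ℚ.+ ε)             ≡⟨ ℚS.solve 4 (λ c r k e → c ℚS.:* (r ℚS.:* k ℚS.:+ e) ℚS.:= c ℚS.:* r ℚS.:* k ℚS.:+ c ℚS.:* e) refl (fromℕ (suc C)) (recip (suc C)) (fromℕ k) ε ⟩
        fromℕ (suc C) ℚ.* recip (suc C) ℚ.* fromℕ k ℚ.+ fromℕ (suc C) ℚ.* ε ≡⟨ cong₂ ℚ._+_ (trans (cong (ℚ._* fromℕ k) (fromℕ*recip C)) (ℚP.*-identityˡ (fromℕ k))) eq ⟩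
        fromℕ k ℚ.+ ½                                                   ∎)
      where open ℚP.≤-Reasoning

    -- Toughness weakens as its parameter decreases, and T is an integer above almost all
    -- approximations of `t₀`. So the combinatorial part deals with integers only.
    toughReal : ∀ (t₀ : ℝ) T M → (∀ m → M ≤ m → seq t₀ m ℚ.≤ fromℕ T) → ∀ {m} (H : Graph m) →
                (∀ S c → ComponentCount H S c → c ≤ 1 ⊎ T * c ≤ ∣ S ∣) → Tough t₀ H
    toughReal t₀ T M t₀≤T H tough S c C = go (tough S c C)
      where
      go : c ≤ 1 ⊎ T * c ≤ ∣ S ∣ → c ≤ 1 ⊎ t₀ D.* nat c D.≤ nat ∣ S ∣
      go (inj₁ c≤1) = inj₁ c≤1
      go (inj₂ le)  = inj₂ λ ε 0<ε → M , λ i M≤i → ℚP.≤-trans (*-monoʳ (fromℕ-nonNeg c) (t₀≤T i M≤i))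
        (ℚP.≤-trans (ℚP.≤-reflexive (sym (fromℕ-* T c))) (ℚP.≤-trans (fromℕ-mono le) (≤-+ʳ {fromℕ ∣ S ∣} (ℚP.<⇒≤ 0<ε))))

  partA : (t₀ : ℝ) → ι 1ℚ D.≤ t₀ →
    (∀ n (G : Graph n) → 3 ≤ n → Tough t₀ G → Hamiltonian G) →
    ∃ λ (c₁ : ℝ) → ∃ λ (c₂ : ℝ) → ι 0ℚ D.< c₁ × ι 0ℚ D.< c₂ ×
    ((G : ∀ n → Graph n) (k : ℕ → ℕ) →
      Eventually (λ n → δ (G n) ≡ k n) →
      Eventually (λ n → nat (α (G n)) D.≤ c₂ D.* nat (k n)) →
      (p : ℕ → ℝ) → (∀ n → IsProbability (p n)) →
      Eventually (λ n → c₁ D.* log n /ℕ (n * k n) D.≤ p n) →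
      AAS[ G ∪𝔾 p ⊨ pancyclic? ])
  partA t₀ _ hyp = main (bound (seq t₀) (cauchy t₀))
    where
    Goal : Set₁
    Goal = ∃ λ (c₁ : ℝ) → ∃ λ (c₂ : ℝ) → ι 0ℚ D.< c₁ × ι 0ℚ D.< c₂ ×
      ((G : ∀ n → Graph n) (k : ℕ → ℕ) →
        Eventually (λ n → δ (G n) ≡ k n) →
        Eventually (λ n → nat (α (G n)) D.≤ c₂ D.* nat (k n)) →
        (p : ℕ → ℝ) → (∀ n → IsProbability (p n)) →
        Eventually (λ n → c₁ D.* log n /ℕ (n * k n) D.≤ p n) →
        AAS[ G ∪𝔾 p ⊨ pancyclic? ])
    -- The reciprocal of c₂ is 600 + 40T: the multiple 600 is what the short cycles demand, and 40T
    -- gives 2Ta ≤ k/20.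
    withT : ∀ T M → 1 ≤ T → (∀ m → M ≤ m → seq t₀ m ℚ.≤ fromℕ T) → ∀ C′ → suc C′ ≡ 600 + 40 * T → ∀ K → K ≡ 1280 * (4 * (4 + T * 3)) → Goal
    withT T M 1≤T t₀≤T C′ C≡ K K≡ =
      ι (fromℕ (4 * K)) , ι (recip (suc C′)) ,
      (fromℕ (4 * K) , pos {4 * K} (≤-trans 1≤K (m≤n*m K 4)) , 0 , λ _ _ → ℚP.≤-reflexive (ℚP.+-identityˡ _)) ,
      (recip (suc C′) , ℚP.positive⁻¹ (recip (suc C′)) {{ℚP.normalize-pos 1 (suc C′)}} , 0 , λ _ _ → ℚP.≤-reflexive (ℚP.+-identityˡ _)) ,
      λ G k (N₁ , δ≡) (N₂ , α≤) p isP (N₃ , p≥) →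
        let N = 2 ⊔ (N₁ ⊔ N₂)
            facts : ∀ n → N ≤ n → 1 ≤ lg n × 1 ≤ α (G n) × suc C′ * α (G n) ≤ k n
            facts n N≤n = lg-large 1 n (m⊔n≤o⇒m≤o 2 (N₁ ⊔ N₂) N≤n) ,
              1≤α (G n) (fromℕ< (≤-trans (s≤s z≤n) (m⊔n≤o⇒m≤o 2 (N₁ ⊔ N₂) N≤n))) ,
              multiple C′ (α (G n)) (k n) (α≤ n (m⊔n≤o⇒n≤o N₁ N₂ (m⊔n≤o⇒n≤o 2 (N₁ ⊔ N₂) N≤n)))
        in aas {P = Pancyclic} pancyclic? G p isP (λ n q → fromℕ (K * lg n) ℚ.≤ fromℕ (n * k n) ℚ.* q)
          (N ⊔ N₃ , λ n N≤n →
            let 1≤l , 1≤a , Ca≤k = facts n (m⊔n≤o⇒m≤o N N₃ N≤n)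
            in frequent (4 + T * 3) K K≡ (s≤s z≤n) n (k n) {p n} (isP n) 1≤l (≤-trans (*-mono-≤ {1} {suc C′} (s≤s z≤n) 1≤a) Ca≤k) (p≥ n (m⊔n≤o⇒n≤o N N₃ N≤n)))
          λ η 0<η →
            let N₄ , 1≤N₄η = archimedean′ 1ℚ 0<η
            in N ⊔ N₄ , λ n N≤n q 0≤q q≤1 rel →
              let N≤n′ = m⊔n≤o⇒m≤o N N₄ N≤n
                  1≤l , 1≤a , Ca≤k = facts n N≤n′
              in likely (G n) (k n) (δ≡ n (m⊔n≤o⇒m≤o N₁ N₂ (m⊔n≤o⇒n≤o 2 (N₁ ⊔ N₂) N≤n′))) (fromℕ< (≤-trans (s≤s z≤n) (m⊔n≤o⇒m≤o 2 (N₁ ⊔ N₂) N≤n′)))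
                   1≤l 1≤a Ca≤k 0≤q q≤1 rel
                   (ℚP.≤-trans 1≤N₄η (*-monoʳ (ℚP.<⇒≤ 0<η) (fromℕ-mono (m⊔n≤o⇒n≤o N N₄ N≤n))))
      where
      1≤K : 1 ≤ K
      1≤K = ≤-trans (≤-trans (s≤s z≤n) (≤-trans (m≤n*m (4 + T * 3) 4) (m≤n*m (4 * (4 + T * 3)) 1280))) (≤-reflexive (sym K≡))
      likely : ∀ {n} (G : Graph n) k → δ G ≡ k → Fin n → 1 ≤ lg n → 1 ≤ α G → suc C′ * α G ≤ k → ∀ {q η} → 0ℚ ℚ.≤ q → q ℚ.≤ 1ℚ →
               fromℕ (K * lg n) ℚ.≤ fromℕ (n * k) ℚ.* q → 1ℚ ℚ.≤ fromℕ n ℚ.* η → 1ℚ ℚ.- η ℚ.≤ probability G q pancyclic?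
      likely {n} G k δ≡ v 1≤l 1≤a Ca≤k 0≤q q≤1 rel 1≤nη =
        pancyclicLikely G {α G} {k} {T} (α-dense G) deg 1≤a (≤-trans 80≤600a 600a≤k) 600a≤k 1≤T 2Ta≤s (≤-trans (deg v) (#≤n (adj? G v))) v
          (λ m H 3≤m tough → hyp m H 3≤m (toughReal t₀ T M t₀≤T H tough)) 0≤q q≤1
          (tinyPower (4 + T * 3) K K≡ (s≤s z≤n) {n} {k} 1≤l 0≤q q≤1 rel) 1≤nη
        where
        deg : ∀ v → k ≤ # (adj? G v)
        deg v = ≤-trans (≤-reflexive (sym δ≡)) (δ≤# G v)
        C≤ : ∀ {c} → c ≤ 600 + 40 * T → c * α G ≤ k
        C≤ h = ≤-trans (*-monoˡ-≤ (α G) (≤-trans h (≤-reflexive (sym C≡)))) Ca≤k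
        600a≤k : 600 * α G ≤ k
        600a≤k = C≤ {600} (m≤m+n 600 (40 * T))
        80≤600a : 80 ≤ 600 * α G
        80≤600a = ≤-trans (m≤m+n 80 520) (*-monoʳ-≤ 600 1≤a)
        2Ta≤s : 2 * (T * α G) ≤ k / 20
        2Ta≤s = ≤-trans (≤-reflexive (sym (m*n/n≡m (2 * (T * α G)) 20))) (/-monoˡ-≤ {2 * (T * α G) * 20} {k} 20
          (≤-trans (≤-reflexive (solve 2 (λ T a → con 2 :* (T :* a) :* con 20 := con 40 :* T :* a) refl T (α G))) (C≤ {40 * T} (m≤n+m (40 * T) 600))))
    main : (∃ λ B → 0ℚ ℚ.< B × ∃ λ N → ∀ n → N ≤ n → ℚ.∣ seq t₀ n ∣ ℚ.≤ B) → Goal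
    main (B , _ , M , t₀≤B) =
      let T , B≤T = archimedean B
      in withT (suc T) M (s≤s z≤n) (λ m M≤m → ℚP.≤-trans (p≤∣p∣ (seq t₀ m)) (ℚP.≤-trans (t₀≤B m M≤m) (ℚP.≤-trans B≤T (fromℕ-mono (n≤1+n T)))))
           (599 + 40 * suc T) refl (1280 * (4 * (4 + suc T * 3))) refl
      where
      p≤∣p∣ : ∀ p → p ℚ.≤ ℚ.∣ p ∣
      p≤∣p∣ p with ℚP.≤-total 0ℚ p
      ... | inj₁ 0≤p = ℚP.≤-reflexive (sym (ℚP.0≤p⇒∣p∣≡p 0≤p))
      ... | inj₂ p≤0 = ℚP.≤-trans p≤0 (ℚP.0≤∣p∣ p)

open import Defs
open import Data.Nat.Base as ℕ using (ℕ)
open import Data.Rational.Base using (0ℚ; ½; 1ℚ)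
open import Data.Product.Base using (∃; _×_; _,_)
open import Relation.Binary.PropositionalEquality using (_≡_)

theorem1p5 : ( (t₀ : ℝ) → ι 1ℚ ≤ t₀ →
    (∀ n (G : Graph n) → 3 ℕ.≤ n → Tough t₀ G → Hamiltonian G) →
    ∃ λ (c₁ : ℝ) → ∃ λ (c₂ : ℝ) → ι 0ℚ < c₁ × ι 0ℚ < c₂ ×
    ( (G : ∀ n → Graph n) (k : ℕ → ℕ) →
    Eventually (λ n → δ (G n) ≡ k n) →
    Eventually (λ n → nat (α (G n)) ≤ c₂ * nat (k n)) →
    (p : ℕ → ℝ) → (∀ n → IsProbability (p n)) →
    Eventually (λ n → c₁ * log n /ℕ (n ℕ.* k n) ≤ p n) →
    AAS[ G ∪𝔾 p ⊨ pancyclic? ] ) )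
    ×
    ( (ε : ℝ) → ι 0ℚ < ε → ε < ι ½ →
    (k : ℕ → ℕ) →
    Eventually (λ n → n ^ʳ ε ≤ nat (k n) × nat (k n) ≤ n ^ʳ (ι 1ℚ - ε)) →
    (c : ℝ) → ι 0ℚ < c → c < ι 1ℚ →
    ∃ λ (c′ : ℝ) → ι 0ℚ < c′ ×
    ∃ λ (H : ∀ n → Graph n) →
    Eventually (λ n → δ (H n) ≡ k n × nat (α (H n)) ≤ c * nat (k n)) ×
    ( (p : ℕ → ℝ) → (∀ n → IsProbability (p n)) →
    Eventually (λ n → p n ≤ c′ * log n /ℕ (n ℕ.* k n)) →
    AAS[ H ∪𝔾 p ⊨ nonHamiltonian? ] ) )
    ×
    ( (k : ℕ → ℕ) →
    Eventually (λ n → nat (k n) ≤ nat n /ℕ 2) →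
    k ⟶∞ →
    ∃ λ (H : ∀ n → Graph n) →
    Eventually (λ n → α (H n) ≡ k n × nat (k n) /ℕ 2 ≤ nat (δ (H n))) ×
    ( (p : ℕ → ℝ) → (∀ n → IsProbability (p n)) →
    Eventually (λ n → p n ≤ ι 1ℚ /ℕ (3 ℕ.* n)) →
    AAS[ H ∪𝔾 p ⊨ nonHamiltonian? ] ) )
theorem1p5 = PartA.partA , PartB.partB , PartC.partC
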